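{- Let $k$ be a field and let $P$ be the face poset (with empty face as $\hat0$ and a top element $\hat1$ adjoined) of a Gorenstein* simplicial complex of dimension $n-1$, so $P$ is graded of rank $n+1$. Then there exists a standard $\mathbb{Z}^n$-graded $k$-algebra $A=\bigoplus_{v\in\mathbb{Z}^n}A_v$ such that $\Psi_{P,v}=\dim_k A_v$ for every $v\in\mathbb{Z}^n$.
   Context: A simplicial complex of dimension $n-1$ is Gorenstein* if it is a homology $(n-1)$-sphere: for every face $F$ (including the empty face) the link of $F$ has the reduced homology of a sphere of dimension $n-2-\dim F$. Flag numbers and the $\mathbf{c}\mathbf{d}$-index: for a graded poset $P$ of rank $n+1$ with $\hat0,\hat1$ and rank function $\rho$, the type of a chain $\hat0<x_1<\dots<x_m<\hat1$ is $S=\{\rho(x_1),\dots,\rho(x_m)\}\subseteq\{1,\dots,n\}$, and $f_S$ is the number of chains of type $S$. Set $\Psi_P(t_1,\dots,t_n)=\sum_S f_S\prod_{i\notin S}(t_i-1)$. A degree-$n$ monomial in noncommuting variables $\mathbf{c}$ (degree 1), $\mathbf{d}$ (degree 2) is identified with a polynomial in $t_1,\dots,t_n$ by replacing, left to right, each $\mathbf{c}$ in position $i$ by $(t_i+1)$ and each $\mathbf{d}$ in positions $i,i+1$ by $(t_i+t_{i+1})$. For Eulerian $P$ (such as $P$ in the claim) $\Psi_P$ is uniquely a homogeneous degree-$n$ polynomial in $\mathbf{c},\mathbf{d}$ (the $\mathbf{c}\mathbf{d}$-index). The multidegree of a $\mathbf{c}\mathbf{d}$-monomial is the $0/1$ vector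 in $\mathbb{Z}^n$ obtained by replacing $\mathbf{c}$ by $0$ and $\mathbf{d}$ by $1,0$. $\Psi_{P,v}$ is the coefficient of the monomial of multidegree $v$, and $0$ if $v$ is not such a multidegree. A $\mathbb{Z}^n$-graded $k$-algebra $A$ (associative, commutative, with $1$) is standard if $A_0=k$ and $A$ is generated by elements of degrees $e_1,\dots,e_n$, the standard basis vectors of $\mathbb{Z}^n$. -}

module Defs where

open import Level using (Level; _⊔_) renaming (suc to lsuc)
open import Data.Bool using (Bool; true; false; if_then_else_; _∧_; not)
open import Data.Nat as ℕ using (ℕ; zero; suc; _≤_; _∸_)
open import Data.Integer as ℤ using (ℤ; +_)
open import Data.Fin using (Fin; zero; suc; _≟_)
open import Data.Fin.Subset using (Subset; ⊥; _⊆_; _∪_; ⁅_⁆; ∣_∣)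
open import Data.Vec using (Vec; []; _∷_; replicate; zipWith; tabulate; lookup)
open import Data.Vec.Relation.Unary.All as VAll using ()
open import Data.List as List using (List; []; _∷_; _++_; allFin)
open import Data.List.Relation.Unary.All as LAll using ()
open import Data.List.Relation.Unary.Unique.Propositional using (Unique)
open import Data.Product using (Σ; _×_; _,_; ∃; proj₁; proj₂)
open import Relation.Nullary using (¬_; does)
open import Relation.Binary.PropositionalEquality using (_≡_; _≢_)
open import Algebra.Bundles using (CommutativeRing)
import Algebra.Morphism.Structures as MS

record Field (c ℓ : Level) : Set (lsuc (c ⊔ ℓ)) where
  field
    commutativeRing : CommutativeRing c ℓ
  open CommutativeRing commutativeRing public
  field
    0≉1     : ¬ (0# ≈ 1#)
    inverse : ∀ x → ¬ (x ≈ 0#) → ∃ λ y → (x * y) ≈ 1#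

memᵇ : ∀ {m} → Fin m → Subset m → Bool
memᵇ i G = lookup G i

subsetᵇ : ∀ {m} → Subset m → Subset m → Bool
subsetᵇ [] [] = true
subsetᵇ (x ∷ F) (y ∷ G) = (if x then y else true) ∧ subsetᵇ F G

disjointᵇ : ∀ {m} → Subset m → Subset m → Bool
disjointᵇ [] [] = true
disjointᵇ (x ∷ F) (y ∷ G) = not (x ∧ y) ∧ disjointᵇ F G

allSubsets : ∀ m → List (Subset m)
allSubsets zero = [] ∷ []
allSubsets (suc m) = List.map (true ∷_) (allSubsets m) ++ List.map (false ∷_) (allSubsets m)

below : ∀ {m} → Fin m → Subset m → ℕ
below zero _ = 0
below (suc v) (s ∷ G) = (if s then 1 else 0) ℕ.+ below v G

record SimplicialComplex (m : ℕ) : Set where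
  field
    face        : Subset m → Bool
    empty-face  : face ⊥ ≡ true
    down-closed : ∀ F G → G ⊆ F → face F ≡ true → face G ≡ true
open SimplicialComplex public

-- Δ has dimension n - 1: the maximal cardinality of a face is n
HasDimension : ∀ {m} → SimplicialComplex m → ℕ → Set
HasDimension Δ n = (∃ λ F → face Δ F ≡ true × ∣ F ∣ ≡ n)
                 × (∀ F → face Δ F ≡ true → ∣ F ∣ ≤ n)

linkFaceᵇ : ∀ {m} → SimplicialComplex m → Subset m → Subset m → Bool
linkFaceᵇ Δ F G = face Δ (F ∪ G) ∧ disjointᵇ F G

-- Reduced simplicial homology over a field K of the link of a face.
-- A chain of "size" i (i.e. of dimension i - 1; size 0 is the
-- augmentation degree -1) is a K-valued function on subsets supported
-- on faces of the link of size i.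

module Homology {c ℓ} (K : Field c ℓ) {m : ℕ} (Δ : SimplicialComplex m) where
  open Field K

  Cochainish : Set c
  Cochainish = Subset m → Carrier

  sumL : List Carrier → Carrier
  sumL = List.foldr _+_ 0#

  signed : ℕ → Carrier → Carrier
  signed zero x = x
  signed (suc k) x = - signed k x

  IsChain : Subset m → ℕ → Cochainish → Set ℓ
  IsChain F i z = ∀ G → (linkFaceᵇ Δ F G ∧ (∣ G ∣ ℕ.≡ᵇ i)) ≡ false → z G ≈ 0#

  ∂ : Cochainish → Cochainish
  ∂ z G = sumL (List.map (λ v → if memᵇ v G then 0# else signed (below v G) (z (G ∪ ⁅ v ⁆))) (allFin m))

  IsCycle : Cochainish → Set ℓ
  IsCycle z = ∀ G → ∂ z G ≈ 0#

  IsBoundary : Subset m → ℕ → Cochainish → Set (c ⊔ ℓ)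
  IsBoundary F i z = ∃ λ b → IsChain F (suc i) b × (∀ G → ∂ b G ≈ z G)

  -- the link of F has the reduced K-homology of a sphere whose chains
  -- have size s (sphere of dimension s - 1): all reduced homology vanishes
  -- except in size s, where it is one-dimensional
  HomologySphereLink : Subset m → ℕ → Set (c ⊔ ℓ)
  HomologySphereLink F s =
      (∀ i → i ≢ s → ∀ z → IsChain F i z → IsCycle z → IsBoundary F i z)
    × (∃ λ ζ → IsChain F s ζ × IsCycle ζ × ¬ IsBoundary F s ζ
         × (∀ z → IsChain F s z → IsCycle z →
              ∃ λ a → ∃ λ b → IsChain F (suc s) b × (∀ G → z G ≈ (a * ζ G) + ∂ b G)))

-- Gorenstein* of dimension n - 1 over K: for every face F (including ∅),
-- the link of F is a K-homology sphere of dimension n - 2 - dim F = n - 1 - |F|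
Gorenstein* : ∀ {c ℓ} (K : Field c ℓ) {m} → SimplicialComplex m → ℕ → Set (c ⊔ ℓ)
Gorenstein* K Δ n = ∀ F → face Δ F ≡ true → HomologySphereLink F (n ∸ ∣ F ∣)
  where open Homology K Δ

-- Flag f-numbers of P = face poset of Δ with 1̂ adjoined (rank F = |F|).
-- S : Subset n encodes a set of ranks: index i ↦ rank i+1.

ranks : ∀ {n} → Subset n → List ℕ
ranks {n} S = List.map (λ i → suc (Data.Fin.toℕ i)) (List.filter (λ i → Relation.Nullary.Decidable.Core.T? (memᵇ i S)) (allFin n))
  where import Relation.Nullary.Decidable.Core
        import Data.Fin

countChains : ∀ {m} → SimplicialComplex m → Subset m → List ℕ → ℕ
countChains Δ prev [] = 1
countChains {m} Δ prev (r ∷ rs) =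
  List.foldr ℕ._+_ 0 (List.map (λ G → if face Δ G ∧ subsetᵇ prev G ∧ (∣ G ∣ ℕ.≡ᵇ r)
                              then countChains Δ G rs else 0) (allSubsets m))

flagF : ∀ {m n} → SimplicialComplex m → Subset n → ℕ
flagF Δ S = countChains Δ ⊥ (ranks S)

prodNotIn : ∀ {n} → Subset n → (Fin n → ℤ) → ℤ
prodNotIn [] t = ℤ.+ 1
prodNotIn (s ∷ S) t = (if s then ℤ.+ 1 else t zero ℤ.- ℤ.+ 1) ℤ.* prodNotIn S (λ i → t (suc i))

-- Ψ_P(t₁,…,tₙ) = Σ_S f_S ∏_{i∉S}(t_i - 1), as a function ℤⁿ → ℤ
-- (a polynomial over ℤ is determined by its values on ℤⁿ)
Ψ : ∀ {m} → SimplicialComplex m → (n : ℕ) → (Fin n → ℤ) → ℤ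
Ψ Δ n t = List.foldr ℤ._+_ (ℤ.+ 0)
            (List.map (λ S → (ℤ.+ flagF Δ S) ℤ.* prodNotIn S t) (allSubsets n))

data CD : ℕ → Set where
  ε  : CD 0
  c· : ∀ {n} → CD n → CD (suc n)
  d· : ∀ {n} → CD n → CD (suc (suc n))

allCD : ∀ n → List (CD n)
allCD zero = ε ∷ []
allCD (suc zero) = List.map c· (allCD zero)
allCD (suc (suc n)) = List.map c· (allCD (suc n)) ++ List.map d· (allCD n)

evalCD : ∀ {n} → CD n → (Fin n → ℤ) → ℤ
evalCD ε t = ℤ.+ 1
evalCD (c· w) t = (t zero ℤ.+ ℤ.+ 1) ℤ.* evalCD w (λ i → t (suc i))
evalCD (d· w) t = (t zero ℤ.+ t (suc zero)) ℤ.* evalCD w (λ i → t (suc (suc i)))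

multideg : ∀ {n} → CD n → Vec ℤ n
multideg ε = []
multideg (c· w) = ℤ.+ 0 ∷ multideg w
multideg (d· w) = ℤ.+ 1 ∷ ℤ.+ 0 ∷ multideg w

IsCDIndex : ∀ {m} → SimplicialComplex m → (n : ℕ) → (CD n → ℤ) → Set
IsCDIndex Δ n coef = ∀ t → Ψ Δ n t ≡
  List.foldr ℤ._+_ (ℤ.+ 0) (List.map (λ w → coef w ℤ.* evalCD w t) (allCD n))

record KAlgebra {c ℓ} (K : Field c ℓ) : Set (lsuc (c ⊔ ℓ)) where
  field
    R : CommutativeRing c ℓ
  open CommutativeRing R public
  field
    ι     : Field.Carrier K → Carrier
    ι-hom : MS.RingMorphisms.IsRingHomomorphism (Field.rawRing K) rawRing ι

  _·_ : Field.Carrier K → Carrier → Carrier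
  a · x = ι a * x

0ⁿ : ∀ n → Vec ℤ n
0ⁿ n = replicate n (ℤ.+ 0)

_⊕_ : ∀ {n} → Vec ℤ n → Vec ℤ n → Vec ℤ n
_⊕_ = zipWith ℤ._+_

𝐞 : ∀ {n} → Fin n → Vec ℤ n
𝐞 i = tabulate (λ j → if does (i ≟ j) then ℤ.+ 1 else ℤ.+ 0)

-- A ℤⁿ-grading A = ⊕_v A_v of a K-algebra; Hom v x means x ∈ A_v
record Grading {c ℓ} {K : Field c ℓ} (A : KAlgebra K) (n : ℕ) : Set (lsuc (c ⊔ ℓ)) where
  open KAlgebra A
  field
    Hom       : Vec ℤ n → Carrier → Set (c ⊔ ℓ)
    Hom-resp  : ∀ {v x y} → x ≈ y → Hom v x → Hom v y
    Hom-0     : ∀ {v} → Hom v 0#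
    Hom-+     : ∀ {v x y} → Hom v x → Hom v y → Hom v (x + y)
    Hom-·     : ∀ {v x} a → Hom v x → Hom v (a · x)
    Hom-1     : Hom (0ⁿ n) 1#
    Hom-*     : ∀ {v w x y} → Hom v x → Hom w y → Hom (v ⊕ w) (x * y)
    decompose : ∀ x → ∃ λ (hs : List (Vec ℤ n × Carrier)) →
                  LAll.All (λ p → Hom (proj₁ p) (proj₂ p)) hs
                  × x ≈ List.foldr _+_ 0# (List.map proj₂ hs)
    direct    : ∀ (hs : List (Vec ℤ n × Carrier)) →
                  LAll.All (λ p → Hom (proj₁ p) (proj₂ p)) hs →
                  Unique (List.map proj₁ hs) →
                  List.foldr _+_ 0# (List.map proj₂ hs) ≈ 0# →
                  LAll.All (λ p → proj₂ p ≈ 0#) hs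

module _ {c ℓ} {K : Field c ℓ} {A : KAlgebra K} {n : ℕ} (Gr : Grading A n) where
  open KAlgebra A
  open Grading Gr

  data Generated : Carrier → Set (c ⊔ ℓ) where
    gen-scalar : ∀ a → Generated (ι a)
    gen-deg    : ∀ i {x} → Hom (𝐞 i) x → Generated x
    gen-+      : ∀ {x y} → Generated x → Generated y → Generated (x + y)
    gen-*      : ∀ {x y} → Generated x → Generated y → Generated (x * y)

  -- standard: A₀ = K (A₀ is the image of K, and A ≠ 0) and A is generated
  -- by elements of degrees e₁,…,eₙ
  IsStandard : Set (c ⊔ ℓ)
  IsStandard = (∀ x → Hom (0ⁿ n) x → ∃ λ a → x ≈ ι a)
             × ¬ (1# ≈ 0#)
             × (∀ x → Generated x)

  lincomb : ∀ {d} → Vec (Field.Carrier K) d → Vec Carrier d → Carrier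
  lincomb [] [] = 0#
  lincomb (a ∷ as) (b ∷ bs) = (a · b) + lincomb as bs

  HasDim : Vec ℤ n → ℤ → Set (c ⊔ ℓ)
  HasDim v z = ∃ λ (d : ℕ) → (ℤ.+ d ≡ z) × ∃ λ (b : Vec Carrier d) →
                 VAll.All (Hom v) b
               × (∀ x → Hom v x → ∃ λ as → x ≈ lincomb as b)
               × (∀ as → lincomb as b ≈ 0# → ∀ j → Field._≈_ K (lookup as j) (Field.0# K))

record StandardGradedAlgebra {c ℓ} (K : Field c ℓ) (n : ℕ) : Set (lsuc (c ⊔ ℓ)) where
  field
    algebra  : KAlgebra K
    grading  : Grading algebra n
    standard : IsStandard grading

{-# OPTIONS --safe #-}

-- Let h be the h-vector of Δ. Splitting flags at their largest element, and closing up the boundary of Δ by one more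
-- cell, gives Φₙ(h) = Φₙ₋₁(P h) c + Φₙ₋₂(D h) d, where P takes partial sums and D has nonnegative coefficients. The
-- correction term does not involve the last variable, and no nonzero cd-polynomial has this property, so the
-- coefficients of the cd-index are those of Φₙ(h): they count lattice paths weighted by h. Cutting a path at its
-- letters d, and starting anew at the unit of the h-vector after each cut, turns a path into a set of vertices, one
-- for each d. These sets are the faces of a coloured complex, and the algebra is spanned by its monomials.
--
-- That h is nonnegative is shown over ℚ: Gaussian elimination on the integral boundary matrices carries the vanishing
-- of the homology of links from K to ℚ. Up to sign i! hₙ₋ᵢ is the Euler characteristic of the complex of the faces F
-- with coefficients in the tensor product over a < i of the evaluation maps ℚ[x]_{< n - a} → ℚ^F at distinct points.
-- Its homology sits in degree n: below n it vanishes because Δ is Cohen–Macaulay, and above n because for each F that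
-- occurs there one of the Vandermonde matrices is square.

module Submission where

-- Nonnegativity of h is usually read off from a linear system of parameters. A finite `K` may have
-- none, and equality in `K` need not be decidable, so that a pivot can be found only under a double
-- negation. Over ℚ the points 0, 1, 2, ... are distinct, and the conclusion is an inequality of
-- integers, from which a double negation can be removed.
--
-- Why i evaluation maps with bounds n, n - 1, ...: the factor with bound n - a contributes |F| - (n
-- - a) to the Euler characteristic over F. The alternating sum over all F of the products of these
-- numbers is, up to sign, the i-th derivative at x = 0 of Σ_F (x - 1)^(n - |F|) = Σ_j h_j x^(n -
-- j), and this is i! h_(n - i).
--
-- Why paths are cut at d: a set of vertices has to remain admissible when a vertex is deleted.
-- Since h_0 = 1 there is just one path that stays at height 0, and D offers at most i + 1 branches
-- at height i; so the branch taken at a deleted d can be read as a height from which the path drops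
-- to 0.

-- Finite sums over lists.

module Sums where

  open import Level using (Level)
  open import Algebra.Bundles using (CommutativeSemiring; CommutativeRing)
  open import Data.List as List using (List; []; _∷_; _++_)
  open import Data.List.Membership.Propositional using (_∈_)
  open import Data.List.Relation.Unary.Any using (here; there)
  open import Data.List.Relation.Binary.Permutation.Propositional as Perm using (_↭_)
  import Relation.Binary.PropositionalEquality as ≡

  -- The congruence laws with types that unfold to plain equations, which unification handles much better.
  module Congruence {c ℓ : Level} (R : CommutativeSemiring c ℓ) where
    open CommutativeSemiring R hiding (+-congˡ; +-congʳ; *-congˡ; *-congʳ)

    +-congˡ : ∀ {x y z} → y ≈ z → x + y ≈ x + z
    +-congˡ = +-cong refl

    +-congʳ : ∀ {x y z} → y ≈ z → y + x ≈ z + x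
    +-congʳ p = +-cong p refl

    *-congˡ : ∀ {x y z} → y ≈ z → x * y ≈ x * z
    *-congˡ = *-cong refl

    *-congʳ : ∀ {x y z} → y ≈ z → y * x ≈ z * x
    *-congʳ p = *-cong p refl

    *-absorbˡ : ∀ {x y} → x ≈ 0# → x * y ≈ 0#
    *-absorbˡ p = trans (*-cong p refl) (zeroˡ _)

    *-absorbʳ : ∀ {x y} → y ≈ 0# → x * y ≈ 0#
    *-absorbʳ p = trans (*-cong refl p) (zeroʳ _)

    +-absorbˡ : ∀ {x y} → x ≈ 0# → x + y ≈ y
    +-absorbˡ p = trans (+-cong p refl) (+-identityˡ _)

    +-absorbʳ : ∀ {x y} → y ≈ 0# → x + y ≈ x
    +-absorbʳ p = trans (+-cong refl p) (+-identityʳ _)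

    +-vanish : ∀ {x y} → x ≈ 0# → y ≈ 0# → x + y ≈ 0#
    +-vanish p q = trans (+-cong p q) (+-identityˡ 0#)

  module Sum {c ℓ : Level} (R : CommutativeSemiring c ℓ) where
    open CommutativeSemiring R hiding (+-congˡ; +-congʳ; *-congˡ; *-congʳ)
    open Congruence R
    open import Relation.Binary.Reasoning.Setoid setoid
    open import Algebra.Properties.CommutativeSemigroup +-commutativeSemigroup using (interchange; x∙yz≈y∙xz)

    ∑ : ∀ {a} {X : Set a} → List X → (X → Carrier) → Carrier
    ∑ []       f = 0#
    ∑ (x ∷ xs) f = f x + ∑ xs f

    module _ {a} {X : Set a} where

      ∑-cong∈ : ∀ xs {f g : X → Carrier} → (∀ {x} → x ∈ xs → f x ≈ g x) → ∑ xs f ≈ ∑ xs g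
      ∑-cong∈ []       h = refl
      ∑-cong∈ (x ∷ xs) h = +-cong (h (here ≡.refl)) (∑-cong∈ xs (λ p → h (there p)))

      ∑-cong : ∀ xs {f g : X → Carrier} → (∀ x → f x ≈ g x) → ∑ xs f ≈ ∑ xs g
      ∑-cong xs h = ∑-cong∈ xs (λ {x} _ → h x)

      ∑-0 : ∀ xs {f : X → Carrier} → (∀ {x} → x ∈ xs → f x ≈ 0#) → ∑ xs f ≈ 0#
      ∑-0 []       h = refl
      ∑-0 (x ∷ xs) h = +-vanish (h (here ≡.refl)) (∑-0 xs (λ p → h (there p)))

      ∑-+ : ∀ xs (f g : X → Carrier) → ∑ xs (λ x → f x + g x) ≈ ∑ xs f + ∑ xs g
      ∑-+ []       f g = sym (+-identityˡ 0#)
      ∑-+ (x ∷ xs) f g = trans (+-congˡ (∑-+ xs f g)) (interchange (f x) (g x) (∑ xs f) (∑ xs g))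

      ∑-*ˡ : ∀ xs k (f : X → Carrier) → ∑ xs (λ x → k * f x) ≈ k * ∑ xs f
      ∑-*ˡ []       k f = sym (zeroʳ k)
      ∑-*ˡ (x ∷ xs) k f = trans (+-congˡ (∑-*ˡ xs k f)) (sym (distribˡ k (f x) (∑ xs f)))

      ∑-*ʳ : ∀ xs (f : X → Carrier) k → ∑ xs (λ x → f x * k) ≈ ∑ xs f * k
      ∑-*ʳ []       f k = sym (zeroˡ k)
      ∑-*ʳ (x ∷ xs) f k = trans (+-congˡ (∑-*ʳ xs f k)) (sym (distribʳ k (f x) (∑ xs f)))

      ∑-++ : ∀ xs ys (f : X → Carrier) → ∑ (xs ++ ys) f ≈ ∑ xs f + ∑ ys f
      ∑-++ []       ys f = sym (+-identityˡ (∑ ys f))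
      ∑-++ (x ∷ xs) ys f = trans (+-congˡ (∑-++ xs ys f)) (sym (+-assoc (f x) (∑ xs f) (∑ ys f)))

      ∑-map : ∀ {b} {Y : Set b} (h : Y → X) ys (f : X → Carrier) → ∑ (List.map h ys) f ≈ ∑ ys (λ y → f (h y))
      ∑-map h []       f = refl
      ∑-map h (y ∷ ys) f = +-congˡ (∑-map h ys f)

      ∑-↭ : ∀ {xs ys} → xs ↭ ys → (f : X → Carrier) → ∑ xs f ≈ ∑ ys f
      ∑-↭ Perm.refl          f = refl
      ∑-↭ (Perm.prep x p)    f = +-congˡ (∑-↭ p f)
      ∑-↭ (Perm.swap x y p)  f = trans (+-congˡ (+-congˡ (∑-↭ p f))) (x∙yz≈y∙xz _ _ _)
      ∑-↭ (Perm.trans p q)   f = trans (∑-↭ p f) (∑-↭ q f)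

    ∑-swap : ∀ {a b} {X : Set a} {Y : Set b} xs (ys : List Y) (f : X → Y → Carrier) →
             ∑ xs (λ x → ∑ ys (f x)) ≈ ∑ ys (λ y → ∑ xs (λ x → f x y))
    ∑-swap []       ys f = sym (∑-0 ys (λ _ → refl))
    ∑-swap (x ∷ xs) ys f = trans (+-congˡ (∑-swap xs ys f)) (sym (∑-+ ys (f x) (λ y → ∑ xs (λ x → f x y))))

  module SumNegation {c ℓ : Level} (R : CommutativeRing c ℓ) where
    open CommutativeRing R using (Carrier; _≈_; -_; ring; +-abelianGroup; commutativeSemiring; sym; trans)
    open Congruence commutativeSemiring using (+-congˡ)
    open Sum commutativeSemiring using (∑)
    open import Algebra.Properties.Ring ring using (-0#≈0#)
    open import Algebra.Properties.AbelianGroup +-abelianGroup using (⁻¹-∙-comm)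

    ∑-neg : ∀ {a} {X : Set a} xs (f : X → Carrier) → ∑ xs (λ x → - f x) ≈ - ∑ xs f
    ∑-neg []       f = sym -0#≈0#
    ∑-neg (x ∷ xs) f = trans (+-congˡ (∑-neg xs f)) (⁻¹-∙-comm _ _)

-- The action of ℤ on a commutative ring, and a ring solver with integer constants.

module IntegerCoefficients where

  open import Level using (Level)
  open import Algebra.Bundles using (CommutativeRing)
  open import Data.Nat as ℕ using (ℕ; zero; suc)
  open import Data.Integer as ℤ using (ℤ; +_; -[1+_]; _⊖_)
  import Data.Integer.Properties as ℤₚ
  open import Data.Maybe using (Maybe; just; nothing)
  open import Relation.Nullary using (yes; no)
  import Relation.Binary.PropositionalEquality as ≡
  open import Algebra.Solver.Ring.AlmostCommutativeRing using (fromCommutativeRing; _-Raw-AlmostCommutative⟶_)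
  import Algebra.Solver.Ring

  module ℤ-Action {c ℓ : Level} (R : CommutativeRing c ℓ) where
    open CommutativeRing R
    open import Relation.Binary.Reasoning.Setoid setoid
    open import Algebra.Properties.Ring ring
    open import Algebra.Properties.Semiring.Mult semiring
    open import Algebra.Properties.AbelianGroup +-abelianGroup using (⁻¹-∙-comm)
    open import Algebra.Properties.CommutativeSemigroup +-commutativeSemigroup using (interchange)

    ⟦_⟧ : ℤ → Carrier
    ⟦ + n ⟧      = n × 1#
    ⟦ -[1+ n ] ⟧ = - (suc n × 1#)

    ⟦⟧-cong : ∀ {i j} → i ≡.≡ j → ⟦ i ⟧ ≈ ⟦ j ⟧
    ⟦⟧-cong ≡.refl = refl

    ⟦⟧-1 : ⟦ + 1 ⟧ ≈ 1#
    ⟦⟧-1 = +-identityʳ 1#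

    ⟦⟧-neg : ∀ i → ⟦ ℤ.- i ⟧ ≈ - ⟦ i ⟧
    ⟦⟧-neg (+ zero)  = sym -0#≈0#
    ⟦⟧-neg (+ suc n) = refl
    ⟦⟧-neg -[1+ n ]  = sym (-‿involutive _)

    ⟦⟧-⊖ : ∀ m n → ⟦ m ⊖ n ⟧ ≈ m × 1# - n × 1#
    ⟦⟧-⊖ m zero = sym (trans (+-congˡ -0#≈0#) (+-identityʳ _))
    ⟦⟧-⊖ zero (suc n) = sym (+-identityˡ _)
    ⟦⟧-⊖ (suc m) (suc n) = begin
      ⟦ suc m ⊖ suc n ⟧                    ≈⟨ ⟦⟧-cong (ℤₚ.[1+m]⊖[1+n]≡m⊖n m n) ⟩
      ⟦ m ⊖ n ⟧                            ≈⟨ ⟦⟧-⊖ m n ⟩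
      m × 1# - n × 1#                      ≈⟨ +-identityˡ _ ⟨
      0# + (m × 1# - n × 1#)               ≈⟨ +-congʳ (-‿inverseʳ 1#) ⟨
      (1# - 1#) + (m × 1# - n × 1#)        ≈⟨ interchange 1# (- 1#) _ _ ⟩
      (1# + m × 1#) + (- 1# - n × 1#)      ≈⟨ +-congˡ (⁻¹-∙-comm 1# _) ⟩
      suc m × 1# - suc n × 1#              ∎

    ⟦⟧-+ : ∀ i j → ⟦ i ℤ.+ j ⟧ ≈ ⟦ i ⟧ + ⟦ j ⟧
    ⟦⟧-+ (+ m) (+ n) = ×-homo-+ 1# m n
    ⟦⟧-+ (+ m) -[1+ n ] = ⟦⟧-⊖ m (suc n)
    ⟦⟧-+ -[1+ m ] (+ n) = trans (⟦⟧-⊖ n (suc m)) (+-comm _ _)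
    ⟦⟧-+ -[1+ m ] -[1+ n ] = begin
      - (suc (suc (m ℕ.+ n)) × 1#)        ≡⟨ ≡.cong (λ k → - (suc k × 1#)) (≡.sym (ℕₚ.+-suc m n)) ⟩
      - ((suc m ℕ.+ suc n) × 1#)          ≈⟨ -‿cong (×-homo-+ 1# (suc m) (suc n)) ⟩
      - (suc m × 1# + suc n × 1#)         ≈⟨ ⁻¹-∙-comm _ _ ⟨
      - (suc m × 1#) - suc n × 1#         ∎
      where import Data.Nat.Properties as ℕₚ

    ⟦⟧-* : ∀ i j → ⟦ i ℤ.* j ⟧ ≈ ⟦ i ⟧ * ⟦ j ⟧
    ⟦⟧-* i (+ n) = trans (⟦⟧-cong (ℤₚ.*-comm i (+ n))) (trans (go n i) (*-comm _ _))
      where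
        go : ∀ n i → ⟦ + n ℤ.* i ⟧ ≈ n × 1# * ⟦ i ⟧
        go zero i = sym (zeroˡ _)
        go (suc n) i = begin
          ⟦ + suc n ℤ.* i ⟧             ≈⟨ ⟦⟧-cong (ℤₚ.suc-* (+ n) i) ⟩
          ⟦ i ℤ.+ + n ℤ.* i ⟧           ≈⟨ ⟦⟧-+ i (+ n ℤ.* i) ⟩
          ⟦ i ⟧ + ⟦ + n ℤ.* i ⟧         ≈⟨ +-cong (sym (*-identityˡ _)) (go n i) ⟩
          1# * ⟦ i ⟧ + n × 1# * ⟦ i ⟧   ≈⟨ distribʳ _ _ _ ⟨
          (1# + n × 1#) * ⟦ i ⟧         ∎
    ⟦⟧-* i j@(-[1+ n ]) = begin
      ⟦ i ℤ.* j ⟧                        ≈⟨ ⟦⟧-cong (≡.sym (ℤₚ.neg-distribʳ-* i (+ suc n))) ⟩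
      ⟦ ℤ.- (i ℤ.* + suc n) ⟧            ≈⟨ ⟦⟧-neg (i ℤ.* + suc n) ⟩
      - ⟦ i ℤ.* + suc n ⟧                ≈⟨ -‿cong (⟦⟧-* i (+ suc n)) ⟩
      - (⟦ i ⟧ * ⟦ + suc n ⟧)            ≈⟨ -‿distribʳ-* _ _ ⟩
      ⟦ i ⟧ * ⟦ j ⟧                      ∎

    private
      almost = fromCommutativeRing R

      morphism : CommutativeRing.rawRing ℤₚ.+-*-commutativeRing -Raw-AlmostCommutative⟶ almost
      morphism = record
        { ⟦_⟧ = ⟦_⟧ ; +-homo = ⟦⟧-+ ; *-homo = ⟦⟧-* ; -‿homo = ⟦⟧-neg ; 0-homo = refl ; 1-homo = ⟦⟧-1 }

      decide : ∀ i j → Maybe (⟦ i ⟧ ≈ ⟦ j ⟧)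
      decide i j with i ℤ.≟ j
      ... | yes i≡j = just (⟦⟧-cong i≡j)
      ... | no _    = nothing

    open Algebra.Solver.Ring (CommutativeRing.rawRing ℤₚ.+-*-commutativeRing) almost morphism decide public
      using (solve; _:=_; _:+_; _:*_; _:-_; :-_; con)

-- Cancelling one pair of cells in a complex.

module Elimination where

  open import Level using (Level; _⊔_)
  open import Algebra.Bundles using (CommutativeRing)
  open import Data.Nat as ℕ using (ℕ; suc)
  import Data.Nat.Properties as ℕₚ
  open import Data.Integer using (+_)
  open import Data.List using (List; _∷_)
  open import Data.List.Membership.Propositional using (_∈_)
  open import Data.List.Relation.Unary.Any using (here; there)
  import Data.List.Relation.Unary.All as All
  open import Data.List.Relation.Unary.AllPairs as AllPairs using (_∷_)
  open import Data.List.Relation.Unary.Unique.Propositional using (Unique)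
  open import Data.List.Relation.Binary.Permutation.Propositional as Perm using (_↭_)
  open import Data.List.Relation.Binary.Permutation.Propositional.Properties using (∈-resp-↭)
  open import Data.Product using (∃; _×_; _,_; proj₁; proj₂)
  open import Data.Empty using (⊥-elim)
  open import Relation.Nullary using (yes; no)
  open import Relation.Binary.Definitions using (DecidableEquality)
  open import Relation.Binary.PropositionalEquality as ≡ using (_≡_; _≢_)
  open Sums
  open IntegerCoefficients

  module Exactness {c ℓ : Level} (R : CommutativeRing c ℓ) {X : Set} (deg : X → ℕ) where
    open CommutativeRing R hiding (+-congˡ; +-congʳ; *-congˡ; *-congʳ)
    open Congruence commutativeSemiring
    open Sum commutativeSemiring

    Matrix : Set c
    Matrix = X → X → Carrier

    apply : Matrix → List X → (X → Carrier) → X → Carrier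
    apply D L z x = ∑ L (λ y → D x y * z y)

    Homogeneous : List X → ℕ → (X → Carrier) → Set ℓ
    Homogeneous L q z = ∀ {x} → x ∈ L → deg x ≢ q → z x ≈ 0#

    Graded : Matrix → Set ℓ
    Graded D = ∀ x y → deg y ≢ suc (deg x) → D x y ≈ 0#

    SquareZero : Matrix → List X → Set ℓ
    SquareZero D L = ∀ {x z} → x ∈ L → z ∈ L → apply D L (λ y → D y z) x ≈ 0#

    -- Every condition is tested on `L` only and values off `L` are arbitrary, so cells can be
    -- removed from the list without changing the index type.
    Exact : Matrix → List X → ℕ → Set (c ⊔ ℓ)
    Exact D L q = ∀ z → Homogeneous L q z → (∀ {x} → x ∈ L → apply D L z x ≈ 0#) →
                  ∃ λ w → Homogeneous L (suc q) w × (∀ {x} → x ∈ L → apply D L w x ≈ z x)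

    SquareZero-↭ : ∀ {D L L′} → L ↭ L′ → SquareZero D L → SquareZero D L′
    SquareZero-↭ p sq x∈ z∈ =
      trans (sym (∑-↭ p _)) (sq (∈-resp-↭ (Perm.↭-sym p) x∈) (∈-resp-↭ (Perm.↭-sym p) z∈))

    Exact-↭ : ∀ {D L L′ q} → L ↭ L′ → Exact D L q → Exact D L′ q
    Exact-↭ p ex z hom cyc with ex z (λ x∈ → hom (∈-resp-↭ p x∈)) (λ x∈ → trans (∑-↭ p _) (cyc (∈-resp-↭ p x∈)))
    ... | w , homw , eq = w , (λ x∈ → homw (∈-resp-↭ (Perm.↭-sym p) x∈)) ,
                              (λ x∈ → trans (sym (∑-↭ p _)) (eq (∈-resp-↭ (Perm.↭-sym p) x∈)))

    Exact-cong : ∀ {D D′ L q} → (∀ x y → D x y ≈ D′ x y) → Exact D L q → Exact D′ L q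
    Exact-cong {L = L} eqD ex z hom cyc with ex z hom (λ x∈ → trans (∑-cong L (λ y → *-congʳ (eqD _ y))) (cyc x∈))
    ... | w , homw , eq = w , homw , λ x∈ → trans (∑-cong L (λ y → *-congʳ (sym (eqD _ y)))) (eq x∈)

  -- Gaussian elimination at the entry u = D x y, scaled by u so that it never divides.
  module Cancellation {c ℓ : Level} (R : CommutativeRing c ℓ) {X : Set} (_≟_ : DecidableEquality X) (deg : X → ℕ) where
    open CommutativeRing R hiding (+-congˡ; +-congʳ; *-congˡ; *-congʳ)
    open Congruence commutativeSemiring
    open Sum commutativeSemiring
    open Exactness R deg
    open ℤ-Action R using (solve; _:=_; _:+_; _:*_; _:-_; :-_; con)
    open import Relation.Binary.Reasoning.Setoid setoid
    open import Algebra.Properties.Ring ring using (-0#≈0#; -1*x≈-x)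

    private
      identity1 : ∀ u v r → u * v * r ≈ v * (u * r)
      identity1 = solve 3 (λ u v r → u :* v :* r := v :* (u :* r)) refl
      identity2 : ∀ u d e f z → (u * d - e * f) * z ≈ u * (d * z) + (- e) * (f * z)
      identity2 = solve 5 (λ u d e f z → (u :* d :- e :* f) :* z := u :* (d :* z) :+ (:- e) :* (f :* z)) refl
      identity3 : ∀ d u z → d * (u * z) ≈ u * (d * z)
      identity3 = solve 3 (λ d u z → d :* (u :* z) := u :* (d :* z)) refl
      identity4 : ∀ d p q → d * (- p) + q ≈ q - d * p
      identity4 = solve 3 (λ d p q → d :* (:- p) :+ q := q :- d :* p) refl
      identity5 : ∀ z u v → z - (z * v) * u ≈ z - z * (u * v)
      identity5 = solve 3 (λ z u v → z :- (z :* v) :* u := z :- z :* (u :* v)) refl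
      identity6 : ∀ d z k e → d * (z - k * e) ≈ d * z + (- k) * (d * e)
      identity6 = solve 4 (λ d z k e → d :* (z :- k :* e) := d :* z :+ (:- k) :* (d :* e)) refl
      identity7 : ∀ p q → - q ≈ p - (p + q)
      identity7 = solve 2 (λ p q → :- q := p :- (p :+ q)) refl
      identity8 : ∀ p q → q ≈ (p + q) - p
      identity8 = solve 2 (λ p q → q := (p :+ q) :- p) refl
      identity9 : ∀ d k w → d * (k * w) ≈ k * (d * w)
      identity9 = solve 3 (λ d k w → d :* (k :* w) := k :* (d :* w)) refl
      identity10 : ∀ u v z d w → v * v * (u * (u * z - d * w) - d * (0# - u * w)) ≈ (u * v) * ((u * v) * z)
      identity10 = solve 5 (λ u v z d w → v :* v :* (u :* (u :* z :- d :* w) :- d :* (con (+ 0) :- u :* w)) := (u :* v) :* ((u :* v) :* z)) refl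
      identity11 : ∀ u d z → u * (- (d * z)) - d * (- (u * z)) ≈ 0#
      identity11 = solve 3 (λ u d z → u :* (:- (d :* z)) :- d :* (:- (u :* z)) := con (+ 0)) refl
      identity12 : ∀ d p q → d * (p - q) ≈ d * p - d * q
      identity12 = solve 3 (λ d p q → d :* (p :- q) := d :* p :- d :* q) refl
      identity15 : ∀ u p e q → u * p + (- e) * q ≈ u * p - e * q
      identity15 = solve 4 (λ u p e q → u :* p :+ (:- e) :* q := u :* p :- e :* q) refl
      identity13 : ∀ p q → q ≈ p - (p - q)
      identity13 = solve 2 (λ p q → q := p :- (p :- q)) refl
      identity14 : ∀ p q → p - q + q ≈ p
      identity14 = solve 2 (λ p q → p :- q :+ q := p) refl

    reduce : Matrix → X → X → Matrix
    reduce D x y a b = D x y * D a b - D a y * D x b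

    module Cancel (D : Matrix) (B : List X) (x y : X) (uniq : Unique (x ∷ y ∷ B)) (graded : Graded D)
                  (sq : SquareZero D (x ∷ y ∷ B)) (v : Carrier) (uv≈1 : D x y * v ≈ 1#)
                  (degy : deg y ≡ suc (deg x)) where
      private
        u : Carrier
        u = D x y

        L : List X
        L = x ∷ y ∷ B

        D″ : Matrix
        D″ = reduce D x y

        dot : X → (X → Carrier) → Carrier
        dot a z = ∑ B (λ b → D a b * z b)

        x≢ : ∀ {b} → b ∈ y ∷ B → x ≢ b
        x≢ = All.lookup (AllPairs.head uniq)

        y≢ : ∀ {b} → b ∈ B → y ≢ b
        y≢ = All.lookup (AllPairs.head (AllPairs.tail uniq))

        glue : Carrier → Carrier → (X → Carrier) → X → Carrier
        glue cx cy w b with b ≟ x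
        ... | yes _ = cx
        ... | no _ with b ≟ y
        ...   | yes _ = cy
        ...   | no _  = w b

        glue-x : ∀ cx cy w → glue cx cy w x ≈ cx
        glue-x cx cy w with x ≟ x
        ... | yes _ = refl
        ... | no ne = ⊥-elim (ne ≡.refl)

        glue-y : ∀ cx cy w → glue cx cy w y ≈ cy
        glue-y cx cy w with y ≟ x
        ... | yes e = ⊥-elim (x≢ (here ≡.refl) (≡.sym e))
        ... | no _ with y ≟ y
        ...   | yes _ = refl
        ...   | no ne = ⊥-elim (ne ≡.refl)

        glue-B : ∀ cx cy w {b} → b ∈ B → glue cx cy w b ≈ w b
        glue-B cx cy w {b} b∈ with b ≟ x
        ... | yes e = ⊥-elim (x≢ (there b∈) (≡.sym e))
        ... | no _ with b ≟ y
        ...   | yes e = ⊥-elim (y≢ b∈ (≡.sym e))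
        ...   | no _  = refl

        cancel-u : ∀ {r} → u * r ≈ 0# → r ≈ 0#
        cancel-u {r} e = begin
          r            ≈⟨ *-identityˡ r ⟨
          1# * r       ≈⟨ *-congʳ uv≈1 ⟨
          u * v * r    ≈⟨ identity1 u v r ⟩
          v * (u * r)  ≈⟨ *-congˡ e ⟩
          v * 0#       ≈⟨ zeroʳ v ⟩
          0#           ∎

        reduce-dot : ∀ a z → ∑ B (λ b → D″ a b * z b) ≈ u * dot a z - D a y * dot x z
        reduce-dot a z = begin
          ∑ B (λ b → D″ a b * z b)
            ≈⟨ ∑-cong B (λ b → identity2 u (D a b) (D a y) (D x b) (z b)) ⟩
          ∑ B (λ b → u * (D a b * z b) + (- D a y) * (D x b * z b))
            ≈⟨ ∑-+ B _ _ ⟩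
          ∑ B (λ b → u * (D a b * z b)) + ∑ B (λ b → (- D a y) * (D x b * z b))
            ≈⟨ +-cong (∑-*ˡ B u _) (∑-*ˡ B (- D a y) _) ⟩
          u * dot a z + (- D a y) * dot x z
            ≈⟨ identity15 u (dot a z) (D a y) (dot x z) ⟩
          u * dot a z - D a y * dot x z ∎

        apply-apply : ∀ {a} z → a ∈ L → apply D L (apply D L z) a ≈ 0#
        apply-apply {a} z a∈ = begin
          ∑ L (λ b → D a b * ∑ L (λ e → D b e * z e))
            ≈⟨ ∑-cong L (λ b → sym (∑-*ˡ L (D a b) _)) ⟩
          ∑ L (λ b → ∑ L (λ e → D a b * (D b e * z e)))
            ≈⟨ ∑-swap L L _ ⟩
          ∑ L (λ e → ∑ L (λ b → D a b * (D b e * z e)))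
            ≈⟨ ∑-0 L (λ {e} e∈ → trans (∑-cong L (λ b → sym (*-assoc _ _ _)))
                   (trans (∑-*ʳ L _ (z e)) (*-absorbˡ (sq a∈ e∈)))) ⟩
          0# ∎

        D-diag : D x x ≈ 0#
        D-diag = graded x x (λ e → ℕₚ.1+n≢n (≡.sym e))

        -- A chain on L determined by a chain on B so that its boundary has no x-component.
        lift : (X → Carrier) → X → Carrier
        lift z = glue 0# (- dot x z) (λ b → u * z b)

        apply-lift : ∀ z a → apply D L (lift z) a ≈ ∑ B (λ b → D″ a b * z b)
        apply-lift z a = begin
          D a x * lift z x + (D a y * lift z y + ∑ B (λ b → D a b * lift z b))
            ≈⟨ +-cong (*-absorbʳ (glue-x _ _ _))
                      (+-cong (*-congˡ (glue-y _ _ _))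
                              (∑-cong∈ B (λ {b} b∈ → trans (*-congˡ (glue-B _ _ _ b∈))
                                 (identity3 (D a b) u (z b))))) ⟩
          0# + (D a y * (- dot x z) + ∑ B (λ b → u * (D a b * z b)))
            ≈⟨ +-identityˡ _ ⟩
          D a y * (- dot x z) + ∑ B (λ b → u * (D a b * z b))
            ≈⟨ +-congˡ (∑-*ˡ B u _) ⟩
          D a y * (- dot x z) + u * dot a z
            ≈⟨ identity4 (D a y) (dot x z) (u * dot a z) ⟩
          u * dot a z - D a y * dot x z
            ≈⟨ reduce-dot a z ⟨
          ∑ B (λ b → D″ a b * z b) ∎

        reduce-x : ∀ b → D″ x b ≈ 0#
        reduce-x b = -‿inverseʳ _

        apply-lift-x : ∀ z → apply D L (lift z) x ≈ 0#
        apply-lift-x z = trans (apply-lift z x) (∑-0 B (λ {b} _ → *-absorbˡ (reduce-x b)))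

        dot-x-degree : ∀ {q} z → Homogeneous B q z → deg y ≢ q → dot x z ≈ 0#
        dot-x-degree {q} z hom ne = ∑-0 B term
          where
            term : ∀ {b} → b ∈ B → D x b * z b ≈ 0#
            term {b} b∈ with deg b ℕ.≟ q
            ... | no ne′ = *-absorbʳ (hom b∈ ne′)
            ... | yes e = *-absorbˡ (graded x b (λ e′ → ne (≡.trans degy (≡.trans (≡.sym e′) e))))

        lift-homogeneous : ∀ {q} z → Homogeneous B q z → Homogeneous L q (lift z)
        lift-homogeneous z hom (here ≡.refl) ne = glue-x _ _ _
        lift-homogeneous z hom (there (here ≡.refl)) ne =
          trans (glue-y _ _ _) (trans (-‿cong (dot-x-degree z hom ne)) -0#≈0#)
        lift-homogeneous z hom (there (there b∈)) ne =
          trans (glue-B _ _ _ b∈) (*-absorbʳ (hom b∈ ne))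

        -- Row x of D determines the y-component, because D x y is invertible.
        y-component : ∀ r → (∀ {a} → a ∈ L → apply D L r a ≈ 0#) → r x ≈ 0# → (∀ {b} → b ∈ B → r b ≈ 0#) → r y ≈ 0#
        y-component r cyc rx rB = cancel-u (begin
          u * r y                                                ≈⟨ +-identityˡ _ ⟨
          0# + u * r y                                           ≈⟨ +-congˡ (+-identityʳ _) ⟨
          0# + (u * r y + 0#)
            ≈⟨ +-cong (sym (*-absorbʳ rx))
                      (+-congˡ (sym (∑-0 B (λ b∈ → *-absorbʳ (rB b∈))))) ⟩
          D x x * r x + (u * r y + ∑ B (λ b → D x b * r b))      ≈⟨ cyc (here ≡.refl) ⟩
          0# ∎)

        -- Subtracting a multiple of the boundary of y kills the x-component.
        clear : (X → Carrier) → X → Carrier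
        clear z b = z b - (z x * v) * D b y

        clear-x : ∀ z → clear z x ≈ 0#
        clear-x z = begin
          z x - (z x * v) * u    ≈⟨ identity5 (z x) u v ⟩
          z x - z x * (u * v)    ≈⟨ +-congˡ (-‿cong (trans (*-congˡ uv≈1) (*-identityʳ _))) ⟩
          z x - z x              ≈⟨ -‿inverseʳ _ ⟩
          0#                     ∎

        apply-clear : ∀ z {a} → a ∈ L → apply D L (clear z) a ≈ apply D L z a
        apply-clear z {a} a∈ = begin
          ∑ L (λ b → D a b * clear z b)
            ≈⟨ ∑-cong L (λ b → identity6 (D a b) (z b) (z x * v) (D b y)) ⟩
          ∑ L (λ b → D a b * z b + (- (z x * v)) * (D a b * D b y))
            ≈⟨ ∑-+ L _ _ ⟩
          apply D L z a + ∑ L (λ b → (- (z x * v)) * (D a b * D b y))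
            ≈⟨ +-congˡ (trans (∑-*ˡ L _ _) (*-absorbʳ (sq a∈ (there (here ≡.refl))))) ⟩
          apply D L z a + 0#
            ≈⟨ +-identityʳ _ ⟩
          apply D L z a ∎

        clear-homogeneous : ∀ {q} z → Homogeneous L q z → Homogeneous L q (clear z)
        clear-homogeneous {q} z hom {b} b∈ ne = begin
          z b - (z x * v) * D b y   ≈⟨ +-cong (hom b∈ ne) (-‿cong other) ⟩
          0# - 0#                   ≈⟨ -‿inverseʳ 0# ⟩
          0#                        ∎
          where
            other : (z x * v) * D b y ≈ 0#
            other with deg x ℕ.≟ q
            ... | no ne′ = trans (*-congʳ (*-absorbˡ (hom (here ≡.refl) ne′))) (zeroˡ _)
            ... | yes e = trans (*-congˡ (graded b y (λ e′ → ne (≡.trans (ℕₚ.suc-injective (≡.trans (≡.sym e′) degy)) e)))) (zeroʳ _)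

      -- Column `e` of the reduced matrix is the boundary of the lifted basis vector at `e`. Lifting
      -- that column again gives `u` times the same boundary, so applying the reduced matrix twice
      -- is `u` times applying `D` twice.
      reduce-squareZero : SquareZero D″ B
      reduce-squareZero {a} {e} a∈ e∈ = begin
        ∑ B (λ b → D″ a b * D″ b e)          ≈⟨ apply-lift (λ b → D″ b e) a ⟨
        apply D L (lift (λ b → D″ b e)) a    ≈⟨ ∑-cong∈ L (λ {b} b∈ → *-congˡ (values b∈)) ⟩
        apply D L (λ b → u * apply D L ŵ b) a ≈⟨ ∑-cong L (λ b → identity9 (D a b) u (apply D L ŵ b)) ⟩
        ∑ L (λ b → u * (D a b * apply D L ŵ b)) ≈⟨ ∑-*ˡ L u _ ⟩
        u * apply D L (apply D L ŵ) a         ≈⟨ *-congˡ (apply-apply ŵ (there (there a∈))) ⟩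
        u * 0#                                ≈⟨ zeroʳ u ⟩
        0# ∎
        where
          δ : X → Carrier
          δ b with b ≟ e
          ... | yes _ = 1#
          ... | no _  = 0#

          δ-e : δ e ≈ 1#
          δ-e with e ≟ e
          ... | yes _ = refl
          ... | no ne = ⊥-elim (ne ≡.refl)

          δ-other : ∀ {b} → e ≢ b → δ b ≈ 0#
          δ-other {b} ne with b ≟ e
          ... | yes p = ⊥-elim (ne (≡.sym p))
          ... | no _  = refl

          ∑-δ : ∀ (f : X → Carrier) {bs} → Unique bs → e ∈ bs → ∑ bs (λ b → f b * δ b) ≈ f e
          ∑-δ f {b ∷ bs} (p ∷ ps) (here ≡.refl) =
            trans (+-cong (trans (*-congˡ δ-e) (*-identityʳ _))
                          (∑-0 bs (λ b∈ → *-absorbʳ (δ-other (All.lookup p b∈)))))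
                  (+-identityʳ _)
          ∑-δ f {b ∷ bs} (p ∷ ps) (there q) =
            trans (+-cong (trans (*-congˡ (δ-other (λ eq → All.lookup p q (≡.sym eq)))) (zeroʳ _)) (∑-δ f ps q)) (+-identityˡ _)

          uniqB : Unique B
          uniqB = AllPairs.tail (AllPairs.tail uniq)

          ŵ = lift δ

          boundary : ∀ b → apply D L ŵ b ≈ D″ b e
          boundary b = trans (apply-lift δ b) (∑-δ (D″ b) uniqB e∈)

          values : ∀ {b} → b ∈ L → lift (λ b → D″ b e) b ≈ u * apply D L ŵ b
          values (here ≡.refl) = trans (glue-x _ _ _) (sym (*-absorbʳ (apply-lift-x δ)))
          values (there (there b∈)) = trans (glue-B _ _ _ b∈) (*-congˡ (sym (boundary _)))
          -- The y-components agree because row `x` of `D` annihilates the boundary of `ŵ`, and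
          -- `D x x` vanishes for reasons of degree.
          values (there (here ≡.refl)) = trans (glue-y _ _ _) (begin
            - dot x (λ b → D″ b e)          ≈⟨ -‿cong (∑-cong B (λ b → *-congˡ (sym (boundary b)))) ⟩
            - dot x (apply D L ŵ)           ≈⟨ identity7 (u * apply D L ŵ y) (dot x (apply D L ŵ)) ⟩
            u * apply D L ŵ y - (u * apply D L ŵ y + dot x (apply D L ŵ))
              ≈⟨ +-congˡ (-‿cong (trans (sym (+-identityˡ _)) (trans (+-congʳ (sym (*-absorbˡ D-diag)))
                    (apply-apply ŵ (here ≡.refl))))) ⟩
            u * apply D L ŵ y - 0#          ≈⟨ trans (+-congˡ -0#≈0#) (+-identityʳ _) ⟩
            u * apply D L ŵ y               ∎)

      -- A cycle of the reduced matrix lifts to a cycle of `D`. A chain bounded by the lift, once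
      -- cleared of its x-component, restricts to a solution on `B` up to a power of `u`.
      reduce-exact : ∀ {q} → Exact D L q → Exact D″ B q
      reduce-exact {q} ex z hom cyc = w , w-hom , w-boundary
        where
          ẑ = lift z

          B-component : ∀ {b} → b ∈ B → apply D L ẑ b ≈ 0#
          B-component b∈ = trans (apply-lift z _) (cyc b∈)

          cycle : ∀ {a} → a ∈ L → apply D L ẑ a ≈ 0#
          cycle (here ≡.refl) = apply-lift-x z
          cycle (there (here ≡.refl)) = y-component (apply D L ẑ) (apply-apply ẑ) (apply-lift-x z) B-component
          cycle (there (there b∈)) = B-component b∈

          found = ex ẑ (lift-homogeneous z hom) cycle
          ŵ = clear (proj₁ found)
          ŵ-hom = clear-homogeneous (proj₁ found) (proj₁ (proj₂ found))

          ŵ-boundary : ∀ {a} → a ∈ L → apply D L ŵ a ≈ ẑ a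
          ŵ-boundary a∈ = trans (apply-clear (proj₁ found) a∈) (proj₂ (proj₂ found) a∈)

          -- The reduced matrix carries one factor `u` and the lift another, so the solution has to
          -- be divided by `u` twice.
          w : X → Carrier
          w b = (v * v) * ŵ b

          w-hom : Homogeneous B (suc q) w
          w-hom b∈ ne = trans (*-congˡ (ŵ-hom (there (there b∈)) ne)) (zeroʳ _)

          row : ∀ {a} → a ∈ L → D a y * ŵ y + dot a ŵ ≈ ẑ a
          row {a} a∈ = trans (trans (sym (+-identityˡ _)) (+-congʳ (sym (*-absorbʳ (clear-x (proj₁ found)))))) (ŵ-boundary a∈)

          dot-ŵ : ∀ {a} → a ∈ L → dot a ŵ ≈ ẑ a - D a y * ŵ y
          dot-ŵ {a} a∈ = trans (identity8 (D a y * ŵ y) (dot a ŵ)) (+-congʳ (row a∈))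

          w-boundary : ∀ {a} → a ∈ B → ∑ B (λ b → D″ a b * w b) ≈ z a
          w-boundary {a} a∈ = begin
            ∑ B (λ b → D″ a b * (v * v * ŵ b))
              ≈⟨ ∑-cong B (λ b → identity9 (D″ a b) (v * v) (ŵ b)) ⟩
            ∑ B (λ b → v * v * (D″ a b * ŵ b))
              ≈⟨ ∑-*ˡ B _ _ ⟩
            v * v * ∑ B (λ b → D″ a b * ŵ b)
              ≈⟨ *-congˡ (reduce-dot a ŵ) ⟩
            v * v * (u * dot a ŵ - D a y * dot x ŵ)
              ≈⟨ *-congˡ (+-cong (*-congˡ (trans (dot-ŵ (there (there a∈))) (+-congʳ (glue-B _ _ _ a∈))))
                   (-‿cong (*-congˡ (trans (dot-ŵ (here ≡.refl)) (+-congʳ (glue-x _ _ _)))))) ⟩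
            v * v * (u * (u * z a - D a y * ŵ y) - D a y * (0# - u * ŵ y))
              ≈⟨ identity10 u v (z a) (D a y) (ŵ y) ⟩
            (u * v) * ((u * v) * z a)
              ≈⟨ *-cong uv≈1 (*-congʳ uv≈1) ⟩
            1# * (1# * z a)
              ≈⟨ trans (*-identityˡ _) (*-identityˡ _) ⟩
            z a ∎

      -- Clearing the x-component of `ẑ` subtracts a multiple of the boundary of `y`; the same
      -- multiple of `y` is added back to the solution at the end.
      unreduce-exact : ∀ {q} → Exact D″ B q → Exact D L q
      unreduce-exact {q} ex ẑ hom cyc = ŵ , ŵ-hom , ŵ-boundary
        where
          z = clear ẑ
          z-hom = clear-homogeneous ẑ hom

          z-cycle : ∀ {a} → a ∈ L → apply D L z a ≈ 0#
          z-cycle a∈ = trans (apply-clear ẑ a∈) (cyc a∈)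

          dot-z : ∀ {a} → a ∈ L → dot a z ≈ - (D a y * z y)
          dot-z {a} a∈ = trans (identity8 (D a y * z y) (dot a z))
            (trans (+-congʳ (trans (trans (sym (+-identityˡ _)) (+-congʳ (sym (*-absorbʳ (clear-x ẑ))))) (z-cycle a∈)))
                   (+-identityˡ _))

          found = ex z (λ b∈ → z-hom (there (there b∈))) (λ {a} a∈ → begin
            ∑ B (λ b → D″ a b * z b)         ≈⟨ reduce-dot a z ⟩
            u * dot a z - D a y * dot x z    ≈⟨ +-cong (*-congˡ (dot-z (there (there a∈)))) (-‿cong (*-congˡ (dot-z (here ≡.refl)))) ⟩
            u * (- (D a y * z y)) - D a y * (- (u * z y))
              ≈⟨ identity11 u (D a y) (z y) ⟩
            0# ∎)

          ŵ₀ = lift (proj₁ found)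

          ŵ : X → Carrier
          ŵ b = ŵ₀ b + glue 0# (ẑ x * v) (λ _ → 0#) b

          glue-apply : ∀ {a} → apply D L (glue 0# (ẑ x * v) (λ _ → 0#)) a ≈ (ẑ x * v) * D a y
          glue-apply {a} = begin
            _ ≈⟨ +-cong (*-absorbʳ (glue-x _ _ _))
                   (+-cong (*-congˡ (glue-y _ _ _)) (∑-0 B (λ b∈ → *-absorbʳ (glue-B _ _ _ b∈)))) ⟩
            0# + (D a y * (ẑ x * v) + 0#) ≈⟨ trans (+-identityˡ _) (trans (+-identityʳ _) (*-comm _ _)) ⟩
            (ẑ x * v) * D a y ∎

          ŵ₀-x : apply D L ŵ₀ x ≈ z x
          ŵ₀-x = trans (apply-lift-x _) (sym (clear-x ẑ))

          ŵ₀-B : ∀ {b} → b ∈ B → apply D L ŵ₀ b ≈ z b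
          ŵ₀-B b∈ = trans (apply-lift _ _) (proj₂ (proj₂ found) b∈)

          -- The equation already holds at `x` and on `B`. What remains is a cycle concentrated at
          -- `y`, which is zero because `D x y` is a unit.
          diff : X → Carrier
          diff b = z b - apply D L ŵ₀ b

          diff-cycle : ∀ {a} → a ∈ L → apply D L diff a ≈ 0#
          diff-cycle {a} a∈ = begin
            ∑ L (λ b → D a b * (z b - apply D L ŵ₀ b))
              ≈⟨ ∑-cong L (λ b → trans (identity12 (D a b) (z b) (apply D L ŵ₀ b)) (+-congˡ (sym (-1*x≈-x _)))) ⟩
            ∑ L (λ b → D a b * z b + (- 1#) * (D a b * apply D L ŵ₀ b))
              ≈⟨ ∑-+ L _ _ ⟩
            apply D L z a + ∑ L (λ b → (- 1#) * (D a b * apply D L ŵ₀ b))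
              ≈⟨ +-cong (z-cycle a∈) (trans (∑-*ˡ L _ _) (*-absorbʳ (apply-apply ŵ₀ a∈))) ⟩
            0# + 0# ≈⟨ +-identityˡ 0# ⟩
            0# ∎

          diff-y : z y - apply D L ŵ₀ y ≈ 0#
          diff-y = y-component diff diff-cycle (trans (+-congʳ (sym ŵ₀-x)) (-‿inverseʳ _))
                     (λ b∈ → trans (+-congʳ (sym (ŵ₀-B b∈))) (-‿inverseʳ _))

          ŵ₀-boundary : ∀ {a} → a ∈ L → apply D L ŵ₀ a ≈ z a
          ŵ₀-boundary (here ≡.refl) = ŵ₀-x
          ŵ₀-boundary (there (here ≡.refl)) = begin
            apply D L ŵ₀ y                          ≈⟨ identity13 (z y) (apply D L ŵ₀ y) ⟩
            z y - (z y - apply D L ŵ₀ y)            ≈⟨ trans (+-congˡ (trans (-‿cong diff-y) -0#≈0#)) (+-identityʳ _) ⟩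
            z y                                     ∎
          ŵ₀-boundary (there (there b∈)) = ŵ₀-B b∈

          ŵ-boundary : ∀ {a} → a ∈ L → apply D L ŵ a ≈ ẑ a
          ŵ-boundary {a} a∈ = begin
            apply D L ŵ a
              ≈⟨ trans (∑-cong L (λ b → distribˡ _ _ _)) (∑-+ L _ _) ⟩
            apply D L ŵ₀ a + apply D L (glue 0# (ẑ x * v) (λ _ → 0#)) a
              ≈⟨ +-cong (ŵ₀-boundary a∈) glue-apply ⟩
            ẑ a - (ẑ x * v) * D a y + (ẑ x * v) * D a y
              ≈⟨ identity14 (ẑ a) ((ẑ x * v) * D a y) ⟩
            ẑ a ∎

          ŵ-hom : Homogeneous L (suc q) ŵ
          ŵ-hom b∈ ne = trans (+-cong (lift-homogeneous _ (proj₁ (proj₂ found)) b∈ ne) (bump b∈ ne)) (+-identityˡ 0#)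
            where
              bump : Homogeneous L (suc q) (glue 0# (ẑ x * v) (λ _ → 0#))
              bump (here ≡.refl) ne = glue-x _ _ _
              bump (there (here ≡.refl)) ne =
                trans (glue-y _ _ _) (trans (*-congʳ (hom (here ≡.refl) (λ e → ne (≡.trans degy (≡.cong suc e))))) (zeroˡ v))
              bump (there (there b∈)) ne = glue-B _ _ _ b∈

-- Complete elimination: Euler characteristics and change of field.

module Pivoting where

  open import Level using (Level)
  open import Algebra.Bundles using (CommutativeRing)
  open import Data.Nat as ℕ using (ℕ; zero; suc; z≤n)
  import Data.Nat.Properties as ℕₚ
  open import Data.Integer as ℤ using (ℤ; +_; 0ℤ; 1ℤ)
  import Data.Integer.Properties as ℤₚ
  open import Data.List using (List; []; _∷_; _++_; length)
  open import Data.List.Membership.Propositional using (_∈_)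
  open import Data.List.Membership.Propositional.Properties using (∈-∃++)
  open import Data.List.Relation.Unary.Any using (here; there)
  import Data.List.Relation.Unary.AllPairs as AllPairs
  open import Data.List.Relation.Unary.Unique.Propositional using (Unique)
  open import Data.List.Relation.Binary.Permutation.Propositional using (_↭_; ↭-sym; ↭-trans; prep; ↭⇒↭ₛ)
  open import Data.List.Relation.Binary.Permutation.Propositional.Properties using (∈-resp-↭; shift; ↭-length)
  import Data.List.Relation.Binary.Permutation.Setoid.Properties as PermSetoid
  open import Data.Product using (∃; _×_; _,_; proj₁; proj₂)
  open import Data.Sum using (_⊎_; inj₁; inj₂)
  open import Data.Empty using (⊥-elim)
  open import Relation.Nullary using (¬_; yes; no)
  open import Relation.Binary.Definitions using (DecidableEquality)
  open import Relation.Binary.PropositionalEquality as ≡ using (_≡_; _≢_)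
  open import Defs using (Field)
  open Sums
  open IntegerCoefficients
  open Elimination

  ¬¬_ : ∀ {a} → Set a → Set a
  ¬¬ A = ¬ ¬ A

  ¬¬-bind : ∀ {a b} {A : Set a} {B : Set b} → ¬¬ A → (A → ¬¬ B) → ¬¬ B
  ¬¬-bind m f k = m (λ a → f a k)

  ¬¬-map : ∀ {a b} {A : Set a} {B : Set b} → (A → B) → ¬¬ A → ¬¬ B
  ¬¬-map f m k = m (λ a → k (f a))

  ¬¬-em : ∀ {a} (A : Set a) → ¬¬ (¬ A ⊎ A)
  ¬¬-em A k = k (inj₁ (λ a → k (inj₂ a)))

  ¬¬-∀∈ : ∀ {a b} {X : Set a} {A : X → Set b} (xs : List X) → (∀ {x} → x ∈ xs → ¬¬ A x) → ¬¬ (∀ {x} → x ∈ xs → A x)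
  ¬¬-∀∈ []       f k = k (λ ())
  ¬¬-∀∈ (x ∷ xs) f = ¬¬-bind (f (here ≡.refl)) λ a → ¬¬-bind (¬¬-∀∈ xs (λ p → f (there p))) λ g →
    λ k → k λ { (here ≡.refl) → a ; (there p) → g p }

  ¬¬-search : ∀ {a b d} {X : Set a} {A : X → Set b} {B : X → Set d} (xs : List X) → (∀ x → ¬¬ (A x ⊎ B x)) →
              ¬¬ ((∃ λ x → x ∈ xs × A x) ⊎ (∀ {x} → x ∈ xs → B x))
  ¬¬-search [] f k = k (inj₂ λ ())
  ¬¬-search (x ∷ xs) f = ¬¬-bind (f x) λ
    { (inj₁ a) → λ k → k (inj₁ (x , here ≡.refl , a))
    ; (inj₂ b) → ¬¬-map (λ { (inj₁ (y , p , a)) → inj₁ (y , there p , a)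
                           ; (inj₂ g) → inj₂ λ { (here ≡.refl) → b ; (there p) → g p } }) (¬¬-search xs f) }

  sign : ℕ → ℤ
  sign zero    = 1ℤ
  sign (suc n) = ℤ.- sign n

  sign-+ : ∀ m n → sign (m ℕ.+ n) ≡ sign m ℤ.* sign n
  sign-+ zero    n = ≡.sym (ℤₚ.*-identityˡ (sign n))
  sign-+ (suc m) n = ≡.trans (≡.cong ℤ.-_ (sign-+ m n)) (ℤₚ.neg-distribˡ-* (sign m) (sign n))

  sign-double : ∀ n → sign (n ℕ.+ n) ≡ 1ℤ
  sign-double zero    = ≡.refl
  sign-double (suc n) = ≡.trans (≡.cong (λ k → ℤ.- sign k) (ℕₚ.+-suc n n))
                                (≡.trans (ℤₚ.neg-involutive _) (sign-double n))

  ∃-split : ∀ {a} {X : Set a} {x : X} {xs} → x ∈ xs → ∃ λ ys → xs ↭ x ∷ ys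
  ∃-split {x = x} p with ∈-∃++ p
  ... | as , bs , ≡.refl = as ++ bs , shift x as bs

  Unique-↭ : ∀ {a} {X : Set a} {xs ys : List X} → xs ↭ ys → Unique xs → Unique ys
  Unique-↭ {X = X} p = PermSetoid.Unique-resp-↭ (≡.setoid X) (↭⇒↭ₛ p)

  module IntegerMatrix {X : Set} (_≟_ : DecidableEquality X) (deg : X → ℕ) where

    GradedZ : (X → X → ℤ) → Set
    GradedZ D = ∀ x y → deg y ≢ suc (deg x) → D x y ≡ 0ℤ

    module ℤ-Cancel = Cancellation ℤₚ.+-*-commutativeRing _≟_ deg

    reduceℤ : (X → X → ℤ) → X → X → X → X → ℤ
    reduceℤ = ℤ-Cancel.reduce

    reduceℤ-graded : ∀ {D} x y → deg y ≡ suc (deg x) → GradedZ D → GradedZ (reduceℤ D x y)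
    reduceℤ-graded {D} x y degy graded a b ne with deg y ℕ.≟ suc (deg a)
    ... | no ne′ rewrite graded a b ne | graded a y ne′ = ≡.trans (≡.cong (ℤ._- 0ℤ) (ℤₚ.*-zeroʳ (D x y))) ≡.refl
    ... | yes e rewrite graded a b ne
                      | graded x b (λ e′ → ne (≡.trans e′ (≡.trans (≡.sym degy) e)))
                      | ℤₚ.*-zeroʳ (D x y) | ℤₚ.*-zeroʳ (D a y) = ≡.refl

    module Over {c ℓ : Level} (K : Field c ℓ) where
      open Field K using (commutativeRing; 0≉1; inverse)
      open CommutativeRing commutativeRing hiding (+-congˡ; +-congʳ; *-congˡ; *-congʳ)
      open Congruence commutativeSemiring
      open Sum commutativeSemiring
      open ℤ-Action commutativeRing public
      open Exactness commutativeRing deg public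

      image : (X → X → ℤ) → Matrix
      image D x y = ⟦ D x y ⟧

      image-graded : ∀ {D} → GradedZ D → Graded (image D)
      image-graded graded x y ne = ⟦⟧-cong (graded x y ne)

      module Pivot (D : X → X → ℤ) (B : List X) (x y : X) (uniq : Unique (x ∷ y ∷ B)) (graded : GradedZ D)
                   (sq : SquareZero (image D) (x ∷ y ∷ B)) (u≉0 : ¬ (⟦ D x y ⟧ ≈ 0#)) (degy : deg y ≡ suc (deg x)) where
        private
          module C = Cancellation commutativeRing _≟_ deg
          module CC = C.Cancel (image D) B x y uniq (image-graded graded) sq
                               (proj₁ (inverse _ u≉0)) (proj₂ (inverse _ u≉0)) degy

          image-reduce : ∀ a b → C.reduce (image D) x y a b ≈ image (reduceℤ D x y) a b
          image-reduce a b = sym (trans (⟦⟧-+ (D x y ℤ.* D a b) _)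
            (+-cong (⟦⟧-* (D x y) (D a b)) (trans (⟦⟧-neg (D a y ℤ.* D x b)) (-‿cong (⟦⟧-* (D a y) (D x b))))))

        squareZero : SquareZero (image (reduceℤ D x y)) B
        squareZero {a} {e} a∈ e∈ =
          trans (∑-cong B (λ b → *-cong (sym (image-reduce a b)) (sym (image-reduce b e)))) (CC.reduce-squareZero a∈ e∈)

        exact : ∀ {q} → Exact (image D) (x ∷ y ∷ B) q → Exact (image (reduceℤ D x y)) B q
        exact ex = Exact-cong image-reduce (CC.reduce-exact ex)

        unexact : ∀ {q} → Exact (image (reduceℤ D x y)) B q → Exact (image D) (x ∷ y ∷ B) q
        unexact ex = CC.unreduce-exact (Exact-cong (λ a b → sym (image-reduce a b)) ex)

      Reduced : (ℕ → Set) → List X → Set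
      Reduced Good L = ∀ {x} → x ∈ L → ¬ Good (deg x)

      -- When the differential is zero, every basis vector is a cycle and only zero is a boundary;
      -- exactness in a degree then leaves no cell there.
      zero⇒reduced : ∀ {Good D L} → (∀ q → Good q → Exact (image D) L q) →
                     (∀ {x} → x ∈ L → ∀ {y} → y ∈ L → image D x y ≈ 0#) → Reduced Good L
      zero⇒reduced {D = D} {L} ex vanish {x} x∈ good =
        0≉1 (trans (sym (apply-0 {proj₁ found} x∈)) (trans (proj₂ (proj₂ found) x∈) δ-x))
        where
          δ : X → Carrier
          δ b with b ≟ x
          ... | yes _ = 1#
          ... | no _  = 0#

          δ-x : δ x ≈ 1#
          δ-x with x ≟ x
          ... | yes _ = refl
          ... | no ne = ⊥-elim (ne ≡.refl)

          δ-hom : Homogeneous L (deg x) δ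
          δ-hom {b} _ ne with b ≟ x
          ... | yes e = ⊥-elim (ne (≡.cong deg e))
          ... | no _  = refl

          apply-0 : ∀ {w z} → z ∈ L → apply (image D) L w z ≈ 0#
          apply-0 z∈ = ∑-0 L (λ y∈ → *-absorbˡ (vanish z∈ y∈))

          found = ex (deg x) good δ δ-hom (λ z∈ → apply-0 {δ} z∈)

      -- An induction principle along the elimination. The pivot is passed on as a nonzero integer,
      -- not as a unit of `K`; this is what allows a second field to follow the same elimination.
      eliminate : ∀ {q} (Good : ℕ → Set) (Q : (X → X → ℤ) → List X → Set q) →
        (∀ {D L L′} → L ↭ L′ → Q D L′ → Q D L) →
        (∀ {D B x y} → Unique (x ∷ y ∷ B) → GradedZ D → D x y ≢ 0ℤ → deg y ≡ suc (deg x) →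
           Q (reduceℤ D x y) B → Q D (x ∷ y ∷ B)) →
        (∀ {D L} → Reduced Good L → Q D L) →
        ∀ {D L} → Unique L → GradedZ D → SquareZero (image D) L → (∀ q → Good q → Exact (image D) L q) → ¬¬ Q D L
      eliminate Good Q Q-↭ Q-pivot Q-reduced {L = L} = go (length L) ℕₚ.≤-refl
        where
          -- `k` bounds the number of cells; each pivot removes two of them.
          go : ∀ k {D L} → length L ℕ.≤ k → Unique L → GradedZ D → SquareZero (image D) L →
               (∀ q → Good q → Exact (image D) L q) → ¬¬ Q D L
          go zero {L = []} _ _ _ _ _ k = k (Q-reduced λ ())
          go (suc k) {D} {L} len uniq graded sq ex =
            ¬¬-bind (¬¬-search L (λ x → ¬¬-search L (λ y → ¬¬-em (image D x y ≈ 0#)))) λ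
              { (inj₂ vanish) → λ k → k (Q-reduced (zero⇒reduced {D = D} ex vanish))
              ; (inj₁ (x , x∈ , y , y∈ , u≉0)) → step x x∈ y y∈ u≉0 }
            where
              step : ∀ x → x ∈ L → ∀ y → y ∈ L → ¬ (image D x y ≈ 0#) → ¬¬ Q D L
              step x x∈ y y∈ u≉0 with deg y ℕ.≟ suc (deg x) | ∃-split x∈
              ... | no ne | _ = ⊥-elim (u≉0 (⟦⟧-cong (graded x y ne)))
              ... | yes degy | ys , L↭ with ∈-resp-↭ L↭ y∈
              ...   | here ≡.refl = ⊥-elim (ℕₚ.1+n≢n (≡.sym degy))
              ...   | there y∈ys with ∃-split y∈ys
              ...     | B , ys↭ = ¬¬-map (λ h → Q-↭ perm (Q-pivot uniq′ graded (λ e → u≉0 (⟦⟧-cong e)) degy h))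
                                    (go k len′ (AllPairs.tail (AllPairs.tail uniq′))
                                       (reduceℤ-graded x y degy graded) P.squareZero
                                       (λ q good → P.exact (Exact-↭ perm (ex q good))))
                where
                  perm : L ↭ x ∷ y ∷ B
                  perm = ↭-trans L↭ (prep x ys↭)
                  uniq′ = Unique-↭ perm uniq
                  module P = Pivot D B x y uniq′ graded (SquareZero-↭ perm sq) u≉0 degy
                  len′ : length B ℕ.≤ k
                  len′ = ℕₚ.≤-trans (ℕₚ.n≤1+n _) (ℕₚ.≤-pred (ℕₚ.≤-trans (ℕₚ.≤-reflexive (≡.sym (↭-length perm))) len))

      open Sum (CommutativeRing.commutativeSemiring ℤₚ.+-*-commutativeRing) using () renaming (∑ to ∑ℤ; ∑-↭ to ∑ℤ-↭)

      euler-nonneg : ∀ N {D L} → Unique L → GradedZ D → SquareZero (image D) L →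
                     (∀ q → q ≢ N → Exact (image D) L q) → 0ℤ ℤ.≤ ∑ℤ L (λ x → sign (N ℕ.+ deg x))
      euler-nonneg N {D} uniq graded sq ex = stable (eliminate (_≢ N) (λ _ L → 0ℤ ℤ.≤ χ L) (λ {D} → Q-↭ {D}) Q-pivot (λ {_} {L} → base L) {D} uniq graded sq ex)
        where
          χ : List X → ℤ
          χ L = ∑ℤ L (λ x → sign (N ℕ.+ deg x))

          stable : ∀ {i} → ¬¬ (0ℤ ℤ.≤ i) → 0ℤ ℤ.≤ i
          stable {i} nn with 0ℤ ℤ.≤? i
          ... | yes p = p
          ... | no ¬p = ⊥-elim (nn ¬p)

          Q-↭ : ∀ {D : X → X → ℤ} {L L′} → L ↭ L′ → 0ℤ ℤ.≤ χ L′ → 0ℤ ℤ.≤ χ L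
          Q-↭ p h = ℤₚ.≤-trans h (ℤₚ.≤-reflexive (≡.sym (∑ℤ-↭ p _)))

          Q-pivot : ∀ {D B x y} → Unique (x ∷ y ∷ B) → GradedZ D → D x y ≢ 0ℤ → deg y ≡ suc (deg x) →
                    0ℤ ℤ.≤ χ B → 0ℤ ℤ.≤ χ (x ∷ y ∷ B)
          Q-pivot {B = B} {x} {y} _ _ _ degy h rewrite degy | ℕₚ.+-suc N (deg x) =
            ℤₚ.≤-trans h (ℤₚ.≤-reflexive (≡.sym (≡.trans (≡.sym (ℤₚ.+-assoc s (ℤ.- s) (χ B)))
              (≡.trans (≡.cong (ℤ._+ χ B) (ℤₚ.+-inverseʳ s)) (ℤₚ.+-identityˡ (χ B))))))
            where s = sign (N ℕ.+ deg x)

          base : ∀ L → Reduced (_≢ N) L → 0ℤ ℤ.≤ χ L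
          base [] red = ℤₚ.≤-refl
          base (x ∷ L) red with deg x ℕ.≟ N
          ... | no ne = ⊥-elim (red (here ≡.refl) ne)
          ... | yes e rewrite e | sign-double N = ℤₚ.+-mono-≤ (ℤ.+≤+ z≤n) (base L (λ p → red (there p)))

    -- An integral pivot that is nonzero in K is nonzero in F, so one elimination serves both fields.
    module Transfer {c ℓ c′ ℓ′ : Level} (K : Field c ℓ) (F : Field c′ ℓ′)
                    (char0 : ∀ i → i ≢ 0ℤ → ¬ (Field._≈_ F (ℤ-Action.⟦_⟧ (Field.commutativeRing F) i) (Field.0# F))) where
      private
        module 𝕂 = Over K
        module 𝔽 = Over F
      open CommutativeRing (Field.commutativeRing F)
      open Sum commutativeSemiring using (∑-0)

      transfer : ∀ {Good : ℕ → Set} {D L} → Unique L → GradedZ D →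
                 𝕂.SquareZero (𝕂.image D) L → 𝔽.SquareZero (𝔽.image D) L →
                 (∀ q → Good q → 𝕂.Exact (𝕂.image D) L q) → ¬¬ (∀ q → Good q → 𝔽.Exact (𝔽.image D) L q)
      transfer {Good} uniq graded sqK sqF ex =
        ¬¬-map (λ h → h sqF) (𝕂.eliminate Good Q (λ {D} → Q-↭ {D}) Q-pivot (λ {D} → Q-reduced {D}) uniq graded sqK ex)
        where
          Q : (X → X → ℤ) → List X → Set _
          Q D L = 𝔽.SquareZero (𝔽.image D) L → ∀ q → Good q → 𝔽.Exact (𝔽.image D) L q

          Q-↭ : ∀ {D L L′} → L ↭ L′ → Q D L′ → Q D L
          Q-↭ p h sq q good = 𝔽.Exact-↭ (↭-sym p) (h (𝔽.SquareZero-↭ p sq) q good)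

          Q-pivot : ∀ {D B x y} → Unique (x ∷ y ∷ B) → GradedZ D → D x y ≢ 0ℤ → deg y ≡ suc (deg x) →
                    Q (reduceℤ D x y) B → Q D (x ∷ y ∷ B)
          Q-pivot {D} {B} {x} {y} uniq graded u≢0 degy h sq q good = P.unexact (h P.squareZero q good)
            where module P = 𝔽.Pivot D B x y uniq graded sq (char0 _ u≢0) degy

          Q-reduced : ∀ {D L} → 𝕂.Reduced Good L → Q D L
          -- No cell of `L` has degree `q`, so `z` is zero on `L` and bounds the zero chain.
          Q-reduced {L = L} red sq q good z hom cyc = (λ _ → 0#) , (λ _ _ → refl) , λ x∈ →
            trans (∑-0 L (λ _ → zeroʳ _)) (sym (hom x∈ (λ e → red x∈ (≡.subst Good (≡.sym e) good))))

-- Integral operators with finite rows, and their restriction to a list of cells.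

module Operators where

  open import Level using (Level; _⊔_)
  open import Algebra.Bundles using (CommutativeRing)
  open import Data.Nat using (ℕ; suc)
  open import Data.Integer using (ℤ; 0ℤ)
  import Data.Integer.Properties as ℤₚ
  open import Data.Bool using (if_then_else_)
  open import Data.List using (List; []; _∷_)
  open import Data.List.Membership.Propositional using (_∈_; _∉_)
  import Data.List.Membership.DecPropositional as DecMembership
  open import Data.List.Relation.Unary.Any using (here; there)
  import Data.List.Relation.Unary.All as All
  open import Data.List.Relation.Unary.AllPairs using (_∷_)
  open import Data.List.Relation.Unary.Unique.Propositional using (Unique)
  open import Data.Product using (∃; _×_; _,_; proj₁; proj₂)
  open import Data.Empty using (⊥-elim)
  open import Relation.Nullary using (yes; no; does)
  open import Relation.Binary.Definitions using (DecidableEquality)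
  open import Relation.Binary.PropositionalEquality as ≡ using (_≡_; _≢_)
  open import Defs using (Field)
  open Sums
  open IntegerCoefficients
  open Elimination
  open Pivoting

  -- A linear operator with integer coefficients, given by the finitely many entries of each row.
  module SparseOperator {X : Set} (_≟_ : DecidableEquality X) (deg : X → ℕ) (terms : X → List (ℤ × X))
                        (terms-degree : ∀ x {t} → t ∈ terms x → deg (proj₂ t) ≡ suc (deg x)) where
    open IntegerMatrix _≟_ deg
    open DecMembership _≟_ using (_∈?_)
    open Sum (CommutativeRing.commutativeSemiring ℤₚ.+-*-commutativeRing) using () renaming (∑ to ∑ℤ; ∑-0 to ∑ℤ-0)

    entry : X → ℤ × X → ℤ
    entry y t = if does (proj₂ t ≟ y) then proj₁ t else 0ℤ

    matrix : X → X → ℤ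
    matrix x y = ∑ℤ (terms x) (entry y)

    matrix-graded : GradedZ matrix
    matrix-graded x y ne = ∑ℤ-0 (terms x) vanish
      where
        vanish : ∀ {t} → t ∈ terms x → entry y t ≡ 0ℤ
        vanish {t} t∈ with proj₂ t ≟ y
        ... | yes ≡.refl = ⊥-elim (ne (terms-degree x t∈))
        ... | no _       = ≡.refl

    module Act {c ℓ : Level} (K : Field c ℓ) where
      open Field K using (commutativeRing)
      open CommutativeRing commutativeRing hiding (+-congˡ; +-congʳ; *-congˡ; *-congʳ)
      open Congruence commutativeSemiring
      open Sum commutativeSemiring
      open Over K
      open import Relation.Binary.Reasoning.Setoid setoid

      -- Here every entry of the row counts, whether or not its target lies in a chosen list; on
      -- functions supported in the list this is the same as `apply`.
      op : (X → Carrier) → X → Carrier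
      op z x = ∑ (terms x) (λ t → ⟦ proj₁ t ⟧ * z (proj₂ t))

      Supported : List X → (X → Carrier) → Set ℓ
      Supported L z = ∀ y → y ∉ L → z y ≈ 0#

      ⟦∑⟧ : ∀ {A : Set} (ts : List A) f → ⟦ ∑ℤ ts f ⟧ ≈ ∑ ts (λ t → ⟦ f t ⟧)
      ⟦∑⟧ []       f = refl
      ⟦∑⟧ (t ∷ ts) f = trans (⟦⟧-+ (f t) (∑ℤ ts f)) (+-congˡ (⟦∑⟧ ts f))

      ∑-entry : ∀ {L} → Unique L → ∀ z → Supported L z → ∀ t →
                ∑ L (λ y → ⟦ entry y t ⟧ * z y) ≈ ⟦ proj₁ t ⟧ * z (proj₂ t)
      ∑-entry {L} uniq z supp t@(c , y′) with y′ ∈? L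
      ... | no y′∉ = trans (∑-0 L (λ {y} y∈ → miss y∈ (λ { ≡.refl → y′∉ y∈ }))) (sym (*-absorbʳ (supp y′ y′∉)))
        where
          miss : ∀ {y} → y ∈ L → y′ ≢ y → ⟦ entry y t ⟧ * z y ≈ 0#
          miss {y} _ ne with y′ ≟ y
          ... | yes e = ⊥-elim (ne e)
          ... | no _  = zeroˡ _
      ... | yes y′∈ = go uniq y′∈
        where
          miss : ∀ {y} → y′ ≢ y → ⟦ entry y t ⟧ * z y ≈ 0#
          miss {y} ne with y′ ≟ y
          ... | yes e = ⊥-elim (ne e)
          ... | no _  = zeroˡ _

          hit : ⟦ entry y′ t ⟧ * z y′ ≈ ⟦ c ⟧ * z y′
          hit with y′ ≟ y′
          ... | yes _ = refl
          ... | no ne = ⊥-elim (ne ≡.refl)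

          go : ∀ {ys} → Unique ys → y′ ∈ ys → ∑ ys (λ y → ⟦ entry y t ⟧ * z y) ≈ ⟦ c ⟧ * z y′
          go {y ∷ ys} (p ∷ ps) (here ≡.refl) =
            trans (+-absorbʳ (∑-0 ys (λ y∈ → miss (All.lookup p y∈)))) hit
          go {y ∷ ys} (p ∷ ps) (there q) =
            trans (+-absorbˡ (miss (λ e → All.lookup p q (≡.sym e)))) (go ps q)

      apply-matrix : ∀ {L} → Unique L → ∀ z → Supported L z → ∀ x → apply (image matrix) L z x ≈ op z x
      apply-matrix {L} uniq z supp x = begin
        ∑ L (λ y → ⟦ matrix x y ⟧ * z y)
          ≈⟨ ∑-cong L (λ y → trans (*-congʳ (⟦∑⟧ (terms x) (entry y))) (sym (∑-*ʳ (terms x) _ (z y)))) ⟩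
        ∑ L (λ y → ∑ (terms x) (λ t → ⟦ entry y t ⟧ * z y))
          ≈⟨ ∑-swap L (terms x) _ ⟩
        ∑ (terms x) (λ t → ∑ L (λ y → ⟦ entry y t ⟧ * z y))
          ≈⟨ ∑-cong (terms x) (∑-entry uniq z supp) ⟩
        op z x ∎

      mask : List X → (X → Carrier) → X → Carrier
      mask L z x with x ∈? L
      ... | yes _ = z x
      ... | no _  = 0#

      mask-∈ : ∀ {L} z {x} → x ∈ L → mask L z x ≈ z x
      mask-∈ {L} z {x} x∈ with x ∈? L
      ... | yes _ = refl
      ... | no x∉ = ⊥-elim (x∉ x∈)

      mask-supported : ∀ {L} z → Supported L (mask L z)
      mask-supported {L} z x x∉ with x ∈? L
      ... | yes x∈ = ⊥-elim (x∉ x∈)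
      ... | no _   = refl

      mask-homogeneous : ∀ {L q z} → Homogeneous L q z → ∀ {x} → deg x ≢ q → mask L z x ≈ 0#
      mask-homogeneous {L} hom {x} ne with x ∈? L
      ... | yes x∈ = hom x∈ ne
      ... | no _   = refl

      -- The counterpart of `Exact` for honest functions on all of `X` that vanish off `L`; `op` can
      -- be computed for these without reference to the list.
      OpExact : List X → ℕ → Set (c ⊔ ℓ)
      OpExact L q = ∀ z → Supported L z → (∀ {x} → deg x ≢ q → z x ≈ 0#) → (∀ {x} → x ∈ L → op z x ≈ 0#) →
                    ∃ λ w → Supported L w × (∀ {x} → deg x ≢ suc q → w x ≈ 0#) × (∀ {x} → x ∈ L → op w x ≈ z x)

      toExact : ∀ {L q} → Unique L → OpExact L q → Exact (image matrix) L q
      toExact {L} uniq ex z hom cyc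
        with ex (mask L z) (mask-supported z) (mask-homogeneous hom)
                (λ {x} x∈ → trans (sym (apply-matrix uniq (mask L z) (mask-supported z) x))
                                  (trans (∑-cong∈ L (λ y∈ → *-congˡ (mask-∈ z y∈))) (cyc x∈)))
      ... | w , supp , homw , eq = w , (λ _ ne → homw ne) , λ {x} x∈ →
        trans (apply-matrix uniq w supp x) (trans (eq x∈) (mask-∈ z x∈))

      fromExact : ∀ {L q} → Unique L → Exact (image matrix) L q → OpExact L q
      fromExact {L} uniq ex z supp hom cyc
        with ex z (λ _ ne → hom ne) (λ {x} x∈ → trans (apply-matrix uniq z supp x) (cyc x∈))
      ... | w , homw , eq = mask L w , mask-supported w , mask-homogeneous homw , λ {x} x∈ →
        trans (sym (apply-matrix uniq (mask L w) (mask-supported w) x))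
              (trans (∑-cong∈ L (λ y∈ → *-congˡ (mask-∈ w y∈))) (eq x∈))

      -- Column `e` of the matrix is `op` of the basis vector at `e`. The mask between the two
      -- applications appears because a product of matrices sums over `L` only.
      toSquareZero : ∀ {L} → Unique L → (∀ z → Supported L z → ∀ {x} → x ∈ L → op (mask L (op z)) x ≈ 0#) →
                     SquareZero (image matrix) L
      toSquareZero {L} uniq sq {x} {e} x∈ e∈ = begin
        ∑ L (λ y → ⟦ matrix x y ⟧ * ⟦ matrix y e ⟧)
          ≈⟨ ∑-cong∈ L (λ {y} y∈ → *-congˡ (trans (row y) (sym (mask-∈ (op δ) y∈)))) ⟩
        apply (image matrix) L (mask L (op δ)) x
          ≈⟨ apply-matrix uniq _ (mask-supported (op δ)) x ⟩
        op (mask L (op δ)) x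
          ≈⟨ sq δ δ-supported x∈ ⟩
        0# ∎
        where
          δ : X → Carrier
          δ y with y ≟ e
          ... | yes _ = 1#
          ... | no _  = 0#

          δ-supported : Supported L δ
          δ-supported y y∉ with y ≟ e
          ... | yes ≡.refl = ⊥-elim (y∉ e∈)
          ... | no _       = refl

          ⟦entry⟧ : ∀ t → ⟦ entry e t ⟧ ≈ ⟦ proj₁ t ⟧ * δ (proj₂ t)
          ⟦entry⟧ t with proj₂ t ≟ e
          ... | yes _ = sym (*-identityʳ _)
          ... | no _  = sym (zeroʳ _)

          row : ∀ y → ⟦ matrix y e ⟧ ≈ op δ y
          row y = trans (⟦∑⟧ (terms y) (entry e)) (∑-cong (terms y) ⟦entry⟧)

-- The simplicial boundary, and its transport to links.

module Boundary where

  open import Level using (Level)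
  open import Algebra.Bundles using (CommutativeRing)
  open import Data.Bool using (true; false; if_then_else_)
  open import Data.Nat using (ℕ; zero; suc)
  open import Data.Integer as ℤ using (ℤ; +_; 1ℤ)
  open import Data.Fin using (Fin; zero; suc)
  open import Data.Fin.Subset using (Subset; _∪_; ⁅_⁆; ∣_∣; _⊆_)
  open import Data.Fin.Subset.Properties using (∪-identityʳ; ⊆-refl; out⊆; s⊆s)
  open import Data.Vec using ([]; _∷_)
  open import Data.List as List using (List; []; _∷_; tabulate)
  import Data.List.Properties as Listₚ
  open import Data.List.Membership.Propositional using (_∈_)
  open import Data.List.Membership.Propositional.Properties using (∈-map⁻)
  open import Data.List.Relation.Unary.Any using (here; there)
  open import Data.Product using (_×_; _,_; proj₁; proj₂)
  open import Relation.Binary.PropositionalEquality as ≡ using (_≡_; _≢_)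
  open import Defs
  open Sums
  open IntegerCoefficients

  data _⋖_ : ∀ {m} → Subset m → Subset m → Set where
    here  : ∀ {m} {G : Subset m} → (false ∷ G) ⋖ (true ∷ G)
    there : ∀ {m b} {G H : Subset m} → G ⋖ H → (b ∷ G) ⋖ (b ∷ H)

  ⋖-size : ∀ {m} {G H : Subset m} → G ⋖ H → ∣ H ∣ ≡ suc ∣ G ∣
  ⋖-size here = ≡.refl
  ⋖-size (there {b = true}  p) = ≡.cong suc (⋖-size p)
  ⋖-size (there {b = false} p) = ⋖-size p

  ⋖-∪ : ∀ {m} (F : Subset m) {G H} → G ⋖ H → (F ∪ G) ⊆ (F ∪ H)
  ⋖-∪ (true  ∷ F) here = ⊆-refl
  ⋖-∪ (false ∷ F) here = out⊆ ⊆-refl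
  ⋖-∪ (true  ∷ F) (there p)             = s⊆s (⋖-∪ F p)
  ⋖-∪ (false ∷ F) (there {b = true}  p) = s⊆s (⋖-∪ F p)
  ⋖-∪ (false ∷ F) (there {b = false} p) = s⊆s (⋖-∪ F p)

  ⋖-disjoint : ∀ {m} (F : Subset m) {G H} → G ⋖ H → disjointᵇ F H ≡ true → disjointᵇ F G ≡ true
  ⋖-disjoint (false ∷ F) here d = d
  ⋖-disjoint (true  ∷ F) here ()
  ⋖-disjoint (true  ∷ F) (there {b = false} p) d = ⋖-disjoint F p d
  ⋖-disjoint (false ∷ F) (there {b = false} p) d = ⋖-disjoint F p d
  ⋖-disjoint (false ∷ F) (there {b = true}  p) d = ⋖-disjoint F p d
  ⋖-disjoint (true  ∷ F) (there {b = true}  p) ()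

  boundaryTerms : ∀ {m} → Subset m → List (ℤ × Subset m)
  boundaryTerms []          = []
  boundaryTerms (false ∷ G) = (1ℤ , true ∷ G) ∷ List.map (λ t → proj₁ t , false ∷ proj₂ t) (boundaryTerms G)
  boundaryTerms (true  ∷ G) = List.map (λ t → ℤ.- proj₁ t , true ∷ proj₂ t) (boundaryTerms G)

  boundaryTerms-⋖ : ∀ {m} (G : Subset m) {t} → t ∈ boundaryTerms G → G ⋖ proj₂ t
  boundaryTerms-⋖ (false ∷ G) (here ≡.refl) = here
  boundaryTerms-⋖ (false ∷ G) (there t∈) with ∈-map⁻ _ t∈
  ... | _ , s∈ , ≡.refl = there (boundaryTerms-⋖ G s∈)
  boundaryTerms-⋖ (true ∷ G) t∈ with ∈-map⁻ _ t∈
  ... | _ , s∈ , ≡.refl = there (boundaryTerms-⋖ G s∈)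

  module Simplicial {c ℓ : Level} (K : Field c ℓ) where
    open Field K using (commutativeRing)
    open CommutativeRing commutativeRing hiding (zero; +-congˡ; +-congʳ; *-congˡ; *-congʳ)
    open Congruence commutativeSemiring public
    open Sum commutativeSemiring
    open SumNegation commutativeRing using (∑-neg)
    open ℤ-Action commutativeRing using (⟦_⟧; ⟦⟧-1; ⟦⟧-neg)
    open import Relation.Binary.Reasoning.Setoid setoid
    open import Algebra.Properties.Ring ring using (-0#≈0#; -‿involutive; -‿distribˡ-*)
    open import Algebra.Properties.AbelianGroup +-abelianGroup using (⁻¹-∙-comm)
    open import Algebra.Properties.CommutativeSemigroup +-commutativeSemigroup using (interchange)

    Chain : ℕ → Set c
    Chain m = Subset m → Carrier

    -- The same operator as `∂`, by recursion on the vertices: the minus sign in the last clause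
    -- accumulates the signs that `∂` takes from `below v G`.
    bd : ∀ {m} → Chain m → Chain m
    bd z []          = 0#
    bd z (false ∷ G) = z (true ∷ G) + bd (λ H → z (false ∷ H)) G
    bd z (true  ∷ G) = - bd (λ H → z (true ∷ H)) G

    bd-cong : ∀ {m} {z w : Chain m} G → (∀ H → G ⋖ H → z H ≈ w H) → bd z G ≈ bd w G
    bd-cong []          h = refl
    bd-cong (false ∷ G) h = +-cong (h _ here) (bd-cong G (λ H p → h _ (there p)))
    bd-cong (true  ∷ G) h = -‿cong (bd-cong G (λ H p → h _ (there p)))

    bd-+ : ∀ {m} (z w : Chain m) G → bd (λ H → z H + w H) G ≈ bd z G + bd w G
    bd-+ z w []          = sym (+-identityˡ 0#)
    bd-+ z w (false ∷ G) = trans (+-congˡ (bd-+ _ _ G)) (interchange _ _ _ _)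
    bd-+ z w (true  ∷ G) = trans (-‿cong (bd-+ _ _ G)) (sym (⁻¹-∙-comm _ _))

    bd-neg : ∀ {m} (z : Chain m) G → bd (λ H → - z H) G ≈ - bd z G
    bd-neg z []          = sym -0#≈0#
    bd-neg z (false ∷ G) = trans (+-congˡ (bd-neg _ G)) (⁻¹-∙-comm _ _)
    bd-neg z (true  ∷ G) = -‿cong (bd-neg _ G)

    bd-0 : ∀ {m} {z : Chain m} G → (∀ H → G ⋖ H → z H ≈ 0#) → bd z G ≈ 0#
    bd-0 []          h = refl
    bd-0 (false ∷ G) h = +-vanish (h _ here) (bd-0 G (λ H p → h _ (there p)))
    bd-0 (true  ∷ G) h = trans (-‿cong (bd-0 G (λ H p → h _ (there p)))) -0#≈0#

    bd-bd : ∀ {m} (z : Chain m) G → bd (bd z) G ≈ 0#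
    bd-bd z []          = refl
    bd-bd z (false ∷ G) = begin
      - bd z₁ G + bd (λ H → z₁ H + bd z₀ H) G  ≈⟨ +-congˡ (bd-+ z₁ (bd z₀) G) ⟩
      - bd z₁ G + (bd z₁ G + bd (bd z₀) G)     ≈⟨ +-congˡ (+-absorbʳ (bd-bd z₀ G)) ⟩
      - bd z₁ G + bd z₁ G                      ≈⟨ -‿inverseˡ _ ⟩
      0# ∎
      where
        z₁ = λ H → z (true ∷ H)
        z₀ = λ H → z (false ∷ H)
    bd-bd z (true ∷ G) = begin
      - bd (λ H → - bd z₁ H) G   ≈⟨ -‿cong (bd-neg (bd z₁) G) ⟩
      - - bd (bd z₁) G           ≈⟨ -‿involutive _ ⟩
      bd (bd z₁) G               ≈⟨ bd-bd z₁ G ⟩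
      0# ∎
      where z₁ = λ H → z (true ∷ H)

    bd-terms : ∀ {m} (z : Chain m) G → ∑ (boundaryTerms G) (λ t → ⟦ proj₁ t ⟧ * z (proj₂ t)) ≈ bd z G
    bd-terms z []          = refl
    bd-terms z (false ∷ G) = +-cong (trans (*-congʳ ⟦⟧-1) (*-identityˡ _))
      (trans (∑-map (λ t → proj₁ t , false ∷ proj₂ t) (boundaryTerms G) _) (bd-terms _ G))
    bd-terms z (true  ∷ G) = begin
      _ ≈⟨ ∑-map (λ t → ℤ.- proj₁ t , true ∷ proj₂ t) (boundaryTerms G) _ ⟩
      ∑ (boundaryTerms G) (λ t → ⟦ ℤ.- proj₁ t ⟧ * z (true ∷ proj₂ t))
        ≈⟨ ∑-cong (boundaryTerms G) (λ t → trans (*-congʳ (⟦⟧-neg (proj₁ t))) (sym (-‿distribˡ-* _ _))) ⟩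
      ∑ (boundaryTerms G) (λ t → - (⟦ proj₁ t ⟧ * z (true ∷ proj₂ t)))
        ≈⟨ ∑-neg (boundaryTerms G) _ ⟩
      - ∑ (boundaryTerms G) (λ t → ⟦ proj₁ t ⟧ * z (true ∷ proj₂ t))
        ≈⟨ -‿cong (bd-terms _ G) ⟩
      - bd (λ H → z (true ∷ H)) G ∎

    module _ {m} (Δ : SimplicialComplex m) where
      open Homology K Δ using (∂; signed; sumL)

      private
        ∑Fin : ∀ {k} → (Fin k → Carrier) → Carrier
        ∑Fin f = sumL (tabulate f)

        ∑Fin-cong : ∀ {k} {f g : Fin k → Carrier} → (∀ v → f v ≈ g v) → ∑Fin f ≈ ∑Fin g
        ∑Fin-cong {zero}  h = refl
        ∑Fin-cong {suc k} h = +-cong (h zero) (∑Fin-cong (λ v → h (suc v)))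

        ∑Fin-neg : ∀ {k} (f : Fin k → Carrier) → ∑Fin (λ v → - f v) ≈ - ∑Fin f
        ∑Fin-neg {zero}  f = sym -0#≈0#
        ∑Fin-neg {suc k} f = trans (+-congˡ (∑Fin-neg (λ v → f (suc v)))) (⁻¹-∙-comm _ _)

        term : ∀ {k} → Chain k → Subset k → Fin k → Carrier
        term z G v = if memᵇ v G then 0# else signed (below v G) (z (G ∪ ⁅ v ⁆))

        ∑term : ∀ {k} (z : Chain k) G → ∑Fin (term z G) ≈ bd z G
        ∑term z []          = refl
        ∑term z (false ∷ G) = +-cong (reflexive (≡.cong (λ H → z (true ∷ H)) (∪-identityʳ G)))
                                     (∑term (λ H → z (false ∷ H)) G)
        ∑term z (true  ∷ G) = begin
          0# + ∑Fin (λ v → term z (true ∷ G) (suc v))   ≈⟨ +-identityˡ _ ⟩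
          ∑Fin (λ v → term z (true ∷ G) (suc v))        ≈⟨ ∑Fin-cong negated ⟩
          ∑Fin (λ v → - term (λ H → z (true ∷ H)) G v)  ≈⟨ ∑Fin-neg (term (λ H → z (true ∷ H)) G) ⟩
          - ∑Fin (term (λ H → z (true ∷ H)) G)          ≈⟨ -‿cong (∑term (λ H → z (true ∷ H)) G) ⟩
          - bd (λ H → z (true ∷ H)) G                   ∎
          where
            negated : ∀ v → term z (true ∷ G) (suc v) ≈ - term (λ H → z (true ∷ H)) G v
            negated v with memᵇ v G
            ... | true  = sym -0#≈0#
            ... | false = refl

      ∂≈bd : ∀ z G → ∂ z G ≈ bd z G
      ∂≈bd z G = trans (reflexive (≡.cong sumL (Listₚ.map-tabulate (λ v → v) (term z G)))) (∑term z G)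

    alternate : ∀ {m} → Subset m → Carrier → Carrier
    alternate []          x = x
    alternate (true  ∷ G) x = - alternate G x
    alternate (false ∷ G) x = alternate G x

    alternate-cong : ∀ {m} (G : Subset m) {x y} → x ≈ y → alternate G x ≈ alternate G y
    alternate-cong []          p = p
    alternate-cong (true  ∷ G) p = -‿cong (alternate-cong G p)
    alternate-cong (false ∷ G) p = alternate-cong G p

    alternate-+ : ∀ {m} (G : Subset m) x y → alternate G (x + y) ≈ alternate G x + alternate G y
    alternate-+ []          x y = refl
    alternate-+ (true  ∷ G) x y = trans (-‿cong (alternate-+ G x y)) (sym (⁻¹-∙-comm _ _))
    alternate-+ (false ∷ G) x y = alternate-+ G x y

    alternate-neg : ∀ {m} (G : Subset m) x → alternate G (- x) ≈ - alternate G x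
    alternate-neg []          x = refl
    alternate-neg (true  ∷ G) x = -‿cong (alternate-neg G x)
    alternate-neg (false ∷ G) x = alternate-neg G x

    alternate-involutive : ∀ {m} (G : Subset m) x → alternate G (alternate G x) ≈ x
    alternate-involutive []          x = refl
    alternate-involutive (false ∷ G) x = alternate-involutive G x
    alternate-involutive (true  ∷ G) x =
      trans (-‿cong (alternate-neg G _)) (trans (-‿involutive _) (alternate-involutive G x))

    alternate-0 : ∀ {m} (G : Subset m) {x} → x ≈ 0# → alternate G x ≈ 0#
    alternate-0 []          p = p
    alternate-0 (true  ∷ G) p = trans (-‿cong (alternate-0 G p)) -0#≈0#
    alternate-0 (false ∷ G) p = alternate-0 G p

    -- `bd` at `G` only reads sets with one vertex more than `G`, and (-1)^|H| = - (-1)^|G| for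
    -- these.
    bd-alternate : ∀ {m} (z : Chain m) G → bd (λ H → alternate H (z H)) G ≈ - alternate G (bd z G)
    bd-alternate z []          = sym -0#≈0#
    bd-alternate z (false ∷ G) = begin
      - alternate G (z (true ∷ G)) + bd (λ H → alternate H (z₀ H)) G  ≈⟨ +-congˡ (bd-alternate z₀ G) ⟩
      - alternate G (z (true ∷ G)) + - alternate G (bd z₀ G)          ≈⟨ ⁻¹-∙-comm _ _ ⟩
      - (alternate G (z (true ∷ G)) + alternate G (bd z₀ G))          ≈⟨ -‿cong (alternate-+ G _ _) ⟨
      - alternate G (z (true ∷ G) + bd z₀ G)                          ∎
      where z₀ = λ H → z (false ∷ H)
    bd-alternate z (true ∷ G) = -‿cong (begin
      bd (λ H → - alternate H (z₁ H)) G    ≈⟨ bd-neg _ G ⟩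
      - bd (λ H → alternate H (z₁ H)) G    ≈⟨ -‿cong (bd-alternate z₁ G) ⟩
      - - alternate G (bd z₁ G)            ≈⟨ -‿cong (alternate-neg G _) ⟨
      - alternate G (- bd z₁ G)            ∎)
      where z₁ = λ H → z (true ∷ H)

    -- The isomorphism, with its signs, between chains on the faces containing A and chains on the link of A.
    toLink : ∀ {m} → Subset m → Chain m → Chain m
    toLink []          z []          = z []
    toLink (false ∷ A) z (b ∷ G)     = toLink A (λ H → z (b ∷ H)) G
    toLink (true  ∷ A) z (false ∷ G) = alternate G (toLink A (λ H → z (true ∷ H)) G)
    toLink (true  ∷ A) z (true  ∷ G) = 0#

    fromLink : ∀ {m} → Subset m → Chain m → Chain m
    fromLink []          z []          = z []
    fromLink (false ∷ A) z (b ∷ G)     = fromLink A (λ H → z (b ∷ H)) G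
    fromLink (true  ∷ A) z (true  ∷ G) = fromLink A (λ H → alternate H (z (false ∷ H))) G
    fromLink (true  ∷ A) z (false ∷ G) = 0#

    toLink-+ : ∀ {m} (A : Subset m) z w G → toLink A (λ H → z H + w H) G ≈ toLink A z G + toLink A w G
    toLink-+ []          z w []          = refl
    toLink-+ (false ∷ A) z w (b ∷ G)     = toLink-+ A _ _ G
    toLink-+ (true  ∷ A) z w (false ∷ G) = trans (alternate-cong G (toLink-+ A _ _ G)) (alternate-+ G _ _)
    toLink-+ (true  ∷ A) z w (true  ∷ G) = sym (+-identityˡ 0#)

    toLink-neg : ∀ {m} (A : Subset m) z G → toLink A (λ H → - z H) G ≈ - toLink A z G
    toLink-neg []          z []          = refl
    toLink-neg (false ∷ A) z (b ∷ G)     = toLink-neg A _ G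
    toLink-neg (true  ∷ A) z (false ∷ G) = trans (alternate-cong G (toLink-neg A _ G)) (alternate-neg G _)
    toLink-neg (true  ∷ A) z (true  ∷ G) = sym -0#≈0#

    -- Each vertex of `A` gives `bd` a factor -1 on the sets containing it. The alternating sign
    -- that `toLink` inserts for this vertex anticommutes with `bd` and cancels the factor.
    toLink-bd : ∀ {m} (A : Subset m) z G → bd (toLink A z) G ≈ toLink A (bd z) G
    toLink-bd []          z []          = refl
    toLink-bd (false ∷ A) z (false ∷ G) = trans (+-congˡ (toLink-bd A _ G)) (sym (toLink-+ A _ _ G))
    toLink-bd (false ∷ A) z (true  ∷ G) = trans (-‿cong (toLink-bd A _ G)) (sym (toLink-neg A _ G))
    toLink-bd (true  ∷ A) z (true  ∷ G) = trans (-‿cong (bd-0 G (λ _ _ → refl))) -0#≈0#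
    toLink-bd (true  ∷ A) z (false ∷ G) = begin
      0# + bd (λ H → alternate H (toLink A z₁ H)) G   ≈⟨ +-identityˡ _ ⟩
      bd (λ H → alternate H (toLink A z₁ H)) G        ≈⟨ bd-alternate (toLink A z₁) G ⟩
      - alternate G (bd (toLink A z₁) G)              ≈⟨ alternate-neg G _ ⟨
      alternate G (- bd (toLink A z₁) G)              ≈⟨ alternate-cong G (-‿cong (toLink-bd A z₁ G)) ⟩
      alternate G (- toLink A (bd z₁) G)              ≈⟨ alternate-cong G (toLink-neg A _ G) ⟨
      alternate G (toLink A (λ H → - bd z₁ H) G)      ∎
      where z₁ = λ H → z (true ∷ H)

    toLink-injective : ∀ {m} (A : Subset m) z w → (∀ G → toLink A z G ≈ toLink A w G) →
                       ∀ G → subsetᵇ A G ≡ true → z G ≈ w G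
    toLink-injective []          z w h []         p = h []
    toLink-injective (false ∷ A) z w h (b ∷ G)    p = toLink-injective A _ _ (λ H → h (b ∷ H)) G p
    toLink-injective (true  ∷ A) z w h (true ∷ G) p = toLink-injective A _ _
      (λ H → trans (sym (alternate-involutive H _)) (trans (alternate-cong H (h (false ∷ H))) (alternate-involutive H _))) G p
    toLink-injective (true  ∷ A) z w h (false ∷ G) ()

    toLink-fromLink : ∀ {m} (A : Subset m) z → (∀ G → disjointᵇ A G ≢ true → z G ≈ 0#) →
                      ∀ G → toLink A (fromLink A z) G ≈ z G
    toLink-fromLink []          z h []          = refl
    toLink-fromLink (false ∷ A) z h (b ∷ G)     = toLink-fromLink A _ (λ H ne → h _ ne) G
    toLink-fromLink (true  ∷ A) z h (true ∷ G)  = sym (h (true ∷ G) (λ ()))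
    toLink-fromLink (true  ∷ A) z h (false ∷ G) =
      trans (alternate-cong G (toLink-fromLink A _ (λ H ne → alternate-0 H (h _ ne)) G)) (alternate-involutive G _)

    toLink-0 : ∀ {m} (A : Subset m) z G → (disjointᵇ A G ≡ true → z (A ∪ G) ≈ 0#) → toLink A z G ≈ 0#
    toLink-0 []          z []          h = h ≡.refl
    toLink-0 (false ∷ A) z (b ∷ G)     h = toLink-0 A _ G h
    toLink-0 (true  ∷ A) z (false ∷ G) h = alternate-0 G (toLink-0 A _ G h)
    toLink-0 (true  ∷ A) z (true  ∷ G) h = refl

    fromLink-0 : ∀ {m} (A : Subset m) z G → (∀ H → disjointᵇ A H ≡ true → A ∪ H ≡ G → z H ≈ 0#) → fromLink A z G ≈ 0#
    fromLink-0 []          z []          h = h [] ≡.refl ≡.refl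
    fromLink-0 (false ∷ A) z (b ∷ G)     h = fromLink-0 A _ G (λ H d e → h (b ∷ H) d (≡.cong (b ∷_) e))
    fromLink-0 (true  ∷ A) z (true  ∷ G) h =
      fromLink-0 A _ G (λ H d e → alternate-0 H (h (false ∷ H) d (≡.cong (true ∷_) e)))
    fromLink-0 (true  ∷ A) z (false ∷ G) h = refl

-- Vanishing of the homology of links, carried from `K` to characteristic 0.

module Links where

  open import Level using (Level; _⊔_; 0ℓ)
  open import Algebra.Bundles using (CommutativeRing)
  open import Data.Bool as Bool using (Bool; true; false; _∧_)
  import Data.Bool.Properties as Boolₚ
  open import Data.Nat as ℕ using (ℕ; zero; suc; _∸_; z≤n; s≤s)
  import Data.Nat.Properties as ℕₚ
  open import Data.Integer using (+_; -[1+_]; 0ℤ)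
  open import Data.Rational as ℚ using (ℚ; 0ℚ; 1ℚ)
  import Data.Rational.Properties as ℚₚ
  open import Data.Fin.Subset using (Subset; _∪_; ∣_∣)
  open import Data.Vec using ([]; _∷_)
  import Data.Vec.Properties as Vecₚ
  open import Data.List as List using (List; []; _∷_)
  open import Data.List.Membership.Propositional using (_∈_; _∉_)
  open import Data.List.Membership.Propositional.Properties using (∈-map⁺; ∈-map⁻; ∈-++⁺ˡ; ∈-++⁺ʳ; ∈-filter⁺; ∈-filter⁻)
  open import Data.List.Relation.Unary.Any using (here)
  open import Data.List.Relation.Unary.All using ([]; _∷_)
  open import Data.List.Relation.Unary.AllPairs using ([]; _∷_)
  open import Data.List.Relation.Unary.Unique.Propositional using (Unique)
  import Data.List.Relation.Unary.Unique.Propositional.Properties as Uniqueₚ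
  open import Data.Product using (∃; _×_; _,_; proj₁; proj₂)
  open import Data.Empty using (⊥-elim) renaming (⊥ to Empty)
  open import Relation.Nullary using (¬_; yes; no)
  open import Relation.Binary.Definitions using (DecidableEquality)
  open import Relation.Binary.PropositionalEquality as ≡ using (_≡_; _≢_)
  open import Defs
  open Sums
  open IntegerCoefficients
  open Elimination
  open Pivoting
  open Operators
  open Boundary

  _≟ˢ_ : ∀ {m} → DecidableEquality (Subset m)
  _≟ˢ_ = Vecₚ.≡-dec Bool._≟_

  ∈-allSubsets : ∀ {m} (G : Subset m) → G ∈ allSubsets m
  ∈-allSubsets []          = here ≡.refl
  ∈-allSubsets (true  ∷ G) = ∈-++⁺ˡ (∈-map⁺ _ (∈-allSubsets G))
  ∈-allSubsets (false ∷ G) = ∈-++⁺ʳ (List.map (true ∷_) (allSubsets _)) (∈-map⁺ _ (∈-allSubsets G))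

  allSubsets-unique : ∀ m → Unique (allSubsets m)
  allSubsets-unique zero    = [] ∷ []
  allSubsets-unique (suc m) = Uniqueₚ.++⁺ (Uniqueₚ.map⁺ Vecₚ.∷-injectiveʳ (allSubsets-unique m))
                                          (Uniqueₚ.map⁺ Vecₚ.∷-injectiveʳ (allSubsets-unique m)) disjoint
    where
      disjoint : ∀ {G} → G ∈ List.map (true ∷_) (allSubsets m) × G ∈ List.map (false ∷_) (allSubsets m) → Empty
      disjoint (p , q) with ∈-map⁻ _ p | ∈-map⁻ _ q
      ... | _ , _ , ≡.refl | _ , _ , ()

  ∧-true : ∀ {a b} → a ∧ b ≡ true → a ≡ true × b ≡ true
  ∧-true {true} {true} _ = ≡.refl , ≡.refl

  ∣∪∣-disjoint : ∀ {m} (A G : Subset m) → disjointᵇ A G ≡ true → ∣ A ∪ G ∣ ≡ ∣ A ∣ ℕ.+ ∣ G ∣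
  ∣∪∣-disjoint []          []          d = ≡.refl
  ∣∪∣-disjoint (false ∷ A) (false ∷ G) d = ∣∪∣-disjoint A G d
  ∣∪∣-disjoint (false ∷ A) (true  ∷ G) d = ≡.trans (≡.cong suc (∣∪∣-disjoint A G d)) (≡.sym (ℕₚ.+-suc _ _))
  ∣∪∣-disjoint (true  ∷ A) (false ∷ G) d = ≡.cong suc (∣∪∣-disjoint A G d)

  subsetᵇ-∪ : ∀ {m} (A G : Subset m) → subsetᵇ A (A ∪ G) ≡ true
  subsetᵇ-∪ []          []      = ≡.refl
  subsetᵇ-∪ (true  ∷ A) (b ∷ G) = subsetᵇ-∪ A G
  subsetᵇ-∪ (false ∷ A) (b ∷ G) = subsetᵇ-∪ A G

  subsetᵇ-size : ∀ {m} (A G : Subset m) → subsetᵇ A G ≡ true → ∣ A ∣ ℕ.≤ ∣ G ∣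
  subsetᵇ-size []          []          p = z≤n
  subsetᵇ-size (true  ∷ A) (true  ∷ G) p = s≤s (subsetᵇ-size A G p)
  subsetᵇ-size (false ∷ A) (true  ∷ G) p = ℕₚ.m≤n⇒m≤1+n (subsetᵇ-size A G p)
  subsetᵇ-size (false ∷ A) (false ∷ G) p = subsetᵇ-size A G p

  ℚ-field : Field 0ℓ 0ℓ
  ℚ-field = record
    { commutativeRing = ℚₚ.+-*-commutativeRing
    ; 0≉1 = λ ()
    ; inverse = λ x x≢0 → ℚ.1/_ x ⦃ ℚ.≢-nonZero x≢0 ⦄ , ℚₚ.*-inverseʳ x ⦃ ℚ.≢-nonZero x≢0 ⦄
    }

  CharacteristicZero : ∀ {c ℓ} → Field c ℓ → Set ℓ
  CharacteristicZero F = ∀ i → i ≢ 0ℤ → ¬ (F.⟦ i ⟧ F.≈ F.0#)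
    where module F where
            open Field F public
            open ℤ-Action commutativeRing public

  module _ where
    open ℤ-Action ℚₚ.+-*-commutativeRing

    private
      positive : ∀ n → 0ℚ ℚ.< ⟦ + suc n ⟧
      positive zero    = ℚₚ.positive⁻¹ 1ℚ
      positive (suc n) = ℚₚ.+-mono-< (ℚₚ.positive⁻¹ 1ℚ) (positive n)

    ℚ-characteristicZero : CharacteristicZero ℚ-field
    ℚ-characteristicZero (+ zero)  ne e = ne ≡.refl
    ℚ-characteristicZero (+ suc n) ne e = ℚₚ.<-irrefl (≡.sym e) (positive n)
    ℚ-characteristicZero -[1+ n ]  ne e =
      ℚₚ.<-irrefl (≡.sym (ℚₚ.neg-injective {⟦ + suc n ⟧} {0ℚ} e)) (positive n)

  module _ {m : ℕ} (Δ : SimplicialComplex m) where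

    linkFaces : Subset m → List (Subset m)
    linkFaces A = List.filter (λ G → linkFaceᵇ Δ A G Bool.≟ true) (allSubsets m)

    linkFaces-unique : ∀ A → Unique (linkFaces A)
    linkFaces-unique A = Uniqueₚ.filter⁺ _ (allSubsets-unique m)

    ∈-linkFaces⁺ : ∀ A {G} → linkFaceᵇ Δ A G ≡ true → G ∈ linkFaces A
    ∈-linkFaces⁺ A p = ∈-filter⁺ _ (∈-allSubsets _) p

    ∈-linkFaces⁻ : ∀ A {G} → G ∈ linkFaces A → linkFaceᵇ Δ A G ≡ true
    ∈-linkFaces⁻ A p = proj₂ (∈-filter⁻ _ {xs = allSubsets m} p)

    linkFaces-⋖ : ∀ A {G H} → G ⋖ H → H ∈ linkFaces A → G ∈ linkFaces A
    linkFaces-⋖ A {G} {H} p H∈ with ∧-true (∈-linkFaces⁻ A H∈)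
    ... | f , d = ∈-linkFaces⁺ A (≡.cong₂ _∧_ (down-closed Δ (A ∪ H) (A ∪ G) (⋖-∪ A p) f) (⋖-disjoint A p d))

    open SparseOperator _≟ˢ_ (∣_∣ {m}) boundaryTerms (λ G t∈ → ⋖-size (boundaryTerms-⋖ G t∈))

    module LinkOver {c ℓ : Level} (K : Field c ℓ) where
      open Field K using (commutativeRing)
      open CommutativeRing commutativeRing hiding (zero; +-congˡ; +-congʳ; *-congˡ; *-congʳ)
      open Simplicial K
      open Act K public
      open Homology K Δ using (IsChain; IsCycle; IsBoundary)

      bd-outside : ∀ A {z} → Supported (linkFaces A) z → ∀ {G} → G ∉ linkFaces A → bd z G ≈ 0#
      bd-outside A supp G∉ = bd-0 _ (λ H p → supp H (λ H∈ → G∉ (linkFaces-⋖ A p H∈)))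

      op≈bd : ∀ z G → op z G ≈ bd z G
      op≈bd = bd-terms

      link-squareZero : ∀ A → IntegerMatrix.Over.SquareZero _≟ˢ_ (∣_∣ {m}) K (IntegerMatrix.Over.image _≟ˢ_ (∣_∣ {m}) K matrix) (linkFaces A)
      link-squareZero A = toSquareZero (linkFaces-unique A) λ z supp {x} x∈ →
        trans (op≈bd _ x) (trans (bd-cong x (λ H p → masked z supp H)) (bd-bd z x))
        where
          open import Data.List.Membership.DecPropositional (_≟ˢ_ {m}) using (_∈?_)
          masked : ∀ z → Supported (linkFaces A) z → ∀ H → mask (linkFaces A) (op z) H ≈ bd z H
          masked z supp H with H ∈? linkFaces A
          ... | yes _ = op≈bd z H
          ... | no H∉ = sym (bd-outside A supp H∉)

      vanishing⇒OpExact : ∀ A i → (∀ z → IsChain A i z → IsCycle z → IsBoundary A i z) → OpExact (linkFaces A) i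
      vanishing⇒OpExact A i van z supp hom cyc = w , w-supp , w-hom , λ {x} x∈ →
        trans (op≈bd w x) (trans (sym (∂≈bd Δ w x)) (proj₂ (proj₂ found) x))
        where
          open import Data.List.Membership.DecPropositional (_≟ˢ_ {m}) using (_∈?_)

          chain : IsChain A i z
          chain G e with linkFaceᵇ Δ A G in eq
          ... | false = supp G (λ G∈ → case (≡.trans (≡.sym eq) (∈-linkFaces⁻ A G∈)))
            where case : false ≡ true → Empty
                  case ()
          ... | true = hom (λ { ≡.refl → subst≢ (ℕₚ.≡⇒≡ᵇ ∣ G ∣ ∣ G ∣ ≡.refl) e })
            where subst≢ : ∀ {b} → Bool.T b → b ≡ false → Empty
                  subst≢ t ≡.refl = t

          cycle : IsCycle z
          cycle G with G ∈? linkFaces A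
          ... | yes G∈ = trans (∂≈bd Δ z G) (trans (sym (op≈bd z G)) (cyc G∈))
          ... | no G∉  = trans (∂≈bd Δ z G) (bd-outside A supp G∉)

          found = van z chain cycle
          w = proj₁ found

          w-supp : Supported (linkFaces A) w
          w-supp G G∉ = proj₁ (proj₂ found) G (notLink (λ e → G∉ (∈-linkFaces⁺ A e)))
            where notLink : ∀ {a b} → (a ≡ true → Empty) → a ∧ b ≡ false
                  notLink {true}  h = ⊥-elim (h ≡.refl)
                  notLink {false} h = ≡.refl

          w-hom : ∀ {G} → ∣ G ∣ ≢ suc i → w G ≈ 0#
          w-hom {G} ne = proj₁ (proj₂ found) G (notSize (linkFaceᵇ Δ A G) (λ t → ne (ℕₚ.≡ᵇ⇒≡ ∣ G ∣ (suc i) t)))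
            where notSize : ∀ a {b} → ¬ Bool.T b → a ∧ b ≡ false
                  notSize a {true}  h = ⊥-elim (h _)
                  notSize a {false} h = Boolₚ.∧-zeroʳ a

      InStar : Subset m → Subset m → Set
      InStar A G = face Δ G ≡ true × subsetᵇ A G ≡ true

      -- This is a relative complex: chains live on the faces containing `A`, and their boundaries
      -- are read off only at sets containing `A`. Its part in size `q` corresponds to the link of
      -- `A` in size q - |A|.
      StarExact : Subset m → ℕ → Set (c ⊔ ℓ)
      StarExact A q = ∀ z → (∀ G → ¬ (InStar A G × ∣ G ∣ ≡ q) → z G ≈ 0#) →
                      (∀ G → subsetᵇ A G ≡ true → bd z G ≈ 0#) →
                      ∃ λ w → (∀ G → ¬ (InStar A G × ∣ G ∣ ≡ suc q) → w G ≈ 0#) ×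
                              (∀ G → subsetᵇ A G ≡ true → bd w G ≈ z G)

      toStarExact : ∀ A i → OpExact (linkFaces A) i → StarExact A (∣ A ∣ ℕ.+ i)
      toStarExact A i ex z supp cyc = fromLink A w̃ , w-supp , w-boundary
        where
          open import Data.List.Membership.DecPropositional (_≟ˢ_ {m}) using (_∈?_)

          z̃ = toLink A z

          z̃-supp : Supported (linkFaces A) z̃
          z̃-supp G G∉ = toLink-0 A z G (λ d → supp (A ∪ G) (λ { ((f , _) , _) → G∉ (∈-linkFaces⁺ A (≡.cong₂ _∧_ f d)) }))

          z̃-hom : ∀ {G} → ∣ G ∣ ≢ i → z̃ G ≈ 0#
          z̃-hom {G} ne = toLink-0 A z G (λ d → supp (A ∪ G) (λ { (_ , e) →
            ne (ℕₚ.+-cancelˡ-≡ ∣ A ∣ _ _ (≡.trans (≡.sym (∣∪∣-disjoint A G d)) e)) }))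

          z̃-cyc : ∀ G → bd z̃ G ≈ 0#
          z̃-cyc G = trans (toLink-bd A z G) (toLink-0 A (bd z) G (λ d → cyc (A ∪ G) (subsetᵇ-∪ A G)))

          found = ex z̃ z̃-supp z̃-hom (λ {x} _ → trans (op≈bd z̃ x) (z̃-cyc x))
          w̃ = proj₁ found

          w-supp : ∀ G → ¬ (InStar A G × ∣ G ∣ ≡ suc (∣ A ∣ ℕ.+ i)) → fromLink A w̃ G ≈ 0#
          w-supp G notIn = fromLink-0 A w̃ G λ H d e → vanish H d e
            where
              vanish : ∀ H → disjointᵇ A H ≡ true → A ∪ H ≡ G → w̃ H ≈ 0#
              vanish H d ≡.refl with H ∈? linkFaces A | ∣ H ∣ ℕ.≟ suc i
              ... | no H∉ | _ = proj₁ (proj₂ found) H H∉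
              ... | yes _ | no ne = proj₁ (proj₂ (proj₂ found)) ne
              ... | yes H∈ | yes e = ⊥-elim (notIn ((proj₁ (∧-true (∈-linkFaces⁻ A H∈)) , subsetᵇ-∪ A H) ,
                      ≡.trans (∣∪∣-disjoint A H d) (≡.trans (≡.cong (∣ A ∣ ℕ.+_) e) (ℕₚ.+-suc ∣ A ∣ i))))

          w̃-disjoint : ∀ G → disjointᵇ A G ≢ true → w̃ G ≈ 0#
          w̃-disjoint G nd = proj₁ (proj₂ found) G (λ G∈ → nd (proj₂ (∧-true (∈-linkFaces⁻ A G∈))))

          w̃-boundary : ∀ G → bd w̃ G ≈ z̃ G
          w̃-boundary G with G ∈? linkFaces A
          ... | yes G∈ = trans (sym (op≈bd w̃ G)) (proj₂ (proj₂ (proj₂ found)) G∈)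
          ... | no G∉  = trans (bd-outside A (proj₁ (proj₂ found)) G∉) (sym (z̃-supp G G∉))

          w-boundary : ∀ G → subsetᵇ A G ≡ true → bd (fromLink A w̃) G ≈ z G
          w-boundary = toLink-injective A (bd (fromLink A w̃)) z λ G →
            trans (sym (toLink-bd A (fromLink A w̃) G))
                  (trans (bd-cong G (λ H _ → toLink-fromLink A w̃ w̃-disjoint H)) (w̃-boundary G))

      starExact-small : ∀ A q → q ℕ.< ∣ A ∣ → StarExact A q
      starExact-small A q lt z supp cyc = (λ _ → 0#) , (λ _ _ → refl) , λ G A⊆G → trans (bd-0 G (λ _ _ → refl))
        (sym (supp G (λ { (_ , ≡.refl) → ℕₚ.<⇒≱ lt (subsetᵇ-size A G A⊆G) })))

    -- Cohen–Macaulayness passes from K to any field of characteristic 0.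
    starExact : ∀ {c ℓ c′ ℓ′} (K : Field c ℓ) (F : Field c′ ℓ′) → CharacteristicZero F → ∀ {n} → Gorenstein* K Δ n →
                ¬¬ (∀ A → face Δ A ≡ true → ∀ q → q ℕ.< n → LinkOver.StarExact F A q)
    starExact K F char0 {n} gor = ¬¬-map (λ h A fA → h (∈-allSubsets A) fA) (¬¬-∀∈ (allSubsets m) perFace)
      where
        module 𝕂 = LinkOver K
        module 𝔽 = LinkOver F

        perFace : ∀ {A} → A ∈ allSubsets m → ¬¬ (face Δ A ≡ true → ∀ q → q ℕ.< n → 𝔽.StarExact A q)
        perFace {A} _ with face Δ A Bool.≟ true
        ... | no ¬f = λ k → k (λ f → ⊥-elim (¬f f))
        ... | yes f = ¬¬-map (λ h _ q q<n → star h q q<n)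
            (IntegerMatrix.Transfer.transfer _≟ˢ_ ∣_∣ K F char0 {Good = _≢ (n ∸ ∣ A ∣)} (linkFaces-unique A) matrix-graded
              (𝕂.link-squareZero A) (𝔽.link-squareZero A)
              (λ i ne → 𝕂.toExact (linkFaces-unique A) (𝕂.vanishing⇒OpExact A i (proj₁ (gor A f) i ne))))
          where
            star : (∀ i → i ≢ n ∸ ∣ A ∣ → IntegerMatrix.Over.Exact _≟ˢ_ (∣_∣ {m}) F (IntegerMatrix.Over.image _≟ˢ_ (∣_∣ {m}) F matrix) (linkFaces A) i) →
                   ∀ q → q ℕ.< n → 𝔽.StarExact A q
            star h q q<n with ∣ A ∣ ℕ.≤? q
            ... | no  ≰q = 𝔽.starExact-small A q (ℕₚ.≰⇒> ≰q)
            -- The link of `A` may have homology in size n - |A| only, and q - |A| is smaller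
            -- because q < n.
            ... | yes ≤q = ≡.subst (𝔽.StarExact A) (ℕₚ.m+[n∸m]≡n ≤q)
                   (𝔽.toStarExact A (q ∸ ∣ A ∣) (𝔽.fromExact (linkFaces-unique A) (h (q ∸ ∣ A ∣) λ e →
                     ℕₚ.<-irrefl (ℕₚ.∸-cancelʳ-≡ ≤q (ℕₚ.≤-trans ≤q (ℕₚ.<⇒≤ q<n)) e) q<n)))

-- Polynomials, interpolation and Vandermonde matrices.

module Interpolation where

  open import Level using (Level)
  open import Algebra.Bundles using (CommutativeRing)
  open import Data.Nat as ℕ using (ℕ; zero; suc; z≤n; s≤s)
  import Data.Nat.Properties as ℕₚ
  open import Data.Integer as ℤ using (ℤ; +_)
  import Data.Integer.Properties as ℤₚ
  open import Data.Fin as Fin using (Fin; toℕ)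
  import Data.Fin.Properties as Finₚ
  open import Data.List using ([]; _∷_; length)
  open import Data.List.Membership.Propositional using (_∈_)
  open import Data.List.Relation.Unary.Any using (here; there)
  import Data.List.Relation.Unary.All as All
  open import Data.List.Relation.Unary.AllPairs using (_∷_)
  open import Data.List.Relation.Unary.Unique.Propositional using (Unique)
  open import Data.Product using (∃; _,_; proj₁; proj₂)
  open import Data.Empty using (⊥-elim)
  open import Relation.Nullary using (¬_; yes; no)
  open import Relation.Binary.PropositionalEquality as ≡ using (_≢_)
  open import Defs using (Field)
  open Sums
  open IntegerCoefficients
  open Links using (CharacteristicZero)

  module Polynomials {c ℓ : Level} (R : CommutativeRing c ℓ) where
    open CommutativeRing R hiding (zero; +-congˡ; +-congʳ; *-congˡ; *-congʳ)
    open Congruence commutativeSemiring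
    open ℤ-Action R using (solve; _:=_; _:+_; _:*_; _:-_; :-_)
    open import Relation.Binary.Reasoning.Setoid setoid

    -- Horner's scheme on the first `d` coefficients. A sequence may continue arbitrarily beyond
    -- them, which is why `truncate` is used below.
    evaluate : ℕ → (ℕ → Carrier) → Carrier → Carrier
    evaluate zero    c x = 0#
    evaluate (suc d) c x = c 0 + x * evaluate d (λ e → c (suc e)) x

    evaluate-cong : ∀ d {c c′} x → (∀ {e} → e ℕ.< d → c e ≈ c′ e) → evaluate d c x ≈ evaluate d c′ x
    evaluate-cong zero    x h = refl
    evaluate-cong (suc d) x h = +-cong (h (s≤s z≤n)) (*-congˡ (evaluate-cong d x (λ lt → h (s≤s lt))))

    private
      rearrange₁ : ∀ a b x p q → (a + b) + x * (p + q) ≈ (a + x * p) + (b + x * q)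
      rearrange₁ = solve 5 (λ a b x p q → (a :+ b) :+ x :* (p :+ q) := (a :+ x :* p) :+ (b :+ x :* q)) refl

      rearrange₂ : ∀ k a x p → k * a + x * (k * p) ≈ k * (a + x * p)
      rearrange₂ = solve 4 (λ k a x p → k :* a :+ x :* (k :* p) := k :* (a :+ x :* p)) refl

      rearrange₃ : ∀ c x x₀ p q → c + x * (p + (x - x₀) * q) ≈ (c + x₀ * p) + (x - x₀) * (p + x * q)
      rearrange₃ = solve 5 (λ c x x₀ p q → c :+ x :* (p :+ (x :- x₀) :* q)
                                         := (c :+ x₀ :* p) :+ (x :- x₀) :* (p :+ x :* q)) refl

      rearrange₄ : ∀ y x x₀ q₀ p q → (y + (- x₀) * q₀) + x * (p + (- x₀) * q) ≈ y + (x * p - x₀ * (q₀ + x * q))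
      rearrange₄ = solve 6 (λ y x x₀ q₀ p q → (y :+ (:- x₀) :* q₀) :+ x :* (p :+ (:- x₀) :* q)
                                           := y :+ (x :* p :- x₀ :* (q₀ :+ x :* q))) refl

      rearrange₅ : ∀ y x x₀ p → y + (x * p - x₀ * p) ≈ y + (x - x₀) * p
      rearrange₅ = solve 4 (λ y x x₀ p → y :+ (x :* p :- x₀ :* p) := y :+ (x :- x₀) :* p) refl

    evaluate-+ : ∀ d c c′ x → evaluate d (λ e → c e + c′ e) x ≈ evaluate d c x + evaluate d c′ x
    evaluate-+ zero    c c′ x = sym (+-identityˡ 0#)
    evaluate-+ (suc d) c c′ x = trans (+-congˡ (*-congˡ (evaluate-+ d _ _ x))) (rearrange₁ (c 0) (c′ 0) x _ _)

    evaluate-* : ∀ d k c x → evaluate d (λ e → k * c e) x ≈ k * evaluate d c x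
    evaluate-* zero    k c x = sym (zeroʳ k)
    evaluate-* (suc d) k c x = trans (+-congˡ (*-congˡ (evaluate-* d k _ x))) (rearrange₂ k (c 0) x _)

    evaluate-0 : ∀ d {c} x → (∀ {e} → e ℕ.< d → c e ≈ 0#) → evaluate d c x ≈ 0#
    evaluate-0 zero    x h = refl
    evaluate-0 (suc d) x h = +-vanish (h (s≤s z≤n)) (*-absorbʳ (evaluate-0 d x (λ lt → h (s≤s lt))))

    evaluate-extend : ∀ d c x → c d ≈ 0# → evaluate (suc d) c x ≈ evaluate d c x
    evaluate-extend zero    c x h = +-vanish h (zeroʳ x)
    evaluate-extend (suc d) c x h = +-congˡ (*-congˡ (evaluate-extend d (λ e → c (suc e)) x h))

    -- Synthetic division by x - x₀: coefficient e of the quotient is the tail of the polynomial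
    -- from coefficient e + 1 on, evaluated at x₀.
    quotient : ℕ → (ℕ → Carrier) → Carrier → ℕ → Carrier
    quotient zero    c x₀ e       = 0#
    quotient (suc d) c x₀ zero    = evaluate (suc d) (λ e → c (suc e)) x₀
    quotient (suc d) c x₀ (suc e) = quotient d (λ e → c (suc e)) x₀ e

    evaluate-quotient : ∀ d c x₀ x →
      evaluate (suc d) c x ≈ evaluate (suc d) c x₀ + (x - x₀) * evaluate d (quotient d c x₀) x
    evaluate-quotient zero c x₀ x = begin
      c 0 + x * 0#                            ≈⟨ +-congˡ (trans (zeroʳ x) (sym (zeroʳ x₀))) ⟩
      c 0 + x₀ * 0#                           ≈⟨ +-absorbʳ (zeroʳ (x - x₀)) ⟨
      c 0 + x₀ * 0# + (x - x₀) * 0#           ∎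
    evaluate-quotient (suc d) c x₀ x =
      trans (+-congˡ (*-congˡ (evaluate-quotient d c⁺ x₀ x)))
            (rearrange₃ (c 0) x x₀ (evaluate (suc d) c⁺ x₀) (evaluate d (quotient d c⁺ x₀) x))
      where c⁺ = λ e → c (suc e)

    -- Coefficient e of the quotient is c (e + 1) plus x₀ times an expression in the later
    -- coefficients, so these vanish one after another from the top.
    quotient-0 : ∀ d c x₀ → (∀ {e} → e ℕ.< d → quotient d c x₀ e ≈ 0#) → ∀ {e} → e ℕ.< d → c (suc e) ≈ 0#
    quotient-0 (suc d) c x₀ h {zero} _ =
      trans (sym (+-absorbʳ (*-absorbʳ (evaluate-0 d x₀ (λ lt → quotient-0 d _ x₀ (λ lt → h (s≤s lt)) lt))))) (h (s≤s z≤n))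
    quotient-0 (suc d) c x₀ h {suc e} (s≤s lt) = quotient-0 d _ x₀ (λ lt → h (s≤s lt)) lt

    truncate : ℕ → (ℕ → Carrier) → ℕ → Carrier
    truncate d c e with e ℕ.<? d
    ... | yes _ = c e
    ... | no _  = 0#

    truncate-< : ∀ d c {e} → e ℕ.< d → truncate d c e ≈ c e
    truncate-< d c {e} lt with e ℕ.<? d
    ... | yes _ = refl
    ... | no ≮d = ⊥-elim (≮d lt)

    truncate-d : ∀ d c → truncate d c d ≈ 0#
    truncate-d d c with d ℕ.<? d
    ... | yes lt = ⊥-elim (ℕₚ.<-irrefl ≡.refl lt)
    ... | no _   = refl

    -- The coefficients of y + (x - x₀) q(x).
    raise : ℕ → Carrier → Carrier → (ℕ → Carrier) → ℕ → Carrier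
    raise d y x₀ q zero    = y + (- x₀) * truncate d q 0
    raise d y x₀ q (suc e) = truncate d q e + (- x₀) * truncate d q (suc e)

    evaluate-raise : ∀ d y x₀ q x → evaluate (suc d) (raise d y x₀ q) x ≈ y + (x - x₀) * evaluate d q x
    evaluate-raise d y x₀ q x = begin
      (y + (- x₀) * q₀) + x * evaluate d (λ e → q′ e + (- x₀) * q′ (suc e)) x
        ≈⟨ +-congˡ (*-congˡ (trans (evaluate-+ d q′ _ x) (+-congˡ (evaluate-* d (- x₀) (λ e → q′ (suc e)) x)))) ⟩
      (y + (- x₀) * q₀) + x * (evaluate d q′ x + (- x₀) * evaluate d (λ e → q′ (suc e)) x)
        ≈⟨ rearrange₄ y x x₀ q₀ (evaluate d q′ x) (evaluate d (λ e → q′ (suc e)) x) ⟩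
      y + (x * evaluate d q′ x - x₀ * evaluate (suc d) q′ x)
        ≈⟨ +-congˡ (+-congˡ (-‿cong (*-congˡ (evaluate-extend d q′ x (truncate-d d q))))) ⟩
      y + (x * evaluate d q′ x - x₀ * evaluate d q′ x)
        ≈⟨ rearrange₅ y x x₀ (evaluate d q′ x) ⟩
      y + (x - x₀) * evaluate d q′ x
        ≈⟨ +-congˡ (*-congˡ (evaluate-cong d x (truncate-< d q))) ⟩
      y + (x - x₀) * evaluate d q x ∎
      where
        q′ = truncate d q
        q₀ = q′ 0

  module Vandermonde {c ℓ : Level} (F : Field c ℓ) (char0 : CharacteristicZero F) (m : ℕ) where
    open Field F using (commutativeRing; inverse)
    open CommutativeRing commutativeRing hiding (zero; +-congˡ; +-congʳ; *-congˡ; *-congʳ)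
    open Congruence commutativeSemiring
    open ℤ-Action commutativeRing using (⟦_⟧; ⟦⟧-+; ⟦⟧-neg)
    open Polynomials commutativeRing public
    open import Relation.Binary.Reasoning.Setoid setoid

    point : Fin m → Carrier
    point v = ⟦ + toℕ v ⟧

    point-distinct : ∀ {u v} → u ≢ v → ¬ (point u - point v ≈ 0#)
    point-distinct {u} {v} ne e = char0 (+ toℕ u ℤ.- + toℕ v)
      (λ z → ne (Finₚ.toℕ-injective (ℤₚ.+-injective (ℤₚ.i-j≡0⇒i≡j (+ toℕ u) (+ toℕ v) z))))
      (trans (⟦⟧-+ (+ toℕ u) (ℤ.- (+ toℕ v))) (trans (+-congˡ (⟦⟧-neg (+ toℕ v))) e))

    private
      slope : (Fin m → Carrier) → Fin m → Fin m → Carrier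
      slope y p u with u Fin.≟ p
      -- An arbitrary value: slopes are taken only at points different from `p`.
      ... | yes _ = 0#
      ... | no ne = (y u - y p) * proj₁ (inverse (point u - point p) (point-distinct ne))

      slope-spec : ∀ y p u → p ≢ u → y p + (point u - point p) * slope y p u ≈ y u
      slope-spec y p u p≢u with u Fin.≟ p
      ... | yes e = ⊥-elim (p≢u (≡.sym e))
      ... | no ne = begin
        y p + d * ((y u - y p) * i)     ≈⟨ +-congˡ (trans (*-congˡ (*-comm _ i)) (sym (*-assoc d i _))) ⟩
        y p + d * i * (y u - y p)       ≈⟨ +-congˡ (trans (*-congʳ (proj₂ inv)) (*-identityˡ _)) ⟩
        y p + (y u - y p)               ≈⟨ +-comm _ _ ⟩
        y u - y p + y p                 ≈⟨ +-assoc _ _ _ ⟩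
        y u + (- y p + y p)             ≈⟨ +-absorbʳ (-‿inverseˡ (y p)) ⟩
        y u                             ∎
        where
          inv = inverse (point u - point p) (point-distinct ne)
          d = point u - point p
          i = proj₁ inv

    -- Newton interpolation: subtracting the value at `p` and dividing by x - p leaves the
    -- interpolation problem for the slopes at the other points.
    interpolate : ∀ ps → Unique ps → (y : Fin m → Carrier) →
                  ∃ λ c → ∀ {v} → v ∈ ps → evaluate (length ps) c (point v) ≈ y v
    interpolate [] _ y = (λ _ → 0#) , λ ()
    interpolate (p ∷ ps) (fresh ∷ uniq) y = k , values
      where
        rest = interpolate ps uniq (slope y p)
        d = length ps
        q = proj₁ rest
        k = raise d (y p) (point p) q

        values : ∀ {v} → v ∈ p ∷ ps → evaluate (suc d) k (point v) ≈ y v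
        values (here ≡.refl) = trans (evaluate-raise d (y p) (point p) q (point p))
          (+-absorbʳ (*-absorbˡ (-‿inverseʳ (point p))))
        values {v} (there v∈) = trans (evaluate-raise d (y p) (point p) q (point v))
          (trans (+-congˡ (*-congˡ (proj₂ rest v∈))) (slope-spec y p v (All.lookup fresh v∈)))

    -- Division by x - p at the root `p` leaves a shorter polynomial that vanishes at the other
    -- points, because their differences from `p` are invertible.
    evaluate-injective : ∀ ps → Unique ps → ∀ c → (∀ {v} → v ∈ ps → evaluate (length ps) c (point v) ≈ 0#) →
                         ∀ {e} → e ℕ.< length ps → c e ≈ 0#
    evaluate-injective (p ∷ ps) (fresh ∷ uniq) c h = coefficients
      where
        d = length ps
        q = quotient d c (point p)

        q-vanishes : ∀ {v} → v ∈ ps → evaluate d q (point v) ≈ 0#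
        q-vanishes {v} v∈ = begin
          r                  ≈⟨ *-identityˡ r ⟨
          1# * r             ≈⟨ *-congʳ (trans (sym (proj₂ inv)) (*-comm _ i)) ⟩
          i * δ * r          ≈⟨ *-assoc i δ r ⟩
          i * (δ * r)        ≈⟨ *-absorbʳ (trans (sym (+-absorbˡ (h (here ≡.refl))))
                                   (trans (sym (evaluate-quotient d c (point p) (point v))) (h (there v∈)))) ⟩
          0#                 ∎
          where
            δ = point v - point p
            r = evaluate d q (point v)
            inv = inverse δ (point-distinct (λ e → All.lookup fresh v∈ (≡.sym e)))
            i = proj₁ inv

        tail : ∀ {e} → e ℕ.< d → c (suc e) ≈ 0#
        tail = quotient-0 d c (point p) (evaluate-injective ps uniq q q-vanishes)

        coefficients : ∀ {e} → e ℕ.< suc d → c e ≈ 0#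
        coefficients {suc e} (s≤s lt) = tail lt
        coefficients {zero}  _ = trans (sym (+-absorbʳ (*-absorbʳ (evaluate-0 d (point p) tail)))) (h (here ≡.refl))

-- Exactness of a filtered complex from exactness of its level-preserving part.

module Perturbation where

  open import Level using (Level)
  open import Algebra.Bundles using (CommutativeRing)
  open import Data.Nat as ℕ using (ℕ; zero; suc)
  import Data.Nat.Properties as ℕₚ
  open import Data.Integer using (ℤ)
  open import Data.List using (List)
  open import Data.List.Membership.Propositional using (_∈_)
  import Data.List.Membership.DecPropositional as DecMembership
  open import Data.Product using (∃; _×_; _,_; proj₁; proj₂)
  open import Data.Empty using (⊥-elim)
  open import Relation.Nullary using (yes; no)
  open import Relation.Binary.Definitions using (DecidableEquality)
  open import Relation.Binary.PropositionalEquality as ≡ using (_≡_; _≢_)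
  open import Defs using (Field)
  open Sums
  open IntegerCoefficients
  open Operators

  module Filtration {c ℓ : Level} (K : Field c ℓ) {X : Set} (_≟_ : DecidableEquality X) (deg : X → ℕ) (terms : X → List (ℤ × X))
                    (terms-degree : ∀ x {t} → t ∈ terms x → deg (proj₂ t) ≡ suc (deg x)) where
    open Field K using (commutativeRing)
    open CommutativeRing commutativeRing hiding (zero; +-congˡ; +-congʳ; *-congˡ; *-congʳ)
    open Congruence commutativeSemiring
    open Sum commutativeSemiring
    open SumNegation commutativeRing using (∑-neg)
    open SparseOperator _≟_ deg terms terms-degree
    open Act K
    open DecMembership _≟_ using (_∈?_)
    open import Relation.Binary.Reasoning.Setoid setoid
    open import Algebra.Properties.Ring ring using (-0#≈0#; -‿distribʳ-*)
    open import Algebra.Properties.AbelianGroup +-abelianGroup using (xyx⁻¹≈y)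

    private
      Ch = X → Carrier

    op-+ : ∀ (z w : Ch) x → op (λ y → z y + w y) x ≈ op z x + op w x
    op-+ z w x = trans (∑-cong (terms x) (λ t → distribˡ _ _ _)) (∑-+ (terms x) _ _)

    op-neg : ∀ (z : Ch) x → op (λ y → - z y) x ≈ - op z x
    op-neg z x = trans (∑-cong (terms x) (λ t → sym (-‿distribʳ-* _ _))) (∑-neg (terms x) _)

    op-homogeneous : ∀ {q} {w : Ch} → (∀ {x} → deg x ≢ suc q → w x ≈ 0#) → ∀ {x} → deg x ≢ q → op w x ≈ 0#
    op-homogeneous h {x} ne = ∑-0 (terms x) (λ {t} t∈ → *-absorbʳ (h (λ e →
      ne (ℕₚ.suc-injective (≡.trans (≡.sym (terms-degree x t∈)) e)))))

    -- A cycle is a boundary once its lowest parts are, for the part D₀ of the operator preserving the level.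
    module Perturb (lev : X → ℕ) (B : ℕ) (lev≤B : ∀ x → lev x ℕ.≤ B) (D₀ D₁ : Ch → Ch)
                   (split : ∀ z x → op z x ≈ D₀ z x + D₁ z x)
                   (D₀-local : ∀ {z w} x → (∀ y → lev y ≡ lev x → z y ≈ w y) → D₀ z x ≈ D₀ w x)
                   (D₁-local : ∀ {z w} x → (∀ y → suc (lev y) ≡ lev x → z y ≈ w y) → D₁ z x ≈ D₁ w x)
                   (D₀-zero : ∀ x → D₀ (λ _ → 0#) x ≈ 0#) (D₁-zero : ∀ x → D₁ (λ _ → 0#) x ≈ 0#)
                   (L : List X) (sq : ∀ z → Supported L z → ∀ {x} → x ∈ L → op (mask L (op z)) x ≈ 0#)
                   (q : ℕ)
                   (exact₀ : ∀ z → Supported L z → (∀ {x} → deg x ≢ q → z x ≈ 0#) → (∀ {x} → x ∈ L → D₀ z x ≈ 0#) →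
                             ∃ λ w → Supported L w × (∀ {x} → deg x ≢ suc q → w x ≈ 0#) × (∀ {x} → x ∈ L → D₀ w x ≈ z x)) where

      private
        D₀-0 : ∀ {z} x → (∀ y → lev y ≡ lev x → z y ≈ 0#) → D₀ z x ≈ 0#
        D₀-0 x h = trans (D₀-local x h) (D₀-zero x)

        D₁-0 : ∀ {z} x → (∀ y → suc (lev y) ≡ lev x → z y ≈ 0#) → D₁ z x ≈ 0#
        D₁-0 x h = trans (D₁-local x h) (D₁-zero x)

        at : ℕ → Ch → Ch
        at k z x with lev x ℕ.+ k ℕ.≟ B
        ... | yes _ = z x
        ... | no _  = 0#

        at-yes : ∀ k z x → lev x ℕ.+ k ≡ B → at k z x ≈ z x
        at-yes k z x e with lev x ℕ.+ k ℕ.≟ B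
        ... | yes _ = refl
        ... | no ne = ⊥-elim (ne e)

        at-no : ∀ k z x → lev x ℕ.+ k ≢ B → at k z x ≈ 0#
        at-no k z x ne with lev x ℕ.+ k ℕ.≟ B
        ... | yes e = ⊥-elim (ne e)
        ... | no _  = refl

        at-vanish : ∀ k z x → z x ≈ 0# → at k z x ≈ 0#
        at-vanish k z x h with lev x ℕ.+ k ℕ.≟ B
        ... | yes e = h
        ... | no _  = refl

        -- `z` lives on levels above B - k. Solving for its lowest part with `D₀` and subtracting
        -- the full boundary clears one level; `D₁` raises the level by one, so it disturbs only
        -- levels not yet cleared.
        descend : ∀ k z → Supported L z → (∀ {x} → deg x ≢ q → z x ≈ 0#) → (∀ {x} → x ∈ L → op z x ≈ 0#) →
                  (∀ x → lev x ℕ.+ k ℕ.≤ B → z x ≈ 0#) →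
                  ∃ λ w → Supported L w × (∀ {x} → deg x ≢ suc q → w x ≈ 0#) × (∀ {x} → x ∈ L → op w x ≈ z x)
        descend zero z supp hom cyc low = (λ _ → 0#) , (λ _ _ → refl) , (λ _ → refl) , λ {x} _ →
          trans (∑-0 (terms x) (λ _ → zeroʳ _))
                (sym (low x (ℕₚ.≤-trans (ℕₚ.≤-reflexive (ℕₚ.+-identityʳ (lev x))) (lev≤B x))))
        descend (suc k) z supp hom cyc low = w , w-supp , w-hom , w-boundary
          where
            zₖ = at k z

            below : ∀ {x y} → suc (lev y) ≡ lev x → lev x ℕ.+ k ≡ B → lev y ℕ.+ suc k ℕ.≤ B
            below {x} {y} e e′ = ℕₚ.≤-reflexive (≡.trans (ℕₚ.+-suc (lev y) k) (≡.trans (≡.cong (ℕ._+ k) e) e′))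

            -- At the lowest level of `z` the contribution of `D₁` comes from the level below and
            -- vanishes, so `op z` is `D₀ z` there.
            zₖ-cycle : ∀ {x} → x ∈ L → D₀ zₖ x ≈ 0#
            zₖ-cycle {x} x∈ with lev x ℕ.+ k ℕ.≟ B
            ... | no ne = D₀-0 x (λ y e → at-no k z y (λ e′ → ne (≡.trans (≡.cong (ℕ._+ k) (≡.sym e)) e′)))
            ... | yes e = begin
              D₀ zₖ x              ≈⟨ D₀-local x (λ y e′ → at-yes k z y (≡.trans (≡.cong (ℕ._+ k) e′) e)) ⟩
              D₀ z x               ≈⟨ +-absorbʳ (D₁-0 x (λ y e′ → low y (below {x} e′ e))) ⟨
              D₀ z x + D₁ z x      ≈⟨ split z x ⟨
              op z x               ≈⟨ cyc x∈ ⟩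
              0#                   ∎

            found = exact₀ zₖ (λ y y∉ → at-vanish k z y (supp y y∉)) (λ {x} ne → at-vanish k z x (hom ne)) zₖ-cycle
            w₀ = proj₁ found
            wₖ = at k w₀

            wₖ-supp : Supported L wₖ
            wₖ-supp y y∉ = at-vanish k w₀ y (proj₁ (proj₂ found) y y∉)

            wₖ-hom : ∀ {x} → deg x ≢ suc q → wₖ x ≈ 0#
            wₖ-hom {x} ne = at-vanish k w₀ x (proj₁ (proj₂ (proj₂ found)) ne)

            z′ : Ch
            z′ x = z x - mask L (op wₖ) x

            z′-supp : Supported L z′
            z′-supp x x∉ = trans (+-cong (supp x x∉) (trans (-‿cong (mask-supported (op wₖ) x x∉)) -0#≈0#)) (+-identityˡ 0#)

            z′-hom : ∀ {x} → deg x ≢ q → z′ x ≈ 0#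
            z′-hom ne = trans (+-cong (hom ne) (trans (-‿cong (mask-homogeneous {L = L} (λ _ → op-homogeneous wₖ-hom) ne)) -0#≈0#))
                              (+-identityˡ 0#)

            z′-cyc : ∀ {x} → x ∈ L → op z′ x ≈ 0#
            z′-cyc {x} x∈ = trans (op-+ z (λ y → - mask L (op wₖ) y) x)
              (+-vanish (cyc x∈) (trans (op-neg _ x) (trans (-‿cong (sq wₖ wₖ-supp x∈)) -0#≈0#)))

            z′-low : ∀ x → lev x ℕ.+ k ℕ.≤ B → z′ x ≈ 0#
            z′-low x le with x ∈? L
            ... | no x∉ = trans (+-cong (supp x x∉) -0#≈0#) (+-identityˡ 0#)
            ... | yes x∈ with lev x ℕ.+ k ℕ.≟ B
            ...   | yes e = trans (+-congˡ (-‿cong (begin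
                op wₖ x               ≈⟨ split wₖ x ⟩
                D₀ wₖ x + D₁ wₖ x     ≈⟨ +-absorbʳ (D₁-0 x (λ y e′ → at-no k w₀ y (λ e″ →
                                           ℕₚ.1+n≢n {lev y ℕ.+ k} (≡.trans (≡.trans (≡.cong (ℕ._+ k) e′) e) (≡.sym e″))))) ⟩
                D₀ wₖ x               ≈⟨ D₀-local x (λ y e′ → at-yes k w₀ y (≡.trans (≡.cong (ℕ._+ k) e′) e)) ⟩
                D₀ w₀ x               ≈⟨ proj₂ (proj₂ (proj₂ found)) x∈ ⟩
                zₖ x                  ≈⟨ at-yes k z x e ⟩
                z x                   ∎))) (-‿inverseʳ (z x))
            ...   | no ne = trans (+-cong (low x (ℕₚ.≤-trans (ℕₚ.≤-reflexive (ℕₚ.+-suc (lev x) k)) (ℕₚ.≤∧≢⇒< le ne)))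
                (trans (-‿cong (trans (split wₖ x) (+-vanish
                  (D₀-0 x (λ y e → at-no k w₀ y (λ e′ → ne (≡.trans (≡.cong (ℕ._+ k) (≡.sym e)) e′))))
                  (D₁-0 x (λ y e → at-no k w₀ y (λ e′ → ℕₚ.<-irrefl e′
                     (ℕₚ.≤-<-trans (ℕₚ.n≤1+n _) (≡.subst (ℕ._< B) (≡.cong (ℕ._+ k) (≡.sym e)) (ℕₚ.≤∧≢⇒< le ne)))))))))
                  -0#≈0#)) (+-identityˡ 0#)

            rest = descend k z′ z′-supp z′-hom z′-cyc z′-low

            w : Ch
            w x = wₖ x + proj₁ rest x

            w-supp : Supported L w
            w-supp x x∉ = +-vanish (wₖ-supp x x∉) (proj₁ (proj₂ rest) x x∉)

            w-hom : ∀ {x} → deg x ≢ suc q → w x ≈ 0#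
            w-hom ne = +-vanish (wₖ-hom ne) (proj₁ (proj₂ (proj₂ rest)) ne)

            w-boundary : ∀ {x} → x ∈ L → op w x ≈ z x
            w-boundary {x} x∈ = begin
              op w x                                  ≈⟨ op-+ wₖ (proj₁ rest) x ⟩
              op wₖ x + op (proj₁ rest) x             ≈⟨ +-congˡ (proj₂ (proj₂ (proj₂ rest)) x∈) ⟩
              op wₖ x + (z x - mask L (op wₖ) x)      ≈⟨ +-congˡ (+-congˡ (-‿cong (mask-∈ (op wₖ) x∈))) ⟩
              op wₖ x + (z x - op wₖ x)               ≈⟨ sym (+-assoc _ _ _) ⟩
              op wₖ x + z x - op wₖ x                 ≈⟨ xyx⁻¹≈y (op wₖ x) (z x) ⟩
              z x                                     ∎

      exact : OpExact L q
      -- For k = B + 1 no level satisfies the bound, so the vanishing required at the start is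
      -- vacuous.
      exact z supp hom cyc = descend (suc B) z supp hom cyc
        (λ x le → ⊥-elim (ℕₚ.<-irrefl ≡.refl (ℕₚ.≤-trans (ℕₚ.m≤n+m (suc B) (lev x)) le)))

-- The evaluation complex: its cells, its differential, and its columns.

module EvaluationCells where

  open import Level using (Level)
  open import Algebra.Bundles using (CommutativeRing)
  open import Data.Bool as Bool using (Bool; true; false)
  open import Data.Nat as ℕ using (ℕ; zero; suc; _∸_; z≤n; s≤s)
  import Data.Nat.Properties as ℕₚ
  open import Data.Integer as ℤ using (ℤ; +_; 1ℤ)
  open import Data.Fin as Fin using (Fin; zero; suc; toℕ)
  import Data.Fin.Properties as Finₚ
  open import Data.Fin.Subset using (Subset; ⊥; _∪_; ⁅_⁆; ∣_∣; _⊆_)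
  open import Data.Fin.Subset.Properties using (out⊆; s⊆s)
  open import Data.Vec using (Vec; []; _∷_; lookup)
  import Data.Vec.Properties as Vecₚ
  open import Data.List as List using (List; []; _∷_; _++_; length; upTo)
  import Data.List.Properties as Listₚ
  open import Data.List.Membership.Propositional using (_∈_)
  open import Data.List.Membership.Propositional.Properties using (∈-map⁺; ∈-map⁻; ∈-++⁺ˡ; ∈-++⁺ʳ; ∈-++⁻; ∈-upTo⁺; ∈-upTo⁻; ∈-cartesianProductWith⁺; ∈-cartesianProductWith⁻)
  open import Data.List.Relation.Unary.Any using (here; there)
  open import Data.List.Relation.Unary.All as All using ([]; _∷_)
  open import Data.List.Relation.Unary.AllPairs using ([]; _∷_)
  open import Data.List.Relation.Unary.Unique.Propositional using (Unique)
  import Data.List.Relation.Unary.Unique.Propositional.Properties as Uniqueₚ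
  open import Data.Product using (∃; _×_; _,_; proj₁; proj₂)
  import Data.Product.Properties as Productₚ
  open import Data.Sum using (_⊎_; inj₁; inj₂)
  import Data.Sum.Properties as Sumₚ
  open import Data.Unit using (⊤; tt)
  open import Data.Empty using (⊥-elim) renaming (⊥ to Empty)
  open import Relation.Nullary using (yes; no; Dec)
  open import Relation.Binary.Definitions using (DecidableEquality)
  open import Relation.Binary.PropositionalEquality as ≡ using (_≡_; _≢_)
  open import Defs
  open Sums
  open IntegerCoefficients
  open Pivoting
  open Operators
  open Boundary
  open Links
  open Interpolation
  open Perturbation

  elements : ∀ {m} → Subset m → List (Fin m)
  elements []          = []
  elements (true  ∷ G) = zero ∷ List.map suc (elements G)
  elements (false ∷ G) = List.map suc (elements G)

  length-elements : ∀ {m} (G : Subset m) → length (elements G) ≡ ∣ G ∣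
  length-elements []          = ≡.refl
  length-elements (true  ∷ G) = ≡.cong suc (≡.trans (Listₚ.length-map suc (elements G)) (length-elements G))
  length-elements (false ∷ G) = ≡.trans (Listₚ.length-map suc (elements G)) (length-elements G)

  ∈-elements⁺ : ∀ {m} (G : Subset m) v → lookup G v ≡ true → v ∈ elements G
  ∈-elements⁺ (true  ∷ G) zero    p = here ≡.refl
  ∈-elements⁺ (true  ∷ G) (suc v) p = there (∈-map⁺ suc (∈-elements⁺ G v p))
  ∈-elements⁺ (false ∷ G) (suc v) p = ∈-map⁺ suc (∈-elements⁺ G v p)

  ∈-elements⁻ : ∀ {m} (G : Subset m) {v} → v ∈ elements G → lookup G v ≡ true
  ∈-elements⁻ (true  ∷ G) (here ≡.refl) = ≡.refl
  ∈-elements⁻ (true  ∷ G) (there p) with ∈-map⁻ suc p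
  ... | _ , q , ≡.refl = ∈-elements⁻ G q
  ∈-elements⁻ (false ∷ G) p with ∈-map⁻ suc p
  ... | _ , q , ≡.refl = ∈-elements⁻ G q

  elements-unique : ∀ {m} (G : Subset m) → Unique (elements G)
  elements-unique []          = []
  elements-unique (true  ∷ G) = All.tabulate (λ p → fresh p) ∷ Uniqueₚ.map⁺ Finₚ.suc-injective (elements-unique G)
    where
      fresh : ∀ {v} → v ∈ List.map suc (elements G) → zero ≢ v
      fresh p ≡.refl with ∈-map⁻ suc p
      ... | _ , _ , ()
  elements-unique (false ∷ G) = Uniqueₚ.map⁺ Finₚ.suc-injective (elements-unique G)

  subsetᵇ⇒⊆ : ∀ {m} (A G : Subset m) → subsetᵇ A G ≡ true → A ⊆ G
  subsetᵇ⇒⊆ []          []          p = λ ()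
  subsetᵇ⇒⊆ (true  ∷ A) (true  ∷ G) p = s⊆s (subsetᵇ⇒⊆ A G p)
  subsetᵇ⇒⊆ (false ∷ A) (b ∷ G)     p = out⊆ (subsetᵇ⇒⊆ A G p)

  ⋖-lookup : ∀ {m} {G H : Subset m} → G ⋖ H → ∀ v → lookup G v ≡ true → lookup H v ≡ true
  ⋖-lookup here      (suc v) p = p
  ⋖-lookup (there r) zero    p = p
  ⋖-lookup (there r) (suc v) p = ⋖-lookup r v p

  ⋖-⊆ : ∀ {m} {G H : Subset m} → G ⋖ H → G ⊆ H
  ⋖-⊆ here                  = out⊆ (λ p → p)
  ⋖-⊆ (there {b = true} r)  = s⊆s (⋖-⊆ r)
  ⋖-⊆ (there {b = false} r) = s⊆s (⋖-⊆ r)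

  subsetᵇ-⊥ : ∀ {m} (G : Subset m) → subsetᵇ ⊥ G ≡ true
  subsetᵇ-⊥ []      = ≡.refl
  subsetᵇ-⊥ (b ∷ G) = subsetᵇ-⊥ G

  subsetᵇ-insert⁺ : ∀ {m} v (A G : Subset m) → lookup G v ≡ true → subsetᵇ A G ≡ true → subsetᵇ (⁅ v ⁆ ∪ A) G ≡ true
  subsetᵇ-insert⁺ zero    (a ∷ A)     (true ∷ G)  p q = go A G (tail a q)
    where
      tail : ∀ a → subsetᵇ (a ∷ A) (true ∷ G) ≡ true → subsetᵇ A G ≡ true
      tail true  q = q
      tail false q = q
      go : ∀ {k} (A G : Subset k) → subsetᵇ A G ≡ true → subsetᵇ (⊥ ∪ A) G ≡ true
      go []      []      q = q
      go (true  ∷ A) (true ∷ G) q = go A G q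
      go (false ∷ A) (b ∷ G)    q = go A G q
  subsetᵇ-insert⁺ (suc v) (true  ∷ A) (true ∷ G)  p q = subsetᵇ-insert⁺ v A G p q
  subsetᵇ-insert⁺ (suc v) (false ∷ A) (b ∷ G)     p q = subsetᵇ-insert⁺ v A G p q

  subsetᵇ-insert⁻ : ∀ {m} v (A G : Subset m) → subsetᵇ (⁅ v ⁆ ∪ A) G ≡ true → lookup G v ≡ true × subsetᵇ A G ≡ true
  subsetᵇ-insert⁻ zero    (a ∷ A)     (true ∷ G)  q = ≡.refl , head a (go A G q)
    where
      head : ∀ a → subsetᵇ A G ≡ true → subsetᵇ (a ∷ A) (true ∷ G) ≡ true
      head true  q = q
      head false q = q
      go : ∀ {k} (A G : Subset k) → subsetᵇ (⊥ ∪ A) G ≡ true → subsetᵇ A G ≡ true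
      go []          []         q = q
      go (true  ∷ A) (true ∷ G) q = go A G q
      go (false ∷ A) (b ∷ G)    q = go A G q
  subsetᵇ-insert⁻ (suc v) (true  ∷ A) (true ∷ G)  q = subsetᵇ-insert⁻ v A G q
  subsetᵇ-insert⁻ (suc v) (false ∷ A) (b ∷ G)     q = subsetᵇ-insert⁻ v A G q

  -- A slot holds an exponent e, standing for the monomial x ^ e, or a vertex, at which polynomials are evaluated.
  Slot : ℕ → Set
  Slot m = ℕ ⊎ Fin m

  Slots : ℕ → ℕ → Set
  Slots m i = Vec (Slot m) i

  exponents vertices : ∀ {m i} → Slots m i → ℕ
  exponents []           = 0
  exponents (inj₁ e ∷ s) = suc (exponents s)
  exponents (inj₂ v ∷ s) = exponents s
  vertices []           = 0
  vertices (inj₁ e ∷ s) = vertices s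
  vertices (inj₂ v ∷ s) = suc (vertices s)

  vertices≤ : ∀ {m i} (s : Slots m i) → vertices s ℕ.≤ i
  vertices≤ []           = z≤n
  vertices≤ (inj₁ e ∷ s) = ℕₚ.m≤n⇒m≤1+n (vertices≤ s)
  vertices≤ (inj₂ v ∷ s) = s≤s (vertices≤ s)

  exponents≤ : ∀ {m i} (s : Slots m i) → exponents s ℕ.≤ i
  exponents≤ []           = z≤n
  exponents≤ (inj₁ e ∷ s) = s≤s (exponents≤ s)
  exponents≤ (inj₂ v ∷ s) = ℕₚ.m≤n⇒m≤1+n (exponents≤ s)

  vertexSet : ∀ {m i} → Slots m i → Subset m
  vertexSet []           = ⊥
  vertexSet (inj₁ e ∷ s) = vertexSet s
  vertexSet (inj₂ v ∷ s) = ⁅ v ⁆ ∪ vertexSet s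

  -- The slot with i slots to its right carries polynomials of degree < n - i.
  module Slotted (m n : ℕ) where

    data _⊲_ : ∀ {i} → Slots m i → Slots m i → Set where
      here  : ∀ {i v e} {s : Slots m i} → e ℕ.< n ∸ i → (inj₂ v ∷ s) ⊲ (inj₁ e ∷ s)
      there : ∀ {i x} {s t : Slots m i} → s ⊲ t → (x ∷ s) ⊲ (x ∷ t)

    ⊲-exponents : ∀ {i} {s t : Slots m i} → s ⊲ t → exponents t ≡ suc (exponents s)
    ⊲-exponents (here _) = ≡.refl
    ⊲-exponents (there {x = inj₁ e} r) = ≡.cong suc (⊲-exponents r)
    ⊲-exponents (there {x = inj₂ v} r) = ⊲-exponents r

    ⊲-vertices : ∀ {i} {s t : Slots m i} → s ⊲ t → suc (vertices t) ≡ vertices s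
    ⊲-vertices (here _) = ≡.refl
    ⊲-vertices (there {x = inj₁ e} r) = ⊲-vertices r
    ⊲-vertices (there {x = inj₂ v} r) = ≡.cong suc (⊲-vertices r)

    GoodSlot : Subset m → ℕ → Slot m → Set
    GoodSlot G d (inj₁ e) = e ℕ.< d
    GoodSlot G d (inj₂ v) = lookup G v ≡ true

    Good : Subset m → ∀ {i} → Slots m i → Set
    Good G []              = ⊤
    Good G {suc i} (x ∷ s) = GoodSlot G (n ∸ i) x × Good G s

    Good-⊲ : ∀ {G i} {s t : Slots m i} → s ⊲ t → Good G s → Good G t
    Good-⊲ (here lt) (_ , g) = lt , g
    Good-⊲ (there r) (p , g) = p , Good-⊲ r g

    Good-⋖ : ∀ {G H} → G ⋖ H → ∀ {i} (s : Slots m i) → Good G s → Good H s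
    Good-⋖ r []           g       = tt
    Good-⋖ r (inj₁ e ∷ s) (p , g) = p , Good-⋖ r s g
    Good-⋖ r (inj₂ v ∷ s) (p , g) = ⋖-lookup r v p , Good-⋖ r s g

    GoodExponents : ∀ {i} → Slots m i → Set
    GoodExponents []                   = ⊤
    GoodExponents {suc i} (inj₁ e ∷ s) = e ℕ.< n ∸ i × GoodExponents s
    GoodExponents (inj₂ v ∷ s)         = GoodExponents s

    goodExponents? : ∀ {i} (s : Slots m i) → Dec (GoodExponents s)
    goodExponents? []                   = yes tt
    goodExponents? {suc i} (inj₁ e ∷ s) with e ℕ.<? n ∸ i | goodExponents? s
    ... | yes p | yes q = yes (p , q)
    ... | no ¬p | _     = no (λ { (p , _) → ¬p p })
    ... | _     | no ¬q = no (λ { (_ , q) → ¬q q })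
    goodExponents? (inj₂ v ∷ s) = goodExponents? s

    -- With `good⁻` this identifies the sets over which given slots occur: once the exponents are in
    -- range, they are the sets containing `vertexSet s`. A row of the complex is therefore a star.
    good⁺ : ∀ {G i} (s : Slots m i) → GoodExponents s → subsetᵇ (vertexSet s) G ≡ true → Good G s
    good⁺ []           _       _ = tt
    good⁺ (inj₁ e ∷ s) (p , g) q = p , good⁺ s g q
    good⁺ {G} (inj₂ v ∷ s) g   q with subsetᵇ-insert⁻ v (vertexSet s) G q
    ... | p , q′ = p , good⁺ s g q′

    good⁻ : ∀ {G i} (s : Slots m i) → Good G s → GoodExponents s × subsetᵇ (vertexSet s) G ≡ true
    good⁻ {G} []           _ = tt , subsetᵇ-⊥ G
    good⁻ (inj₁ e ∷ s) (p , g) with good⁻ s g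
    ... | ge , q = (p , ge) , q
    good⁻ {G} (inj₂ v ∷ s) (p , g) with good⁻ s g
    ... | ge , q = ge , subsetᵇ-insert⁺ v (vertexSet s) G p q

    headSlots : Subset m → ℕ → List (Slot m)
    headSlots G d = List.map inj₁ (upTo d) ++ List.map inj₂ (elements G)

    goodSlots : Subset m → ∀ i → List (Slots m i)
    goodSlots G zero    = [] ∷ []
    goodSlots G (suc i) = List.cartesianProductWith _∷_ (headSlots G (n ∸ i)) (goodSlots G i)

    ∈-goodSlots⁺ : ∀ G {i} (s : Slots m i) → Good G s → s ∈ goodSlots G i
    ∈-goodSlots⁺ G []                   g       = here ≡.refl
    ∈-goodSlots⁺ G {suc i} (inj₁ e ∷ s) (p , g) =
      ∈-cartesianProductWith⁺ _∷_ (∈-++⁺ˡ (∈-map⁺ inj₁ (∈-upTo⁺ p))) (∈-goodSlots⁺ G s g)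
    ∈-goodSlots⁺ G {suc i} (inj₂ v ∷ s) (p , g) =
      ∈-cartesianProductWith⁺ _∷_ (∈-++⁺ʳ (List.map inj₁ (upTo (n ∸ i))) (∈-map⁺ inj₂ (∈-elements⁺ G v p))) (∈-goodSlots⁺ G s g)

    ∈-goodSlots⁻ : ∀ G {i} (s : Slots m i) → s ∈ goodSlots G i → Good G s
    ∈-goodSlots⁻ G []                s∈ = tt
    ∈-goodSlots⁻ G {suc i} (x ∷ s) s∈
      with ∈-cartesianProductWith⁻ _∷_ (headSlots G (n ∸ i)) (goodSlots G i) s∈
    ... | _ , _ , x∈ , s∈′ , ≡.refl = goodHead (∈-++⁻ (List.map inj₁ (upTo (n ∸ i))) x∈) , ∈-goodSlots⁻ G s s∈′
      where
        goodHead : ∀ {y} → y ∈ List.map inj₁ (upTo (n ∸ i)) ⊎ y ∈ List.map inj₂ (elements G) → GoodSlot G (n ∸ i) y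
        goodHead (inj₁ p) with ∈-map⁻ inj₁ p
        ... | _ , q , ≡.refl = ∈-upTo⁻ q
        goodHead (inj₂ p) with ∈-map⁻ inj₂ p
        ... | _ , q , ≡.refl = ∈-elements⁻ G q

    goodSlots-unique : ∀ G i → Unique (goodSlots G i)
    goodSlots-unique G zero    = [] ∷ []
    goodSlots-unique G (suc i) = Uniqueₚ.cartesianProductWith⁺ _∷_ Vecₚ.∷-injective
      (Uniqueₚ.++⁺ (Uniqueₚ.map⁺ Sumₚ.inj₁-injective (Uniqueₚ.upTo⁺ (n ∸ i)))
                   (Uniqueₚ.map⁺ Sumₚ.inj₂-injective (elements-unique G)) separate)
      (goodSlots-unique G i)
      where
        separate : ∀ {y} → y ∈ List.map inj₁ (upTo (n ∸ i)) × y ∈ List.map inj₂ (elements G) → Empty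
        separate (p , q) with ∈-map⁻ inj₁ p | ∈-map⁻ inj₂ q
        ... | _ , _ , ≡.refl | _ , _ , ()

    powerTerms : ℕ → ℤ → List (ℤ × ℕ)
    powerTerms zero    x = []
    powerTerms (suc d) x = (1ℤ , 0) ∷ List.map (λ t → x ℤ.* proj₁ t , suc (proj₂ t)) (powerTerms d x)

    powerTerms-< : ∀ d x {t} → t ∈ powerTerms d x → proj₂ t ℕ.< d
    powerTerms-< (suc d) x (here ≡.refl) = s≤s z≤n
    powerTerms-< (suc d) x (there t∈) with ∈-map⁻ _ t∈
    ... | _ , u∈ , ≡.refl = s≤s (powerTerms-< d x u∈)

    slotTerms : ∀ {i} → Slots m i → List (ℤ × Slots m i)
    slotTerms []                   = []
    slotTerms (inj₁ e ∷ s)         = List.map (λ t → proj₁ t , inj₁ e ∷ proj₂ t) (slotTerms s)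
    slotTerms {suc i} (inj₂ v ∷ s) =
      List.map (λ t → proj₁ t , inj₁ (proj₂ t) ∷ s) (powerTerms (n ∸ i) (+ toℕ v)) ++
      List.map (λ t → ℤ.- proj₁ t , inj₂ v ∷ proj₂ t) (slotTerms s)

    slotTerms-⊲ : ∀ {i} (s : Slots m i) {t} → t ∈ slotTerms s → s ⊲ proj₂ t
    slotTerms-⊲ (inj₁ e ∷ s) t∈ with ∈-map⁻ _ t∈
    ... | _ , u∈ , ≡.refl = there (slotTerms-⊲ s u∈)
    slotTerms-⊲ {suc i} (inj₂ v ∷ s) t∈
      with ∈-++⁻ (List.map (λ t → proj₁ t , inj₁ (proj₂ t) ∷ s) (powerTerms (n ∸ i) (+ toℕ v))) t∈
    ... | inj₁ p with ∈-map⁻ _ p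
    ...   | _ , u∈ , ≡.refl = here (powerTerms-< (n ∸ i) (+ toℕ v) u∈)
    slotTerms-⊲ (inj₂ v ∷ s) t∈ | inj₂ p with ∈-map⁻ _ p
    ...   | _ , u∈ , ≡.refl = there (slotTerms-⊲ s u∈)

    Cell : ℕ → Set
    Cell i = Subset m × Slots m i

    _≟ᶜ_ : ∀ {i} → DecidableEquality (Cell i)
    _≟ᶜ_ = Productₚ.≡-dec _≟ˢ_ (Vecₚ.≡-dec (Sumₚ.≡-dec ℕ._≟_ Fin._≟_))

    cellDegree : ∀ {i} → Cell i → ℕ
    cellDegree (G , s) = ∣ G ∣ ℕ.+ exponents s

    -- The factor (-1)^|G| makes the simplicial and the evaluation differential anticommute, so that
    -- their sum squares to zero.
    cellTerms : ∀ {i} → Cell i → List (ℤ × Cell i)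
    cellTerms (G , s) = List.map (λ t → proj₁ t , (proj₂ t , s)) (boundaryTerms G) ++
                        List.map (λ t → sign ∣ G ∣ ℤ.* proj₁ t , (G , proj₂ t)) (slotTerms s)

    cellTerms-degree : ∀ {i} (x : Cell i) {t} → t ∈ cellTerms x → cellDegree (proj₂ t) ≡ suc (cellDegree x)
    cellTerms-degree (G , s) t∈ with ∈-++⁻ (List.map (λ t → proj₁ t , (proj₂ t , s)) (boundaryTerms G)) t∈
    ... | inj₁ p with ∈-map⁻ _ p
    ...   | _ , u∈ , ≡.refl = ≡.cong (ℕ._+ exponents s) (⋖-size (boundaryTerms-⋖ G u∈))
    cellTerms-degree (G , s) t∈ | inj₂ p with ∈-map⁻ _ p
    ...   | _ , u∈ , ≡.refl = ≡.trans (≡.cong (∣ G ∣ ℕ.+_) (⊲-exponents (slotTerms-⊲ s u∈))) (ℕₚ.+-suc _ _)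

    module Evaluation {c ℓ : Level} (K : Field c ℓ) (char0 : CharacteristicZero K) where
      open Field K using (commutativeRing)
      open CommutativeRing commutativeRing hiding (zero; +-congˡ; +-congʳ; *-congˡ; *-congʳ)
      open Congruence commutativeSemiring
      open Sums.Sum commutativeSemiring
      open SumNegation commutativeRing using (∑-neg)
      open ℤ-Action commutativeRing using (⟦_⟧; ⟦⟧-1; ⟦⟧-neg; ⟦⟧-*; ⟦⟧-cong)
      open Vandermonde K char0 m
      open Simplicial K using (bd; bd-cong; bd-+; bd-bd; bd-terms; alternate; bd-alternate)
      open import Relation.Binary.Reasoning.Setoid setoid
      open import Algebra.Properties.Ring ring using (-0#≈0#; -‿involutive; -‿distribˡ-*; -‿distribʳ-*)
      open import Algebra.Properties.AbelianGroup +-abelianGroup using (⁻¹-∙-comm)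
      open import Algebra.Properties.CommutativeSemigroup +-commutativeSemigroup using (interchange)

      -- The differential of the tensor product of the evaluation maps. A polynomial slot has degree
      -- 1 and is sent to its values, which have degree 0; the sign counts the vertex slots passed
      -- on the way.
      δ : ∀ {i} → (Slots m i → Carrier) → Slots m i → Carrier
      δ z []                   = 0#
      δ z (inj₁ e ∷ s)         = δ (λ t → z (inj₁ e ∷ t)) s
      δ {suc i} z (inj₂ v ∷ s) = evaluate (n ∸ i) (λ e → z (inj₁ e ∷ s)) (point v) - δ (λ t → z (inj₂ v ∷ t)) s

      δ-cong : ∀ {i} {z w : Slots m i → Carrier} s → (∀ t → s ⊲ t → z t ≈ w t) → δ z s ≈ δ w s
      δ-cong []           h = refl
      δ-cong (inj₁ e ∷ s) h = δ-cong s (λ t r → h _ (there r))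
      δ-cong {suc i} (inj₂ v ∷ s) h = +-cong (evaluate-cong (n ∸ i) (point v) (λ lt → h _ (here lt)))
                                            (-‿cong (δ-cong s (λ t r → h _ (there r))))

      δ-+ : ∀ {i} (z w : Slots m i → Carrier) s → δ (λ t → z t + w t) s ≈ δ z s + δ w s
      δ-+ z w []           = sym (+-identityˡ 0#)
      δ-+ z w (inj₁ e ∷ s) = δ-+ _ _ s
      δ-+ {suc i} z w (inj₂ v ∷ s) =
        trans (+-cong (evaluate-+ (n ∸ i) _ _ (point v)) (trans (-‿cong (δ-+ _ _ s)) (sym (⁻¹-∙-comm _ _))))
              (interchange _ _ _ _)

      δ-* : ∀ {i} k (z : Slots m i → Carrier) s → δ (λ t → k * z t) s ≈ k * δ z s
      δ-* k z []           = sym (zeroʳ k)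
      δ-* k z (inj₁ e ∷ s) = δ-* k _ s
      δ-* {suc i} k z (inj₂ v ∷ s) =
        trans (+-cong (evaluate-* (n ∸ i) k _ (point v)) (trans (-‿cong (δ-* k _ s)) (-‿distribʳ-* k _)))
              (sym (distribˡ k _ _))

      δ-neg : ∀ {i} (z : Slots m i → Carrier) s → δ (λ t → - z t) s ≈ - δ z s
      δ-neg z s = begin
        δ (λ t → - z t) s         ≈⟨ δ-cong s (λ t _ → sym (trans (sym (-‿distribˡ-* 1# (z t))) (-‿cong (*-identityˡ (z t))))) ⟩
        δ (λ t → - 1# * z t) s    ≈⟨ δ-* (- 1#) z s ⟩
        - 1# * δ z s              ≈⟨ trans (sym (-‿distribˡ-* 1# _)) (-‿cong (*-identityˡ _)) ⟩
        - δ z s                   ∎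

      δ-0 : ∀ {i} {z : Slots m i → Carrier} s → (∀ t → s ⊲ t → z t ≈ 0#) → δ z s ≈ 0#
      δ-0 []           h = refl
      δ-0 (inj₁ e ∷ s) h = δ-0 s (λ t r → h _ (there r))
      δ-0 {suc i} (inj₂ v ∷ s) h = +-vanish (evaluate-0 (n ∸ i) (point v) (λ lt → h _ (here lt)))
                                          (trans (-‿cong (δ-0 s (λ t r → h _ (there r)))) -0#≈0#)

      δ-evaluate : ∀ {i} d (z : ℕ → Slots m i → Carrier) x s →
                   δ (λ t → evaluate d (λ e → z e t) x) s ≈ evaluate d (λ e → δ (z e) s) x
      δ-evaluate zero    z x s = δ-0 s (λ _ _ → refl)
      δ-evaluate (suc d) z x s = trans (δ-+ (z 0) _ s)
        (+-congˡ (trans (δ-* x _ s) (*-congˡ (δ-evaluate d (λ e → z (suc e)) x s))))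

      δ-δ : ∀ {i} (z : Slots m i → Carrier) s → δ (δ z) s ≈ 0#
      δ-δ z []           = refl
      δ-δ z (inj₁ e ∷ s) = δ-δ _ s
      δ-δ {suc i} z (inj₂ v ∷ s) = begin
        p - δ (λ t → evaluate d (λ e → z (inj₁ e ∷ t)) (point v) - δ zᵥ t) s
          ≈⟨ +-congˡ (-‿cong (trans (δ-+ _ _ s) (+-cong (δ-evaluate d (λ e t → z (inj₁ e ∷ t)) (point v) s)
               (trans (δ-neg (δ zᵥ) s) (trans (-‿cong (δ-δ zᵥ s)) -0#≈0#))))) ⟩
        p - (p + 0#)
          ≈⟨ +-congˡ (-‿cong (+-identityʳ p)) ⟩
        p - p
          ≈⟨ -‿inverseʳ p ⟩
        0# ∎
        where
          d = n ∸ i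
          zᵥ = λ t → z (inj₂ v ∷ t)
          p = evaluate d (λ e → δ (λ t → z (inj₁ e ∷ t)) s) (point v)

      powerTerms-evaluate : ∀ d x c → ∑ (powerTerms d x) (λ t → ⟦ proj₁ t ⟧ * c (proj₂ t)) ≈ evaluate d c ⟦ x ⟧
      powerTerms-evaluate zero    x c = refl
      powerTerms-evaluate (suc d) x c = +-cong (trans (*-congʳ ⟦⟧-1) (*-identityˡ _)) (begin
        ∑ (List.map (λ t → x ℤ.* proj₁ t , suc (proj₂ t)) (powerTerms d x)) (λ t → ⟦ proj₁ t ⟧ * c (proj₂ t))
          ≈⟨ ∑-map (λ t → x ℤ.* proj₁ t , suc (proj₂ t)) (powerTerms d x) _ ⟩
        ∑ (powerTerms d x) (λ t → ⟦ x ℤ.* proj₁ t ⟧ * c (suc (proj₂ t)))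
          ≈⟨ ∑-cong (powerTerms d x) (λ t → trans (*-congʳ (⟦⟧-* x (proj₁ t))) (*-assoc _ _ _)) ⟩
        ∑ (powerTerms d x) (λ t → ⟦ x ⟧ * (⟦ proj₁ t ⟧ * c (suc (proj₂ t))))
          ≈⟨ trans (∑-*ˡ (powerTerms d x) ⟦ x ⟧ _) (*-congˡ (powerTerms-evaluate d x (λ e → c (suc e)))) ⟩
        ⟦ x ⟧ * evaluate d (λ e → c (suc e)) ⟦ x ⟧ ∎)

      slotTerms-δ : ∀ {i} (z : Slots m i → Carrier) s → ∑ (slotTerms s) (λ t → ⟦ proj₁ t ⟧ * z (proj₂ t)) ≈ δ z s
      slotTerms-δ z []           = refl
      slotTerms-δ z (inj₁ e ∷ s) = trans (∑-map (λ t → proj₁ t , inj₁ e ∷ proj₂ t) (slotTerms s) _) (slotTerms-δ _ s)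
      slotTerms-δ {suc i} z (inj₂ v ∷ s) = trans (∑-++ first second _) (+-cong
        (trans (∑-map (λ t → proj₁ t , inj₁ (proj₂ t) ∷ s) (powerTerms (n ∸ i) (+ toℕ v)) _)
               (powerTerms-evaluate (n ∸ i) (+ toℕ v) (λ e → z (inj₁ e ∷ s))))
        (trans (∑-map (λ t → ℤ.- proj₁ t , inj₂ v ∷ proj₂ t) (slotTerms s) _)
          (trans (∑-cong (slotTerms s) (λ t → trans (*-congʳ (⟦⟧-neg (proj₁ t))) (sym (-‿distribˡ-* _ _))))
            (trans (∑-neg (slotTerms s) _) (-‿cong (slotTerms-δ _ s))))))
        where
          first second : List (ℤ × Slots m (suc i))
          first = List.map (λ t → proj₁ t , inj₁ (proj₂ t) ∷ s) (powerTerms (n ∸ i) (+ toℕ v))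
          second = List.map (λ t → ℤ.- proj₁ t , inj₂ v ∷ proj₂ t) (slotTerms s)

      σ : Subset m → Carrier
      σ G = ⟦ sign ∣ G ∣ ⟧

      σ-alternate : ∀ {k} (G : Subset k) x → alternate G x ≈ ⟦ sign ∣ G ∣ ⟧ * x
      σ-alternate []          x = sym (trans (*-congʳ ⟦⟧-1) (*-identityˡ x))
      σ-alternate (true  ∷ G) x = trans (-‿cong (σ-alternate G x)) (trans (-‿distribˡ-* _ x) (*-congʳ (sym (⟦⟧-neg (sign ∣ G ∣)))))
      σ-alternate (false ∷ G) x = σ-alternate G x

      σ-involutive : ∀ G x → σ G * (σ G * x) ≈ x
      σ-involutive G x = trans (sym (*-assoc _ _ x)) (trans (*-congʳ (trans (sym (⟦⟧-* (sign ∣ G ∣) (sign ∣ G ∣)))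
        (trans (⟦⟧-cong (≡.trans (≡.sym (sign-+ ∣ G ∣ ∣ G ∣)) (sign-double ∣ G ∣))) ⟦⟧-1))) (*-identityˡ x))

      along across : ∀ {i} → (Cell i → Carrier) → Cell i → Carrier
      along  z (G , s) = bd (λ H → z (H , s)) G
      across z (G , s) = σ G * δ (λ t → z (G , t)) s

      module _ {i : ℕ} where
        open SparseOperator (_≟ᶜ_ {i}) cellDegree cellTerms cellTerms-degree
        open Act K using (op)

        op-split : ∀ z x → op z x ≈ along z x + across z x
        op-split z (G , s) = trans (∑-++ first second _) (+-cong
          (trans (∑-map (λ t → proj₁ t , (proj₂ t , s)) (boundaryTerms G) _) (bd-terms (λ H → z (H , s)) G))
          (trans (∑-map (λ t → sign ∣ G ∣ ℤ.* proj₁ t , (G , proj₂ t)) (slotTerms s) _)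
            (trans (∑-cong (slotTerms s) (λ t → trans (*-congʳ (⟦⟧-* (sign ∣ G ∣) (proj₁ t))) (*-assoc _ _ _)))
              (trans (∑-*ˡ (slotTerms s) (σ G) _) (*-congˡ (slotTerms-δ (λ t → z (G , t)) s))))))
          where
            first second : List (ℤ × Cell i)
            first = List.map (λ t → proj₁ t , (proj₂ t , s)) (boundaryTerms G)
            second = List.map (λ t → sign ∣ G ∣ ℤ.* proj₁ t , (G , proj₂ t)) (slotTerms s)

        δ-bd : ∀ {k} (z : Subset k → Slots m i → Carrier) G s →
               δ (λ t → bd (λ H → z H t) G) s ≈ bd (λ H → δ (z H) s) G
        δ-bd z []          s = δ-0 s (λ _ _ → refl)
        δ-bd z (false ∷ G) s = trans (δ-+ _ _ s) (+-congˡ (δ-bd _ G s))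
        δ-bd z (true  ∷ G) s = trans (δ-neg _ s) (-‿cong (δ-bd _ G s))

        op-op : ∀ z x → op (op z) x ≈ 0#
        op-op z x@(G , s) = begin
          op (op z) x
            ≈⟨ op-split (op z) x ⟩
          bd (λ H → op z (H , s)) G + σ G * δ (λ t → op z (G , t)) s
            ≈⟨ +-cong (trans (bd-cong G (λ H _ → op-split z (H , s))) (bd-+ _ _ G))
                      (*-congˡ (trans (δ-cong s (λ t _ → op-split z (G , t))) (δ-+ _ _ s))) ⟩
          (bd (λ H → bd (λ H′ → z (H′ , s)) H) G + bd (λ H → σ H * y H) G) +
          σ G * (δ (λ t → bd (λ H → z (H , t)) G) s + δ (λ t → σ G * δ (λ t′ → z (G , t′)) t) s)
            ≈⟨ +-cong (+-absorbˡ (bd-bd _ G)) (*-congˡ (+-cong (δ-bd (λ H t → z (H , t)) G s)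
                 (trans (δ-* (σ G) _ s) (*-absorbʳ (δ-δ _ s))))) ⟩
          bd (λ H → σ H * y H) G + σ G * (bd y G + 0#)
            ≈⟨ +-cong (trans (bd-cong G (λ H _ → sym (σ-alternate H (y H))))
                 (trans (bd-alternate y G) (-‿cong (σ-alternate G _)))) (*-congˡ (+-identityʳ _)) ⟩
          - (σ G * bd y G) + σ G * bd y G
            ≈⟨ -‿inverseˡ _ ⟩
          0# ∎
          where y = λ H → δ (λ t → z (H , t)) s

      -- The evaluation complex of a simplex is exact as soon as one of its Vandermonde matrices is square.
      column-exact : ∀ G {i} a → a ℕ.< i → n ∸ a ≡ ∣ G ∣ → (z : Slots m i → Carrier) → (∀ s → Good G s → δ z s ≈ 0#) →
                     ∃ λ w → ∀ s → Good G s → δ w s ≈ z s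
      column-exact G {suc i} a (s≤s a≤i) eq z cyc with a ℕ.≟ i
      ... | yes ≡.refl = w , w-boundary
        where
          ps = elements G
          d = length ps

          d≡ : d ≡ n ∸ i
          d≡ = ≡.trans (length-elements G) (≡.sym eq)

          coefficients : Slots m i → ℕ → Carrier
          coefficients s = proj₁ (interpolate ps (elements-unique G) (λ v → z (inj₂ v ∷ s)))

          values : ∀ s {v} → lookup G v ≡ true → evaluate (n ∸ i) (coefficients s) (point v) ≈ z (inj₂ v ∷ s)
          values s {v} v∈ = ≡.subst (λ k → evaluate k (coefficients s) (point v) ≈ z (inj₂ v ∷ s)) d≡
            (proj₂ (interpolate ps (elements-unique G) (λ v → z (inj₂ v ∷ s))) (∈-elements⁺ G v v∈))

          -- The head slot has a square Vandermonde matrix. Interpolation in it already produces the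
          -- vertex components of `z`, so the vertex components of `w` can be zero.
          w : Slots m (suc i) → Carrier
          w (inj₁ e ∷ s) = coefficients s e
          w (inj₂ v ∷ s) = 0#

          w-boundary : ∀ s → Good G s → δ w s ≈ z s
          w-boundary (inj₂ v ∷ s) (v∈ , g) =
            trans (+-absorbʳ (trans (-‿cong (δ-0 s (λ _ _ → refl))) -0#≈0#)) (values s v∈)
          -- Both sides are coefficients of polynomials that agree at all points of `G`, by the
          -- cycle condition on `z`; evaluation at these points is injective.
          w-boundary (inj₁ e ∷ s) (e< , g) = begin
            δ (λ t → coefficients t e) s          ≈⟨ sym (+-absorbʳ (-‿inverseˡ _)) ⟩
            δc e + (- ze e + ze e)                ≈⟨ sym (+-assoc _ _ _) ⟩
            (δc e - ze e) + ze e
              ≈⟨ +-absorbˡ (evaluate-injective ps (elements-unique G) (λ e → δc e - ze e)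
                   (λ {v} v∈ → ≡.subst (λ k → evaluate k (λ e → δc e - ze e) (point v) ≈ 0#) (≡.sym d≡) (agree (∈-elements⁻ G v∈)))
                   (≡.subst (e ℕ.<_) (≡.sym d≡) e<)) ⟩
            ze e                                  ∎
            where
              δc ze : ℕ → Carrier
              δc e = δ (λ t → coefficients t e) s
              ze e = z (inj₁ e ∷ s)

              agree : ∀ {v} → lookup G v ≡ true → evaluate (n ∸ i) (λ e → δc e - ze e) (point v) ≈ 0#
              agree {v} v∈ = begin
                evaluate (n ∸ i) (λ e → δc e - ze e) (point v)
                  ≈⟨ evaluate-cong (n ∸ i) (point v) (λ {e} _ → +-comm (δc e) (- ze e)) ⟩
                evaluate (n ∸ i) (λ e → - ze e + δc e) (point v)
                  ≈⟨ evaluate-+ (n ∸ i) (λ e → - ze e) δc (point v) ⟩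
                evaluate (n ∸ i) (λ e → - ze e) (point v) + evaluate (n ∸ i) δc (point v)
                  ≈⟨ +-cong (trans (evaluate-cong (n ∸ i) (point v)
                               (λ {e} _ → sym (trans (sym (-‿distribˡ-* 1# (ze e))) (-‿cong (*-identityˡ (ze e))))))
                               (evaluate-* (n ∸ i) (- 1#) ze (point v)))
                            (sym (δ-evaluate (n ∸ i) (λ e t → coefficients t e) (point v) s)) ⟩
                - 1# * evaluate (n ∸ i) ze (point v) + δ (λ t → evaluate (n ∸ i) (coefficients t) (point v)) s
                  ≈⟨ +-cong (trans (sym (-‿distribˡ-* 1# _)) (-‿cong (*-identityˡ _))) (δ-cong s (λ t _ → values t v∈)) ⟩
                - evaluate (n ∸ i) ze (point v) + δ (λ t → z (inj₂ v ∷ t)) s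
                  ≈⟨ trans (+-comm _ _) (sym (trans (-‿cong (+-comm _ _)) (trans (sym (⁻¹-∙-comm _ _)) (+-congʳ (-‿involutive _))))) ⟩
                - (evaluate (n ∸ i) ze (point v) - δ (λ t → z (inj₂ v ∷ t)) s)
                  ≈⟨ trans (-‿cong (cyc (inj₂ v ∷ s) (v∈ , g))) -0#≈0# ⟩
                0# ∎
      -- The square matrix belongs to a later slot. The exponent components are solved first;
      -- evaluating the solutions corrects the right-hand sides of the vertex components, and the
      -- corrected `remainder` is again a cycle.
      ... | no a≢i = w , w-boundary
        where
          a<i : a ℕ.< i
          a<i = ℕₚ.≤∧≢⇒< a≤i a≢i

          d = n ∸ i

          exponentPart : ∀ e → ∃ λ w → e ℕ.< d → ∀ s → Good G s → δ w s ≈ z (inj₁ e ∷ s)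
          exponentPart e with e ℕ.<? d
          ... | no ≮d = (λ _ → 0#) , λ lt → ⊥-elim (≮d lt)
          ... | yes e< with column-exact G a a<i eq (λ t → z (inj₁ e ∷ t)) (λ s g → cyc (inj₁ e ∷ s) (e< , g))
          ...   | w , eqw = w , λ _ → eqw

          wᵉ : ℕ → Slots m i → Carrier
          wᵉ e = proj₁ (exponentPart e)

          remainder : Fin m → Slots m i → Carrier
          remainder v t = evaluate d (λ e → wᵉ e t) (point v) - z (inj₂ v ∷ t)

          remainder-cycle : ∀ v → lookup G v ≡ true → ∀ s → Good G s → δ (remainder v) s ≈ 0#
          remainder-cycle v v∈ s g = begin
            δ (remainder v) s
              ≈⟨ δ-+ _ _ s ⟩
            δ (λ t → evaluate d (λ e → wᵉ e t) (point v)) s + δ (λ t → - z (inj₂ v ∷ t)) s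
              ≈⟨ +-cong (δ-evaluate d wᵉ (point v) s) (δ-neg _ s) ⟩
            evaluate d (λ e → δ (wᵉ e) s) (point v) - δ (λ t → z (inj₂ v ∷ t)) s
              ≈⟨ +-congʳ (evaluate-cong d (point v) (λ {e} lt → proj₂ (exponentPart e) lt s g)) ⟩
            evaluate d (λ e → z (inj₁ e ∷ s)) (point v) - δ (λ t → z (inj₂ v ∷ t)) s
              ≈⟨ cyc (inj₂ v ∷ s) (v∈ , g) ⟩
            0# ∎

          vertexPart : ∀ v → ∃ λ w → lookup G v ≡ true → ∀ s → Good G s → δ w s ≈ remainder v s
          vertexPart v with lookup G v Bool.≟ true
          ... | no v∉ = (λ _ → 0#) , λ v∈ → ⊥-elim (v∉ v∈)
          ... | yes v∈ with column-exact G a a<i eq (remainder v) (remainder-cycle v v∈)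
          ...   | w , eqw = w , λ _ → eqw

          w : Slots m (suc i) → Carrier
          w (inj₁ e ∷ s) = wᵉ e s
          w (inj₂ v ∷ s) = proj₁ (vertexPart v) s

          w-boundary : ∀ s → Good G s → δ w s ≈ z s
          w-boundary (inj₁ e ∷ s) (e< , g) = proj₂ (exponentPart e) e< s g
          w-boundary (inj₂ v ∷ s) (v∈ , g) = begin
            p - δ (proj₁ (vertexPart v)) s    ≈⟨ +-congˡ (-‿cong (proj₂ (vertexPart v) v∈ s g)) ⟩
            p - (p - z (inj₂ v ∷ s))          ≈⟨ +-congˡ (trans (sym (⁻¹-∙-comm _ _)) (+-congˡ (-‿involutive _))) ⟩
            p + (- p + z (inj₂ v ∷ s))        ≈⟨ sym (+-assoc _ _ _) ⟩
            p - p + z (inj₂ v ∷ s)            ≈⟨ +-absorbˡ (-‿inverseʳ p) ⟩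
            z (inj₂ v ∷ s)                    ∎
            where p = evaluate d (λ e → wᵉ e s) (point v)

-- Exactness of the evaluation complex outside degree n.

module EvaluationExactness where

  open import Level using (Level)
  open import Algebra.Bundles using (CommutativeRing)
  open import Data.Bool as Bool using (Bool; true)
  open import Data.Nat as ℕ using (ℕ; zero; suc; _∸_)
  import Data.Nat.Properties as ℕₚ
  open import Data.Integer as ℤ using (ℤ; +_; 0ℤ)
  import Data.Integer.Properties as ℤₚ
  open import Data.Fin.Subset using (Subset; ∣_∣)
  open import Data.Fin.Subset.Properties using (∣p∣≤n)
  open import Data.Vec using ([]; _∷_)
  open import Data.List as List using (List; []; _∷_; _++_)
  open import Data.List.Membership.Propositional using (_∈_)
  import Data.List.Membership.DecPropositional as DecMembership
  open import Data.List.Membership.Propositional.Properties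
    using (∈-map⁺; ∈-map⁻; ∈-++⁺ˡ; ∈-++⁺ʳ; ∈-++⁻; ∈-filter⁺; ∈-filter⁻)
  open import Data.List.Relation.Unary.Any using (here; there)
  import Data.List.Relation.Unary.All as All
  open import Data.List.Relation.Unary.AllPairs using ([]; _∷_)
  open import Data.List.Relation.Unary.Unique.Propositional using (Unique)
  import Data.List.Relation.Unary.Unique.Propositional.Properties as Uniqueₚ
  open import Data.Product as Product using (∃; _×_; _,_; proj₁; proj₂)
  import Data.Product.Properties as Productₚ
  open import Data.Sum using (inj₁; inj₂)
  open import Data.Empty using (⊥-elim) renaming (⊥ to Empty)
  open import Relation.Nullary using (¬_; yes; no)
  open import Relation.Binary.Definitions using (tri<; tri≈; tri>)
  open import Relation.Binary.PropositionalEquality as ≡ using (_≡_; _≢_)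
  open import Defs
  open Sums
  open IntegerCoefficients
  open Pivoting
  open Operators
  open Boundary
  open Links
  open Interpolation
  open Perturbation
  open EvaluationCells

  ∸-bound : ∀ {n k i} → n ℕ.< k ℕ.+ i → k ℕ.≤ n → n ∸ k ℕ.< i
  ∸-bound {n} {k} {i} lt le = ℕₚ.+-cancelˡ-< k (n ∸ k) i (≡.subst (ℕ._< k ℕ.+ i) (≡.sym (ℕₚ.m+[n∸m]≡n le)) lt)

  module EvaluationComplex {m : ℕ} (Δ : SimplicialComplex m) (n : ℕ) (dim : ∀ G → face Δ G ≡ true → ∣ G ∣ ℕ.≤ n) (i : ℕ) where
    open Slotted m n

    faces : List (Subset m)
    faces = List.filter (λ G → face Δ G Bool.≟ true) (allSubsets m)

    cellsOver : List (Subset m) → List (Cell i)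
    cellsOver []       = []
    cellsOver (G ∷ Gs) = List.map (G ,_) (goodSlots G i) ++ cellsOver Gs

    cells : List (Cell i)
    cells = cellsOver faces

    ∈-cellsOver⁺ : ∀ {Gs G s} → G ∈ Gs → Good G s → (G , s) ∈ cellsOver Gs
    ∈-cellsOver⁺ {G = G} {s} (here ≡.refl) g = ∈-++⁺ˡ (∈-map⁺ (G ,_) (∈-goodSlots⁺ G s g))
    ∈-cellsOver⁺ {G′ ∷ Gs} (there p) g = ∈-++⁺ʳ (List.map (G′ ,_) (goodSlots G′ i)) (∈-cellsOver⁺ p g)

    ∈-cellsOver⁻ : ∀ Gs {G s} → (G , s) ∈ cellsOver Gs → G ∈ Gs × Good G s
    ∈-cellsOver⁻ (G′ ∷ Gs) {G} {s} p with ∈-++⁻ (List.map (G′ ,_) (goodSlots G′ i)) p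
    ... | inj₂ q = Product.map₁ there (∈-cellsOver⁻ Gs q)
    ... | inj₁ q with ∈-map⁻ (G′ ,_) q
    ...   | _ , t∈ , ≡.refl = here ≡.refl , ∈-goodSlots⁻ G s t∈

    cellsOver-unique : ∀ {Gs} → Unique Gs → Unique (cellsOver Gs)
    cellsOver-unique [] = []
    cellsOver-unique {G ∷ Gs} (fresh ∷ uniq) =
      Uniqueₚ.++⁺ (Uniqueₚ.map⁺ Productₚ.,-injectiveʳ (goodSlots-unique G i)) (cellsOver-unique uniq) separate
      where
        separate : ∀ {x} → x ∈ List.map (G ,_) (goodSlots G i) × x ∈ cellsOver Gs → Empty
        separate (p , q) with ∈-map⁻ (G ,_) p
        ... | _ , _ , ≡.refl = All.lookup fresh (proj₁ (∈-cellsOver⁻ Gs q)) ≡.refl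

    cells-unique : Unique cells
    cells-unique = cellsOver-unique (Uniqueₚ.filter⁺ _ (allSubsets-unique m))

    ∈-cells⁺ : ∀ {G s} → face Δ G ≡ true → Good G s → (G , s) ∈ cells
    ∈-cells⁺ f g = ∈-cellsOver⁺ (∈-filter⁺ _ (∈-allSubsets _) f) g

    ∈-cells⁻ : ∀ {G s} → (G , s) ∈ cells → face Δ G ≡ true × Good G s
    ∈-cells⁻ p with ∈-cellsOver⁻ faces p
    ... | G∈ , g = proj₂ (∈-filter⁻ _ {xs = allSubsets m} G∈) , g

    open SparseOperator (_≟ᶜ_ {i}) cellDegree cellTerms cellTerms-degree
    open DecMembership (_≟ᶜ_ {i}) using (_∈?_)

    nonface-⋖ : ∀ {G H} → G ⋖ H → face Δ G ≢ true → face Δ H ≢ true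
    nonface-⋖ {G} {H} r ¬f f = ¬f (down-closed Δ H G (⋖-⊆ r) f)

    module Over {c ℓ : Level} (K : Field c ℓ) (char0 : CharacteristicZero K)
                (star : ∀ A → face Δ A ≡ true → ∀ q → q ℕ.< n → LinkOver.StarExact Δ K A q) where
      open Field K using (commutativeRing)
      open CommutativeRing commutativeRing hiding (zero; +-congˡ; +-congʳ; *-congˡ; *-congʳ)
      open Congruence commutativeSemiring
      open Evaluation K char0
      open Simplicial K using (bd; bd-cong; bd-0)
      open Act K
      open IntegerMatrix.Over (_≟ᶜ_ {i}) cellDegree K using (SquareZero; image; euler-nonneg)
      open Filtration K (_≟ᶜ_ {i}) cellDegree cellTerms cellTerms-degree using (module Perturb)

      private
        Ch = Cell i → Carrier

      op-nonface : ∀ z → Supported cells z → ∀ G s → face Δ G ≢ true → op z (G , s) ≈ 0#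
      op-nonface z supp G s ¬f = trans (op-split z (G , s)) (+-vanish
        (bd-0 G (λ H r → supp (H , s) (λ p → nonface-⋖ r ¬f (proj₁ (∈-cells⁻ p)))))
        (*-absorbʳ (δ-0 s (λ t _ → supp (G , t) (λ p → ¬f (proj₁ (∈-cells⁻ p)))))))

      -- Masking loses nothing. A cell reached from a listed one is either listed as well or lies
      -- over a nonface, where `op z` vanishes.
      squareZero′ : ∀ z → Supported cells z → ∀ {x} → x ∈ cells → op (mask cells (op z)) x ≈ 0#
      squareZero′ z supp {x@(G , s)} x∈ = trans (op-split _ x) (trans (sym replaced) (trans (sym (op-split (op z) x)) (op-op z x)))
        where
          good : Good G s
          good = proj₂ (∈-cells⁻ x∈)

          faceward : ∀ H → G ⋖ H → op z (H , s) ≈ mask cells (op z) (H , s)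
          faceward H r with (H , s) ∈? cells
          ... | yes _ = refl
          ... | no H∉ = op-nonface z supp H s (λ f → H∉ (∈-cells⁺ f (Good-⋖ r s good)))

          replaced : along (op z) x + across (op z) x ≈ along (mask cells (op z)) x + across (mask cells (op z)) x
          replaced = +-cong (bd-cong G faceward) (*-congˡ (δ-cong s (λ t r →
            sym (mask-∈ (op z) (∈-cells⁺ (proj₁ (∈-cells⁻ x∈)) (Good-⊲ r good))))))

      squareZero : SquareZero (image matrix) cells
      squareZero = toSquareZero cells-unique squareZero′

      -- For fixed slots `s` the cells run over the star of `vertexSet s`, in size `q` minus the
      -- number of exponents, which is still below n. If an exponent is out of range, or
      -- `vertexSet s` is not a face, the row has no cells.
      row-exact : ∀ q → q ℕ.< n → ∀ z → Supported cells z → (∀ {x} → cellDegree x ≢ q → z x ≈ 0#) →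
                  (∀ {x} → x ∈ cells → along z x ≈ 0#) →
                  ∃ λ w → Supported cells w × (∀ {x} → cellDegree x ≢ suc q → w x ≈ 0#) × (∀ {x} → x ∈ cells → along w x ≈ z x)
      row-exact q q<n z supp hom cyc =
        (λ x → proj₁ (row (proj₂ x)) (proj₁ x)) , (λ { (G , s) x∉ → proj₁ (proj₂ (row s)) G (λ { (p , _) → x∉ p }) }) ,
        (λ { {G , s} ne → proj₁ (proj₂ (row s)) G (λ { (_ , e) → ne e }) }) ,
        (λ { {G , s} x∈ → proj₂ (proj₂ (row s)) G x∈ })
        where
          Row : Slots m i → Set _
          Row s = ∃ λ w → (∀ G → ¬ ((G , s) ∈ cells × cellDegree (G , s) ≡ suc q) → w G ≈ 0#) ×
                          (∀ G → (G , s) ∈ cells → bd w G ≈ z (G , s))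

          empty : ∀ s → (∀ G → (G , s) ∈ cells → z (G , s) ≈ 0#) → Row s
          empty s h = (λ _ → 0#) , (λ _ _ → refl) , λ G p → trans (bd-0 G (λ _ _ → refl)) (sym (h G p))

          row : ∀ s → Row s
          row s with goodExponents? s | face Δ (vertexSet s) Bool.≟ true | exponents s ℕ.≤? q
          ... | no ¬g | _ | _ = empty s (λ G p → ⊥-elim (¬g (proj₁ (good⁻ s (proj₂ (∈-cells⁻ p))))))
          ... | yes _ | no ¬f | _ = empty s (λ G p → ⊥-elim (¬f (down-closed Δ G (vertexSet s)
                  (subsetᵇ⇒⊆ _ G (proj₂ (good⁻ s (proj₂ (∈-cells⁻ p))))) (proj₁ (∈-cells⁻ p)))))
          ... | yes _ | yes _ | no ≰q = empty s (λ G _ → hom (λ e → ≰q (≡.subst (exponents s ℕ.≤_) e (ℕₚ.m≤n+m _ ∣ G ∣))))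
          ... | yes ge | yes f | yes ≤q = w , w-supp , w-boundary
            where
              A = vertexSet s
              q′ = q ∸ exponents s

              degree⁺ : ∀ {k j} → k ≡ j ℕ.+ q′ → k ℕ.+ exponents s ≡ j ℕ.+ q
              degree⁺ {j = j} ≡.refl = ≡.trans (ℕₚ.+-assoc j q′ _) (≡.cong (j ℕ.+_) (ℕₚ.m∸n+n≡m ≤q))

              z-supp : ∀ G → ¬ (LinkOver.InStar Δ K A G × ∣ G ∣ ≡ q′) → z (G , s) ≈ 0#
              z-supp G h with (G , s) ∈? cells | cellDegree (G , s) ℕ.≟ q
              ... | no p∉ | _ = supp _ p∉
              ... | yes _ | no ne = hom ne
              ... | yes p | yes e = ⊥-elim (h ((proj₁ (∈-cells⁻ p) , proj₂ (good⁻ s (proj₂ (∈-cells⁻ p)))) ,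
                      ℕₚ.+-cancelʳ-≡ (exponents s) ∣ G ∣ q′ (≡.trans e (≡.sym (ℕₚ.m∸n+n≡m ≤q)))))

              z-cyc : ∀ G → subsetᵇ A G ≡ true → bd (λ H → z (H , s)) G ≈ 0#
              z-cyc G A⊆G with face Δ G Bool.≟ true
              ... | yes fG = cyc (∈-cells⁺ fG (good⁺ s ge A⊆G))
              ... | no ¬fG = bd-0 G (λ H r → supp _ (λ p → nonface-⋖ r ¬fG (proj₁ (∈-cells⁻ p))))

              found = star A f q′ (ℕₚ.≤-<-trans (ℕₚ.m∸n≤m q (exponents s)) q<n) (λ G → z (G , s)) z-supp z-cyc
              w = proj₁ found

              w-supp : ∀ G → ¬ ((G , s) ∈ cells × cellDegree (G , s) ≡ suc q) → w G ≈ 0#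
              w-supp G h = proj₁ (proj₂ found) G (λ { ((fG , A⊆G) , e) →
                h (∈-cells⁺ fG (good⁺ s ge A⊆G) , degree⁺ {j = 1} e) })

              w-boundary : ∀ G → (G , s) ∈ cells → bd w G ≈ z (G , s)
              w-boundary G p = proj₂ (proj₂ found) G (proj₂ (good⁻ s (proj₂ (∈-cells⁻ p))))

      -- A cell of degree above n over `G` forces |G| + i > n. Hence there is a slot with exactly n
      -- - |G| slots to its right; its polynomials have |G| coefficients, so its Vandermonde matrix
      -- is square.
      columns-exact : ∀ q → n ℕ.< q → ∀ z → Supported cells z → (∀ {x} → cellDegree x ≢ q → z x ≈ 0#) →
                      (∀ {x} → x ∈ cells → across z x ≈ 0#) →
                      ∃ λ w → Supported cells w × (∀ {x} → cellDegree x ≢ suc q → w x ≈ 0#) × (∀ {x} → x ∈ cells → across w x ≈ z x)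
      columns-exact q n<q z supp hom cyc = w , w-supp , w-hom , λ { {G , s} x∈ → w-boundary G s x∈ }
        where
          column : ∀ G → ∃ λ w → face Δ G ≡ true → ∀ s → Good G s → δ w s ≈ σ G * z (G , s)
          column G with face Δ G Bool.≟ true | n ℕ.<? ∣ G ∣ ℕ.+ i
          ... | no ¬f | _ = (λ _ → 0#) , λ f → ⊥-elim (¬f f)
          ... | yes f | no ≮ = (λ _ → 0#) , λ _ s g → trans (δ-0 s (λ _ _ → refl)) (sym (*-absorbʳ (hom (λ e →
                  ℕₚ.<-irrefl ≡.refl (ℕₚ.<-≤-trans n<q (ℕₚ.≤-trans (ℕₚ.≤-reflexive (≡.sym e))
                    (ℕₚ.≤-trans (ℕₚ.+-monoʳ-≤ ∣ G ∣ (exponents≤ s)) (ℕₚ.≮⇒≥ ≮))))))))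
          ... | yes f | yes lt with column-exact G (n ∸ ∣ G ∣) (∸-bound lt (dim G f)) (ℕₚ.m∸[m∸n]≡n (dim G f)) (λ s → σ G * z (G , s))
                                       (λ s g → trans (δ-* (σ G) _ s) (cyc (∈-cells⁺ f g)))
          ...   | w , eq = w , λ _ s g → eq s g

          w : Ch
          w (G , s) with (G , s) ∈? cells | cellDegree (G , s) ℕ.≟ suc q
          ... | yes _ | yes _ = proj₁ (column G) s
          ... | yes _ | no _  = 0#
          ... | no _  | _     = 0#

          w-supp : Supported cells w
          w-supp (G , s) p∉ with (G , s) ∈? cells | cellDegree (G , s) ℕ.≟ suc q
          ... | yes p | _ = ⊥-elim (p∉ p)
          ... | no _  | _ = refl

          w-hom : ∀ {x} → cellDegree x ≢ suc q → w x ≈ 0#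
          w-hom {G , s} ne with (G , s) ∈? cells | cellDegree (G , s) ℕ.≟ suc q
          ... | yes _ | yes e = ⊥-elim (ne e)
          ... | yes _ | no _  = refl
          ... | no _  | _     = refl

          w-value : ∀ {G s} → (G , s) ∈ cells → cellDegree (G , s) ≡ suc q → w (G , s) ≈ proj₁ (column G) s
          w-value {G} {s} p e with (G , s) ∈? cells | cellDegree (G , s) ℕ.≟ suc q
          ... | yes _ | yes _ = refl
          ... | yes _ | no ne = ⊥-elim (ne e)
          ... | no p∉ | _     = ⊥-elim (p∉ p)

          degree-⊲ : ∀ G {s t : Slots m i} → s ⊲ t → cellDegree (G , t) ≡ suc (cellDegree (G , s))
          degree-⊲ G r = ≡.trans (≡.cong (∣ G ∣ ℕ.+_) (⊲-exponents r)) (ℕₚ.+-suc _ _)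

          w-boundary : ∀ G s → (G , s) ∈ cells → across w (G , s) ≈ z (G , s)
          w-boundary G s p with cellDegree (G , s) ℕ.≟ q
          ... | no ne = trans (*-absorbʳ (δ-0 s (λ t r → w-hom (λ e → ne (ℕₚ.suc-injective (≡.trans (≡.sym (degree-⊲ G r)) e))))))
                              (sym (hom ne))
          ... | yes e = trans (*-congˡ (trans (δ-cong s (λ t r → w-value (∈-cells⁺ f (Good-⊲ r g)) (≡.trans (degree-⊲ G r) (≡.cong suc e))))
                                              (proj₂ (column G) f s g)))
                              (σ-involutive G _)
            where
              f = proj₁ (∈-cells⁻ p)
              g = proj₂ (∈-cells⁻ p)

      private
        along-local : ∀ {z w : Ch} (x : Cell i) → (∀ y → vertices (proj₂ y) ≡ vertices (proj₂ x) → z y ≈ w y) → along z x ≈ along w x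
        along-local (G , s) h = bd-cong G (λ H _ → h (H , s) ≡.refl)

        across-local : ∀ {z w : Ch} (x : Cell i) → (∀ y → suc (vertices (proj₂ y)) ≡ vertices (proj₂ x) → z y ≈ w y) →
                       across z x ≈ across w x
        across-local (G , s) h = *-congˡ (δ-cong s (λ t r → h (G , t) (⊲-vertices r)))

        across-local′ : ∀ {z w : Ch} (x : Cell i) → (∀ y → m ∸ ∣ proj₁ y ∣ ≡ m ∸ ∣ proj₁ x ∣ → z y ≈ w y) → across z x ≈ across w x
        across-local′ (G , s) h = *-congˡ (δ-cong s (λ t _ → h (G , t) ≡.refl))

        along-local′ : ∀ {z w : Ch} (x : Cell i) → (∀ y → suc (m ∸ ∣ proj₁ y ∣) ≡ m ∸ ∣ proj₁ x ∣ → z y ≈ w y) →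
                       along z x ≈ along w x
        along-local′ (G , s) h = bd-cong G (λ H r → h (H , s) (level r))
          where
            level : ∀ {H} → G ⋖ H → suc (m ∸ ∣ H ∣) ≡ m ∸ ∣ G ∣
            level {H} r = ≡.trans (≡.cong (λ k → suc (m ∸ k)) (⋖-size r))
              (≡.sym (ℕₚ.+-∸-assoc 1 (≡.subst (ℕ._≤ m) (⋖-size r) (∣p∣≤n H))))

        along-zero : ∀ (x : Cell i) → along (λ _ → 0#) x ≈ 0#
        along-zero (G , s) = bd-0 G (λ _ _ → refl)

        across-zero : ∀ (x : Cell i) → across (λ _ → 0#) x ≈ 0#
        across-zero (G , s) = *-absorbʳ (δ-0 s (λ _ _ → refl))

      -- Below n the rows are exact, and the level is the number of vertex slots; above n the
      -- columns are exact, and the level is m - |G|. In both cases the other differential shifts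
      -- the level by one.
      exact : ∀ q → q ≢ n → OpExact cells q
      exact q q≢n with ℕₚ.<-cmp q n
      ... | tri≈ _ e _ = ⊥-elim (q≢n e)
      ... | tri< q<n _ _ = Perturb.exact (λ x → vertices (proj₂ x)) i (λ x → vertices≤ (proj₂ x)) along across op-split
                             along-local across-local along-zero across-zero cells squareZero′ q (row-exact q q<n)
      ... | tri> _ _ n<q = Perturb.exact (λ x → m ∸ ∣ proj₁ x ∣) m (λ x → ℕₚ.m∸n≤m m ∣ proj₁ x ∣) across along
                             (λ z x → trans (op-split z x) (+-comm _ _))
                             across-local′ along-local′ across-zero along-zero cells squareZero′ q (columns-exact q n<q)

      open Sums.Sum (CommutativeRing.commutativeSemiring ℤₚ.+-*-commutativeRing) using () renaming (∑ to ∑ℤ)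

      euler : 0ℤ ℤ.≤ ∑ℤ cells (λ x → sign (n ℕ.+ cellDegree x))
      euler = euler-nonneg n cells-unique matrix-graded squareZero (λ q ne → toExact cells-unique (exact q ne))

-- The h-vector and its nonnegativity.

module HVector where

  open import Algebra.Bundles using (CommutativeRing)
  open import Data.Bool as Bool using (Bool; true; false; if_then_else_; _∧_; T)
  open import Data.Nat as ℕ using (ℕ; zero; suc; _∸_; z≤n; s≤s; _!)
  import Data.Nat.Properties as ℕₚ
  open import Data.Integer as ℤ using (ℤ; +_; 0ℤ; 1ℤ; _+_; _*_; _-_; -_)
  import Data.Integer.Properties as ℤₚ
  open import Data.Integer.Tactic.RingSolver using (solve-∀)
  open import Data.Fin.Subset using (Subset; ∣_∣)
  open import Data.Vec using ([]; _∷_)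
  open import Data.List as List using (List; []; _∷_; length; upTo)
  import Data.List.Properties as Listₚ
  open import Data.Product using (_,_)
  open import Data.Sum using (inj₁; inj₂)
  open import Data.Empty using (⊥-elim)
  open import Relation.Nullary using (yes; no)
  open import Relation.Binary.PropositionalEquality
  open ≡-Reasoning
  open import Defs
  open Sums
  open Pivoting using (sign; sign-+; sign-double)
  open Links using (ℚ-field; ℚ-characteristicZero; starExact)
  open EvaluationCells
  open EvaluationExactness

  open Sum (CommutativeRing.commutativeSemiring ℤₚ.+-*-commutativeRing) public

  partialSum : (ℕ → ℤ) → ℕ → ℤ
  partialSum h zero    = h 0
  partialSum h (suc i) = partialSum h i + h (suc i)

  partialSum-cong : ∀ {g h} i → (∀ {j} → j ℕ.≤ i → g j ≡ h j) → partialSum g i ≡ partialSum h i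
  partialSum-cong zero    e = e z≤n
  partialSum-cong (suc i) e = cong₂ _+_ (partialSum-cong i (λ le → e (ℕₚ.m≤n⇒m≤1+n le))) (e ℕₚ.≤-refl)

  partialSum-+ : ∀ g h i → partialSum (λ j → g j + h j) i ≡ partialSum g i + partialSum h i
  partialSum-+ g h zero    = refl
  partialSum-+ g h (suc i) rewrite partialSum-+ g h i = swap (partialSum g i) (partialSum h i) (g (suc i)) (h (suc i))
    where
      swap : ∀ a b x y → a + b + (x + y) ≡ a + x + (b + y)
      swap = solve-∀

  partialSum-* : ∀ k h i → partialSum (λ j → k * h j) i ≡ k * partialSum h i
  partialSum-* k h zero    = refl
  partialSum-* k h (suc i) rewrite partialSum-* k h i = sym (ℤₚ.*-distribˡ-+ k _ _)

  partialSum-0 : ∀ {h} i → (∀ {j} → j ℕ.≤ i → h j ≡ 0ℤ) → partialSum h i ≡ 0ℤ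
  partialSum-0 zero    e = e z≤n
  partialSum-0 (suc i) e = cong₂ _+_ (partialSum-0 i (λ le → e (ℕₚ.m≤n⇒m≤1+n le))) (e ℕₚ.≤-refl)

  -- Stanley's triangle of differences: row N is the h-vector of a complex with face numbers f₀, …, f_N.
  module Triangle (f : ℕ → ℤ) where

    hEntry : ℕ → ℕ → ℤ
    hEntry zero    i       = f 0
    hEntry (suc N) zero    = hEntry N 0
    hEntry (suc N) (suc i) with i ℕ.<? N
    ... | yes _ = hEntry N (suc i) - hEntry N i
    ... | no _  = f (suc N) - hEntry N i

    hEntry-0 : ∀ N → hEntry N 0 ≡ f 0
    hEntry-0 zero    = refl
    hEntry-0 (suc N) = hEntry-0 N

    hEntry-< : ∀ N i → i ℕ.< N → hEntry (suc N) (suc i) ≡ hEntry N (suc i) - hEntry N i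
    hEntry-< N i lt with i ℕ.<? N
    ... | yes _ = refl
    ... | no ≮ = ⊥-elim (≮ lt)

    hEntry-top : ∀ N → hEntry (suc N) (suc N) ≡ f (suc N) - hEntry N N
    hEntry-top N with N ℕ.<? N
    ... | yes lt = ⊥-elim (ℕₚ.<-irrefl refl lt)
    ... | no _ = refl

    private
      cancel : ∀ a b → a + (b - a) ≡ b
      cancel = solve-∀

    partialSum-hEntry : ∀ N i → i ℕ.≤ N → partialSum (hEntry (suc N)) i ≡ hEntry N i
    partialSum-hEntry N zero    _  = refl
    partialSum-hEntry N (suc i) lt rewrite partialSum-hEntry N i (ℕₚ.<⇒≤ lt) | hEntry-< N i lt = cancel (hEntry N i) (hEntry N (suc i))

    sum-hEntry : ∀ N → partialSum (hEntry N) N ≡ f N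
    sum-hEntry zero    = refl
    sum-hEntry (suc N) rewrite partialSum-hEntry N N ℕₚ.≤-refl | hEntry-top N = cancel (hEntry N N) (f (suc N))

    falling : ℤ → ℕ → ℤ
    falling x zero    = 1ℤ
    falling x (suc i) = falling x i * (x - + i)

    falling-suc : ∀ x i → falling (x + 1ℤ) (suc i) ≡ (x + 1ℤ) * falling x i
    falling-suc x zero    = base x
      where
        base : ∀ x → 1ℤ * (x + 1ℤ - + 0) ≡ (x + 1ℤ) * 1ℤ
        base = solve-∀
    falling-suc x (suc i) = trans (cong₂ _*_ (falling-suc x i) (shift (+ i))) (assoc (x + 1ℤ) (falling x i) (x - + i))
      where
        assoc : ∀ a b c → a * b * c ≡ a * (b * c)
        assoc = solve-∀
        shift : ∀ k → x + 1ℤ - (1ℤ + k) ≡ x - k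
        shift k = simplify x k
          where
            simplify : ∀ x k → x + 1ℤ - (1ℤ + k) ≡ x - k
            simplify = solve-∀

    falling-pascal : ∀ x i → falling (x + 1ℤ) (suc i) ≡ falling x (suc i) + + suc i * falling x i
    falling-pascal x i = trans (falling-suc x i) (expand x (+ i) (falling x i))
      where
        expand : ∀ x k y → (x + 1ℤ) * y ≡ y * (x - k) + (1ℤ + k) * y
        expand = solve-∀

    falling-0 : ∀ k i → k ℕ.< i → falling (+ k) i ≡ 0ℤ
    falling-0 k (suc i) (s≤s le) with ℕₚ.m≤n⇒m<n∨m≡n le
    ... | inj₁ lt rewrite falling-0 k i lt = refl
    ... | inj₂ refl rewrite ℤₚ.+-inverseʳ (+ k) = ℤₚ.*-zeroʳ (falling (+ k) k)

    -- The contribution of the faces of size j to the i-th derivative at 0 of the reversed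
    -- h-polynomial Σ_j f_j (x - 1)^(N - j).
    scaledTerm : ℕ → ℕ → ℕ → ℤ
    scaledTerm N i j = f j * (sign (N ℕ.+ i ℕ.+ j) * falling (+ N - + j) i)

    scaled : ℕ → ℕ → ℤ
    scaled N i = partialSum (scaledTerm N i) N

    private
      +suc : ∀ N j → + suc N - + j ≡ (+ N - + j) + 1ℤ
      +suc N j = simplify (+ N) (+ j)
        where
          simplify : ∀ x k → 1ℤ + x - k ≡ x - k + 1ℤ
          simplify = solve-∀

      step-term : ∀ N i j → scaledTerm (suc N) (suc i) j ≡ (- 1ℤ) * scaledTerm N (suc i) j + + suc i * scaledTerm N i j
      step-term N i j rewrite +suc N j | falling-pascal (+ N - + j) i | ℕₚ.+-suc N i =
        expand (f j) (sign (N ℕ.+ i ℕ.+ j)) (falling (+ N - + j) (suc i)) (falling (+ N - + j) i) (+ suc i)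
        where
          expand : ∀ f s a b k → f * (- (- s) * (a + k * b)) ≡ (- 1ℤ) * (f * ((- s) * a)) + k * (f * (s * b))
          expand = solve-∀

    -- Pascal's rule for falling factorials becomes, after division by (i + 1)!, the rule by which
    -- the triangle is formed. The new face number drops out because `falling` vanishes at 0.
    scaled-suc : ∀ N i → scaled (suc N) (suc i) ≡ + suc i * scaled N i - scaled N (suc i)
    scaled-suc N i = begin
      partialSum (scaledTerm (suc N) (suc i)) N + scaledTerm (suc N) (suc i) (suc N)
        ≡⟨ cong₂ _+_ (partialSum-cong N (λ {j} _ → step-term N i j)) top ⟩
      partialSum (λ j → (- 1ℤ) * scaledTerm N (suc i) j + + suc i * scaledTerm N i j) N + 0ℤ
        ≡⟨ cong (_+ 0ℤ) (trans (partialSum-+ _ _ N) (cong₂ _+_ (partialSum-* (- 1ℤ) _ N) (partialSum-* (+ suc i) _ N))) ⟩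
      (- 1ℤ) * scaled N (suc i) + + suc i * scaled N i + 0ℤ
        ≡⟨ rearrange (scaled N (suc i)) (+ suc i * scaled N i) ⟩
      + suc i * scaled N i - scaled N (suc i) ∎
      where
        rearrange : ∀ a b → (- 1ℤ) * a + b + 0ℤ ≡ b - a
        rearrange = solve-∀
        top : scaledTerm (suc N) (suc i) (suc N) ≡ 0ℤ
        top rewrite ℤₚ.+-inverseʳ (+ suc N) | falling-0 0 (suc i) (s≤s z≤n)
                  | ℤₚ.*-zeroʳ (sign (suc N ℕ.+ suc i ℕ.+ suc N)) = ℤₚ.*-zeroʳ (f (suc N))

    scaled-zero : ∀ N → scaled (suc N) 0 ≡ f (suc N) - scaled N 0
    scaled-zero N = begin
      partialSum (scaledTerm (suc N) 0) N + scaledTerm (suc N) 0 (suc N)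
        ≡⟨ cong₂ _+_ (trans (partialSum-cong N (λ {j} _ → negate j)) (partialSum-* (- 1ℤ) _ N)) top ⟩
      (- 1ℤ) * scaled N 0 + f (suc N)
        ≡⟨ rearrange (scaled N 0) (f (suc N)) ⟩
      f (suc N) - scaled N 0 ∎
      where
        rearrange : ∀ a b → (- 1ℤ) * a + b ≡ b - a
        rearrange = solve-∀
        negate : ∀ j → scaledTerm (suc N) 0 j ≡ (- 1ℤ) * scaledTerm N 0 j
        negate j = expand (f j) (sign (N ℕ.+ 0 ℕ.+ j))
          where
            expand : ∀ f s → f * ((- s) * 1ℤ) ≡ (- 1ℤ) * (f * (s * 1ℤ))
            expand = solve-∀
        top : scaledTerm (suc N) 0 (suc N) ≡ f (suc N)
        top rewrite ℕₚ.+-identityʳ N | sign-double (suc N) = ℤₚ.*-identityʳ (f (suc N))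

    -- The polynomial has degree N, so its derivative of order N + 1 is zero.
    scaled-vanish : ∀ N → scaled N (suc N) ≡ 0ℤ
    scaled-vanish N = partialSum-0 N λ {j} j≤N → zero-term j j≤N
      where
        zero-term : ∀ j → j ℕ.≤ N → scaledTerm N (suc N) j ≡ 0ℤ
        zero-term j j≤N rewrite trans (ℤₚ.m-n≡m⊖n N j) (ℤₚ.⊖-≥ j≤N) | falling-0 (N ∸ j) (suc N) (s≤s (ℕₚ.m∸n≤m N j))
                              | ℤₚ.*-zeroʳ (sign (N ℕ.+ suc N ℕ.+ j)) = ℤₚ.*-zeroʳ (f j)

    scaled-hEntry : ∀ N i → i ℕ.≤ N → scaled N i ≡ + (i !) * hEntry N (N ∸ i)
    scaled-hEntry zero zero _ = trans (ℤₚ.*-identityʳ (f 0)) (sym (ℤₚ.*-identityˡ (f 0)))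
    scaled-hEntry (suc N) zero _ = begin
      scaled (suc N) 0                      ≡⟨ scaled-zero N ⟩
      f (suc N) - scaled N 0                ≡⟨ cong (λ a → f (suc N) - a) (trans (scaled-hEntry N 0 z≤n) (ℤₚ.*-identityˡ (hEntry N N))) ⟩
      f (suc N) - hEntry N N                ≡⟨ sym (hEntry-top N) ⟩
      hEntry (suc N) (suc N)                ≡⟨ sym (ℤₚ.*-identityˡ _) ⟩
      1ℤ * hEntry (suc N) (suc N)           ∎
    scaled-hEntry (suc N) (suc i) (s≤s i≤N) with ℕₚ.m≤n⇒m<n∨m≡n i≤N
    -- For i = N the index N - (i + 1) would be truncated; the second term vanishes by degree
    -- instead.
    ... | inj₂ refl = begin
      scaled (suc i) (suc i)                      ≡⟨ scaled-suc i i ⟩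
      + suc i * scaled i i - scaled i (suc i)     ≡⟨ cong₂ _-_ (cong (+ suc i *_) (scaled-hEntry i i ℕₚ.≤-refl)) (scaled-vanish i) ⟩
      + suc i * (+ (i !) * hEntry i (i ∸ i)) - 0ℤ ≡⟨ cong (λ k → + suc i * (+ (i !) * hEntry i k) - 0ℤ) (ℕₚ.n∸n≡0 i) ⟩
      + suc i * (+ (i !) * hEntry i 0) - 0ℤ       ≡⟨ rearrange (+ suc i) (+ (i !)) (hEntry i 0) ⟩
      (+ suc i * + (i !)) * hEntry i 0            ≡⟨ cong₂ _*_ (sym (ℤₚ.pos-* (suc i) (i !))) (cong (hEntry (suc i)) (sym (ℕₚ.n∸n≡0 i))) ⟩
      + (suc i !) * hEntry (suc i) (i ∸ i)        ∎
      where
        rearrange : ∀ a b c → a * (b * c) - 0ℤ ≡ (a * b) * c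
        rearrange = solve-∀
    ... | inj₁ i<N = begin
      scaled (suc N) (suc i)                      ≡⟨ scaled-suc N i ⟩
      + suc i * scaled N i - scaled N (suc i)     ≡⟨ cong₂ (λ a b → + suc i * a - b) (scaled-hEntry N i i≤N) (scaled-hEntry N (suc i) i<N) ⟩
      + suc i * (+ (i !) * hEntry N (N ∸ i)) - + (suc i !) * hEntry N k
        ≡⟨ cong₂ (λ a b → + suc i * (+ (i !) * hEntry N a) - b * hEntry N k) N∸i (ℤₚ.pos-* (suc i) (i !)) ⟩
      + suc i * (+ (i !) * hEntry N (suc k)) - (+ suc i * + (i !)) * hEntry N k
        ≡⟨ rearrange (+ suc i) (+ (i !)) (hEntry N (suc k)) (hEntry N k) ⟩
      (+ suc i * + (i !)) * (hEntry N (suc k) - hEntry N k)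
        ≡⟨ cong₂ _*_ (sym (ℤₚ.pos-* (suc i) (i !))) (sym (trans (cong (hEntry (suc N)) N∸i) (hEntry-< N k k<N))) ⟩
      + (suc i !) * hEntry (suc N) (N ∸ i) ∎
      where
        k = N ∸ suc i
        N∸i : N ∸ i ≡ suc k
        N∸i = ℕₚ.+-∸-assoc 1 i<N
        k<N : k ℕ.< N
        k<N = subst (ℕ._≤ N) N∸i (ℕₚ.m∸n≤m N i)
        rearrange : ∀ a b c d → a * (b * c) - (a * b) * d ≡ (a * b) * (c - d)
        rearrange = solve-∀

    scaled-nonneg⇒ : ∀ N → (∀ i → i ℕ.≤ N → 0ℤ ℤ.≤ scaled N i) → ∀ i → i ℕ.≤ N → 0ℤ ℤ.≤ hEntry N i
    scaled-nonneg⇒ N nonneg i i≤N = ℤₚ.*-cancelˡ-≤-pos 0ℤ (hEntry N i) (+ ((N ∸ i) !)) ⦃ ℤ.positive (ℤ.+<+ (ℕₚ.1≤n! (N ∸ i))) ⦄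
      (ℤₚ.≤-trans (ℤₚ.≤-reflexive (ℤₚ.*-zeroʳ (+ ((N ∸ i) !)))) (ℤₚ.≤-trans (nonneg (N ∸ i) (ℕₚ.m∸n≤m N i))
        (ℤₚ.≤-reflexive (trans (scaled-hEntry N (N ∸ i) (ℕₚ.m∸n≤m N i)) (cong (λ k → + ((N ∸ i) !) * hEntry N k) (ℕₚ.m∸[m∸n]≡n i≤N))))))

  faceNumber : ∀ {m} → SimplicialComplex m → ℕ → ℤ
  faceNumber {m} Δ j = ∑ (allSubsets m) (λ G → if face Δ G ∧ (∣ G ∣ ℕ.≡ᵇ j) then 1ℤ else 0ℤ)

  ∑-filter : ∀ {A : Set} (p : A → Bool) xs (g : A → ℤ) →
             ∑ (List.filter (λ x → p x Bool.≟ true) xs) g ≡ ∑ xs (λ x → if p x then g x else 0ℤ)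
  ∑-filter p []       g = refl
  ∑-filter p (x ∷ xs) g with p x
  ... | true  = cong (λ a → g x + a) (∑-filter p xs g)
  ... | false = trans (∑-filter p xs g) (sym (ℤₚ.+-identityˡ _))

  partialSum-∑ : ∀ {A : Set} (xs : List A) (g : A → ℕ → ℤ) N →
                 partialSum (λ j → ∑ xs (λ x → g x j)) N ≡ ∑ xs (λ x → partialSum (g x) N)
  partialSum-∑ xs g zero    = refl
  partialSum-∑ xs g (suc N) = trans (cong (λ a → a + ∑ xs (λ x → g x (suc N))) (partialSum-∑ xs g N)) (sym (∑-+ xs (λ x → partialSum (g x) N) (λ x → g x (suc N))))

  private
    ≡ᵇ-≢ : ∀ j k → j ≢ k → (j ℕ.≡ᵇ k) ≡ false
    ≡ᵇ-≢ j k ne with j ℕ.≡ᵇ k in eq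
    ... | false = refl
    ... | true  = ⊥-elim (ne (ℕₚ.≡ᵇ⇒≡ j k (subst T (sym eq) _)))

    ≡ᵇ-refl : ∀ k → (k ℕ.≡ᵇ k) ≡ true
    ≡ᵇ-refl zero    = refl
    ≡ᵇ-refl (suc k) = ≡ᵇ-refl k

  partialSum-select : ∀ b k (φ : ℕ → ℤ) N → k ℕ.≤ N →
                      partialSum (λ j → (if b ∧ (k ℕ.≡ᵇ j) then 1ℤ else 0ℤ) * φ j) N ≡ (if b then φ k else 0ℤ)
  partialSum-select false k φ N k≤N = partialSum-0 N (λ _ → refl)
  partialSum-select true k φ zero z≤n = ℤₚ.*-identityˡ (φ 0)
  partialSum-select true k φ (suc N) k≤N with ℕₚ.m≤n⇒m<n∨m≡n k≤N
  ... | inj₁ (s≤s k≤N′) rewrite partialSum-select true k φ N k≤N′ | ≡ᵇ-≢ k (suc N) (λ { refl → ℕₚ.<-irrefl refl k≤N′ }) = ℤₚ.+-identityʳ (φ k)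
  ... | inj₂ refl rewrite ≡ᵇ-refl N =
    trans (cong₂ _+_ (partialSum-0 N (λ {j} j≤N → cong (λ b → (if b then 1ℤ else 0ℤ) * φ j) (≡ᵇ-≢ (suc N) j (λ { refl → ℕₚ.<-irrefl refl j≤N }))))
                     (ℤₚ.*-identityˡ (φ (suc N)))) (ℤₚ.+-identityˡ _)

  module _ {m : ℕ} (Δ : SimplicialComplex m) (n : ℕ) (dim : ∀ G → face Δ G ≡ true → ∣ G ∣ ℕ.≤ n) where
    open Triangle (faceNumber Δ)

    ∑-faces : ∀ φ → ∑ (List.filter (λ G → face Δ G Bool.≟ true) (allSubsets m)) (λ G → φ ∣ G ∣) ≡
                    partialSum (λ j → faceNumber Δ j * φ j) n
    ∑-faces φ = sym (begin
      partialSum (λ j → faceNumber Δ j * φ j) n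
        ≡⟨ partialSum-cong n (λ {j} _ → sym (∑-*ʳ (allSubsets m) (λ G → if face Δ G ∧ (∣ G ∣ ℕ.≡ᵇ j) then 1ℤ else 0ℤ) (φ j))) ⟩
      partialSum (λ j → ∑ (allSubsets m) (λ G → (if face Δ G ∧ (∣ G ∣ ℕ.≡ᵇ j) then 1ℤ else 0ℤ) * φ j)) n
        ≡⟨ partialSum-∑ (allSubsets m) _ n ⟩
      ∑ (allSubsets m) (λ G → partialSum (λ j → (if face Δ G ∧ (∣ G ∣ ℕ.≡ᵇ j) then 1ℤ else 0ℤ) * φ j) n)
        ≡⟨ ∑-cong (allSubsets m) perFace ⟩
      ∑ (allSubsets m) (λ G → if face Δ G then φ ∣ G ∣ else 0ℤ)
        ≡⟨ sym (∑-filter (face Δ) (allSubsets m) _) ⟩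
      ∑ (List.filter (λ G → face Δ G Bool.≟ true) (allSubsets m)) (λ G → φ ∣ G ∣) ∎)
      where
        perFace : ∀ G → partialSum (λ j → (if face Δ G ∧ (∣ G ∣ ℕ.≡ᵇ j) then 1ℤ else 0ℤ) * φ j) n ≡ (if face Δ G then φ ∣ G ∣ else 0ℤ)
        perFace G with face Δ G in eq
        ... | true  = partialSum-select true ∣ G ∣ φ n (dim G eq)
        ... | false = partialSum-0 n (λ _ → refl)

    module _ (i : ℕ) where
      open EvaluationComplex Δ n dim i using (cells; cellsOver; faces)
      open Slotted m n

      -- The Euler characteristic of the evaluation complex of a simplex with j vertices: each slot
      -- contributes its number of vertices minus its number of exponents.
      column : ℕ → ℕ → ℤ
      column j zero    = 1ℤ
      column j (suc i) = (+ j - + (n ∸ i)) * column j i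

      ∑-product : ∀ {A B C : Set} (g : A → B → C) xs ys (φ : C → ℤ) →
                  ∑ (List.cartesianProductWith g xs ys) φ ≡ ∑ xs (λ x → ∑ ys (λ y → φ (g x y)))
      ∑-product g []       ys φ = refl
      ∑-product g (x ∷ xs) ys φ = trans (∑-++ (List.map (g x) ys) _ φ) (cong₂ _+_ (∑-map (g x) ys φ) (∑-product g xs ys φ))

      ∑-constant : ∀ {A : Set} (xs : List A) k → ∑ xs (λ _ → k) ≡ + length xs * k
      ∑-constant []       k = sym (ℤₚ.*-zeroˡ k)
      ∑-constant (x ∷ xs) k = trans (cong (λ a → k + a) (∑-constant xs k)) (sym (ℤₚ.suc-* (+ length xs) k))

      size : Subset m → ℕ
      size G = ∣ G ∣

      ∑-goodSlots : ∀ G k → ∑ (goodSlots G k) (λ s → sign (exponents s)) ≡ column (size G) k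
      ∑-goodSlots G zero    = refl
      ∑-goodSlots G (suc k) = begin
        ∑ (goodSlots G (suc k)) (λ s → sign (exponents s))
          ≡⟨ ∑-product _∷_ (headSlots G (n ∸ k)) (goodSlots G k) _ ⟩
        ∑ (headSlots G (n ∸ k)) (λ x → ∑ (goodSlots G k) (λ s → sign (exponents (x ∷ s))))
          ≡⟨ ∑-++ (List.map inj₁ (upTo (n ∸ k))) _ _ ⟩
        ∑ (List.map inj₁ (upTo (n ∸ k))) (λ x → ∑ (goodSlots G k) (λ s → sign (exponents (x ∷ s)))) +
        ∑ (List.map inj₂ (elements G)) (λ x → ∑ (goodSlots G k) (λ s → sign (exponents (x ∷ s))))
          ≡⟨ cong₂ _+_ (trans (∑-map inj₁ (upTo (n ∸ k)) _) (∑-constant (upTo (n ∸ k)) _))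
                       (trans (∑-map inj₂ (elements G) _) (∑-constant (elements G) _)) ⟩
        + length (upTo (n ∸ k)) * ∑ (goodSlots G k) (λ s → - sign (exponents s)) +
        + length (elements G) * ∑ (goodSlots G k) (λ s → sign (exponents s))
          ≡⟨ cong₂ _+_ (cong₂ (λ a b → + a * b) (Listₚ.length-upTo (n ∸ k))
                         (trans (∑-cong (goodSlots G k) (λ s → neg (sign (exponents s))))
                                (trans (∑-*ˡ (goodSlots G k) (- 1ℤ) _) (cong ((- 1ℤ) *_) (∑-goodSlots G k)))))
                       (cong₂ (λ a b → + a * b) (length-elements G) (∑-goodSlots G k)) ⟩
        + (n ∸ k) * ((- 1ℤ) * column (size G) k) + + (size G) * column (size G) k
          ≡⟨ rearrange (+ (n ∸ k)) (+ (size G)) (column (size G) k) ⟩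
        (+ (size G) - + (n ∸ k)) * column (size G) k ∎
        where
          neg : ∀ a → - a ≡ (- 1ℤ) * a
          neg = solve-∀
          rearrange : ∀ d g c → d * ((- 1ℤ) * c) + g * c ≡ (g - d) * c
          rearrange = solve-∀

      ∑-cellsOver : ∀ Gs → ∑ (cellsOver Gs) (λ x → sign (n ℕ.+ cellDegree x)) ≡ ∑ Gs (λ G → sign (n ℕ.+ size G) * column (size G) i)
      ∑-cellsOver []       = refl
      ∑-cellsOver (G ∷ Gs) = trans (∑-++ (List.map (G ,_) (goodSlots G i)) _ _) (cong₂ _+_ (begin
        ∑ (List.map (G ,_) (goodSlots G i)) (λ x → sign (n ℕ.+ cellDegree x))
          ≡⟨ ∑-map (G ,_) (goodSlots G i) _ ⟩
        ∑ (goodSlots G i) (λ s → sign (n ℕ.+ (size G ℕ.+ exponents s)))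
          ≡⟨ ∑-cong (goodSlots G i) (λ s → trans (cong sign (sym (ℕₚ.+-assoc n (size G) (exponents s)))) (sign-+ (n ℕ.+ size G) (exponents s))) ⟩
        ∑ (goodSlots G i) (λ s → sign (n ℕ.+ size G) * sign (exponents s))
          ≡⟨ trans (∑-*ˡ (goodSlots G i) (sign (n ℕ.+ size G)) (λ s → sign (exponents s))) (cong (sign (n ℕ.+ size G) *_) (∑-goodSlots G i)) ⟩
        sign (n ℕ.+ size G) * column (size G) i ∎) (∑-cellsOver Gs))

      column-falling : ∀ j k → k ℕ.≤ n → column j k ≡ sign k * falling (+ n - + j) k
      column-falling j zero    _  = refl
      column-falling j (suc k) lt = begin
        (+ j - + (n ∸ k)) * column j k
          ≡⟨ cong₂ (λ a b → (+ j - a) * b) (trans (sym (ℤₚ.⊖-≥ (ℕₚ.<⇒≤ lt))) (sym (ℤₚ.m-n≡m⊖n n k))) (column-falling j k (ℕₚ.<⇒≤ lt)) ⟩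
        (+ j - (+ n - + k)) * (sign k * falling (+ n - + j) k)
          ≡⟨ rearrange (+ j) (+ n) (+ k) (sign k) (falling (+ n - + j) k) ⟩
        (- sign k) * (falling (+ n - + j) k * (+ n - + j - + k)) ∎
        where
          rearrange : ∀ j n k s x → (j - (n - k)) * (s * x) ≡ (- s) * (x * (n - j - k))
          rearrange = solve-∀

      euler-scaled : i ℕ.≤ n → ∑ cells (λ x → sign (n ℕ.+ cellDegree x)) ≡ scaled n i
      euler-scaled i≤n = begin
        ∑ cells (λ x → sign (n ℕ.+ cellDegree x))
          ≡⟨ ∑-cellsOver faces ⟩
        ∑ faces (λ G → sign (n ℕ.+ size G) * column (size G) i)
          ≡⟨ ∑-faces (λ j → sign (n ℕ.+ j) * column j i) ⟩
        partialSum (λ j → faceNumber Δ j * (sign (n ℕ.+ j) * column j i)) n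
          ≡⟨ partialSum-cong n (λ {j} _ → cong (faceNumber Δ j *_) (begin
               sign (n ℕ.+ j) * column j i
                 ≡⟨ cong₂ _*_ (sign-+ n j) (column-falling j i i≤n) ⟩
               (sign n * sign j) * (sign i * falling (+ n - + j) i)
                 ≡⟨ rearrange (sign n) (sign j) (sign i) (falling (+ n - + j) i) ⟩
               sign n * sign i * sign j * falling (+ n - + j) i
                 ≡⟨ cong (_* falling (+ n - + j) i) (sym (trans (sign-+ (n ℕ.+ i) j) (cong (_* sign j) (sign-+ n i)))) ⟩
               sign (n ℕ.+ i ℕ.+ j) * falling (+ n - + j) i ∎)) ⟩
        scaled n i ∎
        where
          rearrange : ∀ a b c d → (a * b) * (c * d) ≡ a * c * b * d
          rearrange = solve-∀

    -- Exactness over ℚ is available only doubly negated. Deciding the inequality first leaves a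
    -- contradiction as the goal, where this is enough.
    hEntry-nonneg : ∀ {c ℓ} (K : Field c ℓ) → Gorenstein* K Δ n → ∀ i → i ℕ.≤ n → 0ℤ ℤ.≤ hEntry n i
    hEntry-nonneg K gor i i≤n with 0ℤ ℤ.≤? hEntry n i
    ... | yes p = p
    ... | no ¬p = ⊥-elim (starExact Δ K ℚ-field ℚ-characteristicZero gor λ star →
      ¬p (scaled-nonneg⇒ n (λ k k≤n → ℤₚ.≤-trans (EvaluationComplex.Over.euler Δ n dim k ℚ-field ℚ-characteristicZero star)
                                                  (ℤₚ.≤-reflexive (euler-scaled k k≤n))) i i≤n))

-- Flag numbers in terms of the h-vector.

module FlagNumbers where

  open import Data.Bool using (Bool; true; false; if_then_else_; _∧_; T)
  import Data.Bool.Properties as Boolₚ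
  open import Data.Nat as ℕ using (ℕ; zero; suc; z≤n; s≤s)
  import Data.Nat.Properties as ℕₚ
  open import Data.Integer as ℤ using (ℤ; +_; 0ℤ; 1ℤ; _+_; _*_; _-_; -_)
  import Data.Integer.Properties as ℤₚ
  open import Data.Integer.Tactic.RingSolver using (solve-∀)
  open import Data.Fin as Fin using (Fin; zero; suc; toℕ)
  open import Data.Fin.Subset using (Subset; ⊥; ∣_∣)
  open import Data.Vec using ([]; _∷_; _∷ʳ_; lookup)
  open import Data.List as List using (List; []; _∷_; _++_; tabulate)
  import Data.List.Properties as Listₚ
  open import Data.Sum using (inj₁; inj₂)
  open import Relation.Nullary.Decidable.Core using (T?)
  open import Relation.Binary.PropositionalEquality hiding ([_])
  open ≡-Reasoning
  open import Defs
  open EvaluationCells using (subsetᵇ-⊥; subsetᵇ⇒⊆)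
  open HVector

  binomial : ℕ → ℕ → ℤ
  binomial N       zero    = 1ℤ
  binomial zero    (suc r) = 0ℤ
  binomial (suc N) (suc r) = binomial N r + binomial N (suc r)

  -- E n h is Σ_S f_S ∏_{i ∉ S} (τᵢ - 1) for a complex with h-vector h, split by the largest element of S:
  -- the faces of size n + 1 contribute the flags of their boundaries, whose h-vector is constant.
  E : ℕ → (ℕ → ℤ) → (ℕ → ℤ) → ℤ
  E zero    h τ = h 0
  E (suc n) h τ = (τ n - 1ℤ) * E n (partialSum h) τ + partialSum h (suc n) * E n (λ _ → 1ℤ) τ

  E-cong : ∀ n {g h} τ → (∀ {i} → i ℕ.≤ n → g i ≡ h i) → E n g τ ≡ E n h τ
  E-cong zero    τ e = e z≤n
  E-cong (suc n) τ e = cong₂ _+_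
    (cong ((τ n - 1ℤ) *_) (E-cong n τ (λ {i} i≤n → partialSum-cong i (λ j≤i → e (ℕₚ.≤-trans j≤i (ℕₚ.m≤n⇒m≤1+n i≤n))))))
    (cong (_* E n (λ _ → 1ℤ) τ) (partialSum-cong (suc n) e))

  -- The recursion of `E` before face numbers are traded for h: below a top face of n + 1 vertices
  -- lie the faces of a simplex, counted by `binomial (suc n)`.
  fromFaceNumbers : ℕ → (ℕ → ℤ) → (ℕ → ℤ) → ℤ
  fromFaceNumbers zero    f τ = 1ℤ
  fromFaceNumbers (suc n) f τ = (τ n - 1ℤ) * fromFaceNumbers n f τ + f (suc n) * fromFaceNumbers n (binomial (suc n)) τ

  fromFaceNumbers-cong : ∀ n {f g} τ → (∀ r → f r ≡ g r) → fromFaceNumbers n f τ ≡ fromFaceNumbers n g τ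
  fromFaceNumbers-cong zero    τ e = refl
  fromFaceNumbers-cong (suc n) τ e = cong₂ _+_ (cong ((τ n - 1ℤ) *_) (fromFaceNumbers-cong n τ e))
                                               (cong (_* fromFaceNumbers n (binomial (suc n)) τ) (e (suc n)))

  private
    iterated : ℕ → ℕ → ℤ
    iterated zero    = λ _ → 1ℤ
    iterated (suc a) = partialSum (iterated a)

    iterated-0 : ∀ a → iterated a 0 ≡ 1ℤ
    iterated-0 zero    = refl
    iterated-0 (suc a) = iterated-0 a

    binomial-> : ∀ N k → binomial N (suc (N ℕ.+ k)) ≡ 0ℤ
    binomial-> zero    k = refl
    binomial-> (suc N) k = cong₂ _+_ (binomial-> N k) (trans (cong (λ j → binomial N (suc j)) (sym (ℕₚ.+-suc N k))) (binomial-> N (suc k)))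

    binomial-diagonal : ∀ n → binomial n n ≡ 1ℤ
    binomial-diagonal zero    = refl
    binomial-diagonal (suc n) = cong₂ _+_ (binomial-diagonal n) (trans (cong (λ j → binomial n (suc j)) (sym (ℕₚ.+-identityʳ n))) (binomial-> n 0))

    binomial-iterated : ∀ a n → binomial (a ℕ.+ n) n ≡ iterated a n
    binomial-iterated zero    n       = binomial-diagonal n
    binomial-iterated (suc a) zero    = sym (iterated-0 a)
    binomial-iterated (suc a) (suc n) = cong₂ _+_
      (trans (cong (λ k → binomial k n) (ℕₚ.+-suc a n)) (binomial-iterated (suc a) n)) (binomial-iterated a (suc n))

    difference : ∀ a b → a + b - a ≡ b
    difference = solve-∀

    -- Iterated partial sums of 1 are the h-vectors of skeleta of simplices, `a` being the excess of
    -- vertices. Only a = 0, the boundary of a simplex, is wanted; but the triangle forms row n from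
    -- row n - 1 of the same face numbers, where the excess is one larger.
    hEntry-binomial : ∀ n a i → i ℕ.≤ n → Triangle.hEntry (binomial (suc (a ℕ.+ n))) n i ≡ iterated a i
    hEntry-binomial zero    a zero    _  = sym (iterated-0 a)
    hEntry-binomial (suc n) a zero    _  rewrite ℕₚ.+-suc a n = trans (hEntry-binomial n (suc a) zero z≤n) refl
    hEntry-binomial (suc n) a (suc i) (s≤s i≤n) with ℕₚ.m≤n⇒m<n∨m≡n i≤n
    ... | inj₁ i<n rewrite ℕₚ.+-suc a n =
      trans (Triangle.hEntry-< (binomial (suc (suc (a ℕ.+ n)))) n i i<n)
            (trans (cong₂ _-_ (hEntry-binomial n (suc a) (suc i) i<n) (hEntry-binomial n (suc a) i i≤n))
                   (difference (partialSum (iterated a) i) (iterated a (suc i))))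
    ... | inj₂ refl rewrite ℕₚ.+-suc a i =
      trans (Triangle.hEntry-top (binomial (suc (suc (a ℕ.+ i)))) i)
            (trans (cong₂ _-_ (trans (cong (λ k → binomial (suc k) (suc i)) (sym (ℕₚ.+-suc a i))) (binomial-iterated (suc a) (suc i)))
                              (hEntry-binomial i (suc a) i ℕₚ.≤-refl))
                   (difference (partialSum (iterated a) i) (iterated a (suc i))))

  fromFaceNumbers-E : ∀ n f τ → f 0 ≡ 1ℤ → fromFaceNumbers n f τ ≡ E n (Triangle.hEntry f n) τ
  fromFaceNumbers-E zero    f τ f0 = sym f0
  fromFaceNumbers-E (suc n) f τ f0 = cong₂ _+_
    (cong ((τ n - 1ℤ) *_) (trans (fromFaceNumbers-E n f τ f0) (E-cong n τ (λ {i} i≤n → sym (Triangle.partialSum-hEntry f n i i≤n)))))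
    (cong₂ _*_ (sym (Triangle.sum-hEntry f (suc n)))
               (trans (fromFaceNumbers-E n (binomial (suc n)) τ refl) (E-cong n τ (λ {i} i≤n → hEntry-binomial n 0 i i≤n))))

  [_] : Bool → ℤ
  [ b ] = if b then 1ℤ else 0ℤ

  []-∧ : ∀ a b x → [ a ] * ([ b ] * x) ≡ [ a ∧ b ] * x
  []-∧ true  b x = ℤₚ.*-identityˡ _
  []-∧ false b x = refl

  module _ {m : ℕ} where

    DownClosed : (Subset m → Bool) → Set
    DownClosed p = ∀ F G → subsetᵇ F G ≡ true → p G ≡ true → p F ≡ true

    chains : (Subset m → Bool) → Subset m → List ℕ → ℤ
    chains p P []       = 1ℤ
    chains p P (r ∷ rs) = ∑ (allSubsets m) (λ G → [ p G ∧ subsetᵇ P G ∧ (∣ G ∣ ℕ.≡ᵇ r) ] * chains p G rs)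

    simplex : Subset m → Subset m → Bool
    simplex G F = subsetᵇ F G

  subsetᵇ-trans : ∀ {m} (F G H : Subset m) → subsetᵇ F G ≡ true → subsetᵇ G H ≡ true → subsetᵇ F H ≡ true
  subsetᵇ-trans []          []         []         p q = refl
  subsetᵇ-trans (true  ∷ F) (true ∷ G) (true ∷ H) p q = subsetᵇ-trans F G H p q
  subsetᵇ-trans (false ∷ F) (true ∷ G) (true ∷ H) p q = subsetᵇ-trans F G H p q
  subsetᵇ-trans (false ∷ F) (false ∷ G) (x ∷ H)   p q = subsetᵇ-trans F G H p q

  module _ {m : ℕ} where

    private
      boolean : ∀ x y a z w b u → (z ≡ true → w ≡ true → x ≡ true) → (y ≡ true → w ≡ true → u ≡ true) →
                (x ∧ y ∧ a) ∧ (z ∧ w ∧ b) ≡ (z ∧ u ∧ b) ∧ (w ∧ y ∧ a)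
      boolean x y a false w     b u h k = Boolₚ.∧-zeroʳ (x ∧ y ∧ a)
      boolean x y a true  false b u h k = trans (Boolₚ.∧-zeroʳ (x ∧ y ∧ a)) (sym (Boolₚ.∧-zeroʳ (u ∧ b)))
      boolean x false a true true b u h k = trans (cong (_∧ b) (Boolₚ.∧-zeroʳ x)) (sym (Boolₚ.∧-zeroʳ (u ∧ b)))
      boolean x true a true true b u h k rewrite h refl refl | k refl refl = Boolₚ.∧-comm a b

    -- Below its top element `G` a chain of a down-closed family is any chain of subsets of `G`, so
    -- the family matters for `G` alone.
    chains-snoc : ∀ p → DownClosed p → ∀ P rs r → chains p P (rs ++ r ∷ []) ≡
                  ∑ (allSubsets m) (λ G → [ p G ∧ subsetᵇ P G ∧ (∣ G ∣ ℕ.≡ᵇ r) ] * chains (simplex G) P rs)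
    chains-snoc p down P []        r = refl
    chains-snoc p down P (r₁ ∷ rs) r = begin
      ∑ all (λ G₁ → [ p G₁ ∧ subsetᵇ P G₁ ∧ (∣ G₁ ∣ ℕ.≡ᵇ r₁) ] * chains p G₁ (rs ++ r ∷ []))
        ≡⟨ ∑-cong all (λ G₁ → trans (cong ([ p G₁ ∧ subsetᵇ P G₁ ∧ (∣ G₁ ∣ ℕ.≡ᵇ r₁) ] *_) (chains-snoc p down G₁ rs r))
                                    (sym (∑-*ˡ all [ p G₁ ∧ subsetᵇ P G₁ ∧ (∣ G₁ ∣ ℕ.≡ᵇ r₁) ] _))) ⟩
      ∑ all (λ G₁ → ∑ all (λ G → [ p G₁ ∧ subsetᵇ P G₁ ∧ (∣ G₁ ∣ ℕ.≡ᵇ r₁) ] *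
                                ([ p G ∧ subsetᵇ G₁ G ∧ (∣ G ∣ ℕ.≡ᵇ r) ] * chains (simplex G) G₁ rs)))
        ≡⟨ ∑-swap all all _ ⟩
      ∑ all (λ G → ∑ all (λ G₁ → [ p G₁ ∧ subsetᵇ P G₁ ∧ (∣ G₁ ∣ ℕ.≡ᵇ r₁) ] *
                                ([ p G ∧ subsetᵇ G₁ G ∧ (∣ G ∣ ℕ.≡ᵇ r) ] * chains (simplex G) G₁ rs)))
        ≡⟨ ∑-cong all (λ G → trans (∑-cong all (λ G₁ → exchange G G₁)) (∑-*ˡ all [ p G ∧ subsetᵇ P G ∧ (∣ G ∣ ℕ.≡ᵇ r) ] _)) ⟩
      ∑ all (λ G → [ p G ∧ subsetᵇ P G ∧ (∣ G ∣ ℕ.≡ᵇ r) ] * chains (simplex G) P (r₁ ∷ rs)) ∎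
      where
        all = allSubsets m

        exchange : ∀ G G₁ → [ p G₁ ∧ subsetᵇ P G₁ ∧ (∣ G₁ ∣ ℕ.≡ᵇ r₁) ] *
                              ([ p G ∧ subsetᵇ G₁ G ∧ (∣ G ∣ ℕ.≡ᵇ r) ] * chains (simplex G) G₁ rs) ≡
                            [ p G ∧ subsetᵇ P G ∧ (∣ G ∣ ℕ.≡ᵇ r) ] *
                              ([ subsetᵇ G₁ G ∧ subsetᵇ P G₁ ∧ (∣ G₁ ∣ ℕ.≡ᵇ r₁) ] * chains (simplex G) G₁ rs)
        exchange G G₁ = trans ([]-∧ (p G₁ ∧ subsetᵇ P G₁ ∧ (∣ G₁ ∣ ℕ.≡ᵇ r₁)) _ _)
          (trans (cong (λ b → [ b ] * chains (simplex G) G₁ rs)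
                    (boolean (p G₁) (subsetᵇ P G₁) (∣ G₁ ∣ ℕ.≡ᵇ r₁) (p G) (subsetᵇ G₁ G) (∣ G ∣ ℕ.≡ᵇ r) (subsetᵇ P G)
                       (λ z w → down G₁ G w z) (λ y w → subsetᵇ-trans P G₁ G y w)))
                 (sym ([]-∧ (p G ∧ subsetᵇ P G ∧ (∣ G ∣ ℕ.≡ᵇ r)) _ _)))

  -- `allSubsets` branches on the smallest rank, whereas flags are split at the largest.
  ∑-∷ʳ : ∀ n (φ : Subset (suc n) → ℤ) →
         ∑ (allSubsets (suc n)) φ ≡ ∑ (allSubsets n) (λ S → φ (S ∷ʳ true)) + ∑ (allSubsets n) (λ S → φ (S ∷ʳ false))
  ∑-∷ʳ zero    φ = rearrange (φ (true ∷ [])) (φ (false ∷ []))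
    where
      rearrange : ∀ a b → a + (b + 0ℤ) ≡ (a + 0ℤ) + (b + 0ℤ)
      rearrange = solve-∀
  ∑-∷ʳ (suc n) φ = begin
    ∑ (allSubsets (suc (suc n))) φ
      ≡⟨ split (allSubsets (suc n)) φ ⟩
    ∑ (allSubsets (suc n)) (λ S → φ (true ∷ S)) + ∑ (allSubsets (suc n)) (λ S → φ (false ∷ S))
      ≡⟨ cong₂ _+_ (∑-∷ʳ n (λ S → φ (true ∷ S))) (∑-∷ʳ n (λ S → φ (false ∷ S))) ⟩
    (A true true + A true false) + (A false true + A false false)
      ≡⟨ rearrange (A true true) (A true false) (A false true) (A false false) ⟩
    (A true true + A false true) + (A true false + A false false)
      ≡⟨ sym (cong₂ _+_ (split (allSubsets n) (λ S → φ (S ∷ʳ true))) (split (allSubsets n) (λ S → φ (S ∷ʳ false)))) ⟩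
    ∑ (allSubsets (suc n)) (λ S → φ (S ∷ʳ true)) + ∑ (allSubsets (suc n)) (λ S → φ (S ∷ʳ false)) ∎
    where
      A : Bool → Bool → ℤ
      A a b = ∑ (allSubsets n) (λ S → φ (a ∷ (S ∷ʳ b)))

      rearrange : ∀ a b c d → (a + b) + (c + d) ≡ (a + c) + (b + d)
      rearrange = solve-∀

      split : ∀ {k} (Ss : List (Subset k)) (ψ : Subset (suc k) → ℤ) →
              ∑ (List.map (true ∷_) Ss ++ List.map (false ∷_) Ss) ψ ≡ ∑ Ss (λ S → ψ (true ∷ S)) + ∑ Ss (λ S → ψ (false ∷ S))
      split Ss ψ = trans (∑-++ (List.map (true ∷_) Ss) _ ψ) (cong₂ _+_ (∑-map (true ∷_) Ss ψ) (∑-map (false ∷_) Ss ψ))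

  private
    filter-shift : ∀ {k n} (b : Bool) (S : Subset n) (g : Fin k → Fin n) →
      List.map (λ i → ℕ.suc (toℕ i)) (List.filter (λ i → T? (memᵇ i (b ∷ S))) (tabulate (λ j → Fin.suc (g j)))) ≡
      List.map ℕ.suc (List.map (λ i → ℕ.suc (toℕ i)) (List.filter (λ i → T? (memᵇ i S)) (tabulate g)))
    filter-shift {zero}  b S g = refl
    filter-shift {suc k} b S g with lookup S (g zero)
    ... | true  = cong (_ ∷_) (filter-shift b S (λ j → g (suc j)))
    ... | false = filter-shift b S (λ j → g (suc j))

  ranks-∷ : ∀ {n} b (S : Subset n) → ranks (b ∷ S) ≡ (if b then 1 ∷ List.map suc (ranks S) else List.map suc (ranks S))
  ranks-∷ true  S = cong (1 ∷_) (filter-shift true S (λ j → j))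
  ranks-∷ false S = filter-shift false S (λ j → j)

  ranks-∷ʳ-true : ∀ {n} (S : Subset n) → ranks (S ∷ʳ true) ≡ ranks S ++ suc n ∷ []
  ranks-∷ʳ-true []          = refl
  ranks-∷ʳ-true {suc n} (true ∷ S) = trans (ranks-∷ true (S ∷ʳ true)) (trans (cong (λ rs → 1 ∷ List.map suc rs) (ranks-∷ʳ-true S))
    (trans (cong (1 ∷_) (Listₚ.map-++ suc (ranks S) (suc n ∷ []))) (cong (_++ suc (suc n) ∷ []) (sym (ranks-∷ true S)))))
  ranks-∷ʳ-true {suc n} (false ∷ S) = trans (ranks-∷ false (S ∷ʳ true)) (trans (cong (List.map suc) (ranks-∷ʳ-true S))
    (trans (Listₚ.map-++ suc (ranks S) (suc n ∷ [])) (cong (_++ suc (suc n) ∷ []) (sym (ranks-∷ false S)))))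

  ranks-∷ʳ-false : ∀ {n} (S : Subset n) → ranks (S ∷ʳ false) ≡ ranks S
  ranks-∷ʳ-false []          = refl
  ranks-∷ʳ-false (true  ∷ S) = trans (ranks-∷ true (S ∷ʳ false)) (trans (cong (λ rs → 1 ∷ List.map suc rs) (ranks-∷ʳ-false S)) (sym (ranks-∷ true S)))
  ranks-∷ʳ-false (false ∷ S) = trans (ranks-∷ false (S ∷ʳ false)) (trans (cong (List.map suc) (ranks-∷ʳ-false S)) (sym (ranks-∷ false S)))

  prodNotIn-∷ʳ : ∀ {n} (S : Subset n) b (τ : ℕ → ℤ) →
                 prodNotIn (S ∷ʳ b) (λ i → τ (toℕ i)) ≡ (if b then 1ℤ else τ n - 1ℤ) * prodNotIn S (λ i → τ (toℕ i))
  prodNotIn-∷ʳ []      b τ = refl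
  prodNotIn-∷ʳ {suc n} (s ∷ S) b τ = trans (cong (a *_) (prodNotIn-∷ʳ S b (λ j → τ (suc j)))) (rearrange a (if b then 1ℤ else τ (suc n) - 1ℤ) _)
    where
      a = if s then 1ℤ else τ 0 - 1ℤ
      rearrange : ∀ a b c → a * (b * c) ≡ b * (a * c)
      rearrange = solve-∀

  module _ {m : ℕ} where

    count : (Subset m → Bool) → ℕ → ℤ
    count p r = ∑ (allSubsets m) (λ G → [ p G ∧ (∣ G ∣ ℕ.≡ᵇ r) ])

    -- The variables are indexed by all of ℕ, so that dropping the last one leaves τ unchanged.
    flagSum : (Subset m → Bool) → ℕ → (ℕ → ℤ) → ℤ
    flagSum p n τ = ∑ (allSubsets n) (λ S → chains p ⊥ (ranks S) * prodNotIn S (λ i → τ (toℕ i)))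

  private
    count-simplex : ∀ {m} (G : Subset m) r → count (simplex G) r ≡ binomial ∣ G ∣ r
    count-simplex []      zero    = refl
    count-simplex []      (suc r) = refl
    count-simplex {suc m} (g ∷ G) r = trans (∑-++ (List.map (true ∷_) (allSubsets m)) _ _)
      (trans (cong₂ _+_ (∑-map (true ∷_) (allSubsets m) _) (∑-map (false ∷_) (allSubsets m) _)) (step g r))
      where
        step : ∀ g r → ∑ (allSubsets m) (λ F → [ (g ∧ subsetᵇ F G) ∧ (suc ∣ F ∣ ℕ.≡ᵇ r) ]) +
                       ∑ (allSubsets m) (λ F → [ subsetᵇ F G ∧ (∣ F ∣ ℕ.≡ᵇ r) ]) ≡ binomial ∣ g ∷ G ∣ r
        step false r = trans (cong₂ _+_ (∑-0 (allSubsets m) (λ _ → refl)) (count-simplex G r)) (ℤₚ.+-identityˡ _)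
        step true zero = trans (cong₂ _+_ (∑-0 (allSubsets m) (λ {F} _ → cong [_] (Boolₚ.∧-zeroʳ (subsetᵇ F G)))) (count-simplex G 0))
                               (trans (ℤₚ.+-identityˡ _) (binomial-0 ∣ G ∣))
          where
            binomial-0 : ∀ N → binomial N 0 ≡ 1ℤ
            binomial-0 zero    = refl
            binomial-0 (suc N) = refl
        step true (suc r) = cong₂ _+_ (count-simplex G r) (count-simplex G (suc r))

    simplex-down : ∀ {m} (G : Subset m) → DownClosed (simplex G)
    simplex-down G F H F⊆H H⊆G = subsetᵇ-trans F H G F⊆H H⊆G

  -- Either S omits the rank n + 1, or the flag ends in a set `G` of that size and the rest is a
  -- flag of a simplex. The family therefore has to vary in the induction; for a simplex the result
  -- depends on |G| only.
  flagSum-fromFaceNumbers : ∀ {m} (p : Subset m → Bool) → DownClosed p → ∀ n τ → flagSum p n τ ≡ fromFaceNumbers n (count p) τ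
  flagSum-fromFaceNumbers p down zero τ = refl
  flagSum-fromFaceNumbers {m} p down (suc n) τ = begin
    flagSum p (suc n) τ
      ≡⟨ ∑-∷ʳ n _ ⟩
    ∑ (allSubsets n) (λ S → chains p ⊥ (ranks (S ∷ʳ true)) * prodNotIn (S ∷ʳ true) (λ i → τ (toℕ i))) +
    ∑ (allSubsets n) (λ S → chains p ⊥ (ranks (S ∷ʳ false)) * prodNotIn (S ∷ʳ false) (λ i → τ (toℕ i)))
      ≡⟨ cong₂ _+_ withTop withoutTop ⟩
    count p (suc n) * fromFaceNumbers n (binomial (suc n)) τ + (τ n - 1ℤ) * flagSum p n τ
      ≡⟨ trans (ℤₚ.+-comm (count p (suc n) * fromFaceNumbers n (binomial (suc n)) τ) ((τ n - 1ℤ) * flagSum p n τ)) (cong (λ x → (τ n - 1ℤ) * x + count p (suc n) * fromFaceNumbers n (binomial (suc n)) τ) (flagSum-fromFaceNumbers p down n τ)) ⟩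
    (τ n - 1ℤ) * fromFaceNumbers n (count p) τ + count p (suc n) * fromFaceNumbers n (binomial (suc n)) τ ∎
    where
      ∏ : Subset n → ℤ
      ∏ S = prodNotIn S (λ i → τ (toℕ i))

      withoutTop : ∑ (allSubsets n) (λ S → chains p ⊥ (ranks (S ∷ʳ false)) * prodNotIn (S ∷ʳ false) (λ i → τ (toℕ i))) ≡
                   (τ n - 1ℤ) * flagSum p n τ
      withoutTop = trans (∑-cong (allSubsets n) (λ S → trans (cong₂ (λ rs x → chains p ⊥ rs * x) (ranks-∷ʳ-false S) (prodNotIn-∷ʳ S false τ))
                                                            (rearrange (chains p ⊥ (ranks S)) (τ n - 1ℤ) (∏ S))))
                         (∑-*ˡ (allSubsets n) (τ n - 1ℤ) _)
        where
          rearrange : ∀ a b c → a * (b * c) ≡ b * (a * c)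
          rearrange = solve-∀

      weight : Subset m → ℤ
      weight G = [ p G ∧ subsetᵇ ⊥ G ∧ (∣ G ∣ ℕ.≡ᵇ suc n) ]

      perTop : ∀ G → weight G * flagSum (simplex G) n τ ≡ [ p G ∧ (∣ G ∣ ℕ.≡ᵇ suc n) ] * fromFaceNumbers n (binomial (suc n)) τ
      perTop G rewrite subsetᵇ-⊥ G with p G | ∣ G ∣ ℕ.≡ᵇ suc n in eq
      ... | false | _     = refl
      ... | true  | false = refl
      ... | true  | true  = cong (1ℤ *_) (trans (flagSum-fromFaceNumbers (simplex G) (simplex-down G) n τ)
        (fromFaceNumbers-cong n τ (λ r → trans (count-simplex G r) (cong (λ k → binomial k r) (ℕₚ.≡ᵇ⇒≡ ∣ G ∣ (suc n) (subst T (sym eq) _))))))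

      withTop : ∑ (allSubsets n) (λ S → chains p ⊥ (ranks (S ∷ʳ true)) * prodNotIn (S ∷ʳ true) (λ i → τ (toℕ i))) ≡
                count p (suc n) * fromFaceNumbers n (binomial (suc n)) τ
      withTop = begin
        ∑ (allSubsets n) (λ S → chains p ⊥ (ranks (S ∷ʳ true)) * prodNotIn (S ∷ʳ true) (λ i → τ (toℕ i)))
          ≡⟨ ∑-cong (allSubsets n) (λ S → trans
               (cong₂ _*_ (trans (cong (chains p ⊥) (ranks-∷ʳ-true S)) (chains-snoc p down ⊥ (ranks S) (suc n)))
                          (trans (prodNotIn-∷ʳ S true τ) (ℤₚ.*-identityˡ _)))
               (sym (∑-*ʳ (allSubsets m) (λ G → weight G * chains (simplex G) ⊥ (ranks S)) (∏ S)))) ⟩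
        ∑ (allSubsets n) (λ S → ∑ (allSubsets m) (λ G → weight G * chains (simplex G) ⊥ (ranks S) * ∏ S))
          ≡⟨ ∑-swap (allSubsets n) (allSubsets m) _ ⟩
        ∑ (allSubsets m) (λ G → ∑ (allSubsets n) (λ S → weight G * chains (simplex G) ⊥ (ranks S) * ∏ S))
          ≡⟨ ∑-cong (allSubsets m) (λ G → trans (∑-cong (allSubsets n) (λ S → ℤₚ.*-assoc (weight G) (chains (simplex G) ⊥ (ranks S)) (∏ S)))
               (trans (∑-*ˡ (allSubsets n) (weight G) _) (perTop G))) ⟩
        ∑ (allSubsets m) (λ G → [ p G ∧ (∣ G ∣ ℕ.≡ᵇ suc n) ] * fromFaceNumbers n (binomial (suc n)) τ)
          ≡⟨ ∑-*ʳ (allSubsets m) _ _ ⟩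
        count p (suc n) * fromFaceNumbers n (binomial (suc n)) τ ∎

  foldr-∑ : ∀ {A : Set} (xs : List A) (g : A → ℤ) → List.foldr ℤ._+_ 0ℤ (List.map g xs) ≡ ∑ xs g
  foldr-∑ []       g = refl
  foldr-∑ (x ∷ xs) g = cong (λ a → g x + a) (foldr-∑ xs g)

  private
    +foldr-∑ : ∀ {A : Set} (xs : List A) (g : A → ℕ) → + List.foldr ℕ._+_ 0 (List.map g xs) ≡ ∑ xs (λ x → + g x)
    +foldr-∑ []       g = refl
    +foldr-∑ (x ∷ xs) g = cong (λ a → + g x + a) (+foldr-∑ xs g)

    count-0 : ∀ {m} (p : Subset m → Bool) → p ⊥ ≡ true → count p 0 ≡ 1ℤ
    count-0 {zero}  p e rewrite e = refl
    count-0 {suc m} p e = trans (∑-++ (List.map (true ∷_) (allSubsets m)) _ _) (cong₂ _+_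
      (trans (∑-map (true ∷_) (allSubsets m) _) (∑-0 (allSubsets m) (λ {G} _ → cong [_] (Boolₚ.∧-zeroʳ (p (true ∷ G))))))
      (trans (∑-map (false ∷_) (allSubsets m) _) (count-0 (λ G → p (false ∷ G)) e)))

  faceNumber-0 : ∀ {m} (Δ : SimplicialComplex m) → faceNumber Δ 0 ≡ 1ℤ
  faceNumber-0 Δ = count-0 (face Δ) (empty-face Δ)

  countChains-chains : ∀ {m} (Δ : SimplicialComplex m) P rs → + countChains Δ P rs ≡ chains (face Δ) P rs
  countChains-chains Δ P []       = refl
  countChains-chains {m} Δ P (r ∷ rs) = trans (+foldr-∑ (allSubsets m) _) (∑-cong (allSubsets m) term)
    where
      term : ∀ G → + (if face Δ G ∧ subsetᵇ P G ∧ (∣ G ∣ ℕ.≡ᵇ r) then countChains Δ G rs else 0) ≡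
                   [ face Δ G ∧ subsetᵇ P G ∧ (∣ G ∣ ℕ.≡ᵇ r) ] * chains (face Δ) G rs
      term G with face Δ G ∧ subsetᵇ P G ∧ (∣ G ∣ ℕ.≡ᵇ r)
      ... | true  = trans (countChains-chains Δ G rs) (sym (ℤₚ.*-identityˡ _))
      ... | false = refl

  Ψ-E : ∀ {m} (Δ : SimplicialComplex m) n τ → Ψ Δ n (λ i → τ (toℕ i)) ≡ E n (Triangle.hEntry (faceNumber Δ) n) τ
  Ψ-E Δ n τ = begin
    Ψ Δ n (λ i → τ (toℕ i))                     ≡⟨ foldr-∑ (allSubsets n) _ ⟩
    _                                           ≡⟨ ∑-cong (allSubsets n) (λ S → cong (_* prodNotIn S (λ i → τ (toℕ i))) (countChains-chains Δ ⊥ (ranks S))) ⟩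
    flagSum (face Δ) n τ                        ≡⟨ flagSum-fromFaceNumbers (face Δ) (λ F G F⊆G → down-closed Δ G F (subsetᵇ⇒⊆ F G F⊆G)) n τ ⟩
    fromFaceNumbers n (faceNumber Δ) τ          ≡⟨ fromFaceNumbers-E n (faceNumber Δ) τ (faceNumber-0 Δ) ⟩
    E n (Triangle.hEntry (faceNumber Δ) n) τ    ∎

-- The expansion into cd-words and the uniqueness of its coefficients.

module CDExpansion where

  open import Data.Nat as ℕ using (ℕ; zero; suc; _∸_; _⊓_; z≤n; s≤s)
  import Data.Nat.Properties as ℕₚ
  open import Data.Integer using (ℤ; +_; 0ℤ; 1ℤ; _+_; _*_; _-_; -_)
  import Data.Integer.Properties as ℤₚ
  open import Data.Integer.Tactic.RingSolver using (solve-∀)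
  open import Data.Fin using (Fin; zero; suc; toℕ)
  open import Data.List as List using (List)
  open import Data.Sum using (inj₁; inj₂)
  open import Data.Empty using (⊥-elim)
  open import Relation.Nullary using (Dec; yes; no)
  open import Relation.Binary.PropositionalEquality hiding ([_])
  open ≡-Reasoning
  open import Defs
  open HVector
  open FlagNumbers

  private
    Seq : Set
    Seq = ℕ → ℤ

  partialSum-swap : ∀ (g : ℕ → ℕ → ℤ) a b →
                    partialSum (λ i → partialSum (g i) b) a ≡ partialSum (λ j → partialSum (λ i → g i j) a) b
  partialSum-swap g zero    b = refl
  partialSum-swap g (suc a) b = trans (cong (_+ partialSum (g (suc a)) b) (partialSum-swap g a b)) (sym (partialSum-+ _ _ b))

  partialSum-neg : ∀ h i → partialSum (λ j → - h j) i ≡ - partialSum h i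
  partialSum-neg h zero    = refl
  partialSum-neg h (suc i) = trans (cong (_+ (- h (suc i))) (partialSum-neg h i)) (sym (ℤₚ.neg-distrib-+ (partialSum h i) (h (suc i))))

  partialSum-reverse-part : ∀ h N i → i ℕ.< N → partialSum (λ j → h (N ∸ j)) i + partialSum h (N ∸ suc i) ≡ partialSum h N
  partialSum-reverse-part h (suc N) zero    _  = ℤₚ.+-comm (h (suc N)) (partialSum h N)
  partialSum-reverse-part h (suc N) (suc i) (s≤s i<N) = begin
    partialSum (λ j → h (suc N ∸ j)) i + h (N ∸ i) + partialSum h x
      ≡⟨ cong (λ k → partialSum (λ j → h (suc N ∸ j)) i + h k + partialSum h x) N∸i ⟩
    partialSum (λ j → h (suc N ∸ j)) i + h (suc x) + partialSum h x
      ≡⟨ rearrange (partialSum (λ j → h (suc N ∸ j)) i) (h (suc x)) (partialSum h x) ⟩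
    partialSum (λ j → h (suc N ∸ j)) i + partialSum h (suc x)
      ≡⟨ cong (λ k → partialSum (λ j → h (suc N ∸ j)) i + partialSum h k) (sym N∸i) ⟩
    partialSum (λ j → h (suc N ∸ j)) i + partialSum h (N ∸ i)
      ≡⟨ partialSum-reverse-part h (suc N) i (ℕₚ.m≤n⇒m≤1+n i<N) ⟩
    partialSum h (suc N) ∎
    where
      x = N ∸ suc i
      N∸i : N ∸ i ≡ suc x
      N∸i = ℕₚ.+-∸-assoc 1 i<N
      rearrange : ∀ a b c → a + b + c ≡ a + (c + b)
      rearrange = solve-∀

  partialSum-reverse : ∀ h N → partialSum (λ j → h (N ∸ j)) N ≡ partialSum h N
  partialSum-reverse h zero    = refl
  partialSum-reverse h (suc N) = trans (cong (λ k → partialSum (λ j → h (suc N ∸ j)) N + h k) (ℕₚ.n∸n≡0 N))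
    (trans (cong (λ k → partialSum (λ j → h (suc N ∸ j)) N + partialSum h k) (sym (ℕₚ.n∸n≡0 N)))
           (partialSum-reverse-part h (suc N) N (ℕₚ.n<1+n N)))

  E-+ : ∀ n g h τ → E n (λ i → g i + h i) τ ≡ E n g τ + E n h τ
  E-+ zero    g h τ = refl
  E-+ (suc n) g h τ = trans
    (cong₂ (λ a b → (τ n - 1ℤ) * a + b * E n (λ _ → 1ℤ) τ)
      (trans (E-cong n τ (λ {i} _ → partialSum-+ g h i)) (E-+ n (partialSum g) (partialSum h) τ)) (partialSum-+ g h (suc n)))
    (rearrange (τ n - 1ℤ) (E n (partialSum g) τ) (E n (partialSum h) τ) (partialSum g (suc n)) (partialSum h (suc n)) (E n (λ _ → 1ℤ) τ))
    where
      rearrange : ∀ t a b p q e → t * (a + b) + (p + q) * e ≡ (t * a + p * e) + (t * b + q * e)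
      rearrange = solve-∀

  E-* : ∀ n k h τ → E n (λ i → k * h i) τ ≡ k * E n h τ
  E-* zero    k h τ = refl
  E-* (suc n) k h τ = trans
    (cong₂ (λ a b → (τ n - 1ℤ) * a + b * E n (λ _ → 1ℤ) τ)
      (trans (E-cong n τ (λ {i} _ → partialSum-* k h i)) (E-* n k (partialSum h) τ)) (partialSum-* k h (suc n)))
    (rearrange (τ n - 1ℤ) k (E n (partialSum h) τ) (partialSum h (suc n)) (E n (λ _ → 1ℤ) τ))
    where
      rearrange : ∀ t k a p e → t * (k * a) + k * p * e ≡ k * (t * a + p * e)
      rearrange = solve-∀

  E-0 : ∀ n {h} τ → (∀ {i} → i ℕ.≤ n → h i ≡ 0ℤ) → E n h τ ≡ 0ℤ
  E-0 n {h} τ e = trans (E-cong n {h} {λ i → 0ℤ * h i} τ (λ {i} i≤n → trans (e i≤n) (sym (ℤₚ.*-zeroˡ (h i))))) (trans (E-* n 0ℤ h τ) (ℤₚ.*-zeroˡ (E n h τ)))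

  E-agree : ∀ n h {τ τ′} → (∀ {j} → j ℕ.< n → τ j ≡ τ′ j) → E n h τ ≡ E n h τ′
  E-agree zero    h e = refl
  E-agree (suc n) h e = cong₂ _+_
    (cong₂ (λ a b → (a - 1ℤ) * b) (e (ℕₚ.n<1+n n)) (E-agree n (partialSum h) (λ lt → e (ℕₚ.m<n⇒m<1+n lt))))
    (cong (partialSum h (suc n) *_) (E-agree n (λ _ → 1ℤ) (λ lt → e (ℕₚ.m<n⇒m<1+n lt))))

  -- The h-vector of the boundary of a complex with h-vector h of length N + 1 (zero when h is symmetric).
  boundaryH : ℕ → Seq → Seq
  boundaryH N h = partialSum (λ j → h j - h (N ∸ j))

  -- Closing up the boundary with one extra cell makes the poset Eulerian.
  Φ : ℕ → Seq → Seq → ℤ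
  Φ zero    h τ = h 0
  Φ (suc n) h τ = E (suc n) h τ + E n (boundaryH (suc n) h) τ

  -- The coefficient of h_k in the sum over j ≤ i of `antisymmetrize l h j`: the number of such j
  -- with k ≤ l - j, minus the number with k ≤ j. As a natural number it shows that D is
  -- nonnegative; nothing is truncated when k ≤ l and i < l.
  multiplicity : ℕ → ℕ → ℕ → ℕ
  multiplicity l k i = (suc i ⊓ k ℕ.+ suc i ⊓ (suc l ∸ k)) ∸ suc i

  dStep : ℕ → Seq → Seq
  dStep l h i = partialSum (λ k → + multiplicity l k i * h k) l

  private
    indicator : ∀ {A : Set} → Dec A → ℤ
    indicator (yes _) = 1ℤ
    indicator (no _)  = 0ℤ

    [_≤_] : ℕ → ℕ → ℤ
    [ k ≤ j ] = indicator (k ℕ.≤? j)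

    ≤-1 : ∀ {k j} → k ℕ.≤ j → [ k ≤ j ] ≡ 1ℤ
    ≤-1 {k} {j} p with k ℕ.≤? j
    ... | yes _ = refl
    ... | no ¬p = ⊥-elim (¬p p)

    ≤-0 : ∀ {k j} → j ℕ.< k → [ k ≤ j ] ≡ 0ℤ
    ≤-0 {k} {j} p with k ℕ.≤? j
    ... | yes q = ⊥-elim (ℕₚ.<⇒≱ p q)
    ... | no _  = refl

    partialSum-≤ : ∀ h l j → j ℕ.≤ l → partialSum (λ k → [ k ≤ j ] * h k) l ≡ partialSum h j
    partialSum-≤ h zero    zero    z≤n = ℤₚ.*-identityˡ (h 0)
    partialSum-≤ h (suc l) j       j≤l with ℕₚ.m≤n⇒m<n∨m≡n j≤l
    ... | inj₁ (s≤s j≤l′) = trans (cong₂ _+_ (partialSum-≤ h l j j≤l′) (cong (_* h (suc l)) (≤-0 (s≤s j≤l′)))) (ℤₚ.+-identityʳ _)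
    ... | inj₂ refl = cong₂ _+_ (partialSum-cong l (λ {k} k≤l → trans (cong (_* h k) (≤-1 (ℕₚ.m≤n⇒m≤1+n k≤l))) (ℤₚ.*-identityˡ (h k))))
                                (trans (cong (_* h (suc l)) (≤-1 (ℕₚ.≤-refl {suc l}))) (ℤₚ.*-identityˡ (h (suc l))))

    count-≥ : ∀ k i → partialSum (λ j → [ k ≤ j ]) i + + (suc i ⊓ k) ≡ + suc i
    count-≥ zero    zero    = refl
    count-≥ (suc k) zero    = refl
    count-≥ k       (suc i) with ℕₚ.≤-<-connex k (suc i)
    ... | inj₁ k≤ = begin
      partialSum (λ j → [ k ≤ j ]) i + [ k ≤ suc i ] + + (suc (suc i) ⊓ k)
        ≡⟨ cong₂ (λ a b → partialSum (λ j → [ k ≤ j ]) i + a + + b) (≤-1 k≤)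
             (trans (ℕₚ.m≥n⇒m⊓n≡n (ℕₚ.m≤n⇒m≤1+n k≤)) (sym (ℕₚ.m≥n⇒m⊓n≡n k≤))) ⟩
      partialSum (λ j → [ k ≤ j ]) i + 1ℤ + + (suc i ⊓ k)
        ≡⟨ rearrange (partialSum (λ j → [ k ≤ j ]) i) (+ (suc i ⊓ k)) ⟩
      1ℤ + (partialSum (λ j → [ k ≤ j ]) i + + (suc i ⊓ k))
        ≡⟨ cong (λ a → 1ℤ + a) (count-≥ k i) ⟩
      + suc (suc i) ∎
      where
        rearrange : ∀ a b → a + 1ℤ + b ≡ 1ℤ + (a + b)
        rearrange = solve-∀
    ... | inj₂ k> = begin
      partialSum (λ j → [ k ≤ j ]) i + [ k ≤ suc i ] + + (suc (suc i) ⊓ k)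
        ≡⟨ cong₂ (λ a b → a + b + + (suc (suc i) ⊓ k)) (partialSum-0 i (λ j≤i → ≤-0 (ℕₚ.≤-<-trans j≤i (ℕₚ.<-trans (ℕₚ.n<1+n i) k>)))) (≤-0 k>) ⟩
      0ℤ + 0ℤ + + (suc (suc i) ⊓ k)
        ≡⟨ cong (λ b → 0ℤ + 0ℤ + + b) (ℕₚ.m≤n⇒m⊓n≡m k>) ⟩
      + suc (suc i) ∎

    count-≤ : ∀ l k i → i ℕ.≤ l → partialSum (λ j → [ k ≤ l ∸ j ]) i ≡ + (suc i ⊓ (suc l ∸ k))
    count-≤ l k zero _ with ℕₚ.≤-<-connex k l
    ... | inj₁ k≤l = trans (≤-1 k≤l) (cong (λ a → + (1 ⊓ a)) (sym (ℕₚ.+-∸-assoc 1 k≤l)))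
    ... | inj₂ l<k = trans (≤-0 l<k) (cong (λ a → + (1 ⊓ a)) (sym (ℕₚ.m≤n⇒m∸n≡0 l<k)))
    count-≤ l k (suc i) i<l with ℕₚ.≤-<-connex k (l ∸ suc i)
    ... | inj₁ k≤ = begin
      partialSum (λ j → [ k ≤ l ∸ j ]) i + [ k ≤ l ∸ suc i ]
        ≡⟨ cong₂ _+_ (trans (count-≤ l k i (ℕₚ.<⇒≤ i<l)) (cong +_ (ℕₚ.m≤n⇒m⊓n≡m (ℕₚ.<⇒≤ big)))) (≤-1 k≤) ⟩
      + suc i + 1ℤ
        ≡⟨ cong +_ (ℕₚ.+-comm (suc i) 1) ⟩
      + suc (suc i)
        ≡⟨ cong +_ (sym (ℕₚ.m≤n⇒m⊓n≡m big)) ⟩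
      + (suc (suc i) ⊓ (suc l ∸ k)) ∎
      where
        big : suc (suc i) ℕ.≤ suc l ∸ k
        big = ℕₚ.m+n≤o⇒m≤o∸n (suc (suc i)) (s≤s (ℕₚ.≤-trans (ℕₚ.+-monoʳ-≤ (suc i) k≤) (ℕₚ.≤-reflexive (ℕₚ.m+[n∸m]≡n i<l))))
    ... | inj₂ k> = begin
      partialSum (λ j → [ k ≤ l ∸ j ]) i + [ k ≤ l ∸ suc i ]
        ≡⟨ cong₂ _+_ (trans (count-≤ l k i (ℕₚ.<⇒≤ i<l)) (cong +_ (ℕₚ.m≥n⇒m⊓n≡n small))) (≤-0 k>) ⟩
      + (suc l ∸ k) + 0ℤ
        ≡⟨ ℤₚ.+-identityʳ _ ⟩
      + (suc l ∸ k)
        ≡⟨ cong +_ (sym (ℕₚ.m≥n⇒m⊓n≡n (ℕₚ.m≤n⇒m≤1+n small))) ⟩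
      + (suc (suc i) ⊓ (suc l ∸ k)) ∎
      where
        small : suc l ∸ k ℕ.≤ suc i
        small = ℕₚ.m≤n+o⇒m∸n≤o (suc l) k (ℕₚ.≤-trans (s≤s (ℕₚ.≤-reflexive (sym (ℕₚ.m∸n+n≡m i<l)))) (ℕₚ.+-monoˡ-≤ (suc i) k>))

    -- If neither minimum is i + 1, they add up to k + (l + 1 - k) = l + 1.
    multiplicity-large : ∀ l k i → k ℕ.≤ l → i ℕ.< l → suc i ℕ.≤ suc i ⊓ k ℕ.+ suc i ⊓ (suc l ∸ k)
    multiplicity-large l k i k≤l i<l with ℕₚ.≤-total (suc i) k | ℕₚ.≤-total (suc i) (suc l ∸ k)
    ... | inj₁ p | _      = ℕₚ.≤-trans (ℕₚ.≤-reflexive (sym (ℕₚ.m≤n⇒m⊓n≡m p))) (ℕₚ.m≤m+n _ _)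
    ... | inj₂ _ | inj₁ q = ℕₚ.≤-trans (ℕₚ.≤-reflexive (sym (ℕₚ.m≤n⇒m⊓n≡m q))) (ℕₚ.m≤n+m _ _)
    ... | inj₂ p | inj₂ q = ℕₚ.≤-trans (ℕₚ.≤-trans (ℕₚ.m≤n⇒m≤1+n i<l) (ℕₚ.≤-reflexive (sym (ℕₚ.m+[n∸m]≡n (ℕₚ.m≤n⇒m≤1+n k≤l)))))
                                       (ℕₚ.≤-reflexive (sym (cong₂ ℕ._+_ (ℕₚ.m≥n⇒m⊓n≡n p) (ℕₚ.m≥n⇒m⊓n≡n q))))

    multiplicity-count : ∀ l k i → k ℕ.≤ l → i ℕ.< l →
                         + multiplicity l k i ≡ partialSum (λ j → [ k ≤ l ∸ j ] - [ k ≤ j ]) i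
    multiplicity-count l k i k≤l i<l = begin
      + multiplicity l k i
        ≡⟨ trans (sym (ℤₚ.⊖-≥ (multiplicity-large l k i k≤l i<l))) (sym (ℤₚ.m-n≡m⊖n (a ℕ.+ b) (suc i))) ⟩
      + (a ℕ.+ b) - + suc i
        ≡⟨ cong₂ (λ x y → x - y) (ℤₚ.pos-+ a b) (sym (count-≥ k i)) ⟩
      + a + + b - (partialSum (λ j → [ k ≤ j ]) i + + a)
        ≡⟨ rearrange (+ a) (+ b) (partialSum (λ j → [ k ≤ j ]) i) ⟩
      + b - partialSum (λ j → [ k ≤ j ]) i
        ≡⟨ cong₂ _+_ (sym (count-≤ l k i (ℕₚ.<⇒≤ i<l))) (sym (partialSum-neg _ i)) ⟩
      partialSum (λ j → [ k ≤ l ∸ j ]) i + partialSum (λ j → - [ k ≤ j ]) i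
        ≡⟨ sym (partialSum-+ _ _ i) ⟩
      partialSum (λ j → [ k ≤ l ∸ j ] - [ k ≤ j ]) i ∎
      where
        a = suc i ⊓ k
        b = suc i ⊓ (suc l ∸ k)
        rearrange : ∀ a b c → a + b - (c + a) ≡ b - c
        rearrange = solve-∀

  antisymmetrize : ℕ → Seq → Seq
  antisymmetrize l h j = partialSum h (l ∸ j) - partialSum h j

  dStep-antisymmetrize : ∀ l h i → i ℕ.< l → dStep l h i ≡ partialSum (antisymmetrize l h) i
  dStep-antisymmetrize l h i i<l = begin
    partialSum (λ k → + multiplicity l k i * h k) l
      ≡⟨ partialSum-cong l (λ {k} k≤l → trans (cong (_* h k) (multiplicity-count l k i k≤l i<l))
           (trans (ℤₚ.*-comm _ (h k)) (sym (partialSum-* (h k) _ i)))) ⟩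
    partialSum (λ k → partialSum (λ j → h k * ([ k ≤ l ∸ j ] - [ k ≤ j ])) i) l
      ≡⟨ partialSum-swap _ l i ⟩
    partialSum (λ j → partialSum (λ k → h k * ([ k ≤ l ∸ j ] - [ k ≤ j ])) l) i
      ≡⟨ partialSum-cong i (λ {j} j≤i → trans
           (trans (partialSum-cong l (λ {k} _ → expand (h k) [ k ≤ l ∸ j ] [ k ≤ j ])) (partialSum-+ _ _ l))
           (cong₂ _+_ (partialSum-≤ h l (l ∸ j) (ℕₚ.m∸n≤m l j))
                      (trans (partialSum-neg _ l) (cong -_ (partialSum-≤ h l j (ℕₚ.≤-trans j≤i (ℕₚ.<⇒≤ i<l))))))) ⟩
    partialSum (antisymmetrize l h) i ∎
    where
      expand : ∀ h a b → h * (a - b) ≡ a * h + (- (b * h))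
      expand = solve-∀

  antisymmetrize-total : ∀ l h → partialSum (antisymmetrize l h) l ≡ 0ℤ
  antisymmetrize-total l h = trans (partialSum-+ _ _ l)
    (trans (cong₂ _+_ (partialSum-reverse (partialSum h) l) (partialSum-neg (partialSum h) l)) (ℤₚ.+-inverseʳ (partialSum (partialSum h) l)))

  -- `antisymmetrize` changes sign under j ↦ l - j and has total 0, so its partial sums are
  -- symmetric.
  dStep-symmetric : ∀ n h j → j ℕ.≤ n → dStep (suc n) h (n ∸ j) ≡ dStep (suc n) h j
  dStep-symmetric n h j j≤n = begin
    dStep l h (n ∸ j)
      ≡⟨ dStep-antisymmetrize l h (n ∸ j) (s≤s (ℕₚ.m∸n≤m n j)) ⟩
    partialSum g (n ∸ j)
      ≡⟨ cancel (partialSum g j) (partialSum g (n ∸ j)) ⟩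
    partialSum g j + (- partialSum g j + partialSum g (n ∸ j))
      ≡⟨ cong (λ x → partialSum g j + (x + partialSum g (n ∸ j))) (trans (sym (partialSum-neg g j)) (partialSum-cong j flip)) ⟩
    partialSum g j + (partialSum (λ i → g (l ∸ i)) j + partialSum g (l ∸ suc j))
      ≡⟨ cong (λ x → partialSum g j + x) (trans (partialSum-reverse-part g l j (s≤s j≤n)) (antisymmetrize-total l h)) ⟩
    partialSum g j + 0ℤ
      ≡⟨ ℤₚ.+-identityʳ _ ⟩
    partialSum g j
      ≡⟨ sym (dStep-antisymmetrize l h j (s≤s j≤n)) ⟩
    dStep l h j ∎
    where
      l = suc n
      g = antisymmetrize l h
      cancel : ∀ a b → b ≡ a + (- a + b)
      cancel = solve-∀
      negate : ∀ a b → - (a - b) ≡ b - a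
      negate = solve-∀
      flip : ∀ {i} → i ℕ.≤ j → - g i ≡ g (l ∸ i)
      flip {i} i≤j = trans (negate (partialSum h (l ∸ i)) (partialSum h i))
        (cong (λ k → partialSum h k - partialSum h (l ∸ i)) (sym (ℕₚ.m∸[m∸n]≡n (ℕₚ.≤-trans i≤j (ℕₚ.m≤n⇒m≤1+n j≤n)))))

  Φ-symmetric : ∀ n h τ → (∀ j → j ℕ.≤ n → h (n ∸ j) ≡ h j) → Φ n h τ ≡ E n h τ
  Φ-symmetric zero    h τ s = refl
  Φ-symmetric (suc n) h τ s = trans (cong (λ x → E (suc n) h τ + x)
    (E-0 n τ (λ {i} i≤n → partialSum-0 i (λ {j} j≤i →
      trans (cong (λ x → h j - x) (s j (ℕₚ.≤-trans j≤i (ℕₚ.m≤n⇒m≤1+n i≤n)))) (ℤₚ.+-inverseʳ (h j)))))) (ℤₚ.+-identityʳ _)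

  Φ-step₁ : ∀ h τ → Φ 1 h τ ≡ (τ 0 + 1ℤ) * Φ 0 (partialSum h) τ
  Φ-step₁ h τ = expand (τ 0) (h 0) (h 1)
    where
      expand : ∀ t a b → (t - 1ℤ) * a + (a + b) * 1ℤ + (a - b) ≡ (t + 1ℤ) * a
      expand = solve-∀

  -- Writing t′ - 1 = (t′ + 1) - 2, everything besides the multiple of t′ + 1 is E of
  -- `antisymmetrize`. Its total is 0, so this is (t - 1) E (D h). Finally t - 1 = (t + t′) - (t′ +
  -- 1): the first summand gives the d-term, and the second corrects E (P h) to Φ (P h), since - D h
  -- is the boundary term of P h.
  Φ-step : ∀ n h τ → Φ (suc (suc n)) h τ ≡
           (τ (suc n) + 1ℤ) * Φ (suc n) (partialSum h) τ + (τ n + τ (suc n)) * Φ n (dStep (suc n) h) τ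
  Φ-step n h τ = begin
    (t′ - 1ℤ) * E (suc n) (partialSum h) τ + S * E (suc n) (λ _ → 1ℤ) τ + E (suc n) (boundaryH N h) τ
      ≡⟨ regroup t′ (E (suc n) (partialSum h) τ) (S * E (suc n) (λ _ → 1ℤ) τ) (E (suc n) (boundaryH N h) τ) ⟩
    (t′ + 1ℤ) * E (suc n) (partialSum h) τ + (S * E (suc n) (λ _ → 1ℤ) τ + (- + 2) * E (suc n) (partialSum h) τ + E (suc n) (boundaryH N h) τ)
      ≡⟨ cong (λ x → (t′ + 1ℤ) * E (suc n) (partialSum h) τ + x) collect ⟩
    (t′ + 1ℤ) * E (suc n) (partialSum h) τ + E (suc n) g τ
      ≡⟨ cong (λ x → (t′ + 1ℤ) * E (suc n) (partialSum h) τ + x) lower ⟩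
    (t′ + 1ℤ) * E (suc n) (partialSum h) τ + (t - 1ℤ) * E n d τ
      ≡⟨ regroup′ t t′ (E (suc n) (partialSum h) τ) (E n d τ) ⟩
    (t′ + 1ℤ) * (E (suc n) (partialSum h) τ + - 1ℤ * E n d τ) + (t + t′) * E n d τ
      ≡⟨ cong₂ (λ a b → (t′ + 1ℤ) * (E (suc n) (partialSum h) τ + a) + (t + t′) * b)
           (trans (sym (E-* n (- 1ℤ) d τ)) (E-cong n τ bound)) (sym (Φ-symmetric n d τ (dStep-symmetric n h))) ⟩
    (t′ + 1ℤ) * Φ (suc n) (partialSum h) τ + (t + t′) * Φ n d τ ∎
    where
      N = suc (suc n)
      t = τ n
      t′ = τ (suc n)
      S = partialSum h N
      g = antisymmetrize (suc n) h
      d = dStep (suc n) h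

      regroup : ∀ t a b c → (t - 1ℤ) * a + b + c ≡ (t + 1ℤ) * a + (b + (- + 2) * a + c)
      regroup = solve-∀
      regroup′ : ∀ t t′ a e → (t′ + 1ℤ) * a + (t - 1ℤ) * e ≡ (t′ + 1ℤ) * (a + - 1ℤ * e) + (t + t′) * e
      regroup′ = solve-∀

      entry : ∀ {i} → i ℕ.≤ suc n → S * 1ℤ + (- + 2) * partialSum h i + boundaryH N h i ≡ g i
      entry {i} i≤ = trans (cong₂ (λ a b → a * 1ℤ + (- + 2) * partialSum h i + b)
          (sym (partialSum-reverse-part h N i (s≤s i≤)))
          (trans (partialSum-+ _ _ i) (cong (λ x → partialSum h i + x) (partialSum-neg _ i))))
        (simplify (partialSum (λ j → h (N ∸ j)) i) (partialSum h (suc n ∸ i)) (partialSum h i))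
        where
          simplify : ∀ r q p → (r + q) * 1ℤ + (- + 2) * p + (p + - r) ≡ q - p
          simplify = solve-∀

      collect : S * E (suc n) (λ _ → 1ℤ) τ + (- + 2) * E (suc n) (partialSum h) τ + E (suc n) (boundaryH N h) τ ≡ E (suc n) g τ
      collect = sym (trans (E-cong (suc n) τ (λ i≤ → sym (entry i≤)))
        (trans (E-+ (suc n) (λ i → S * 1ℤ + (- + 2) * partialSum h i) (boundaryH N h) τ)
          (cong (_+ E (suc n) (boundaryH N h) τ) (trans (E-+ (suc n) (λ _ → S * 1ℤ) (λ i → (- + 2) * partialSum h i) τ)
            (cong₂ _+_ (E-* (suc n) S (λ _ → 1ℤ) τ) (E-* (suc n) (- + 2) (partialSum h) τ))))))

      lower : E (suc n) g τ ≡ (t - 1ℤ) * E n d τ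
      lower = trans (cong₂ (λ a b → (t - 1ℤ) * a + b * E n (λ _ → 1ℤ) τ)
          (E-cong n τ (λ i≤n → sym (dStep-antisymmetrize (suc n) h _ (s≤s i≤n)))) (antisymmetrize-total (suc n) h))
        (ℤₚ.+-identityʳ _)

      bound : ∀ {i} → i ℕ.≤ n → - 1ℤ * d i ≡ boundaryH (suc n) (partialSum h) i
      bound {i} i≤n = trans (cong (- 1ℤ *_) (dStep-antisymmetrize (suc n) h i (s≤s i≤n)))
        (trans (sym (partialSum-* (- 1ℤ) g i)) (partialSum-cong i (λ {j} _ → negate (partialSum h (suc n ∸ j)) (partialSum h j))))
        where
          negate : ∀ a b → - 1ℤ * (a - b) ≡ b - a
          negate = solve-∀

  Φ-+ : ∀ n g h τ → Φ n (λ i → g i + h i) τ ≡ Φ n g τ + Φ n h τ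
  Φ-+ zero    g h τ = refl
  Φ-+ (suc n) g h τ = trans (cong₂ _+_ (E-+ (suc n) g h τ)
    (trans (E-cong n τ (λ {i} _ → trans (partialSum-cong i (λ {j} _ → swap (g j) (h j) (g (suc n ∸ j)) (h (suc n ∸ j)))) (partialSum-+ _ _ i)))
           (E-+ n (boundaryH (suc n) g) (boundaryH (suc n) h) τ)))
    (rearrange (E (suc n) g τ) (E (suc n) h τ) (E n (boundaryH (suc n) g) τ) (E n (boundaryH (suc n) h) τ))
    where
      swap : ∀ a b c d → a + b - (c + d) ≡ (a - c) + (b - d)
      swap = solve-∀
      rearrange : ∀ a b c d → (a + b) + (c + d) ≡ (a + c) + (b + d)
      rearrange = solve-∀

  Φ-* : ∀ n k h τ → Φ n (λ i → k * h i) τ ≡ k * Φ n h τ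
  Φ-* zero    k h τ = refl
  Φ-* (suc n) k h τ = trans (cong₂ _+_ (E-* (suc n) k h τ)
    (trans (E-cong n τ (λ {i} _ → trans (partialSum-cong i (λ {j} _ → factor k (h j) (h (suc n ∸ j)))) (partialSum-* k _ i)))
           (E-* n k (boundaryH (suc n) h) τ)))
    (sym (ℤₚ.*-distribˡ-+ k _ _))
    where
      factor : ∀ k a b → k * a - k * b ≡ k * (a - b)
      factor = solve-∀

  -- `m` is the number of letters to the left of the word. Operators compose so that the last letter
  -- acts on h first.
  weight : ∀ {k} → ℕ → CD k → Seq → Seq
  weight m ε      h = h
  weight m (c· w) h = partialSum (weight (suc m) w h)
  weight m (d· w) h = dStep (suc m) (weight (suc (suc m)) w h)

  wordSum : ∀ n → (CD n → ℤ) → (ℕ → ℤ) → ℤ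
  wordSum n a τ = ∑ (allCD n) (λ w → a w * evalCD w (λ i → τ (toℕ i)))

  evalCD-cong : ∀ {n} (w : CD n) {s t : Fin n → ℤ} → (∀ i → s i ≡ t i) → evalCD w s ≡ evalCD w t
  evalCD-cong ε      e = refl
  evalCD-cong (c· w) e = cong₂ (λ a b → (a + 1ℤ) * b) (e zero) (evalCD-cong w (λ i → e (suc i)))
  evalCD-cong (d· w) e = cong₂ _*_ (cong₂ _+_ (e zero) (e (suc zero))) (evalCD-cong w (λ i → e (suc (suc i))))

  wordSum-cong : ∀ n (a : CD n → ℤ) {σ τ} → (∀ i → σ i ≡ τ i) → wordSum n a σ ≡ wordSum n a τ
  wordSum-cong n a e = ∑-cong (allCD n) (λ w → cong (a w *_) (evalCD-cong w (λ i → e (toℕ i))))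

  shift : (ℕ → ℤ) → ℕ → ℤ
  shift τ j = τ (suc j)

  wordSum-suc : ∀ n (a : CD (suc (suc n)) → ℤ) τ → wordSum (suc (suc n)) a τ ≡
                (τ 0 + 1ℤ) * wordSum (suc n) (λ w → a (c· w)) (shift τ) + (τ 0 + τ 1) * wordSum n (λ w → a (d· w)) (shift (shift τ))
  wordSum-suc n a τ = trans (∑-++ (List.map c· (allCD (suc n))) _ _) (cong₂ _+_
    (trans (∑-map c· (allCD (suc n)) _) (trans (∑-cong (allCD (suc n)) (λ w → rearrange (a (c· w)) (τ 0 + 1ℤ) (evalCD w (λ i → τ (suc (toℕ i)))))) (∑-*ˡ (allCD (suc n)) (τ 0 + 1ℤ) (λ w → a (c· w) * evalCD w (λ i → τ (suc (toℕ i)))))))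
    (trans (∑-map d· (allCD n) _) (trans (∑-cong (allCD n) (λ w → rearrange (a (d· w)) (τ 0 + τ 1) (evalCD w (λ i → τ (suc (suc (toℕ i))))))) (∑-*ˡ (allCD n) (τ 0 + τ 1) (λ w → a (d· w) * evalCD w (λ i → τ (suc (suc (toℕ i)))))))))
    where
      rearrange : ∀ a b c → a * (b * c) ≡ b * (a * c)
      rearrange = solve-∀

  wordSum-one : ∀ (a : CD 1 → ℤ) τ → wordSum 1 a τ ≡ (τ 0 + 1ℤ) * wordSum 0 (λ w → a (c· w)) (shift τ)
  wordSum-one a τ = rearrange (a (c· ε)) (τ 0 + 1ℤ)
    where
      rearrange : ∀ a b → a * (b * 1ℤ) + 0ℤ ≡ b * (a * 1ℤ + 0ℤ)
      rearrange = solve-∀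

  module _ (h : Seq) (τ : ℕ → ℤ) where

    -- The sum over the words of length k placed at positions m, m + 1, …, as a sequence.
    suffixSum : ℕ → ℕ → Seq
    suffixSum zero          m i = h i
    suffixSum (suc zero)    m i = (τ m + 1ℤ) * partialSum (suffixSum zero (suc m)) i
    suffixSum (suc (suc k)) m i = (τ m + 1ℤ) * partialSum (suffixSum (suc k) (suc m)) i +
                                  (τ m + τ (suc m)) * dStep (suc m) (suffixSum k (suc (suc m))) i

    -- The words whose letter d occupies the positions m - 1 and m.
    straddling : ℕ → ℕ → ℤ
    straddling zero    k       = 0ℤ
    straddling (suc m) zero    = 0ℤ
    straddling (suc m) (suc k) = (τ m + τ (suc m)) * Φ m (dStep (suc m) (suffixSum k (suc (suc m)))) τ

    -- Expanding the outer Φ fixes the letter at position m. The c-term joins the suffix together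
    -- with the d at m and m + 1 that had been kept in `straddling`; the d-term, at m - 1 and m,
    -- becomes the new straddling part.
    Φ-peel : ∀ m k → Φ (suc m) (suffixSum k (suc m)) τ + straddling (suc m) k ≡ Φ m (suffixSum (suc k) m) τ + straddling m (suc k)
    Φ-peel m zero = begin
      Φ (suc m) h τ + 0ℤ
        ≡⟨ ℤₚ.+-identityʳ _ ⟩
      Φ (suc m) h τ
        ≡⟨ step m ⟩
      (τ m + 1ℤ) * Φ m (partialSum h) τ + straddling m 1
        ≡⟨ cong (_+ straddling m 1) (sym (Φ-* m (τ m + 1ℤ) (partialSum h) τ)) ⟩
      Φ m (suffixSum 1 m) τ + straddling m 1 ∎
      where
        step : ∀ m → Φ (suc m) h τ ≡ (τ m + 1ℤ) * Φ m (partialSum h) τ + straddling m 1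
        step zero    = trans (Φ-step₁ h τ) (sym (ℤₚ.+-identityʳ _))
        step (suc m) = Φ-step m h τ
    Φ-peel m (suc k) = begin
      Φ (suc m) V τ + (τ m + τ (suc m)) * Φ m W τ
        ≡⟨ cong (_+ (τ m + τ (suc m)) * Φ m W τ) (step m) ⟩
      (τ m + 1ℤ) * Φ m (partialSum V) τ + straddling m (suc (suc k)) + (τ m + τ (suc m)) * Φ m W τ
        ≡⟨ rearrange ((τ m + 1ℤ) * Φ m (partialSum V) τ) (straddling m (suc (suc k))) ((τ m + τ (suc m)) * Φ m W τ) ⟩
      (τ m + 1ℤ) * Φ m (partialSum V) τ + (τ m + τ (suc m)) * Φ m W τ + straddling m (suc (suc k))
        ≡⟨ cong (_+ straddling m (suc (suc k))) (sym (trans (Φ-+ m (λ i → (τ m + 1ℤ) * partialSum V i) (λ i → (τ m + τ (suc m)) * W i) τ)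
             (cong₂ _+_ (Φ-* m (τ m + 1ℤ) (partialSum V) τ) (Φ-* m (τ m + τ (suc m)) W τ)))) ⟩
      Φ m (suffixSum (suc (suc k)) m) τ + straddling m (suc (suc k)) ∎
      where
        V = suffixSum (suc k) (suc m)
        W = dStep (suc m) (suffixSum k (suc (suc m)))
        rearrange : ∀ a b c → a + b + c ≡ a + c + b
        rearrange = solve-∀
        step : ∀ m → Φ (suc m) (suffixSum (suc k) (suc m)) τ ≡
                     (τ m + 1ℤ) * Φ m (partialSum (suffixSum (suc k) (suc m))) τ + straddling m (suc (suc k))
        step zero    = trans (Φ-step₁ (suffixSum (suc k) 1) τ) (sym (ℤₚ.+-identityʳ _))
        step (suc m) = Φ-step m (suffixSum (suc k) (suc (suc m))) τ

    Φ-suffixSum : ∀ k m → Φ (k ℕ.+ m) h τ ≡ Φ m (suffixSum k m) τ + straddling m k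
    Φ-suffixSum zero    zero    = sym (ℤₚ.+-identityʳ _)
    Φ-suffixSum zero    (suc m) = sym (ℤₚ.+-identityʳ _)
    Φ-suffixSum (suc k) m       = trans (cong (λ j → Φ j h τ) (sym (ℕₚ.+-suc k m))) (trans (Φ-suffixSum k (suc m)) (Φ-peel m k))

    suffixSum-words : ∀ k m i → suffixSum k m i ≡ wordSum k (λ w → weight m w h i) (λ j → τ (m ℕ.+ j))
    suffixSum-words zero m i = rearrange (h i)
      where
        rearrange : ∀ a → a ≡ a * 1ℤ + 0ℤ
        rearrange = solve-∀
    suffixSum-words (suc zero) m i = sym (begin
      wordSum 1 (λ w → weight m w h i) (λ j → τ (m ℕ.+ j))
        ≡⟨ wordSum-one (λ w → weight m w h i) (λ j → τ (m ℕ.+ j)) ⟩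
      (τ (m ℕ.+ 0) + 1ℤ) * (partialSum h i * 1ℤ + 0ℤ)
        ≡⟨ cong₂ (λ a b → (τ a + 1ℤ) * b) (ℕₚ.+-identityʳ m) (trans (ℤₚ.+-identityʳ (partialSum h i * 1ℤ)) (ℤₚ.*-identityʳ (partialSum h i))) ⟩
      (τ m + 1ℤ) * partialSum h i ∎)
    suffixSum-words (suc (suc k)) m i = sym (begin
      wordSum (suc (suc k)) (λ w → weight m w h i) (λ j → τ (m ℕ.+ j))
        ≡⟨ wordSum-suc k (λ w → weight m w h i) (λ j → τ (m ℕ.+ j)) ⟩
      (τ (m ℕ.+ 0) + 1ℤ) * wordSum (suc k) (λ w → weight m (c· w) h i) (λ j → τ (m ℕ.+ suc j)) +
      (τ (m ℕ.+ 0) + τ (m ℕ.+ 1)) * wordSum k (λ w → weight m (d· w) h i) (λ j → τ (m ℕ.+ suc (suc j)))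
        ≡⟨ cong₂ _+_ (cong₂ (λ a b → (τ a + 1ℤ) * b) (ℕₚ.+-identityʳ m) (cPart (suffixSum-words (suc k))))
                     (cong₂ (λ a b → a * b) (cong₂ (λ a b → τ a + τ b) (ℕₚ.+-identityʳ m) (trans (ℕₚ.+-suc m 0) (cong suc (ℕₚ.+-identityʳ m)))) (dPart (suffixSum-words k))) ⟩
      suffixSum (suc (suc k)) m i ∎)
      where
        partialSum-words : ∀ k a (φ : CD k → Seq) σ → wordSum k (λ w → partialSum (φ w) a) σ ≡ partialSum (λ j → wordSum k (λ w → φ w j) σ) a
        partialSum-words k a φ σ = trans (∑-cong (allCD k) (λ w → trans (ℤₚ.*-comm (partialSum (φ w) a) (eval w))
            (trans (sym (partialSum-* (eval w) (φ w) a)) (partialSum-cong a (λ {j} _ → ℤₚ.*-comm (eval w) (φ w j))))))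
          (sym (partialSum-∑ (allCD k) (λ w j → φ w j * eval w) a))
          where
            eval : CD k → ℤ
            eval w = evalCD w (λ i → σ (toℕ i))

        cPart : (∀ m i → suffixSum (suc k) m i ≡ wordSum (suc k) (λ w → weight m w h i) (λ j → τ (m ℕ.+ j))) →
                wordSum (suc k) (λ w → weight m (c· w) h i) (λ j → τ (m ℕ.+ suc j)) ≡ partialSum (suffixSum (suc k) (suc m)) i
        cPart ih = trans (partialSum-words (suc k) i (λ w → weight (suc m) w h) (λ j → τ (m ℕ.+ suc j)))
          (partialSum-cong i (λ {j} _ → trans (wordSum-cong (suc k) (λ w → weight (suc m) w h j) (λ x → cong τ (ℕₚ.+-suc m x))) (sym (ih (suc m) j))))

        dPart : (∀ m i → suffixSum k m i ≡ wordSum k (λ w → weight m w h i) (λ j → τ (m ℕ.+ j))) →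
                wordSum k (λ w → weight m (d· w) h i) (λ j → τ (m ℕ.+ suc (suc j))) ≡ dStep (suc m) (suffixSum k (suc (suc m))) i
        dPart ih = trans (partialSum-words k (suc m) (λ w j → + multiplicity (suc m) j i * weight (suc (suc m)) w h j) (λ j → τ (m ℕ.+ suc (suc j))))
          (partialSum-cong (suc m) (λ {j} _ → begin
            wordSum k (λ w → + multiplicity (suc m) j i * weight (suc (suc m)) w h j) (λ x → τ (m ℕ.+ suc (suc x)))
              ≡⟨ trans (∑-cong (allCD k) (λ w → ℤₚ.*-assoc (+ multiplicity (suc m) j i) (weight (suc (suc m)) w h j) (eval w)))
                       (∑-*ˡ (allCD k) (+ multiplicity (suc m) j i) (λ w → weight (suc (suc m)) w h j * eval w)) ⟩
            + multiplicity (suc m) j i * wordSum k (λ w → weight (suc (suc m)) w h j) (λ x → τ (m ℕ.+ suc (suc x)))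
              ≡⟨ cong (+ multiplicity (suc m) j i *_) (trans
                   (wordSum-cong k (λ w → weight (suc (suc m)) w h j) (λ x → cong τ (trans (ℕₚ.+-suc m (suc x)) (cong suc (ℕₚ.+-suc m x)))))
                   (sym (ih (suc (suc m)) j))) ⟩
            + multiplicity (suc m) j i * suffixSum k (suc (suc m)) j ∎))
          where
            eval : CD k → ℤ
            eval w = evalCD w (λ x → τ (m ℕ.+ suc (suc (toℕ x))))

    Φ-words : ∀ n → Φ n h τ ≡ wordSum n (λ w → weight 0 w h 0) τ
    Φ-words n = begin
      Φ n h τ                             ≡⟨ cong (λ k → Φ k h τ) (sym (ℕₚ.+-identityʳ n)) ⟩
      Φ (n ℕ.+ 0) h τ                     ≡⟨ Φ-suffixSum n 0 ⟩
      suffixSum n 0 0 + 0ℤ                ≡⟨ ℤₚ.+-identityʳ _ ⟩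
      suffixSum n 0 0                     ≡⟨ suffixSum-words n 0 0 ⟩
      wordSum n (λ w → weight 0 w h 0) τ  ∎

  Agree : ℕ → (ℕ → ℤ) → (ℕ → ℤ) → Set
  Agree n σ τ = ∀ {j} → j ℕ.< n → σ j ≡ τ j

  private
    infixr 5 _◂_

    _◂_ : ℤ → (ℕ → ℤ) → ℕ → ℤ
    (x ◂ τ) zero    = x
    (x ◂ τ) (suc j) = τ j

    ◂-agree : ∀ {n σ τ} x → Agree n σ τ → Agree (suc n) (x ◂ σ) (x ◂ τ)
    ◂-agree x a {zero}  _        = refl
    ◂-agree x a {suc j} (s≤s lt) = a lt

  -- Putting τ₀ = -1 and τ₁ = 2 kills the words beginning with c and turns a leading d into 1. Once
  -- the d-words are gone, τ₀ = 0 turns a leading c into 1. Both times a shorter polynomial remains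
  -- that does not involve the last variable either, until that variable itself is reached.
  independent⇒0 : ∀ n (a : CD (suc n) → ℤ) → (∀ σ τ → Agree n σ τ → wordSum (suc n) a σ ≡ wordSum (suc n) a τ) → ∀ w → a w ≡ 0ℤ
  independent⇒0 zero a ind (c· ε) = begin
    a (c· ε)                               ≡⟨ extract (a (c· ε)) ⟩
    two - one                              ≡⟨ cong (λ x → x - one) (ind (λ _ → 1ℤ) (λ _ → 0ℤ) (λ ())) ⟩
    one - one                              ≡⟨ ℤₚ.+-inverseʳ one ⟩
    0ℤ                                     ∎
    where
      one = wordSum 1 a (λ _ → 0ℤ)
      two = wordSum 1 a (λ _ → 1ℤ)
      extract : ∀ x → x ≡ (x * (+ 2 * 1ℤ) + 0ℤ) - (x * (1ℤ * 1ℤ) + 0ℤ)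
      extract = solve-∀
  independent⇒0 (suc n) a ind = words
    where
      X = wordSum (suc n) (λ w → a (c· w))
      Y = wordSum n (λ w → a (d· w))

      Y-value : ∀ σ → wordSum (suc (suc n)) a ((- 1ℤ) ◂ (+ 2 ◂ σ)) ≡ Y σ
      Y-value σ = trans (wordSum-suc n a ((- 1ℤ) ◂ (+ 2 ◂ σ))) (simplify (X (+ 2 ◂ σ)) (Y σ))
        where
          simplify : ∀ x y → 0ℤ * x + 1ℤ * y ≡ y
          simplify = solve-∀

      d-words : ∀ n (a : CD (suc (suc n)) → ℤ) → (∀ σ τ → Agree (suc n) σ τ → wordSum (suc (suc n)) a σ ≡ wordSum (suc (suc n)) a τ) →
                (∀ σ → wordSum (suc (suc n)) a ((- 1ℤ) ◂ (+ 2 ◂ σ)) ≡ wordSum n (λ w → a (d· w)) σ) → ∀ w → a (d· w) ≡ 0ℤ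
      -- In length 2 the second variable is the last one: replacing 2 by 1 changes the value of d
      -- from 1 to 0.
      d-words zero a ind value ε = begin
        a (d· ε)                                            ≡⟨ expand (a (d· ε)) ⟩
        wordSum 0 (λ w → a (d· w)) (λ _ → 0ℤ)               ≡⟨ sym (value (λ _ → 0ℤ)) ⟩
        wordSum 2 a ((- 1ℤ) ◂ (+ 2 ◂ (λ _ → 0ℤ)))           ≡⟨ ind ((- 1ℤ) ◂ (+ 2 ◂ (λ _ → 0ℤ))) ((- 1ℤ) ◂ (1ℤ ◂ (λ _ → 0ℤ))) (λ { (s≤s z≤n) → refl }) ⟩
        wordSum 2 a ((- 1ℤ) ◂ (1ℤ ◂ (λ _ → 0ℤ)))            ≡⟨ vanish (a (c· (c· ε))) (a (d· ε)) ⟩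
        0ℤ                                                  ∎
        where
          expand : ∀ x → x ≡ x * 1ℤ + 0ℤ
          expand = solve-∀
          vanish : ∀ x y → x * (0ℤ * ((+ 2) * 1ℤ)) + (y * (0ℤ * 1ℤ) + 0ℤ) ≡ 0ℤ
          vanish = solve-∀
      d-words (suc n) a ind value = independent⇒0 n (λ w → a (d· w)) (λ σ τ agree →
        trans (sym (value σ)) (trans (ind _ _ (◂-agree (- 1ℤ) (◂-agree (+ 2) agree))) (value τ)))

      Y-0 : ∀ σ → Y σ ≡ 0ℤ
      Y-0 σ = ∑-0 (allCD n) (λ {w} _ → cong (_* evalCD w (λ i → σ (toℕ i))) (d-words n a ind Y-value w))

      X-value : ∀ σ → wordSum (suc (suc n)) a (0ℤ ◂ σ) ≡ X σ
      X-value σ = trans (wordSum-suc n a (0ℤ ◂ σ)) (trans (cong (λ y → 1ℤ * X σ + (0ℤ + σ 0) * y) (Y-0 (shift σ))) (simplify (X σ) (σ 0)))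
        where
          simplify : ∀ x s → 1ℤ * x + (0ℤ + s) * 0ℤ ≡ x
          simplify = solve-∀

      words : ∀ w → a w ≡ 0ℤ
      words (d· w) = d-words n a ind Y-value w
      words (c· w) = independent⇒0 n (λ w → a (c· w)) (λ σ τ agree →
        trans (sym (X-value σ)) (trans (ind _ _ (◂-agree 0ℤ agree)) (X-value τ))) w

  -- Only the defect of symmetry of h separates E from Φ, and it does not involve the last variable.
  cd-coefficients : ∀ n h (a : CD n → ℤ) → (∀ τ → E n h τ ≡ wordSum n a τ) → ∀ w → a w ≡ weight 0 w h 0
  cd-coefficients zero    h a e ε = trans (expand (a ε)) (sym (e (λ _ → 0ℤ)))
    where
      expand : ∀ x → x ≡ x * 1ℤ + 0ℤ
      expand = solve-∀
  cd-coefficients (suc n) h a e w = ℤₚ.i-j≡0⇒i≡j (a w) (weight 0 w h 0) (independent⇒0 n b independent w)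
    where
      b : CD (suc n) → ℤ
      b w = a w - weight 0 w h 0

      b-sum : ∀ τ → wordSum (suc n) b τ ≡ - E n (boundaryH (suc n) h) τ
      b-sum τ = begin
        wordSum (suc n) b τ
          ≡⟨ trans (∑-cong (allCD (suc n)) (λ w → expand (a w) (weight 0 w h 0) _)) (∑-+ (allCD (suc n)) _ _) ⟩
        wordSum (suc n) a τ + ∑ (allCD (suc n)) (λ w → - 1ℤ * (weight 0 w h 0 * evalCD w (λ i → τ (toℕ i))))
          ≡⟨ cong₂ _+_ (sym (e τ)) (trans (∑-*ˡ (allCD (suc n)) (- 1ℤ) _) (cong (- 1ℤ *_) (sym (Φ-words h τ (suc n))))) ⟩
        E (suc n) h τ + - 1ℤ * (E (suc n) h τ + E n (boundaryH (suc n) h) τ)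
          ≡⟨ simplify (E (suc n) h τ) (E n (boundaryH (suc n) h) τ) ⟩
        - E n (boundaryH (suc n) h) τ ∎
        where
          expand : ∀ a b c → (a - b) * c ≡ a * c + - 1ℤ * (b * c)
          expand = solve-∀
          simplify : ∀ a b → a + - 1ℤ * (a + b) ≡ - b
          simplify = solve-∀

      independent : ∀ σ τ → Agree n σ τ → wordSum (suc n) b σ ≡ wordSum (suc n) b τ
      independent σ τ agree = trans (b-sum σ) (trans (cong -_ (E-agree n (boundaryH (suc n) h) agree)) (sym (b-sum τ)))

-- The face algebra of a coloured complex.

module FaceAlgebra where

  open import Level using (Level; _⊔_; Lift; lift; lower)
  open import Algebra.Bundles using (CommutativeRing)
  open import Data.Nat using (ℕ; zero; suc)
  open import Data.Integer as ℤ using (ℤ; +_)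
  open import Data.Fin using (Fin; zero; suc)
  open import Data.Maybe using (Maybe; just; nothing)
  open import Data.Vec using (Vec; []; _∷_; replicate; lookup; tabulate)
  import Data.Vec.Properties as Vecₚ
  open import Data.Vec.Relation.Unary.All as VAll using ([]; _∷_)
  open import Data.List as List using (List; []; _∷_; length)
  open import Data.List.Membership.Propositional using (_∈_; _∉_)
  open import Data.List.Membership.Propositional.Properties using (∈-lookup)
  open import Data.List.Relation.Unary.Any using (here; there)
  open import Data.List.Relation.Unary.All as LAll using ([]; _∷_)
  open import Data.List.Relation.Unary.AllPairs using ([]; _∷_)
  open import Data.List.Relation.Unary.Unique.Propositional using (Unique)
  open import Data.Product using (∃; _×_; _,_; proj₁; proj₂)
  open import Data.Empty using (⊥-elim)
  open import Function using (_∘_)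
  open import Relation.Nullary using (Dec; yes; no)
  open import Relation.Binary.Definitions using (DecidableEquality)
  open import Relation.Binary.PropositionalEquality as ≡ using (_≡_; _≢_)
  open import Defs
  open Sums

  -- A face of a complex coloured by Fin n picks at most one vertex of each colour.
  Face : Set → ℕ → Set
  Face V n = Vec (Maybe V) n

  data _⊑_ {V : Set} : ∀ {n} → Face V n → Face V n → Set where
    []   : [] ⊑ []
    keep : ∀ {n a} {s t : Face V n} → t ⊑ s → (a ∷ t) ⊑ (a ∷ s)
    drop : ∀ {n a} {s t : Face V n} → t ⊑ s → (nothing ∷ t) ⊑ (a ∷ s)

  support : ∀ {V n} → Face V n → Vec ℤ n
  support []            = []
  support (nothing ∷ s) = + 0 ∷ support s
  support (just v ∷ s)  = + 1 ∷ support s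

  ∅ : ∀ {V} n → Face V n
  ∅ n = replicate n nothing

  support-0 : ∀ {V n} (s : Face V n) → support s ≡ 0ⁿ n → s ≡ ∅ n
  support-0 []            e = ≡.refl
  support-0 (nothing ∷ s) e = ≡.cong (nothing ∷_) (support-0 s (Vecₚ.∷-injectiveʳ e))
  support-0 (just v ∷ s)  e with Vecₚ.∷-injectiveˡ e
  ... | ()

  module Convolution {c ℓ : Level} (K : CommutativeRing c ℓ) {V : Set} (_≟_ : DecidableEquality V) where
    open CommutativeRing K hiding (zero; +-congˡ; +-congʳ; *-congˡ; *-congʳ)
    open Congruence commutativeSemiring
    open Sums.Sum commutativeSemiring
    open import Relation.Binary.Reasoning.Setoid setoid
    open import Algebra.Properties.CommutativeSemigroup +-commutativeSemigroup using (interchange)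

    Fun : ℕ → Set c
    Fun n = Face V n → Carrier

    at : ∀ {n} → Maybe V → Fun (suc n) → Fun n
    at a x s = x (a ∷ s)

    -- The product of squarefree polynomials given by their coefficients: at `s` it sums over all
    -- ways of distributing the vertices of `s` among the two factors.
    _⋆_ : ∀ {n} → Fun n → Fun n → Fun n
    (x ⋆ y) []            = x [] * y []
    (x ⋆ y) (nothing ∷ s) = (at nothing x ⋆ at nothing y) s
    (x ⋆ y) (just v ∷ s)  = (at (just v) x ⋆ at nothing y) s + (at nothing x ⋆ at (just v) y) s

    one : ∀ {n} → Fun n
    one []            = 1#
    one (nothing ∷ s) = one s
    one (just v ∷ s)  = 0#

    -- The coefficient at `s` reads the factors at subfaces of `s` only. Hence restriction to a list
    -- of faces closed under subfaces respects products.
    ⋆-cong : ∀ {n} {x x′ y y′ : Fun n} s → (∀ {t} → t ⊑ s → x t ≈ x′ t) → (∀ {t} → t ⊑ s → y t ≈ y′ t) →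
             (x ⋆ y) s ≈ (x′ ⋆ y′) s
    ⋆-cong []            p q = *-cong (p []) (q [])
    ⋆-cong (nothing ∷ s) p q = ⋆-cong s (λ r → p (keep r)) (λ r → q (keep r))
    ⋆-cong (just v ∷ s)  p q = +-cong (⋆-cong s (λ r → p (keep r)) (λ r → q (drop r)))
                                      (⋆-cong s (λ r → p (drop r)) (λ r → q (keep r)))

    ⋆-comm : ∀ {n} (x y : Fun n) s → (x ⋆ y) s ≈ (y ⋆ x) s
    ⋆-comm x y []            = *-comm _ _
    ⋆-comm x y (nothing ∷ s) = ⋆-comm _ _ s
    ⋆-comm x y (just v ∷ s)  = trans (+-cong (⋆-comm _ _ s) (⋆-comm _ _ s)) (+-comm _ _)

    ⋆-zeroˡ : ∀ {n} {x : Fun n} y s → (∀ {t} → t ⊑ s → x t ≈ 0#) → (x ⋆ y) s ≈ 0#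
    ⋆-zeroˡ y []            p = *-absorbˡ (p [])
    ⋆-zeroˡ y (nothing ∷ s) p = ⋆-zeroˡ _ s (λ r → p (keep r))
    ⋆-zeroˡ y (just v ∷ s)  p = +-vanish (⋆-zeroˡ _ s (λ r → p (keep r))) (⋆-zeroˡ _ s (λ r → p (drop r)))

    ⋆-zeroʳ : ∀ {n} x {y : Fun n} s → (∀ {t} → t ⊑ s → y t ≈ 0#) → (x ⋆ y) s ≈ 0#
    ⋆-zeroʳ x {y} s p = trans (⋆-comm x y s) (⋆-zeroˡ x s p)

    ⋆-distribʳ : ∀ {n} (x y z : Fun n) s → ((λ t → y t + z t) ⋆ x) s ≈ (y ⋆ x) s + (z ⋆ x) s
    ⋆-distribʳ x y z []            = distribʳ _ _ _
    ⋆-distribʳ x y z (nothing ∷ s) = ⋆-distribʳ _ _ _ s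
    ⋆-distribʳ x y z (just v ∷ s)  = trans (+-cong (⋆-distribʳ _ _ _ s) (⋆-distribʳ _ _ _ s)) (interchange _ _ _ _)

    ⋆-distribˡ : ∀ {n} (x y z : Fun n) s → (x ⋆ (λ t → y t + z t)) s ≈ (x ⋆ y) s + (x ⋆ z) s
    ⋆-distribˡ x y z s = trans (⋆-comm x _ s) (trans (⋆-distribʳ x y z s) (+-cong (⋆-comm y x s) (⋆-comm z x s)))

    ⋆-scale : ∀ {n} k (x y : Fun n) s → ((λ t → k * x t) ⋆ y) s ≈ k * (x ⋆ y) s
    ⋆-scale k x y []            = *-assoc _ _ _
    ⋆-scale k x y (nothing ∷ s) = ⋆-scale k _ _ s
    ⋆-scale k x y (just v ∷ s)  = trans (+-cong (⋆-scale k _ _ s) (⋆-scale k _ _ s)) (sym (distribˡ k _ _))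

    ⋆-assoc : ∀ {n} (x y z : Fun n) s → ((x ⋆ y) ⋆ z) s ≈ (x ⋆ (y ⋆ z)) s
    ⋆-assoc x y z []            = *-assoc _ _ _
    ⋆-assoc x y z (nothing ∷ s) = ⋆-assoc _ _ _ s
    ⋆-assoc x y z (just v ∷ s)  = begin
      ((λ t → (x₁ ⋆ y₀) t + (x₀ ⋆ y₁) t) ⋆ z₀) s + ((x₀ ⋆ y₀) ⋆ z₁) s
        ≈⟨ +-congʳ (⋆-distribʳ z₀ (x₁ ⋆ y₀) (x₀ ⋆ y₁) s) ⟩
      ((x₁ ⋆ y₀) ⋆ z₀) s + ((x₀ ⋆ y₁) ⋆ z₀) s + ((x₀ ⋆ y₀) ⋆ z₁) s
        ≈⟨ +-cong (+-cong (⋆-assoc x₁ y₀ z₀ s) (⋆-assoc x₀ y₁ z₀ s)) (⋆-assoc x₀ y₀ z₁ s) ⟩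
      (x₁ ⋆ (y₀ ⋆ z₀)) s + (x₀ ⋆ (y₁ ⋆ z₀)) s + (x₀ ⋆ (y₀ ⋆ z₁)) s
        ≈⟨ +-assoc _ _ _ ⟩
      (x₁ ⋆ (y₀ ⋆ z₀)) s + ((x₀ ⋆ (y₁ ⋆ z₀)) s + (x₀ ⋆ (y₀ ⋆ z₁)) s)
        ≈⟨ +-congˡ (⋆-distribˡ x₀ (y₁ ⋆ z₀) (y₀ ⋆ z₁) s) ⟨
      (x₁ ⋆ (y₀ ⋆ z₀)) s + (x₀ ⋆ (λ t → (y₁ ⋆ z₀) t + (y₀ ⋆ z₁) t)) s ∎
      where
        x₁ = at (just v) x
        x₀ = at nothing x
        y₁ = at (just v) y
        y₀ = at nothing y
        z₁ = at (just v) z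
        z₀ = at nothing z

    ⋆-identityˡ : ∀ {n} (y : Fun n) s → (one ⋆ y) s ≈ y s
    ⋆-identityˡ y []            = *-identityˡ _
    ⋆-identityˡ y (nothing ∷ s) = ⋆-identityˡ _ s
    ⋆-identityˡ y (just v ∷ s)  = trans (+-absorbˡ (⋆-zeroˡ (at nothing y) s (λ _ → refl))) (⋆-identityˡ _ s)

    support-⋆ : ∀ {n} (v w : Vec ℤ n) {x y : Fun n} s →
                (∀ {t} → t ⊑ s → support t ≢ v → x t ≈ 0#) → (∀ {t} → t ⊑ s → support t ≢ w → y t ≈ 0#) →
                support s ≢ v ⊕ w → (x ⋆ y) s ≈ 0#
    support-⋆ []      []      []            p q ne = ⊥-elim (ne ≡.refl)
    support-⋆ (a ∷ v) (b ∷ w) {x} {y} (nothing ∷ s) p q ne with a ℤ.≟ + 0 | b ℤ.≟ + 0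
    ... | no a≢ | _ = ⋆-zeroˡ _ s (λ r → p (keep r) (λ e → a≢ (≡.sym (Vecₚ.∷-injectiveˡ e))))
    ... | yes _ | no b≢ = ⋆-zeroʳ _ s (λ r → q (keep r) (λ e → b≢ (≡.sym (Vecₚ.∷-injectiveˡ e))))
    ... | yes ≡.refl | yes ≡.refl = support-⋆ v w s (λ r ne′ → p (keep r) (λ e → ne′ (Vecₚ.∷-injectiveʳ e)))
                                                   (λ r ne′ → q (keep r) (λ e → ne′ (Vecₚ.∷-injectiveʳ e)))
                                                   (λ e → ne (≡.cong (+ 0 ∷_) e))
    support-⋆ {suc n} (a ∷ v) (b ∷ w) {x} {y} (just u ∷ s) p q ne = +-vanish left right
      where
        left : (at (just u) x ⋆ at nothing y) s ≈ 0#
        left with a ℤ.≟ + 1 | b ℤ.≟ + 0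
        ... | no a≢ | _ = ⋆-zeroˡ _ s (λ r → p (keep r) (λ e → a≢ (≡.sym (Vecₚ.∷-injectiveˡ e))))
        ... | yes _ | no b≢ = ⋆-zeroʳ _ s (λ r → q (drop r) (λ e → b≢ (≡.sym (Vecₚ.∷-injectiveˡ e))))
        ... | yes ≡.refl | yes ≡.refl = support-⋆ v w s (λ r ne′ → p (keep r) (λ e → ne′ (Vecₚ.∷-injectiveʳ e)))
                                                       (λ r ne′ → q (drop r) (λ e → ne′ (Vecₚ.∷-injectiveʳ e)))
                                                       (λ e → ne (≡.cong (+ 1 ∷_) e))
        right : (at nothing x ⋆ at (just u) y) s ≈ 0#
        right with a ℤ.≟ + 0 | b ℤ.≟ + 1
        ... | no a≢ | _ = ⋆-zeroˡ _ s (λ r → p (drop r) (λ e → a≢ (≡.sym (Vecₚ.∷-injectiveˡ e))))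
        ... | yes _ | no b≢ = ⋆-zeroʳ _ s (λ r → q (keep r) (λ e → b≢ (≡.sym (Vecₚ.∷-injectiveˡ e))))
        ... | yes ≡.refl | yes ≡.refl = support-⋆ v w s (λ r ne′ → p (drop r) (λ e → ne′ (Vecₚ.∷-injectiveʳ e)))
                                                       (λ r ne′ → q (keep r) (λ e → ne′ (Vecₚ.∷-injectiveʳ e)))
                                                       (λ e → ne (≡.cong (+ 1 ∷_) e))

    one-∅ : ∀ n → one (∅ n) ≈ 1#
    one-∅ zero    = refl
    one-∅ (suc n) = one-∅ n

    one-0 : ∀ {n} (s : Face V n) → support s ≢ 0ⁿ n → one s ≈ 0#
    one-0 []            ne = ⊥-elim (ne ≡.refl)
    one-0 (nothing ∷ s) ne = one-0 s (λ e → ne (≡.cong (+ 0 ∷_) e))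
    one-0 (just v ∷ s)  ne = refl

    vertex : ∀ {n} → Fin n → V → Fun n
    vertex zero    v (nothing ∷ s) = 0#
    vertex zero    v (just u ∷ s) with u ≟ v
    ... | yes _ = one s
    ... | no _  = 0#
    vertex (suc i) v (nothing ∷ s) = vertex i v s
    vertex (suc i) v (just u ∷ s)  = 0#

    support-vertex : ∀ {n} (i : Fin n) v s → support s ≢ 𝐞 i → vertex i v s ≈ 0#
    support-vertex zero v (nothing ∷ s) ne = refl
    support-vertex {suc n} zero v (just u ∷ s) ne with u ≟ v
    ... | no _  = refl
    ... | yes _ = one-0 s (λ e → ne (≡.cong (+ 1 ∷_) (≡.trans e (zeros n))))
      where
        zeros : ∀ n → 0ⁿ n ≡ tabulate {n = n} (λ j → + 0)
        zeros zero    = ≡.refl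
        zeros (suc n) = ≡.cong (+ 0 ∷_) (zeros n)
    support-vertex (suc i) v (just u ∷ s)  ne = refl
    support-vertex (suc i) v (nothing ∷ s) ne = support-vertex i v s (λ e → ne (≡.cong (+ 0 ∷_)
      (≡.trans e (Vecₚ.tabulate-cong (λ j → ≡.refl)))))

    extend : ∀ {n} → Fun n → Fun (suc n)
    extend x (nothing ∷ s) = x s
    extend x (just v ∷ s)  = 0#

    extend-⋆ : ∀ {n} (x y : Fun n) s → (extend x ⋆ extend y) s ≈ extend (x ⋆ y) s
    extend-⋆ x y (nothing ∷ s) = refl
    extend-⋆ x y (just v ∷ s)  = +-vanish (⋆-zeroˡ _ s (λ _ → refl)) (⋆-zeroʳ _ s (λ _ → refl))

    δ : ∀ {n} → Face V n → Fun n
    δ []            []            = 1#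
    δ (nothing ∷ s) (nothing ∷ t) = δ s t
    δ (nothing ∷ s) (just u ∷ t)  = 0#
    δ (just v ∷ s)  (nothing ∷ t) = 0#
    δ (just v ∷ s)  (just u ∷ t) with u ≟ v
    ... | yes _ = δ s t
    ... | no _  = 0#

    δ-refl : ∀ {n} (s : Face V n) → δ s s ≈ 1#
    δ-refl []            = refl
    δ-refl (nothing ∷ s) = δ-refl s
    δ-refl (just v ∷ s) with v ≟ v
    ... | yes _ = δ-refl s
    ... | no ne = ⊥-elim (ne ≡.refl)

    δ-≢ : ∀ {n} (s t : Face V n) → s ≢ t → δ s t ≈ 0#
    δ-≢ []            []            ne = ⊥-elim (ne ≡.refl)
    δ-≢ (nothing ∷ s) (nothing ∷ t) ne = δ-≢ s t (λ e → ne (≡.cong (nothing ∷_) e))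
    δ-≢ (nothing ∷ s) (just u ∷ t)  ne = refl
    δ-≢ (just v ∷ s)  (nothing ∷ t) ne = refl
    δ-≢ (just v ∷ s)  (just u ∷ t)  ne with u ≟ v
    ... | no _       = refl
    ... | yes ≡.refl = δ-≢ s t (λ e → ne (≡.cong (just v ∷_) e))

    -- `f` places the colours still to be treated among all n colours, so that the recursion on the
    -- face can multiply vertices of the full ring.
    monomial : ∀ {k n} → (Fin k → Fin n) → Face V k → Fun n
    monomial f []            = one
    monomial f (nothing ∷ s) = monomial (f ∘ suc) s
    monomial f (just v ∷ s)  = vertex (f zero) v ⋆ monomial (f ∘ suc) s

    monomial-suc : ∀ {k n} (f : Fin k → Fin n) s t → monomial (suc ∘ f) s t ≈ extend (monomial f s) t
    monomial-suc f []            (nothing ∷ t) = refl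
    monomial-suc f []            (just v ∷ t)  = refl
    monomial-suc f (nothing ∷ s) t = monomial-suc (f ∘ suc) s t
    monomial-suc f (just v ∷ s)  t = trans (⋆-cong t (λ {r} _ → shifted r) (λ {r} _ → monomial-suc (f ∘ suc) s r))
                                           (extend-⋆ (vertex (f zero) v) (monomial (f ∘ suc) s) t)
      where
        shifted : ∀ r → vertex (suc (f zero)) v r ≈ extend (vertex (f zero) v) r
        shifted (nothing ∷ r) = refl
        shifted (just u ∷ r)  = refl

    vertex-hit : ∀ {n} v (r : Face V n) → vertex zero v (just v ∷ r) ≈ one r
    vertex-hit v r with v ≟ v
    ... | yes _ = refl
    ... | no ne = ⊥-elim (ne ≡.refl)

    vertex-miss : ∀ {n u v} → u ≢ v → (r : Face V n) → vertex zero v (just u ∷ r) ≈ 0#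
    vertex-miss {u = u} {v} ne r with u ≟ v
    ... | yes e = ⊥-elim (ne e)
    ... | no _  = refl

    δ-hit : ∀ {n} v (s t : Face V n) → δ (just v ∷ s) (just v ∷ t) ≈ δ s t
    δ-hit v s t with v ≟ v
    ... | yes _ = refl
    ... | no ne = ⊥-elim (ne ≡.refl)

    monomial-δ : ∀ {n} (s t : Face V n) → monomial (λ i → i) s t ≈ δ s t
    monomial-δ []            []            = refl
    monomial-δ (nothing ∷ s) (nothing ∷ t) = trans (monomial-suc (λ i → i) s (nothing ∷ t)) (monomial-δ s t)
    monomial-δ (nothing ∷ s) (just u ∷ t)  = monomial-suc (λ i → i) s (just u ∷ t)
    monomial-δ (just v ∷ s)  t = trans (⋆-cong t (λ _ → refl) (λ {r} _ → monomial-suc (λ i → i) s r)) (value t)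
      where
        value : ∀ t → (vertex zero v ⋆ extend (monomial (λ i → i) s)) t ≈ δ (just v ∷ s) t
        value (nothing ∷ t) = ⋆-zeroˡ _ t (λ _ → refl)
        value (just u ∷ t) = compare (u ≟ v)
          where
            compare : Dec (u ≡ v) → (vertex zero v ⋆ extend (monomial (λ i → i) s)) (just u ∷ t) ≈ δ (just v ∷ s) (just u ∷ t)
            compare (yes ≡.refl) = trans (+-cong (⋆-cong t (λ {r} _ → vertex-hit u r) (λ _ → refl)) (⋆-zeroˡ _ t (λ _ → refl)))
              (trans (+-identityʳ _) (trans (⋆-identityˡ _ t) (trans (monomial-δ s t) (sym (δ-hit u s t)))))
            compare (no ne) = trans (+-vanish (⋆-zeroˡ _ t (λ {r} _ → vertex-miss ne r)) (⋆-zeroˡ _ t (λ _ → refl)))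
              (sym (δ-≢ (just v ∷ s) (just u ∷ t) (λ { ≡.refl → ne ≡.refl })))

    ∑-δ-∉ : ∀ {n} (f : Fun n) ss t → t ∉ ss → ∑ ss (λ s → f s * δ s t) ≈ 0#
    ∑-δ-∉ f ss t t∉ = ∑-0 ss (λ {s} s∈ → *-absorbʳ (δ-≢ s t (λ { ≡.refl → t∉ s∈ })))

    ∑-δ : ∀ {n} (f : Fun n) {ss t} → Unique ss → t ∈ ss → ∑ ss (λ s → f s * δ s t) ≈ f t
    ∑-δ f {s ∷ ss} (fresh ∷ uniq) (here ≡.refl) =
      trans (+-cong (trans (*-congˡ (δ-refl s)) (*-identityʳ _)) (∑-δ-∉ f ss s (λ s∈ → LAll.lookup fresh s∈ ≡.refl))) (+-identityʳ _)
    ∑-δ f {s ∷ ss} {t} (fresh ∷ uniq) (there t∈) =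
      trans (+-absorbˡ (*-absorbʳ (δ-≢ s t (LAll.lookup fresh t∈)))) (∑-δ f uniq t∈)

  -- The algebra K[x_v] / (x_v x_w : {v, w} not a face) of a coloured complex with face list L, where in particular
  -- the product of two vertices of the same colour vanishes.
  module ColouredComplex {c ℓ : Level} (K : Field c ℓ) {V : Set} (_≟_ : DecidableEquality V) {n : ℕ}
                         (L : List (Face V n)) (L-unique : Unique L) (L-∅ : ∅ n ∈ L)
                         (L-down : ∀ {s t} → t ⊑ s → s ∈ L → t ∈ L) where
    private
      module 𝕂 = Field K
    open Field K using (commutativeRing; 0≉1)
    open CommutativeRing commutativeRing hiding (zero; +-congˡ; +-congʳ; *-congˡ; *-congʳ)
    open Congruence commutativeSemiring
    open Sums.Sum commutativeSemiring
    open Convolution commutativeRing _≟_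
    open import Algebra.Properties.Ring ring using (-1*x≈-x)
    open import Relation.Binary.Reasoning.Setoid setoid

    -- Elements are expressions, compared by their values on the faces, so that every element is literally
    -- obtained from scalars and generators.
    data Expr : Set c where
      scalar    : Carrier → Expr
      generator : Fin n → V → Expr
      _⊞_ _⊠_   : Expr → Expr → Expr

    ⟪_⟫ : Expr → Fun n
    ⟪ scalar a ⟫ s      = a * one s
    ⟪ generator i v ⟫ s = vertex i v s
    ⟪ x ⊞ y ⟫ s         = ⟪ x ⟫ s + ⟪ y ⟫ s
    ⟪ x ⊠ y ⟫ s         = (⟪ x ⟫ ⋆ ⟪ y ⟫) s

    _≃_ : Expr → Expr → Set ℓ
    x ≃ y = ∀ {s} → s ∈ L → ⟪ x ⟫ s ≈ ⟪ y ⟫ s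

    scalar-⋆ : ∀ a (y : Fun n) s → ((λ t → a * one t) ⋆ y) s ≈ a * y s
    scalar-⋆ a y s = trans (⋆-scale a one y s) (*-congˡ (⋆-identityˡ y s))

    negate : Expr → Expr
    negate x = scalar (- 1#) ⊠ x

    ⟪negate⟫ : ∀ x s → ⟪ negate x ⟫ s ≈ - ⟪ x ⟫ s
    ⟪negate⟫ x s = trans (scalar-⋆ (- 1#) ⟪ x ⟫ s) (-1*x≈-x _)

    ring-A : CommutativeRing c ℓ
    ring-A = record
      { Carrier = Expr ; _≈_ = _≃_ ; _+_ = _⊞_ ; _*_ = _⊠_ ; -_ = negate ; 0# = scalar 0# ; 1# = scalar 1#
      ; isCommutativeRing = record
        { isRing = record
          { +-isAbelianGroup = record
            { isGroup = record
              { isMonoid = record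
                { isSemigroup = record
                  { isMagma = record
                    { isEquivalence = record { refl = λ _ → refl ; sym = λ p s∈ → sym (p s∈) ; trans = λ p q s∈ → trans (p s∈) (q s∈) }
                    ; ∙-cong = λ p q s∈ → +-cong (p s∈) (q s∈) }
                  ; assoc = λ _ _ _ _ → +-assoc _ _ _ }
                ; identity = (λ x _ → +-absorbˡ (zeroˡ _)) , (λ x _ → +-absorbʳ (zeroˡ _)) }
              ; inverse = (λ x {s} _ → trans (+-congʳ (⟪negate⟫ x s)) (trans (-‿inverseˡ _) (sym (zeroˡ _)))) ,
                          (λ x {s} _ → trans (+-congˡ (⟪negate⟫ x s)) (trans (-‿inverseʳ _) (sym (zeroˡ _))))
              ; ⁻¹-cong = λ {x} {y} p {s} s∈ → trans (⟪negate⟫ x s) (trans (-‿cong (p s∈)) (sym (⟪negate⟫ y s))) }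
            ; comm = λ _ _ _ → +-comm _ _ }
          ; *-cong = λ p q {s} s∈ → ⋆-cong s (λ r → p (L-down r s∈)) (λ r → q (L-down r s∈))
          ; *-assoc = λ x y z {s} _ → ⋆-assoc ⟪ x ⟫ ⟪ y ⟫ ⟪ z ⟫ s
          ; *-identity = (λ x {s} _ → trans (scalar-⋆ 1# ⟪ x ⟫ s) (*-identityˡ _)) ,
                         (λ x {s} _ → trans (⋆-comm ⟪ x ⟫ _ s) (trans (scalar-⋆ 1# ⟪ x ⟫ s) (*-identityˡ _)))
          ; distrib = (λ x y z {s} _ → ⋆-distribˡ ⟪ x ⟫ ⟪ y ⟫ ⟪ z ⟫ s) , (λ x y z {s} _ → ⋆-distribʳ ⟪ x ⟫ ⟪ y ⟫ ⟪ z ⟫ s) }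
        ; *-comm = λ x y {s} _ → ⋆-comm ⟪ x ⟫ ⟪ y ⟫ s } }

    algebra : KAlgebra K
    algebra = record
      { R = ring-A
      ; ι = scalar
      ; ι-hom = record
        { isSemiringHomomorphism = record
          { isNearSemiringHomomorphism = record
            { +-isMonoidHomomorphism = record
              { isMagmaHomomorphism = record
                { isRelHomomorphism = record { cong = λ p _ → *-congʳ p }
                ; homo = λ a b _ → distribʳ _ _ _ }
              ; ε-homo = λ _ → refl }
            ; *-homo = λ a b {s} _ → trans (*-assoc a b _) (sym (scalar-⋆ a (λ t → b * one t) s)) }
          ; 1#-homo = λ _ → refl }
        ; -‿homo = λ a {s} _ → trans (trans (*-congʳ (sym (-1*x≈-x a))) (*-assoc _ _ _)) (sym (scalar-⋆ (- 1#) (λ t → a * one t) s)) } }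

    Homogeneous : Vec ℤ n → Expr → Set ℓ
    Homogeneous v x = ∀ {s} → s ∈ L → support s ≢ v → ⟪ x ⟫ s ≈ 0#

    monomialExpr : ∀ {k} → (Fin k → Fin n) → Face V k → Expr
    monomialExpr f []            = scalar 1#
    monomialExpr f (nothing ∷ s) = monomialExpr (f ∘ suc) s
    monomialExpr f (just v ∷ s)  = generator (f zero) v ⊠ monomialExpr (f ∘ suc) s

    ⟪monomialExpr⟫ : ∀ {k} (f : Fin k → Fin n) s t → ⟪ monomialExpr f s ⟫ t ≈ monomial f s t
    ⟪monomialExpr⟫ f []            t = *-identityˡ _
    ⟪monomialExpr⟫ f (nothing ∷ s) t = ⟪monomialExpr⟫ (f ∘ suc) s t
    ⟪monomialExpr⟫ f (just v ∷ s)  t = ⋆-cong t (λ _ → refl) (λ {r} _ → ⟪monomialExpr⟫ (f ∘ suc) s r)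

    basis : Face V n → Expr
    basis s = monomialExpr (λ i → i) s

    ⟪basis⟫ : ∀ s t → ⟪ basis s ⟫ t ≈ δ s t
    ⟪basis⟫ s t = trans (⟪monomialExpr⟫ (λ i → i) s t) (monomial-δ s t)

    ⟪scaled-basis⟫ : ∀ a s t → ⟪ scalar a ⊠ basis s ⟫ t ≈ a * δ s t
    ⟪scaled-basis⟫ a s t = trans (scalar-⋆ a ⟪ basis s ⟫ t) (*-congˡ (⟪basis⟫ s t))

    basis-homogeneous : ∀ s → Homogeneous (support s) (basis s)
    basis-homogeneous s {t} t∈ ne = trans (⟪basis⟫ s t) (δ-≢ s t (λ { ≡.refl → ne ≡.refl }))

    sumA : List Expr → Expr
    sumA = List.foldr _⊞_ (scalar 0#)

    ⟪sumA⟫ : ∀ {a} {A : Set a} (hs : List A) (g : A → Expr) s → ⟪ sumA (List.map g hs) ⟫ s ≈ ∑ hs (λ h → ⟪ g h ⟫ s)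
    ⟪sumA⟫ []       g s = zeroˡ _
    ⟪sumA⟫ (h ∷ hs) g s = +-congˡ (⟪sumA⟫ hs g s)

    -- One summand for each face; the same degree may occur several times.
    decomposition : Expr → List (Vec ℤ n × Expr)
    decomposition x = List.map (λ s → support s , scalar (⟪ x ⟫ s) ⊠ basis s) L

    private
      decomposition-sum : ∀ x → x ≃ sumA (List.map proj₂ (decomposition x))
      decomposition-sum x {t} t∈ = sym (trans (⟪sumA⟫ (decomposition x) proj₂ t)
        (trans (∑-map (λ s → support s , scalar (⟪ x ⟫ s) ⊠ basis s) L (λ h → ⟪ proj₂ h ⟫ t))
          (trans (∑-cong L (λ s → ⟪scaled-basis⟫ (⟪ x ⟫ s) s t)) (∑-δ ⟪ x ⟫ L-unique t∈))))

      decomposition-homogeneous : ∀ x ss → LAll.All (λ p → Lift c (Homogeneous (proj₁ p) (proj₂ p)))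
                                                    (List.map (λ s → support s , scalar (⟪ x ⟫ s) ⊠ basis s) ss)
      decomposition-homogeneous x []       = []
      decomposition-homogeneous x (s ∷ ss) =
        lift (λ {t} t∈ ne → trans (scalar-⋆ _ ⟪ basis s ⟫ t) (*-absorbʳ (basis-homogeneous s t∈ ne))) ∷ decomposition-homogeneous x ss

      Hs : Set c
      Hs = List (Vec ℤ n × Expr)

      AllHom : Hs → Set (c ⊔ ℓ)
      AllHom = LAll.All (λ p → Lift c (Homogeneous (proj₁ p) (proj₂ p)))

      sum-off-degree : ∀ (hs : Hs) → AllHom hs → ∀ {s} → s ∈ L → LAll.All (λ v → support s ≢ v) (List.map proj₁ hs) →
                       ⟪ sumA (List.map proj₂ hs) ⟫ s ≈ 0#
      sum-off-degree []       []           s∈ []        = zeroˡ _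
      sum-off-degree (h ∷ hs) (hom ∷ homs) s∈ (ne ∷ nes) = +-vanish (lower hom s∈ ne) (sum-off-degree hs homs s∈ nes)

      sum-at-degree : ∀ (hs : Hs) → AllHom hs → Unique (List.map proj₁ hs) → ∀ {s} → s ∈ L → ∀ {h} → h ∈ hs → support s ≡ proj₁ h →
                      ⟪ sumA (List.map proj₂ hs) ⟫ s ≈ ⟪ proj₂ h ⟫ s
      sum-at-degree (h ∷ hs) (hom ∷ homs) (fresh ∷ uniq) s∈ (here ≡.refl) e =
        +-absorbʳ (sum-off-degree hs homs s∈ (LAll.map (λ ne e′ → ne (≡.trans (≡.sym e) e′)) fresh))
      sum-at-degree (h′ ∷ hs) (hom ∷ homs) (fresh ∷ uniq) s∈ (there h∈) e =
        trans (+-absorbˡ (lower hom s∈ (λ e′ → LAll.lookup fresh (∈-map⁺ proj₁ h∈) (≡.trans (≡.sym e′) e))))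
              (sum-at-degree hs homs uniq s∈ h∈ e)
        where open import Data.List.Membership.Propositional.Properties using (∈-map⁺)

    grading : Grading algebra n
    grading = record
      { Hom = λ v x → Lift c (Homogeneous v x)
      ; Hom-resp = λ p h → lift (λ s∈ ne → trans (sym (p s∈)) (lower h s∈ ne))
      ; Hom-0 = lift (λ _ _ → zeroˡ _)
      ; Hom-+ = λ h h′ → lift (λ s∈ ne → +-vanish (lower h s∈ ne) (lower h′ s∈ ne))
      ; Hom-· = λ {v} {x} a h → lift (λ {s} s∈ ne → trans (scalar-⋆ a ⟪ x ⟫ s) (*-absorbʳ (lower h s∈ ne)))
      ; Hom-1 = lift (λ {s} s∈ ne → *-absorbʳ (one-0 s ne))
      ; Hom-* = λ {v} {w} h h′ → lift (λ {s} s∈ ne → support-⋆ v w s (λ r ne′ → lower h (L-down r s∈) ne′) (λ r ne′ → lower h′ (L-down r s∈) ne′) ne)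
      ; decompose = λ x → decomposition x , decomposition-homogeneous x L , decomposition-sum x
      ; direct = λ hs homs uniq zero-sum → LAll.tabulate (λ {h} h∈ {s} s∈ → vanish hs homs uniq zero-sum h h∈ s∈)
      }
      where
        vanish : ∀ hs → AllHom hs → Unique (List.map proj₁ hs) → sumA (List.map proj₂ hs) ≃ scalar 0# →
                 ∀ h → h ∈ hs → ∀ {s} → s ∈ L → ⟪ proj₂ h ⟫ s ≈ 0# * one s
        vanish hs homs uniq zero-sum h h∈ {s} s∈ with Vecₚ.≡-dec ℤ._≟_ (support s) (proj₁ h)
        ... | yes e = trans (sym (sum-at-degree hs homs uniq s∈ h∈ e)) (zero-sum s∈)
        ... | no ne = trans (lower (LAll.lookup homs h∈) s∈ ne) (sym (zeroˡ _))

    standard : IsStandard grading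
    standard = degree-0 , (λ e → 0≉1 (trans (sym (zeroˡ _)) (trans (sym (e L-∅)) (trans (*-identityˡ _) (one-∅ n))))) , generated
      where
        degree-0 : ∀ x → Lift c (Homogeneous (0ⁿ n) x) → ∃ λ a → x ≃ scalar a
        degree-0 x hom = ⟪ x ⟫ (∅ n) , λ {s} s∈ → value s s∈
          where
            value : ∀ s → s ∈ L → ⟪ x ⟫ s ≈ ⟪ x ⟫ (∅ n) * one s
            value s s∈ with Vecₚ.≡-dec ℤ._≟_ (support s) (0ⁿ n)
            ... | no ne = trans (lower hom s∈ ne) (sym (*-absorbʳ (one-0 s ne)))
            ... | yes e with support-0 s e
            ...   | ≡.refl = sym (trans (*-congˡ (one-∅ n)) (*-identityʳ _))

        generated : ∀ x → Generated grading x
        generated (scalar a)      = gen-scalar a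
        generated (generator i v) = gen-deg i (lift (λ {s} _ ne → support-vertex i v s ne))
        generated (x ⊞ y)         = gen-+ (generated x) (generated y)
        generated (x ⊠ y)         = gen-* (generated x) (generated y)

    standardAlgebra : StandardGradedAlgebra K n
    standardAlgebra = record { algebra = algebra ; grading = grading ; standard = standard }

    private
      basisVec : (ss : List (Face V n)) → Vec Expr (length ss)
      basisVec []       = []
      basisVec (s ∷ ss) = basis s ∷ basisVec ss

      values : Expr → (ss : List (Face V n)) → Vec Carrier (length ss)
      values x []       = []
      values x (s ∷ ss) = ⟪ x ⟫ s ∷ values x ss

      lincomb-values : ∀ x ss t → ⟪ lincomb grading (values x ss) (basisVec ss) ⟫ t ≈ ∑ ss (λ s → ⟪ x ⟫ s * δ s t)
      lincomb-values x []       t = zeroˡ _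
      lincomb-values x (s ∷ ss) t = +-cong (⟪scaled-basis⟫ _ s t) (lincomb-values x ss t)

      lincomb-∉ : ∀ ss as t → t ∉ ss → ⟪ lincomb grading as (basisVec ss) ⟫ t ≈ 0#
      lincomb-∉ []       []       t t∉ = zeroˡ _
      lincomb-∉ (s ∷ ss) (a ∷ as) t t∉ = +-vanish (trans (⟪scaled-basis⟫ a s t) (*-absorbʳ (δ-≢ s t (λ e → t∉ (here (≡.sym e))))))
                                                 (lincomb-∉ ss as t (λ t∈ → t∉ (there t∈)))

      lincomb-lookup : ∀ ss as → Unique ss → ∀ j → ⟪ lincomb grading as (basisVec ss) ⟫ (List.lookup ss j) ≈ lookup as j
      lincomb-lookup (s ∷ ss) (a ∷ as) (fresh ∷ uniq) zero =
        trans (+-cong (trans (⟪scaled-basis⟫ a s s) (trans (*-congˡ (δ-refl s)) (*-identityʳ a)))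
                      (lincomb-∉ ss as s (λ s∈ → LAll.lookup fresh s∈ ≡.refl))) (+-identityʳ a)
      lincomb-lookup (s ∷ ss) (a ∷ as) (fresh ∷ uniq) (suc j) =
        trans (+-absorbˡ (trans (⟪scaled-basis⟫ a s _) (*-absorbʳ (δ-≢ s _ (LAll.lookup fresh (∈-lookup j))))))
              (lincomb-lookup ss as uniq j)

    -- The monomials of the faces with support `v` are a basis. The list of these faces is left to
    -- the caller, so that its length can be counted by other means.
    hasDim : ∀ v ss → Unique ss → (∀ {s} → s ∈ ss → s ∈ L × support s ≡ v) → (∀ {s} → s ∈ L → support s ≡ v → s ∈ ss) →
             HasDim grading v (+ length ss)
    hasDim v ss uniq sound complete = length ss , ≡.refl , basisVec ss , homogeneous ss sound , spanning , independent
      where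
        homogeneous : ∀ ss → (∀ {s} → s ∈ ss → s ∈ L × support s ≡ v) → VAll.All (λ x → Lift c (Homogeneous v x)) (basisVec ss)
        homogeneous []       sound = []
        homogeneous (s ∷ ss) sound = lift (λ t∈ ne → basis-homogeneous s t∈ (λ e → ne (≡.trans e (proj₂ (sound (here ≡.refl)))))) ∷
                                     homogeneous ss (λ s∈ → sound (there s∈))

        spanning : ∀ x → Lift c (Homogeneous v x) → ∃ λ as → x ≃ lincomb grading as (basisVec ss)
        spanning x hom = values x ss , λ {t} t∈ → trans (expand t t∈) (sym (lincomb-values x ss t))
          where
            expand : ∀ t → t ∈ L → ⟪ x ⟫ t ≈ ∑ ss (λ s → ⟪ x ⟫ s * δ s t)
            expand t t∈ with Vecₚ.≡-dec ℤ._≟_ (support t) v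
            ... | yes e = sym (∑-δ ⟪ x ⟫ uniq (complete t∈ e))
            ... | no ne = trans (lower hom t∈ ne) (sym (∑-δ-∉ ⟪ x ⟫ ss t (λ t∈ss → ne (proj₂ (sound t∈ss)))))

        independent : ∀ as → lincomb grading as (basisVec ss) ≃ scalar 0# → ∀ j → lookup as j ≈ 0#
        independent as e j = trans (sym (lincomb-lookup ss as uniq j)) (trans (e (proj₁ (sound (∈-lookup j)))) (zeroˡ _))

-- Lattice paths weighted by h, and the faces cut out of them.

module Paths where

  open import Data.Nat as ℕ using (ℕ; zero; suc; _∸_; _⊓_; z≤n; s≤s)
  import Data.Nat.Properties as ℕₚ
  open import Data.Integer as ℤ using (ℤ; +_)
  import Data.Integer.Properties as ℤₚ
  open import Data.Maybe using (just; nothing)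
  open import Data.Vec using ([]; _∷_)
  import Data.Vec.Properties as Vecₚ
  open import Data.List as List using (List; []; _∷_; _++_; length; upTo; concatMap; replicate)
  import Data.List.Properties as Listₚ
  open import Data.List.Membership.Propositional using (_∈_)
  open import Data.List.Membership.Propositional.Properties using (∈-map⁺; ∈-map⁻; ∈-++⁺ˡ; ∈-++⁺ʳ; ∈-++⁻; ∈-upTo⁺; ∈-upTo⁻)
  open import Data.List.Relation.Unary.Any using (here; there)
  import Data.List.Relation.Unary.All as All
  open import Data.List.Relation.Unary.AllPairs using ([]; _∷_)
  open import Data.List.Relation.Unary.Unique.Propositional using (Unique)
  import Data.List.Relation.Unary.Unique.Propositional.Properties as Uniqueₚ
  open import Data.Product using (∃; _×_; _,_; proj₁; proj₂)
  open import Data.Sum using (inj₁; inj₂)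
  open import Data.Empty using (⊥-elim) renaming (⊥ to Empty)
  open import Relation.Binary.PropositionalEquality
  open import Defs
  open HVector using (partialSum; partialSum-cong)
  open CDExpansion using (multiplicity; weight)
  open FaceAlgebra using (Face; _⊑_; []; keep; drop; ∅; support)

  ∈-concatMap⁺′ : ∀ {A B : Set} (f : A → List B) {xs x y} → x ∈ xs → y ∈ f x → y ∈ concatMap f xs
  ∈-concatMap⁺′ f (here refl)               y∈ = ∈-++⁺ˡ y∈
  ∈-concatMap⁺′ f {x′ ∷ xs} (there x∈) y∈ = ∈-++⁺ʳ (f x′) (∈-concatMap⁺′ f x∈ y∈)

  ∈-concatMap⁻′ : ∀ {A B : Set} (f : A → List B) xs {y} → y ∈ concatMap f xs → ∃ λ x → x ∈ xs × y ∈ f x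
  ∈-concatMap⁻′ f (x ∷ xs) y∈ with ∈-++⁻ (f x) y∈
  ... | inj₁ p = x , here refl , p
  ... | inj₂ p with ∈-concatMap⁻′ f xs p
  ...   | x′ , q , r = x′ , there q , r

  -- `key` recovers from an element the block it belongs to, so different blocks are disjoint.
  concatMap-unique : ∀ {A B : Set} (f : A → List B) (key : B → A) xs → Unique xs → (∀ {x} → x ∈ xs → Unique (f x)) →
                     (∀ {x y} → x ∈ xs → y ∈ f x → key y ≡ x) → Unique (concatMap f xs)
  concatMap-unique f key []       _              _  _  = []
  concatMap-unique f key (x ∷ xs) (fresh ∷ uniq) uf kf =
    Uniqueₚ.++⁺ (uf (here refl)) (concatMap-unique f key xs uniq (λ p → uf (there p)) (λ p → kf (there p))) separate
    where
      separate : ∀ {y} → y ∈ f x × y ∈ concatMap f xs → Empty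
      separate (p , q) with ∈-concatMap⁻′ f xs q
      ... | x′ , x′∈ , r = All.lookup fresh x′∈ (trans (sym (kf (here refl) p)) (kf (there x′∈) r))

  length-concatMap-upTo : ∀ {B : Set} (f : ℕ → List B) i → + length (concatMap f (upTo (suc i))) ≡ partialSum (λ j → + length (f j)) i
  length-concatMap-upTo f zero = cong +_ (trans (Listₚ.length-++ (f 0)) (ℕₚ.+-identityʳ _))
  length-concatMap-upTo f (suc i) = trans (cong (λ js → + length (concatMap f js)) (sym (Listₚ.upTo-∷ʳ (suc i))))
    (trans (cong (λ ys → + length ys) (concatMap-++ (upTo (suc i))))
      (trans (cong +_ (Listₚ.length-++ (concatMap f (upTo (suc i)))))
        (trans (ℤₚ.pos-+ (length (concatMap f (upTo (suc i)))) _)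
          (cong₂ ℤ._+_ (length-concatMap-upTo f i) (cong +_ (trans (Listₚ.length-++ (f (suc i))) (ℕₚ.+-identityʳ _)))))))
    where
      concatMap-++ : ∀ xs → concatMap f (xs ++ suc i ∷ []) ≡ concatMap f xs ++ concatMap f (suc i ∷ [])
      concatMap-++ []       = refl
      concatMap-++ (x ∷ xs) = trans (cong (f x ++_) (concatMap-++ xs)) (sym (Listₚ.++-assoc (f x) _ _))

  length-concatMap-constant : ∀ {A B : Set} (f : A → List B) k xs → (∀ x → length (f x) ≡ k) → length (concatMap f xs) ≡ length xs ℕ.* k
  length-concatMap-constant f k []       e = refl
  length-concatMap-constant f k (x ∷ xs) e = trans (Listₚ.length-++ (f x)) (cong₂ ℕ._+_ (e x) (length-concatMap-constant f k xs e))

  -- Hence a branch number a at height i satisfies a ≤ i and can be reused as the height of a path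
  -- coming down from i.
  multiplicity≤ : ∀ l k i → multiplicity l k i ℕ.≤ suc i
  multiplicity≤ l k i = ℕₚ.m≤n+o⇒m∸n≤o _ (suc i) (ℕₚ.+-mono-≤ (ℕₚ.m⊓n≤m (suc i) k) (ℕₚ.m⊓n≤m (suc i) (suc l ∸ k)))

  -- A positive multiplicity at any height forces 0 < k ≤ l, and then the multiplicity at height 0
  -- is 1. So a d that is possible at height i remains possible at height 0.
  multiplicity-0 : ∀ l k i → 0 ℕ.< multiplicity l k i → 0 ℕ.< multiplicity l k 0
  multiplicity-0 l k i = positive (suc i) k (suc l ∸ k)
    where
      positive : ∀ a k r → 0 ℕ.< (a ⊓ k ℕ.+ a ⊓ r) ∸ a → 0 ℕ.< (1 ⊓ k ℕ.+ 1 ⊓ r) ∸ 1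
      positive a zero    r       pos rewrite ℕₚ.⊓-zeroʳ a | ℕₚ.m≤n⇒m∸n≡0 (ℕₚ.m⊓n≤m a r) = ⊥-elim (ℕₚ.<-irrefl refl pos)
      positive a (suc k) zero    pos rewrite ℕₚ.⊓-zeroʳ a | ℕₚ.+-identityʳ (a ⊓ suc k) | ℕₚ.m≤n⇒m∸n≡0 (ℕₚ.m⊓n≤m a (suc k)) = ⊥-elim (ℕₚ.<-irrefl refl pos)
      positive a (suc k) (suc r) pos = s≤s z≤n

  -- At level m only heights up to m occur, so a word of k letters reads h no further than k + m.
  -- This keeps the count within the range where h is known to be nonnegative.
  weight-cong : ∀ {k} m (w : CD k) {g h : ℕ → ℤ} → (∀ {j} → j ℕ.≤ k ℕ.+ m → g j ≡ h j) → ∀ {i} → i ℕ.≤ m → weight m w g i ≡ weight m w h i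
  weight-cong m ε e i≤m = e i≤m
  weight-cong {suc k} m (c· w) e {i} i≤m = partialSum-cong i (λ j≤i → weight-cong (suc m) w
    (λ {j} le → e (subst (j ℕ.≤_) (ℕₚ.+-suc k m) le)) (ℕₚ.≤-trans j≤i (ℕₚ.m≤n⇒m≤1+n i≤m)))
  weight-cong {suc (suc k)} m (d· w) e {i} i≤m = partialSum-cong (suc m) (λ {j} j≤ → cong (+ multiplicity (suc m) j i ℤ.*_)
    (weight-cong (suc (suc m)) w (λ {j} le → e (subst (j ℕ.≤_) (trans (ℕₚ.+-suc k (suc m)) (cong suc (ℕₚ.+-suc k m))) le)) (ℕₚ.m≤n⇒m≤1+n j≤)))

  -- A vertex is a lattice path, recorded as the list of its heights from the current level up to the top level,
  -- followed by the index of a basis element in the degree where it starts.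
  Path : Set
  Path = List ℕ

  multideg-injective : ∀ {k} (w w′ : CD k) → multideg w ≡ multideg w′ → w ≡ w′
  multideg-injective ε      ε       e = refl
  multideg-injective (c· w) (c· w′) e = cong c· (multideg-injective w w′ (Vecₚ.∷-injectiveʳ e))
  multideg-injective (d· w) (d· w′) e = cong d· (multideg-injective w w′ (Vecₚ.∷-injectiveʳ (Vecₚ.∷-injectiveʳ e)))
  multideg-injective (c· w) (d· w′) e with Vecₚ.∷-injectiveˡ e
  ... | ()
  multideg-injective (d· w) (c· w′) e with Vecₚ.∷-injectiveˡ e
  ... | ()

  ∈-allCD : ∀ {k} (w : CD k) → w ∈ allCD k
  ∈-allCD ε                      = here refl
  ∈-allCD {suc zero}    (c· ε)   = here refl
  ∈-allCD {suc (suc k)} (c· w)   = ∈-++⁺ˡ (∈-map⁺ c· (∈-allCD w))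
  ∈-allCD {suc (suc k)} (d· w)   = ∈-++⁺ʳ (List.map c· (allCD (suc k))) (∈-map⁺ d· (∈-allCD w))

  module LatticePaths (h : ℕ → ℕ) where

    -- The path of the unit: k + 1 heights 0, followed by the index 0 of a basis element in degree
    -- 0.
    flat : ℕ → Path
    flat k = replicate (2 ℕ.+ k) 0

    State : ℕ → Set
    State k = Face Path k × Path

    cState : ∀ {k} → ℕ → State k → State (suc k)
    cState i (s , p) = nothing ∷ s , i ∷ p

    dState : ∀ {k} → ℕ → ℕ → State k → State (suc (suc k))
    dState {k} i a (s , p) = just p ∷ nothing ∷ s , i ∷ a ∷ flat k

    -- The faces with the colours prescribed by the letters d of w, together with the path begun after the last vertex,
    -- which stands at height i in level m. At a letter d, the path from level m + 2 becomes a vertex, and a new one,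
    -- starting at the unit element, records the branch a and the height i.
    states : ∀ {k} → ℕ → CD k → ℕ → List (State k)
    states m ε i      = List.map (λ β → [] , i ∷ β ∷ []) (upTo (h i))
    states m (c· w) i = concatMap (λ j → List.map (cState i) (states (suc m) w j)) (upTo (suc i))
    states m (d· w) i = concatMap (λ k → concatMap (λ a → List.map (dState i a) (states (suc (suc m)) w k))
                                                   (upTo (multiplicity (suc m) k i))) (upTo (suc (suc m)))

    length-states : ∀ {k} m (w : CD k) i → + length (states m w i) ≡ weight m w (λ j → + h j) i
    length-states m ε i = cong +_ (trans (Listₚ.length-map _ (upTo (h i))) (Listₚ.length-upTo (h i)))
    length-states m (c· w) i = trans (length-concatMap-upTo (λ j → List.map (cState i) (states (suc m) w j)) i)
      (partialSum-cong i (λ {j} _ → trans (cong +_ (Listₚ.length-map (cState i) (states (suc m) w j))) (length-states (suc m) w j)))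
    length-states m (d· w) i = trans (length-concatMap-upTo (λ k → concatMap (λ a → List.map (dState i a) (states (suc (suc m)) w k)) (upTo (multiplicity (suc m) k i))) (suc m)) (partialSum-cong (suc m) (λ {k} _ → trans
      (cong +_ (trans (length-concatMap-constant (λ a → List.map (dState i a) (states (suc (suc m)) w k)) (length (states (suc (suc m)) w k))
                         (upTo (multiplicity (suc m) k i)) (λ a → Listₚ.length-map (dState i a) (states (suc (suc m)) w k)))
                      (cong (ℕ._* length (states (suc (suc m)) w k)) (Listₚ.length-upTo (multiplicity (suc m) k i)))))
      (trans (ℤₚ.pos-* (multiplicity (suc m) k i) _) (cong (+ multiplicity (suc m) k i ℤ.*_) (length-states (suc (suc m)) w k)))))

    -- Membership in `states` with the word left out. Passing to a subface changes the word, so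
    -- closure under subfaces is proved in this form.
    data Reach : ∀ {k} → ℕ → Face Path k → ℕ → Path → Set where
      start : ∀ {m i β} → β ℕ.< h i → Reach m [] i (i ∷ β ∷ [])
      stepC : ∀ {k m i j p} {s : Face Path k} → j ℕ.≤ i → Reach (suc m) s j p → Reach m (nothing ∷ s) i (i ∷ p)
      stepD : ∀ {n m i k a p} {s : Face Path n} → k ℕ.≤ suc m → a ℕ.< multiplicity (suc m) k i → Reach (suc (suc m)) s k p →
              Reach m (just p ∷ nothing ∷ s) i (i ∷ a ∷ flat n)

    states⇒Reach : ∀ {k} m (w : CD k) i {s p} → (s , p) ∈ states m w i → Reach m s i p
    states⇒Reach m ε i x∈ with ∈-map⁻ _ x∈
    ... | β , β∈ , refl = start (∈-upTo⁻ β∈)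
    states⇒Reach m (c· w) i x∈ with ∈-concatMap⁻′ _ (upTo (suc i)) x∈
    ... | j , j∈ , y∈ with ∈-map⁻ _ y∈
    ...   | (s , p) , z∈ , refl = stepC (ℕₚ.≤-pred (∈-upTo⁻ j∈)) (states⇒Reach (suc m) w j z∈)
    states⇒Reach m (d· w) i x∈ with ∈-concatMap⁻′ _ (upTo (suc (suc m))) x∈
    ... | k , k∈ , y∈ with ∈-concatMap⁻′ _ (upTo (multiplicity (suc m) k i)) y∈
    ...   | a , a∈ , z∈ with ∈-map⁻ _ z∈
    ...     | (s , p) , u∈ , refl = stepD (ℕₚ.≤-pred (∈-upTo⁻ k∈)) (∈-upTo⁻ a∈) (states⇒Reach (suc (suc m)) w k u∈)

    Reach⇒states : ∀ {k m} {s : Face Path k} {i p} → Reach m s i p → ∃ λ w → (s , p) ∈ states m w i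
    Reach⇒states {i = i} (start lt) = ε , ∈-map⁺ _ (∈-upTo⁺ lt)
    Reach⇒states {m = m} {i = i} (stepC le r) with Reach⇒states r
    ... | w , x∈ = c· w , ∈-concatMap⁺′ (λ j → List.map (cState i) (states (suc m) w j)) (∈-upTo⁺ (s≤s le)) (∈-map⁺ (cState i) x∈)
    Reach⇒states {m = m} {i = i} (stepD {k = k} le lt r) with Reach⇒states r
    ... | w , x∈ = d· w , ∈-concatMap⁺′ (λ k → concatMap (λ a → List.map (dState i a) (states (suc (suc m)) w k)) (upTo (multiplicity (suc m) k i)))
        (∈-upTo⁺ (s≤s le)) (∈-concatMap⁺′ (λ a → List.map (dState i a) (states (suc (suc m)) w k)) (∈-upTo⁺ lt) (∈-map⁺ (dState i _) x∈))

    support-states : ∀ {k} m (w : CD k) i {s p} → (s , p) ∈ states m w i → support s ≡ multideg w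
    support-states m ε i x∈ with ∈-map⁻ _ x∈
    ... | β , β∈ , refl = refl
    support-states m (c· w) i x∈ with ∈-concatMap⁻′ _ (upTo (suc i)) x∈
    ... | j , j∈ , y∈ with ∈-map⁻ _ y∈
    ...   | (s , p) , z∈ , refl = cong (+ 0 ∷_) (support-states (suc m) w j z∈)
    support-states m (d· w) i x∈ with ∈-concatMap⁻′ _ (upTo (suc (suc m))) x∈
    ... | k , k∈ , y∈ with ∈-concatMap⁻′ _ (upTo (multiplicity (suc m) k i)) y∈
    ...   | a , a∈ , z∈ with ∈-map⁻ _ z∈
    ...     | (s , p) , u∈ , refl = cong (λ v → + 1 ∷ + 0 ∷ v) (support-states (suc (suc m)) w k u∈)

    private
      height : Path → ℕ
      height []      = 0
      height (i ∷ p) = i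

      tail : Path → Path
      tail []      = []
      tail (i ∷ p) = p

      height-Reach : ∀ {k m} {s : Face Path k} {i p} → Reach m s i p → height p ≡ i
      height-Reach (start _)     = refl
      height-Reach (stepC _ _)   = refl
      height-Reach (stepD _ _ _) = refl

      lastVertexHeight : ∀ {k} → State (suc k) → ℕ
      lastVertexHeight (just p ∷ _ , _)  = height p
      lastVertexHeight (nothing ∷ _ , _) = 0

    -- Every choice can be read back: after a c the chosen height is the second entry of the path;
    -- after a d it is the first entry of the new vertex, and the branch is the second entry of the
    -- new path.
    states-unique : ∀ {k} m (w : CD k) i → Unique (states m w i)
    states-unique m ε i = Uniqueₚ.map⁺ (λ { refl → refl }) (Uniqueₚ.upTo⁺ (h i))
    states-unique m (c· w) i = concatMap-unique _ (λ x → height (tail (proj₂ x))) (upTo (suc i)) (Uniqueₚ.upTo⁺ (suc i))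
      (λ {j} _ → Uniqueₚ.map⁺ (λ { refl → refl }) (states-unique (suc m) w j)) keyed
      where
        keyed : ∀ {j x} → j ∈ upTo (suc i) → x ∈ List.map (cState i) (states (suc m) w j) → height (tail (proj₂ x)) ≡ j
        keyed {j} _ x∈ with ∈-map⁻ _ x∈
        ... | (s , p) , y∈ , refl = height-Reach (states⇒Reach (suc m) w j y∈)
    states-unique m (d· w) i = concatMap-unique _ lastVertexHeight (upTo (suc (suc m))) (Uniqueₚ.upTo⁺ (suc (suc m)))
      (λ {k} _ → concatMap-unique _ (λ x → height (tail (proj₂ x))) (upTo (multiplicity (suc m) k i)) (Uniqueₚ.upTo⁺ _)
        (λ _ → Uniqueₚ.map⁺ (λ { refl → refl }) (states-unique (suc (suc m)) w k)) branch) keyed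
      where
        branch : ∀ {k a x} → a ∈ upTo (multiplicity (suc m) k i) → x ∈ List.map (dState i a) (states (suc (suc m)) w k) → height (tail (proj₂ x)) ≡ a
        branch _ x∈ with ∈-map⁻ _ x∈
        ... | _ , _ , refl = refl
        keyed : ∀ {k x} → k ∈ upTo (suc (suc m)) →
                x ∈ concatMap (λ a → List.map (dState i a) (states (suc (suc m)) w k)) (upTo (multiplicity (suc m) k i)) → lastVertexHeight x ≡ k
        keyed {k} _ x∈ with ∈-concatMap⁻′ _ (upTo (multiplicity (suc m) k i)) x∈
        ... | a , _ , y∈ with ∈-map⁻ _ y∈
        ...   | (s , p) , z∈ , refl = height-Reach (states⇒Reach (suc (suc m)) w k z∈)

    module _ (h0 : h 0 ≡ 1) where

      -- The start can be lowered to height 0 with the vertices unchanged: a c may stay at 0 until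
      -- the first d, which still has a branch there, and if no d follows, degree 0 has a basis
      -- element.
      Reach-flat : ∀ {k m} {s : Face Path k} {i p} → Reach m s i p → Reach m s 0 (flat k)
      Reach-flat (start _)         = start (subst (0 ℕ.<_) (sym h0) (s≤s z≤n))
      Reach-flat (stepC _ r)       = stepC z≤n (Reach-flat r)
      Reach-flat (stepD {m = m} {i = i} {k = k} le lt r) = stepD le (multiplicity-0 (suc m) k i (ℕₚ.≤-<-trans z≤n lt)) r

      -- From height 0 the unfinished path involves no choice: a c stays at 0, a d has one branch,
      -- and h 0 = 1 leaves one index. A state at height 0 is therefore determined by its face.
      Reach-0 : ∀ {k m} {s : Face Path k} {p} → Reach m s 0 p → p ≡ flat k
      Reach-0 (start lt) with ℕₚ.n<1⇒n≡0 (subst (_ ℕ.<_) h0 lt)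
      ... | refl = refl
      Reach-0 (stepC z≤n r) = cong (0 ∷_) (Reach-0 r)
      Reach-0 (stepD {n} {m} {k = k} {a} le lt r) = cong (λ b → 0 ∷ b ∷ flat n) (ℕₚ.n<1⇒n≡0 (ℕₚ.<-≤-trans lt (multiplicity≤ (suc m) k 0)))

      -- The unfinished path of a face serves each of its subfaces as well: after the removal of a vertex the
      -- path through it is replaced by the flat one.
      Reach-⊑ : ∀ {k m} {s t : Face Path k} {i p} → t ⊑ s → Reach m s i p → Reach m t i p
      Reach-⊑ []       (start lt)     = start lt
      Reach-⊑ (keep r) (stepC le q)   = stepC le (Reach-⊑ r q)
      Reach-⊑ (drop r) (stepC le q)   = stepC le (Reach-⊑ r q)
      Reach-⊑ (keep (keep r)) (stepD le lt q) = stepD le lt (Reach-⊑ r q)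
      Reach-⊑ (keep (drop r)) (stepD le lt q) = stepD le lt (Reach-⊑ r q)
      -- Without the vertex the path i, a, 0, 0, ... has to arise from two letters c: it descends to
      -- the former branch number a, which is at most i, and then to 0.
      Reach-⊑ (drop (keep r)) (stepD {m = m} {i = i} {k = k} le lt q) =
        stepC (ℕₚ.≤-pred (ℕₚ.<-≤-trans lt (multiplicity≤ (suc m) k i))) (stepC z≤n (Reach-flat (Reach-⊑ r q)))
      Reach-⊑ (drop (drop r)) (stepD {m = m} {i = i} {k = k} le lt q) =
        stepC (ℕₚ.≤-pred (ℕₚ.<-≤-trans lt (multiplicity≤ (suc m) k i))) (stepC z≤n (Reach-flat (Reach-⊑ r q)))

      Reach-∅ : ∀ k m → Reach m (∅ k) 0 (flat k)
      Reach-∅ zero    m = start (subst (0 ℕ.<_) (sym h0) (s≤s z≤n))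
      Reach-∅ (suc k) m = stepC z≤n (Reach-∅ k (suc m))

      facesOf : ∀ {n} → CD n → List (Face Path n)
      facesOf w = List.map proj₁ (states 0 w 0)

      ∈-facesOf⁻ : ∀ {n} (w : CD n) {s} → s ∈ facesOf w → Reach 0 s 0 (flat n) × support s ≡ multideg w
      ∈-facesOf⁻ w s∈ with ∈-map⁻ proj₁ s∈
      ... | (s , p) , x∈ , refl = Reach-flat (states⇒Reach 0 w 0 x∈) , support-states 0 w 0 x∈

      ∈-facesOf⁺ : ∀ {n} {s : Face Path n} → Reach 0 s 0 (flat n) → ∃ λ w → s ∈ facesOf w
      ∈-facesOf⁺ r with Reach⇒states r
      ... | w , x∈ = w , ∈-map⁺ proj₁ x∈

      facesOf-unique : ∀ {n} (w : CD n) → Unique (facesOf w)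
      facesOf-unique {n} w = project (states 0 w 0) (λ x∈ → Reach-0 (states⇒Reach 0 w 0 x∈)) (states-unique 0 w 0)
        where
          project : ∀ xs → (∀ {x} → x ∈ xs → proj₂ x ≡ flat n) → Unique xs → Unique (List.map proj₁ xs)
          project []             _ _              = []
          project ((s , p) ∷ xs) e (fresh ∷ uniq) = All.tabulate distinct ∷ project xs (λ x∈ → e (there x∈)) uniq
            where
              distinct : ∀ {t} → t ∈ List.map proj₁ xs → s ≢ t
              distinct t∈ refl with ∈-map⁻ proj₁ t∈
              ... | (_ , p′) , x∈ , refl = All.lookup fresh x∈ (cong (s ,_) (trans (e (here refl)) (sym (e (there x∈)))))

-- The path complex of the h-vector, and the comparison with the cd-index.

open import Level using (Level)
open import Data.Nat as ℕ using (ℕ; z≤n)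
import Data.Nat.Properties as ℕₚ
open import Data.Integer as ℤ using (ℤ; +_; 0ℤ)
import Data.Integer.Properties as ℤₚ
open import Data.Fin using (toℕ)
open import Data.Vec using (Vec)
import Data.Vec.Properties as Vecₚ
import Data.Maybe.Properties as Maybeₚ
open import Data.List using (List; []; concatMap; deduplicate)
import Data.List.Properties as Listₚ
open import Data.List.Membership.Propositional using (_∈_)
open import Data.List.Membership.Propositional.Properties using (∈-deduplicate⁺; ∈-deduplicate⁻)
open import Data.List.Relation.Unary.Unique.Propositional using (Unique; [])
import Data.List.Relation.Unary.Unique.DecPropositional.Properties as UniqueDec
open import Data.Product using (Σ; ∃; _×_; _,_; proj₁; proj₂)
open import Data.Empty using (⊥-elim)
open import Relation.Binary.Definitions using (DecidableEquality)
open import Relation.Binary.PropositionalEquality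
open import Defs
open HVector
open FlagNumbers
open CDExpansion
open FaceAlgebra
open Paths

_≟ᵖ_ : DecidableEquality Path
_≟ᵖ_ = Listₚ.≡-dec ℕ._≟_

_≟ᶠ_ : ∀ {n} → DecidableEquality (Face Path n)
_≟ᶠ_ = Vecₚ.≡-dec (Maybeₚ.≡-dec _≟ᵖ_)

module PathComplex {c ℓ : Level} (K : Field c ℓ) (n : ℕ) (h : ℕ → ℕ) (h0 : h 0 ≡ 1) where
  open LatticePaths h

  faces : List (Face Path n)
  faces = deduplicate _≟ᶠ_ (concatMap (facesOf h0) (allCD n))

  faces-unique : Unique faces
  faces-unique = UniqueDec.deduplicate-! _≟ᶠ_ (concatMap (facesOf h0) (allCD n))

  ∈-faces⁺ : ∀ {s} w → s ∈ facesOf h0 w → s ∈ faces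
  ∈-faces⁺ w s∈ = ∈-deduplicate⁺ _≟ᶠ_ (∈-concatMap⁺′ (facesOf h0) (∈-allCD w) s∈)

  ∈-faces⁻ : ∀ {s} → s ∈ faces → ∃ λ w → s ∈ facesOf h0 w
  ∈-faces⁻ s∈ with ∈-concatMap⁻′ (facesOf h0) (allCD n) (∈-deduplicate⁻ _≟ᶠ_ _ s∈)
  ... | w , _ , s∈w = w , s∈w

  faces-∅ : ∅ n ∈ faces
  faces-∅ with ∈-facesOf⁺ h0 (Reach-∅ h0 n 0)
  ... | w , s∈ = ∈-faces⁺ w s∈

  faces-down : ∀ {s t} → t ⊑ s → s ∈ faces → t ∈ faces
  faces-down r s∈ with ∈-faces⁻ s∈
  ... | w , s∈w with ∈-facesOf⁺ h0 (Reach-⊑ h0 r (proj₁ (∈-facesOf⁻ h0 w s∈w)))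
  ...   | w′ , t∈ = ∈-faces⁺ w′ t∈

  open ColouredComplex K _≟ᵖ_ faces faces-unique faces-∅ faces-down public using (standardAlgebra; grading; hasDim)

  hasDim-word : ∀ w → HasDim grading (multideg w) (weight 0 w (λ i → + h i) 0)
  hasDim-word w = subst (HasDim grading (multideg w))
    (trans (cong +_ (Listₚ.length-map proj₁ (states 0 w 0))) (length-states 0 w 0))
    (hasDim (multideg w) (facesOf h0 w) (facesOf-unique h0 w)
       (λ s∈ → ∈-faces⁺ w s∈ , proj₂ (∈-facesOf⁻ h0 w s∈))
       (λ {s} s∈ e → complete s (∈-faces⁻ s∈) e))
    where
      complete : ∀ s → (∃ λ w′ → s ∈ facesOf h0 w′) → support s ≡ multideg w → s ∈ facesOf h0 w
      complete s (w′ , s∈) e with multideg-injective w w′ (trans (sym e) (proj₂ (∈-facesOf⁻ h0 w′ s∈)))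
      ... | refl = s∈

  hasDim-0 : ∀ v → (∀ w → multideg w ≢ v) → HasDim grading v 0ℤ
  hasDim-0 v ne = hasDim v [] [] (λ ()) absurd
    where
      absurd : ∀ {s} → s ∈ faces → support s ≡ v → s ∈ []
      absurd s∈ e with ∈-faces⁻ s∈
      ... | w , s∈w = ⊥-elim (ne w (trans (sym (proj₂ (∈-facesOf⁻ h0 w s∈w))) e))

theorem1p3 : ∀ {c ℓ} (K : Field c ℓ) (n m : ℕ) (Δ : SimplicialComplex m) →
    HasDimension Δ n → Gorenstein* K Δ n →
    Σ (StandardGradedAlgebra K n) λ A →
    ∀ (coef : CD n → ℤ) → IsCDIndex Δ n coef → ∀ (v : Vec ℤ n) →
    (∀ w → multideg w ≡ v → HasDim (StandardGradedAlgebra.grading A) v (coef w))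
    × ((∀ w → multideg w ≢ v) → HasDim (StandardGradedAlgebra.grading A) v (+ 0))
theorem1p3 K n m Δ (_ , dim) gor = standardAlgebra , λ coef cd v →
  (λ { w refl → subst (HasDim grading (multideg w)) (sym (coefficient coef cd w)) (hasDim-word w) }) , hasDim-0 v
  where
    open Triangle (faceNumber Δ) using (hEntry; hEntry-0)

    -- Nonnegativity is known up to index n only. The absolute value gives a total function, and
    -- `weight-cong` confines the comparison to that range.
    h : ℕ → ℕ
    h i = ℤ.∣ hEntry n i ∣

    +h : ∀ {i} → i ℕ.≤ n → hEntry n i ≡ + h i
    +h {i} i≤n = sym (ℤₚ.0≤i⇒+∣i∣≡i (hEntry-nonneg Δ n dim K gor i i≤n))

    h0 : h 0 ≡ 1
    h0 = cong ℤ.∣_∣ (trans (hEntry-0 n) (faceNumber-0 Δ))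

    open PathComplex K n h h0

    coefficient : ∀ coef → IsCDIndex Δ n coef → ∀ w → coef w ≡ weight 0 w (λ i → + h i) 0
    coefficient coef cd w = trans
      (cd-coefficients n (hEntry n) coef (λ τ → trans (sym (Ψ-E Δ n τ)) (trans (cd (λ i → τ (toℕ i))) (foldr-∑ (allCD n) _))) w)
      (weight-cong 0 w (λ {j} j≤ → +h (subst (j ℕ.≤_) (ℕₚ.+-identityʳ n) j≤)) z≤n)
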